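{- Let $M$ be a matroid on a finite set $E$ which is representable over a field of characteristic zero, and fix any total ordering of $E$. \begin{enumerate} \item The $h$-vector of the matroid complex $\mathrm{IN}(M)$ of $M$ is a log-concave sequence of nonnegative integers with no internal zeros. \item The $h$-vector of the broken circuit complex $\mathrm{BC}(M)$ of $M$ (relative to the chosen ordering of $E$) is a log-concave sequence of nonnegative integers with no internal zeros. \end{enumerate}
   Context: Let $M$ have rank $r+1$. The matroid complex $\mathrm{IN}(M)$ is the simplicial complex of all subsets of $E$ that are independent in $M$. A broken circuit of $M$ (relative to a total ordering of $E$) is a subset obtained from a circuit of $M$ by deleting its least element; the broken circuit complex $\mathrm{BC}(M)$ is the simplicial complex of all subsets of $E$ containing no broken circuit. For a simplicial complex $\Delta$ of dimension $r$, its $f$-vector is $f_0,\dots,f_{r+1}$ where $f_i$ is the number of $(i-1)$-dimensional faces (so $f_0=1$), and its $h$-vector $h_0,\dots,h_{r+1}$ is defined by the polynomial identity $\sum_{i=0}^{r+1} f_i (q-1)^{r+1-i} = \sum_{i=0}^{r+1} h_i q^{r+1-i}$. (Here both complexes are regarded as $r$-dimensional.) A sequence $e_0,\dots,e_n$ is log-concave if $e_{i-1}e_{i+1}\le e_i^2$ for all $0<i<n$, and has no internal zeros if there are no $i<j<k$ with $e_i\ne 0$, $e_j=0$, $e_k\neq 0$. -}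

module Defs where

open import Level using (Level; _⊔_) renaming (suc to lsuc)
open import Data.Nat as ℕ using (ℕ; zero; suc; _<_; _≤ᵇ_; _≡ᵇ_)
open import Data.Integer as ℤ using (ℤ; +_; 0ℤ; 1ℤ)
open import Data.Bool using (Bool; true; false; not; _∧_; _∨_; if_then_else_)
open import Data.Fin using (Fin)
open import Data.Fin.Subset using (Subset; _∈_; _∉_; _⊆_; _∪_; ⁅_⁆; ∣_∣) renaming (_-_ to _∖_)
open import Data.Vec using (Vec; []; _∷_; lookup; replicate)
open import Data.List using (List; []; _∷_; map; _++_; foldr; allFin)
open import Data.Product using (Σ; _×_; ∃; ∃-syntax; _,_)
open import Relation.Nullary using (¬_)
open import Relation.Binary.PropositionalEquality using (_≡_)
open import Algebra.Bundles using (CommutativeRing)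

-- Finite enumeration helpers (Bool-valued, so that face numbers can be
-- counted)

allSubsets : (n : ℕ) → List (Subset n)
allSubsets zero    = [] ∷ []
allSubsets (suc n) = map (false ∷_) (allSubsets n) ++ map (true ∷_) (allSubsets n)

anyL : {A : Set} → (A → Bool) → List A → Bool
anyL p = foldr (λ x b → p x ∨ b) false

allL : {A : Set} → (A → Bool) → List A → Bool
allL p = foldr (λ x b → p x ∧ b) true

countL : {A : Set} → (A → Bool) → List A → ℕ
countL p = foldr (λ x k → if p x then suc k else k) 0

anyFin : {n : ℕ} → (Fin n → Bool) → Bool
anyFin {n} p = anyL p (allFin n)

allFin? : {n : ℕ} → (Fin n → Bool) → Bool
allFin? {n} p = allL p (allFin n)

memB : {n : ℕ} → Fin n → Subset n → Bool
memB i S = lookup S i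

subsetB : {n : ℕ} → Subset n → Subset n → Bool
subsetB A B = allFin? (λ i → not (memB i A) ∨ memB i B)

maxL : List ℕ → ℕ
maxL = foldr ℕ._⊔_ 0

-- Matroids on the ground set E = Fin n, given by their independent sets
-- (a classical predicate, encoded as a Bool-valued function)

record Matroid (n : ℕ) : Set where
  field
    indep      : Subset n → Bool
    indep-∅    : indep (replicate n false) ≡ true
    indep-hered : ∀ A B → A ⊆ B → indep B ≡ true → indep A ≡ true
    indep-aug  : ∀ A B → indep A ≡ true → indep B ≡ true → ∣ A ∣ < ∣ B ∣ →
                 ∃[ x ] (x ∈ B × x ∉ A × indep (A ∪ ⁅ x ⁆) ≡ true)
open Matroid public

rank : {n : ℕ} → Matroid n → ℕ
rank {n} M = maxL (map ∣_∣ (Data.List.filterᵇ (indep M) (allSubsets n)))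
  where import Data.List

isCircuit : {n : ℕ} → Matroid n → Subset n → Bool
isCircuit M C = not (indep M C) ∧ allFin? (λ i → not (memB i C) ∨ indep M (C ∖ i))

-- m is the least element of C with respect to the total order induced by
-- the injective ranking ρ
isLeastIn : {n : ℕ} → (Fin n → ℕ) → Subset n → Fin n → Bool
isLeastIn ρ C m = memB m C ∧ allFin? (λ y → not (memB y C) ∨ (ρ m ≤ᵇ ρ y))

containsBrokenCircuit : {n : ℕ} → Matroid n → (Fin n → ℕ) → Subset n → Bool
containsBrokenCircuit {n} M ρ S =
  anyL (λ C → anyFin (λ m → isCircuit M C ∧ isLeastIn ρ C m ∧ subsetB (C ∖ m) S))
       (allSubsets n)

INface : {n : ℕ} → Matroid n → Subset n → Bool
INface M = indep M

BCface : {n : ℕ} → Matroid n → (Fin n → ℕ) → Subset n → Bool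
BCface M ρ S = not (containsBrokenCircuit M ρ S)

-- f-vector: f i = number of faces with i elements ((i-1)-dimensional faces)
fvec : {n : ℕ} → (Subset n → Bool) → ℕ → ℕ
fvec {n} face i = countL (λ S → face S ∧ (∣ S ∣ ≡ᵇ i)) (allSubsets n)

-- h-vector via the polynomial identity
--   Σ_{i=0}^{D} f_i (q-1)^{D-i} = Σ_{i=0}^{D} h_i q^{D-i}
-- (D = r+1), as an identity of integer polynomial functions in q.

sumTo : ℕ → (ℕ → ℤ) → ℤ
sumTo zero    g = g 0
sumTo (suc D) g = sumTo D g ℤ.+ g (suc D)

IsHVector : (f : ℕ → ℕ) (D : ℕ) (h : ℕ → ℤ) → Set
IsHVector f D h = ∀ (q : ℤ) →
  sumTo D (λ i → (+ f i) ℤ.* ((q ℤ.- 1ℤ) ℤ.^ (D ℕ.∸ i))) ≡ sumTo D (λ i → h i ℤ.* (q ℤ.^ (D ℕ.∸ i)))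

Nonneg : (D : ℕ) → (ℕ → ℤ) → Set
Nonneg D e = ∀ i → i ℕ.≤ D → 0ℤ ℤ.≤ e i

LogConcave : (D : ℕ) → (ℕ → ℤ) → Set
LogConcave D e = ∀ i → 0 < i → i < D → e (i ℕ.∸ 1) ℤ.* e (suc i) ℤ.≤ e i ℤ.* e i

NoInternalZeros : (D : ℕ) → (ℕ → ℤ) → Set
NoInternalZeros D e = ∀ i j k → i < j → j < k → k ℕ.≤ D →
  ¬ (e i ≡ 0ℤ) → ¬ (e k ≡ 0ℤ) → ¬ (e j ≡ 0ℤ)

NiceSequence : (D : ℕ) → (ℕ → ℤ) → Set
NiceSequence D e = Nonneg D e × LogConcave D e × NoInternalZeros D e

-- the h-vector of the complex with faces `face`, regarded as (D-1)-dimensional,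
-- exists and every sequence satisfying the defining identity is nice
HVectorNice : {n : ℕ} → (Subset n → Bool) → ℕ → Set
HVectorNice face D =
  (∃[ h ] IsHVector (fvec face) D h) ×
  (∀ h → IsHVector (fvec face) D h → NiceSequence D h)

record IsFieldOver {c ℓ : Level} (R : CommutativeRing c ℓ) : Set (c ⊔ ℓ) where
  open CommutativeRing R
  field
    one≉zero : ¬ (1# ≈ 0#)
    inverse  : ∀ x → ¬ (x ≈ 0#) → ∃[ y ] (x * y ≈ 1#)

record Field (c ℓ : Level) : Set (lsuc (c ⊔ ℓ)) where
  field
    commRing : CommutativeRing c ℓ
    isField  : IsFieldOver commRing
  open CommutativeRing commRing public

module _ {c ℓ : Level} (F : Field c ℓ) where
  open Field F

  natF : ℕ → Carrier
  natF zero    = 0#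
  natF (suc k) = 1# + natF k

  CharZero : Set ℓ
  CharZero = ∀ k → ¬ (natF (suc k) ≈ 0#)

  sumFin : {n : ℕ} → (Fin n → Carrier) → Carrier
  sumFin {n} g = foldr (λ i s → g i + s) 0# (allFin n)

  LinIndepOn : {n d : ℕ} → (Fin n → Fin d → Carrier) → Subset n → Set (c ⊔ ℓ)
  LinIndepOn {n} {d} v S =
    ∀ (a : Fin n → Carrier) → (∀ i → i ∉ S → a i ≈ 0#) →
    (∀ (j : Fin d) → sumFin (λ i → a i * v i j) ≈ 0#) →
    ∀ i → i ∈ S → a i ≈ 0#

  Represents : {n d : ℕ} → (Fin n → Fin d → Carrier) → Matroid n → Set (c ⊔ ℓ)
  Represents {n} v M = ∀ (S : Subset n) →
    (indep M S ≡ true → LinIndepOn v S) × (LinIndepOn v S → indep M S ≡ true)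

RepresentableCharZero : {n : ℕ} → Matroid n → (c ℓ : Level) → Set (lsuc (c ⊔ ℓ))
RepresentableCharZero {n} M c ℓ =
  Σ (Field c ℓ) λ F → CharZero F × Σ ℕ λ d → Σ (Fin n → Fin d → Field.Carrier F) λ v → Represents F v M

{-# OPTIONS --safe #-}
module Submission where

-- The Whitney polynomial W(q) = Σ_A (-1)^(|A| - r A) (q - 1)^(R - r A) of a loopless matroid is the
-- f-polynomial of its broken circuit complex (toggle the largest element m spanned by A_{>m}), and the
-- Whitney polynomial of the free coextension is q times the f-polynomial of the independence complex.
-- So it suffices to treat the coefficients of W.
--
-- Functions on flats are intersected as divisors on the Bergman fan: D σ (φ₁ ∷ … ∷ φₖ) is their degree on
-- the star of the flag σ, computed one function at a time after moving it by a linear function so that it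
-- vanishes on σ.  Deleting elements e₁, e₂, … until a basis is left gives the functions
-- ψ(G) = r (G ─ T) - r (G ─ (T ∪ eᵢ)), where T = {e₁ , … , eᵢ₋₁}; they serve as the roots of a projective
-- bundle with tautological class δ, and Deg is the degree map of that bundle.  With α the hyperplane
-- class, W(q) = Σ_i Deg (αⁱ δ^(d-i)) q^(i+1): expanding δ along one root is deletion of e plus passage to
-- the next flat of the flag, which is also the recursion of W, and it gives nonnegativity and the absence
-- of internal zeros.
--
-- Log-concavity is the Hodge index inequality Deg(u u C) Deg(c c C) ≤ Deg(u c C)², for C a product of
-- limits of ample letters and c such a limit.  It is proved by induction on the dimension: the first letter of C is an
-- effective combination of boundary pieces, on each of which the inequality is known, and a maximum
-- principle on the connected graph of pieces (solvability of a linear system over ℤ) glues them.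

-- The Bergman fan has dimension `R - 1`, but the monomials in `α` and `δ` have degree `n - 2`. The
-- missing dimensions are the fibres of a bundle with one root for each of the `n - R` deletions, so
-- no second fan has to be built. The obstacle is positivity. A root that is moved by a linear
-- function to vanish on a flag may become negative elsewhere, and then an ample letter is no longer
-- an effective combination of boundary pieces. For every flag there is a removable element whose
-- root vanishes on the flag as it stands, but this element depends on the flag. Hence degrees must
-- not depend on the order of deletion. Two orders are joined either by exchanging adjacent
-- deletions, which preserves the sum and the product of the two roots, or by replacing an element
-- by one in series with it, which changes roots by linear functions only. Stars of longer flags and
-- bundles with fewer roots both occur as boundary pieces, so the induction treats them together. It
-- stops at surfaces, where no letter is left to expand; these are computed for one, two and three
-- roots.

open import Defs
open import Level using (Level)
open import Data.Nat as ℕ using (ℕ; zero; suc; z≤n; s≤s)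
import Data.Nat.Properties as ℕP
open import Data.Integer as ℤ using (ℤ; +_; -[1+_]; 0ℤ; 1ℤ; -1ℤ; _+_; _*_; _-_; -_; _≤_; _<_; _<?_; +≤+; +<+)
import Data.Integer.Properties as ℤP
open import Data.Integer.Tactic.RingSolver using (solve-∀)
open import Data.Bool as Bool using (Bool; true; false; not; _∧_; _∨_; if_then_else_)
import Data.Bool.Properties as BoolP
open import Data.Fin using (Fin; zero; suc; fromℕ<; toℕ; splitAt; _↑ˡ_; _↑ʳ_)
import Data.Fin.Properties as FinP
open import Data.Vec as Vec using (Vec; []; _∷_; lookup; tabulate)
import Data.Vec.Properties as VecP
open import Data.Fin.Subset using (Subset; Nonempty; _∈_; _∉_; _⊆_; _∪_; _∩_; _─_; ⁅_⁆; ⊤; ⊥; ∣_∣)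
open import Data.Fin.Subset.Properties
open import Data.List as List using (List; []; _∷_; length; _++_)
open import Data.List.Relation.Unary.All as All using (All; []; _∷_)
open import Data.List.Relation.Unary.Any as Any using (Any; here; there)
open import Data.List.Membership.Propositional using () renaming (_∈_ to _∈ₗ_)
open import Data.List.Relation.Binary.Permutation.Propositional as Perm using (_↭_)
import Data.List.Relation.Binary.Permutation.Propositional.Properties as PermP
open import Data.Product using (Σ; _×_; ∃; ∃-syntax; _,_; proj₁; proj₂)
open import Data.Sum using (_⊎_; inj₁; inj₂; [_,_]′)
open import Data.Empty using (⊥-elim) renaming (⊥ to Absurd)
open import Relation.Nullary using (¬_; Dec; yes; no)
open import Relation.Nullary.Decidable using (_×-dec_; _⊎-dec_; ¬?)
open import Relation.Binary.PropositionalEquality using (_≡_; _≢_; refl; sym; trans; cong; cong₂; subst; subst₂; module ≡-Reasoning)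
open import Function using (_∘_; id; case_of_)
open import Function.Definitions using (Injective)

-- Integers and finite sums

infixl 6 _⊕_
_⊕_ : ∀ {a b} → 0ℤ ≤ a → 0ℤ ≤ b → 0ℤ ≤ a + b
p ⊕ q = ℤP.+-mono-≤ p q

mul≥0 : ∀ {a b} → 0ℤ ≤ a → 0ℤ ≤ b → 0ℤ ≤ a * b
mul≥0 {+ a} {+ b} _ _ = subst (0ℤ ≤_) (ℤP.pos-* a b) (+≤+ z≤n)
mul≥0 {+ _} { -[1+ _ ]} _ ()
mul≥0 { -[1+ _ ]} ()

mul>0 : ∀ {a b} → 0ℤ < a → 0ℤ < b → 0ℤ < a * b
mul>0 {+ suc a} {+ suc b} _ _ = +<+ (s≤s z≤n)
mul>0 {+ suc _} {+ zero} _ (+<+ ())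
mul>0 {+ suc _} { -[1+ _ ]} _ ()
mul>0 {+ zero} (+<+ ())
mul>0 { -[1+ _ ]} ()

sq≥0 : ∀ a → 0ℤ ≤ a * a
sq≥0 (+ a) = subst (0ℤ ≤_) (ℤP.pos-* a a) (+≤+ z≤n)
sq≥0 -[1+ a ] = +≤+ z≤n

sq>0 : ∀ a → a ≢ 0ℤ → 0ℤ < a * a
sq>0 (+ zero) p = ⊥-elim (p refl)
sq>0 (+ suc a) p = +<+ (s≤s z≤n)
sq>0 -[1+ a ] p = +<+ (s≤s z≤n)

pos⇒nn : ∀ {a} → 0ℤ < a → 0ℤ ≤ a
pos⇒nn = ℤP.<⇒≤

≤⇒0≤- : ∀ {a b} → a ≤ b → 0ℤ ≤ b - a
≤⇒0≤- = ℤP.i≤j⇒0≤j-i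

0≤-⇒≤ : ∀ {a b} → 0ℤ ≤ b - a → a ≤ b
0≤-⇒≤ = ℤP.0≤i-j⇒j≤i

pos+nn : ∀ {a b} → 0ℤ < a → 0ℤ ≤ b → 0ℤ < a + b
pos+nn = ℤP.+-mono-<-≤

nn+pos : ∀ {a b} → 0ℤ ≤ a → 0ℤ < b → 0ℤ < a + b
nn+pos = ℤP.+-mono-≤-<

cancel>0 : ∀ {a b} → 0ℤ < a → 0ℤ ≤ a * b → 0ℤ ≤ b
cancel>0 {a} {+ b} _ _ = +≤+ z≤n
cancel>0 {+ suc a} { -[1+ b ]} _ ()
cancel>0 {+ zero} (+<+ ())
cancel>0 { -[1+ _ ]} ()

+R : ∀ a {x y : ℤ} → x ≡ y → a + x ≡ a + y
+R a e = cong (λ w → a + w) e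

*R : ∀ a {x y : ℤ} → x ≡ y → a * x ≡ a * y
*R a e = cong (λ w → a * w) e

ΣF : (m : ℕ) → (Fin m → ℤ) → ℤ
ΣF zero    f = 0ℤ
ΣF (suc m) f = f zero + ΣF m (f ∘ suc)

ΣF-cong : ∀ m {f g : Fin m → ℤ} → (∀ k → f k ≡ g k) → ΣF m f ≡ ΣF m g
ΣF-cong zero    h = refl
ΣF-cong (suc m) h = cong₂ _+_ (h zero) (ΣF-cong m (h ∘ suc))

ΣF-0 : ∀ m {f : Fin m → ℤ} → (∀ k → f k ≡ 0ℤ) → ΣF m f ≡ 0ℤ
ΣF-0 zero    h = refl
ΣF-0 (suc m) h = cong₂ _+_ (h zero) (ΣF-0 m (h ∘ suc))

+-interchange : ∀ a b c d → (a + b) + (c + d) ≡ (a + c) + (b + d)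
+-interchange = solve-∀

ΣF-+ : ∀ m (f g : Fin m → ℤ) → ΣF m (λ k → f k + g k) ≡ ΣF m f + ΣF m g
ΣF-+ zero    f g = refl
ΣF-+ (suc m) f g = trans (+R (f zero + g zero) (ΣF-+ m (f ∘ suc) (g ∘ suc)))
                         (+-interchange (f zero) (g zero) (ΣF m (f ∘ suc)) (ΣF m (g ∘ suc)))

ΣF-* : ∀ m a (f : Fin m → ℤ) → ΣF m (λ k → a * f k) ≡ a * ΣF m f
ΣF-* zero    a f = sym (ℤP.*-zeroʳ a)
ΣF-* (suc m) a f = trans (+R (a * f zero) (ΣF-* m a (f ∘ suc))) (sym (ℤP.*-distribˡ-+ a (f zero) (ΣF m (f ∘ suc))))

ΣF-swap : ∀ m m' (f : Fin m → Fin m' → ℤ) →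
  ΣF m (λ k → ΣF m' (f k)) ≡ ΣF m' (λ l → ΣF m (λ k → f k l))
ΣF-swap zero    m' f = sym (ΣF-0 m' (λ _ → refl))
ΣF-swap (suc m) m' f = trans (+R (ΣF m' (f zero)) (ΣF-swap m m' (f ∘ suc)))
                             (sym (ΣF-+ m' (f zero) (λ l → ΣF m (λ k → f (suc k) l))))

ΣF-≥0 : ∀ m {f : Fin m → ℤ} → (∀ k → 0ℤ ≤ f k) → 0ℤ ≤ ΣF m f
ΣF-≥0 zero    h = ℤP.≤-refl
ΣF-≥0 (suc m) h = h zero ⊕ ΣF-≥0 m (h ∘ suc)

ΣF->0 : ∀ m {f : Fin m → ℤ} → (∀ k → 0ℤ ≤ f k) → (j : Fin m) → 0ℤ < f j → 0ℤ < ΣF m f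
ΣF->0 (suc m) h zero    p = pos+nn p (ΣF-≥0 m (h ∘ suc))
ΣF->0 (suc m) h (suc j) p = nn+pos (h zero) (ΣF->0 m (h ∘ suc) j p)

ΣF-mono : ∀ m {f g : Fin m → ℤ} → (∀ k → f k ≤ g k) → ΣF m f ≤ ΣF m g
ΣF-mono zero    h = ℤP.≤-refl
ΣF-mono (suc m) h = ℤP.+-mono-≤ (h zero) (ΣF-mono m (h ∘ suc))

ΣF-zero-terms : ∀ m {f : Fin m → ℤ} → (∀ k → 0ℤ ≤ f k) → ΣF m f ≡ 0ℤ → ∀ j → f j ≡ 0ℤ
ΣF-zero-terms m {f} h e j with 0ℤ <? f j
... | yes p = ⊥-elim (ℤP.<-irrefl (sym e) (ΣF->0 m h j p))
... | no ¬p = ℤP.≤-antisym (ℤP.≮⇒≥ ¬p) (h j)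

ΣF-point : ∀ m (j : Fin m) (f : Fin m → ℤ) → (∀ k → k ≢ j → f k ≡ 0ℤ) → ΣF m f ≡ f j
ΣF-point (suc m) zero f h = trans (+R (f zero) (ΣF-0 m (λ k → h (suc k) (λ ())))) (ℤP.+-identityʳ (f zero))
ΣF-point (suc m) (suc j) f h =
  trans (cong₂ _+_ (h zero (λ ())) (ΣF-point m j (f ∘ suc) (λ k k≢j → h (suc k) (k≢j ∘ FinP.suc-injective))))
        (ℤP.+-identityˡ _)

ΣF-split : ∀ m m' (f : Fin (m ℕ.+ m') → ℤ) →
  ΣF (m ℕ.+ m') f ≡ ΣF m (λ k → f (k ↑ˡ m')) + ΣF m' (λ k → f (m ↑ʳ k))
ΣF-split zero    m' f = sym (ℤP.+-identityˡ _)
ΣF-split (suc m) m' f = trans (+R (f zero) (ΣF-split m m' (f ∘ suc))) (sym (ℤP.+-assoc (f zero) (ΣF m (λ k → f (suc k ↑ˡ m'))) (ΣF m' (λ k → f (suc m ↑ʳ k)))))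

size : ℕ → ℕ
size zero    = 1
size (suc n) = size n ℕ.+ size n

enum : ∀ n → Fin (size n) → Subset n
enum zero    _ = []
enum (suc n) k = [ (λ i → false ∷ enum n i) , (λ i → true ∷ enum n i) ]′ (splitAt (size n) k)

index : ∀ {n} → Subset n → Fin (size n)
index []                  = zero
index {suc n} (false ∷ A) = index A ↑ˡ size n
index {suc n} (true ∷ A)  = size n ↑ʳ index A

enum-index : ∀ {n} (A : Subset n) → enum n (index A) ≡ A
enum-index [] = refl
enum-index {suc n} (false ∷ A) rewrite FinP.splitAt-↑ˡ (size n) (index A) (size n) = cong (false ∷_) (enum-index A)
enum-index {suc n} (true ∷ A)  rewrite FinP.splitAt-↑ʳ (size n) (size n) (index A) = cong (true ∷_) (enum-index A)

index-enum : ∀ n (k : Fin (size n)) → index (enum n k) ≡ k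
index-enum zero zero = refl
index-enum (suc n) k with splitAt (size n) k in eq
... | inj₁ i = trans (cong (_↑ˡ size n) (index-enum n i)) (FinP.splitAt⁻¹-↑ˡ eq)
... | inj₂ i = trans (cong (size n ↑ʳ_) (index-enum n i)) (FinP.splitAt⁻¹-↑ʳ eq)

ΣS : ∀ {n} → (Subset n → ℤ) → ℤ
ΣS {n} f = ΣF (size n) (f ∘ enum n)

ΣS-suc : ∀ {n} (f : Subset (suc n) → ℤ) → ΣS f ≡ ΣS (f ∘ (false ∷_)) + ΣS (f ∘ (true ∷_))
ΣS-suc {n} f = trans (ΣF-split (size n) (size n) _)
  (cong₂ _+_ (ΣF-cong (size n) (λ k → cong (λ w → f ([ (λ i → false ∷ enum n i) , (λ i → true ∷ enum n i) ]′ w)) (FinP.splitAt-↑ˡ (size n) k (size n))))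
             (ΣF-cong (size n) (λ k → cong (λ w → f ([ (λ i → false ∷ enum n i) , (λ i → true ∷ enum n i) ]′ w)) (FinP.splitAt-↑ʳ (size n) (size n) k))))

ΣS-cong : ∀ {n} {f g : Subset n → ℤ} → (∀ A → f A ≡ g A) → ΣS f ≡ ΣS g
ΣS-cong {n} h = ΣF-cong (size n) (h ∘ enum n)

ΣS-point : ∀ {n} (B : Subset n) (f : Subset n → ℤ) → (∀ A → A ≢ B → f A ≡ 0ℤ) → ΣS f ≡ f B
ΣS-point {n} B f h = trans (ΣF-point (size n) (index B) (f ∘ enum n)
    (λ k k≢ → h (enum n k) (λ e → k≢ (trans (sym (index-enum n k)) (cong index e)))))
  (cong f (enum-index B))

ΣS->0 : ∀ {n} {f : Subset n → ℤ} → (∀ A → 0ℤ ≤ f A) → (B : Subset n) → 0ℤ < f B → 0ℤ < ΣS f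
ΣS->0 {n} {f} h B p = ΣF->0 (size n) (h ∘ enum n) (index B) (subst (λ A → 0ℤ < f A) (sym (enum-index B)) p)

sel : {P : Set} → Dec P → ℤ → ℤ
sel (yes _) x = x
sel (no _)  x = 0ℤ

sel-yes : {P : Set} (d : Dec P) {x : ℤ} → P → sel d x ≡ x
sel-yes (yes _) p = refl
sel-yes (no ¬p) p = ⊥-elim (¬p p)

sel-no : {P : Set} (d : Dec P) {x : ℤ} → ¬ P → sel d x ≡ 0ℤ
sel-no (yes p) ¬p = ⊥-elim (¬p p)
sel-no (no _)  ¬p = refl

sel-cong : {P : Set} (d : Dec P) {x y : ℤ} → (P → x ≡ y) → sel d x ≡ sel d y
sel-cong (yes p) h = h p
sel-cong (no _)  h = refl

sel-⇔ : {P Q : Set} (d : Dec P) (d' : Dec Q) {x : ℤ} → (P → Q) → (Q → P) → sel d x ≡ sel d' x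
sel-⇔ (yes p) (yes q) f g = refl
sel-⇔ (yes p) (no ¬q) f g = ⊥-elim (¬q (f p))
sel-⇔ (no ¬p) (yes q) f g = ⊥-elim (¬p (g q))
sel-⇔ (no ¬p) (no ¬q) f g = refl

sel-0 : {P : Set} (d : Dec P) → sel d 0ℤ ≡ 0ℤ
sel-0 (yes _) = refl
sel-0 (no _)  = refl

sel-+ : {P : Set} (d : Dec P) (x y : ℤ) → sel d (x + y) ≡ sel d x + sel d y
sel-+ (yes _) x y = refl
sel-+ (no _)  x y = refl

sel-* : {P : Set} (d : Dec P) (a x : ℤ) → sel d (a * x) ≡ a * sel d x
sel-* (yes _) a x = refl
sel-* (no _)  a x = sym (ℤP.*-zeroʳ a)

sel-≥0 : {P : Set} (d : Dec P) {x : ℤ} → (P → 0ℤ ≤ x) → 0ℤ ≤ sel d x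
sel-≥0 (yes p) h = h p
sel-≥0 (no _)  h = ℤP.≤-refl

sel-⊎ : {P Q S : Set} (d : Dec P) (d' : Dec Q) (s : Dec S) {x : ℤ} → (P → S) → (Q → S) → (S → P ⊎ Q) → (P → ¬ Q) →
  sel s x ≡ sel d x + sel d' x
sel-⊎ (yes p) (yes q) _ _ _ _ h = ⊥-elim (h p q)
sel-⊎ (yes p) (no _)  s {x} f _ _ _ = trans (sel-yes s (f p)) (sym (ℤP.+-identityʳ x))
sel-⊎ (no _)  (yes q) s {x} _ g _ _ = trans (sel-yes s (g q)) (sym (ℤP.+-identityˡ x))
sel-⊎ (no ¬p) (no ¬q) s _ _ k _ = sel-no s (λ z → [ ¬p , ¬q ]′ (k z))

-- Linear algebra over ℤ

δF : ∀ {m} → Fin m → Fin m → ℤ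
δF j k = sel (k FinP.≟ j) 1ℤ

ΣF-δ : ∀ m (j : Fin m) (f : Fin m → ℤ) → ΣF m (λ k → δF j k * f k) ≡ f j
ΣF-δ m j f = trans (ΣF-point m j (λ k → δF j k * f k)
    (λ k k≢j → cong (λ w → w * f k) (sel-no (k FinP.≟ j) k≢j)))
  (trans (cong (λ w → w * f j) (sel-yes (j FinP.≟ j) refl)) (ℤP.*-identityˡ (f j)))

ΣF-lin : ∀ m a b (f g : Fin m → ℤ) → ΣF m (λ k → a * f k + b * g k) ≡ a * ΣF m f + b * ΣF m g
ΣF-lin m a b f g = trans (ΣF-+ m (λ k → a * f k) (λ k → b * g k)) (cong₂ _+_ (ΣF-* m a f) (ΣF-* m b g))

private
  elim-row : ∀ P K x y a → (P * x - K * y) * a ≡ P * (x * a) + - K * (y * a)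
  elim-row = solve-∀
  elim-sol : ∀ P K N gk gp Sk Sp → P * Sk + - K * Sp ≡ N * (P * gk - K * gp) →
    K * (N * gp - Sp) + P * Sk ≡ N * P * gk
  elim-sol P K N gk gp Sk Sp e = trans (l₁ P K N gp Sk Sp) (trans (cong (λ w → K * (N * gp) + w) e) (l₂ P K N gk gp))
    where
    l₁ : ∀ P K N gp Sk Sp → K * (N * gp - Sp) + P * Sk ≡ K * (N * gp) + (P * Sk + - K * Sp)
    l₁ = solve-∀
    l₂ : ∀ P K N gk gp → K * (N * gp) + N * (P * gk - K * gp) ≡ N * P * gk
    l₂ = solve-∀
  elim-mul : ∀ x P a → x * (P * a) ≡ P * (x * a)
  elim-mul = solve-∀
  elim-ker : ∀ P y d Y f → (P * y - d * Y) * f ≡ P * (y * f) + - Y * (d * f)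
  elim-ker = solve-∀
  elim-ker₂ : ∀ y P x K z → y * (P * x - K * z) ≡ P * (y * x) + - z * (y * K)
  elim-ker₂ = solve-∀
  elim-col0 : ∀ P Y → P * Y + - Y * P ≡ 0ℤ
  elim-col0 = solve-∀

-- The Fredholm alternative, by elimination of one column at a time.
fredholm : ∀ m m' (L : Fin m → Fin m' → ℤ) (g : Fin m → ℤ) →
  (Σ ℤ λ N → Σ (Fin m' → ℤ) λ a → N ≢ 0ℤ × (∀ k → ΣF m' (λ l → L k l * a l) ≡ N * g k)) ⊎
  (Σ (Fin m → ℤ) λ y → (∀ l → ΣF m (λ k → y k * L k l) ≡ 0ℤ) × ΣF m (λ k → y k * g k) ≢ 0ℤ)
fredholm m zero L g with FinP.all? (λ k → g k ℤP.≟ 0ℤ)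
... | yes h = inj₁ (1ℤ , (λ ()) , (λ ()) , (λ k → sym (trans (ℤP.*-identityˡ (g k)) (h k))))
... | no ¬h with FinP.¬∀⟶∃¬ m _ (λ k → g k ℤP.≟ 0ℤ) ¬h
...   | k , gk≢0 = inj₂ (δF k , (λ ()) , (λ e → gk≢0 (trans (sym (ΣF-δ m k g)) e)))
fredholm m (suc m') L g with FinP.all? (λ k → L k zero ℤP.≟ 0ℤ)
fredholm m (suc m') L g | yes h with fredholm m m' (λ k l → L k (suc l)) g
... | inj₁ (N , a , N≢0 , sol) = inj₁ (N , (λ { zero → 0ℤ ; (suc l) → a l }) , N≢0 ,
        (λ k → trans (cong₂ _+_ (ℤP.*-zeroʳ (L k zero)) (sol k)) (ℤP.+-identityˡ (N * g k))))
... | inj₂ (y , ker , ≢0) = inj₂ (y , (λ { zero → ΣF-0 m (λ k → trans (*R (y k) (h k)) (ℤP.*-zeroʳ (y k))) ; (suc l) → ker l }) , ≢0)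
fredholm m (suc m') L g | no ¬h with FinP.¬∀⟶∃¬ m _ (λ k → L k zero ℤP.≟ 0ℤ) ¬h
-- The pivot row `p` clears the column. Row `p` itself is reduced to zero and kept, so the set of
-- rows does not change in the recursion.
... | p , P≢0 with fredholm m m' (λ k l → L p zero * L k (suc l) - L k zero * L p (suc l)) (λ k → L p zero * g k - L k zero * g p)
...   | inj₁ (N , a , N≢0 , sol) = inj₁ (N * P , a' , NP≢0 , sol')
  where
  P = L p zero
  S : Fin m → ℤ
  S k = ΣF m' (λ l → L k (suc l) * a l)
  a' : Fin (suc m') → ℤ
  a' zero    = N * g p - S p
  a' (suc l) = P * a l
  NP≢0 : N * P ≢ 0ℤ
  NP≢0 e with ℤP.i*j≡0⇒i≡0∨j≡0 N {P} e
  ... | inj₁ x = N≢0 x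
  ... | inj₂ x = P≢0 x
  red : ∀ k → P * S k + - L k zero * S p ≡ N * (P * g k - L k zero * g p)
  red k = trans (sym (trans (ΣF-cong m' (λ l → elim-row P (L k zero) (L k (suc l)) (L p (suc l)) (a l)))
                            (ΣF-lin m' P (- L k zero) (λ l → L k (suc l) * a l) (λ l → L p (suc l) * a l)))) (sol k)
  sol' : ∀ k → ΣF (suc m') (λ l → L k l * a' l) ≡ N * P * g k
  sol' k = trans (+R (L k zero * (N * g p - S p))
                     (trans (ΣF-cong m' (λ l → elim-mul (L k (suc l)) P (a l))) (ΣF-* m' P (λ l → L k (suc l) * a l))))
                 (elim-sol P (L k zero) N (g k) (g p) (S k) (S p) (red k))
...   | inj₂ (y , ker , ≢0) = inj₂ (y' , ker' , λ e → ≢0 (trans gval e))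
  where
  P = L p zero
  Y = ΣF m (λ k → y k * L k zero)
  -- The correction at `p` makes the cleared column cancel; with any other vector `y'` pairs as `y`
  -- pairs with the reduced vector.
  y' : Fin m → ℤ
  y' k = P * y k - δF p k * Y
  act : ∀ (f : Fin m → ℤ) → ΣF m (λ k → y' k * f k) ≡ P * ΣF m (λ k → y k * f k) + - Y * f p
  act f = trans (ΣF-cong m (λ k → elim-ker P (y k) (δF p k) Y (f k)))
          (trans (ΣF-lin m P (- Y) (λ k → y k * f k) (λ k → δF p k * f k))
                 (cong (λ w → P * ΣF m (λ k → y k * f k) + - Y * w) (ΣF-δ m p f)))
  act' : ∀ (f : Fin m → ℤ) → ΣF m (λ k → y k * (P * f k - L k zero * f p)) ≡ P * ΣF m (λ k → y k * f k) + - f p * Y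
  act' f = trans (ΣF-cong m (λ k → elim-ker₂ (y k) P (f k) (L k zero) (f p)))
                 (ΣF-lin m P (- f p) (λ k → y k * f k) (λ k → y k * L k zero))
  comm : ∀ Y z → - Y * z ≡ - z * Y
  comm = solve-∀
  same : ∀ (f : Fin m → ℤ) → ΣF m (λ k → y' k * f k) ≡ ΣF m (λ k → y k * (P * f k - L k zero * f p))
  same f = trans (act f) (trans (+R (P * ΣF m (λ k → y k * f k)) (comm Y (f p))) (sym (act' f)))
  ker' : ∀ l → ΣF m (λ k → y' k * L k l) ≡ 0ℤ
  ker' zero    = trans (act (λ k → L k zero)) (elim-col0 P Y)
  ker' (suc l) = trans (same (λ k → L k (suc l))) (ker l)
  gval : ΣF m (λ k → y k * (P * g k - L k zero * g p)) ≡ ΣF m (λ k → y' k * g k)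
  gval = sym (same g)

sq≡0 : ∀ a → a * a ≡ 0ℤ → a ≡ 0ℤ
sq≡0 a e = [ (λ z → z) , (λ z → z) ]′ (ℤP.i*j≡0⇒i≡0∨j≡0 a {a} e)

-- Gluing hyperbolic forms

module Gluing (m : ℕ) (c : Fin m → ℤ) (H : Fin m → Fin m → ℤ) (g : Fin m → ℤ) (U : ℤ)
  (c≥0 : ∀ k → 0ℤ ≤ c k) (H-sym : ∀ k l → H k l ≡ H l k)
  (H-off : ∀ k l → k ≢ l → 0ℤ ≤ c k * c l * H k l) where

  q : Fin m → ℤ
  q k = ΣF m (λ l → H k l * c l)

  Hb : (Fin m → ℤ) → Fin m → ℤ
  Hb b k = ΣF m (λ l → H k l * b l)

  w : Fin m → Fin m → ℤ
  w k l = c k * c l * H k l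

  private
    ΣΣ : (Fin m → Fin m → ℤ) → ℤ
    ΣΣ f = ΣF m (λ k → ΣF m (f k))

    ΣΣ-cong : ∀ {f f' : Fin m → Fin m → ℤ} → (∀ k l → f k l ≡ f' k l) → ΣΣ f ≡ ΣΣ f'
    ΣΣ-cong h = ΣF-cong m (λ k → ΣF-cong m (h k))

    ΣΣ-+ : ∀ (f f' : Fin m → Fin m → ℤ) → ΣΣ (λ k l → f k l + f' k l) ≡ ΣΣ f + ΣΣ f'
    ΣΣ-+ f f' = trans (ΣF-cong m (λ k → ΣF-+ m (f k) (f' k))) (ΣF-+ m (λ k → ΣF m (f k)) (λ k → ΣF m (f' k)))

    w-sym : ∀ k l → w k l ≡ w l k
    w-sym k l = trans (cong (λ z → c k * c l * z) (H-sym k l)) (cong (λ z → z * H l k) (ℤP.*-comm (c k) (c l)))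

    -- the energy form of the weighted graph w
    lap : (Fin m → ℤ) → ℤ
    lap a = ΣΣ (λ k l → w k l * (a k * a k - a k * a l))

    -- Symmetrising turns the energy into a sum of squares in which the diagonal weights are
    -- multiplied by zero. This is why only the off-diagonal signs of `H` matter.
    lap2 : ∀ (a : Fin m → ℤ) → lap a + lap a ≡ ΣΣ (λ k l → w k l * ((a k - a l) * (a k - a l)))
    lap2 a = trans (cong (λ z → lap a + z) (trans (ΣF-swap m m (λ k l → w k l * (a k * a k - a k * a l)))
               (ΣΣ-cong (λ k l → cong (λ z → z * (a l * a l - a l * a k)) (w-sym l k)))))
             (trans (sym (ΣΣ-+ (λ k l → w k l * (a k * a k - a k * a l)) (λ k l → w k l * (a l * a l - a l * a k))))
                    (ΣΣ-cong (λ k l → ring (w k l) (a k) (a l))))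
      where
      ring : ∀ v x y → v * (x * x - x * y) + v * (y * y - y * x) ≡ v * ((x - y) * (x - y))
      ring = solve-∀

    term≥0 : ∀ (a : Fin m → ℤ) k l → 0ℤ ≤ w k l * ((a k - a l) * (a k - a l))
    term≥0 a k l with k FinP.≟ l
    ... | no k≢l  = mul≥0 (H-off k l k≢l) (sq≥0 (a k - a l))
    ... | yes refl = ℤP.≤-reflexive (sym (ring (w k k) (a k)))
      where
      ring : ∀ v x → v * ((x - x) * (x - x)) ≡ 0ℤ
      ring = solve-∀

    lap≥0 : ∀ (a : Fin m → ℤ) → 0ℤ ≤ lap a
    lap≥0 a = cancel>0 {+ 2} (+<+ (s≤s z≤n)) (subst (0ℤ ≤_) (trans (sym (lap2 a)) (dbl (lap a)))
                (ΣF-≥0 m (λ k → ΣF-≥0 m (term≥0 a k))))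
      where
      dbl : ∀ x → x + x ≡ + 2 * x
      dbl = solve-∀

    -- The weighted Laplacian of the graph `w`: the entry `c k * q k` is the sum of row `k` of `w`.
    L : Fin m → Fin m → ℤ
    L k l = δF k l * (c k * q k) - w k l

    L-act : ∀ (a : Fin m → ℤ) k → ΣF m (λ l → L k l * a l) ≡ c k * q k * a k - c k * Hb (λ l → c l * a l) k
    L-act a k = trans (ΣF-cong m (λ l → r₁ (δF k l) (c k * q k) (c k) (c l) (H k l) (a l)))
      (trans (ΣF-lin m (c k * q k) (- c k) (λ l → δF k l * a l) (λ l → H k l * (c l * a l)))
      (trans (cong (λ z → c k * q k * z + - c k * Hb (λ l → c l * a l) k) (ΣF-δ m k a))
             (r₂ (c k * q k * a k) (c k) (Hb (λ l → c l * a l) k))))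
      where
      r₁ : ∀ d Q x y h a → (d * Q - x * y * h) * a ≡ Q * (d * a) + - x * (h * (y * a))
      r₁ = solve-∀
      r₂ : ∀ A x y → A + - x * y ≡ A - x * y
      r₂ = solve-∀

    L-quad : ∀ (a : Fin m → ℤ) → ΣF m (λ k → a k * (c k * q k * a k - c k * Hb (λ l → c l * a l) k)) ≡ lap a
    L-quad a = ΣF-cong m (λ k → trans (r₁ (a k) (c k) (q k) (Hb (λ l → c l * a l) k))
      (trans (sym (ΣF-lin m (a k * a k * c k) (- (a k * c k)) (λ l → H k l * c l) (λ l → H k l * (c l * a l))))
             (ΣF-cong m (λ l → r₂ (a k) (a l) (c k) (c l) (H k l)))))
      where
      r₁ : ∀ a c q h → a * (c * q * a - c * h) ≡ a * a * c * q + - (a * c) * h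
      r₁ = solve-∀
      r₂ : ∀ a b c d h → a * a * c * (h * d) + - (a * c) * (h * (d * b)) ≡ c * d * h * (a * a - a * b)
      r₂ = solve-∀

  -- Connectedness of the support of `c`, phrased through functions that are constant along edges,
  -- because kernel vectors of `L` arise in this form.
  Connected : Set
  Connected = ∀ (y : Fin m → ℤ) → (∀ k l → k ≢ l → w k l ≢ 0ℤ → y k ≡ y l) → ∀ k l → c k ≢ 0ℤ → c l ≢ 0ℤ → y k ≡ y l

  -- Here `U` stands for `Q u u` and `g k` for the pairing of `u` with the piece `D k`. For
  -- `v = N u + Σ b k D k` the left side is `Q v v`, `X k` is the square of `v` on the piece, and
  -- the bound is the Hodge index inequality there, `q k` being the square of the reference letter.
  Locally : Set
  Locally = ∀ N (b : Fin m → ℤ) → Σ (Fin m → ℤ) λ X → (N * N * U + (N * ΣF m (λ k → b k * g k) + N * ΣF m (λ k → b k * g k)) + ΣF m (λ k → b k * Hb b k)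
               ≡ ΣF m (λ k → c k * X k)
             × (∀ k → 0ℤ < c k → X k * q k ≤ (N * g k + Hb b k) * (N * g k + Hb b k)))

  private
   -- A kernel vector has zero energy, so it is constant on the support of `c`. Its pairing with the
   -- right-hand side is then a multiple of `Σ c k g k = 0`.
   kernel-case : Connected → ΣF m (λ k → c k * g k) ≡ 0ℤ → (y : Fin m → ℤ) →
     (∀ l → ΣF m (λ k → y k * L k l) ≡ 0ℤ) → ΣF m (λ k → y k * (c k * g k)) ≡ 0ℤ
   kernel-case conn cg≡0 y ker = zero-pairing
    where
    ker-sym : ∀ k l → L k l ≡ L l k
    ker-sym k l = cong₂ _-_ dd (w-sym k l)
      where
      dd : δF k l * (c k * q k) ≡ δF l k * (c l * q l)
      dd with l FinP.≟ k | k FinP.≟ l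
      ... | yes refl | yes _ = refl
      ... | yes e | no ¬e = ⊥-elim (¬e (sym e))
      ... | no ¬e | yes e = ⊥-elim (¬e (sym e))
      ... | no _ | no _ = refl
    lap0 : lap y ≡ 0ℤ
    lap0 = trans (sym (L-quad y)) (ΣF-0 m (λ k → trans (*R (y k)
             (trans (sym (L-act y k)) (trans (ΣF-cong m (λ l → trans (cong (λ z → z * y l) (ker-sym k l)) (ℤP.*-comm (L l k) (y l)))) (ker k))))
             (ℤP.*-zeroʳ (y k))))
    terms : ∀ k l → w k l * ((y k - y l) * (y k - y l)) ≡ 0ℤ
    terms k l = ΣF-zero-terms m {λ l → w k l * ((y k - y l) * (y k - y l))} (term≥0 y k)
                  (ΣF-zero-terms m {λ k → ΣF m (λ l → w k l * ((y k - y l) * (y k - y l)))} (λ k → ΣF-≥0 m (term≥0 y k))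
                    (trans (sym (lap2 y)) (cong₂ _+_ lap0 lap0)) k) l
    eqs : ∀ k l → k ≢ l → w k l ≢ 0ℤ → y k ≡ y l
    eqs k l _ w≢0 = [ (λ e → ⊥-elim (w≢0 e)) ,
                      (λ e → ℤP.i-j≡0⇒i≡j (y k) (y l) (sq≡0 (y k - y l) e)) ]′
                    (ℤP.i*j≡0⇒i≡0∨j≡0 (w k l) {(y k - y l) * (y k - y l)} (terms k l))
    zero-pairing : ΣF m (λ k → y k * (c k * g k)) ≡ 0ℤ
    zero-pairing with FinP.all? (λ k → c k ℤP.≟ 0ℤ)
    ... | yes h = ΣF-0 m (λ k → trans (cong (λ z → y k * (z * g k)) (h k)) (ℤP.*-zeroʳ (y k)))
    ... | no ¬h with FinP.¬∀⟶∃¬ m _ (λ k → c k ℤP.≟ 0ℤ) ¬h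
    ...   | k₀ , ck₀≢0 = trans (ΣF-cong m one) (trans (ΣF-* m (y k₀) (λ k → c k * g k)) (trans (*R (y k₀) cg≡0) (ℤP.*-zeroʳ (y k₀))))
      where
      one : ∀ k → y k * (c k * g k) ≡ y k₀ * (c k * g k)
      one k with c k ℤP.≟ 0ℤ
      ... | yes e = trans (cong (λ z → y k * (z * g k)) e) (trans (ℤP.*-zeroʳ (y k)) (sym (trans (cong (λ z → y k₀ * (z * g k)) e) (ℤP.*-zeroʳ (y k₀)))))
      ... | no ≢0 = cong (λ z → z * (c k * g k)) (conn y eqs k k₀ ≢0 ck₀≢0)

   -- With `b = c a` the letter `N u + Σ b k D k` meets the piece `k` in `q k * a k`, so the local
   -- bound becomes `X k ≤ q k * a k * a k`. Summing gives `N N U + 2 N B + C ≤ N B + C`, and `N B`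
   -- is the energy of `a`, hence nonnegative.
   solution-case : (∀ k → 0ℤ < c k → 0ℤ < q k) → Locally → (N : ℤ) (a : Fin m → ℤ) → N ≢ 0ℤ →
     (∀ k → ΣF m (λ l → L k l * a l) ≡ N * (c k * g k)) → U ≤ 0ℤ
   solution-case q>0 hyp N a N≢0 sol = ℤP.≮⇒≥ (λ U>0 → ℤP.<⇒≱ (mul>0 (sq>0 N N≢0) U>0) NNU≤0)
    where
    b : Fin m → ℤ
    b k = c k * a k
    X = proj₁ (hyp N b)
    B = ΣF m (λ k → b k * g k)
    C = ΣF m (λ k → b k * Hb b k)
    T₁ = ΣF m (λ k → c k * (q k * (a k * a k)))
    row : ∀ k → c k * q k * a k - c k * Hb b k ≡ N * (c k * g k)
    row k = trans (sym (L-act a k)) (sol k)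
    rowdiv : ∀ k → 0ℤ < c k → N * g k + Hb b k ≡ q k * a k
    rowdiv k c>0 = ℤP.*-cancelˡ-≡ (c k) (N * g k + Hb b k) (q k * a k) {{ℤ.≢-nonZero (λ e → ℤP.<-irrefl (sym e) c>0)}}
      (trans (r₁ (c k) N (g k) (Hb b k)) (trans (cong (λ z → z + c k * Hb b k) (sym (row k))) (r₂ (c k) (q k) (a k) (Hb b k))))
      where
      r₁ : ∀ c N g h → c * (N * g + h) ≡ N * (c * g) + c * h
      r₁ = solve-∀
      r₂ : ∀ c q a h → c * q * a - c * h + c * h ≡ c * (q * a)
      r₂ = solve-∀
    T₁-id : T₁ ≡ N * B + C
    T₁-id = trans (ΣF-cong m (λ k → trans (r₁ (c k) (q k) (a k) (Hb b k)) (trans (cong (λ z → a k * z + b k * Hb b k) (row k)) (r₂ (a k) N (c k) (g k) (b k * Hb b k)))))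
            (trans (ΣF-+ m (λ k → N * (b k * g k)) (λ k → b k * Hb b k)) (cong (λ z → z + C) (ΣF-* m N (λ k → b k * g k))))
      where
      r₁ : ∀ c q a h → c * (q * (a * a)) ≡ a * (c * q * a - c * h) + c * a * h
      r₁ = solve-∀
      r₂ : ∀ a N c g z → a * (N * (c * g)) + z ≡ N * (c * a * g) + z
      r₂ = solve-∀
    X≤ : ∀ k → c k * X k ≤ c k * (q k * (a k * a k))
    X≤ k with 0ℤ <? c k
    ... | no ¬c = ℤP.≤-reflexive (trans (cong (λ z → z * X k) c≡0) (sym (cong (λ z → z * (q k * (a k * a k))) c≡0)))
      where
      c≡0 : c k ≡ 0ℤ
      c≡0 = ℤP.≤-antisym (ℤP.≮⇒≥ ¬c) (c≥0 k)
    ... | yes c>0 = 0≤-⇒≤ (subst (0ℤ ≤_) (r₂ (c k) (X k) (q k * (a k * a k))) (mul≥0 (c≥0 k) (cancel>0 (q>0 k c>0) (subst (0ℤ ≤_) (r₁ (X k) (q k) (a k))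
           (≤⇒0≤- (subst (X k * q k ≤_) (cong (λ z → z * z) (rowdiv k c>0)) (proj₂ (proj₂ (hyp N b)) k c>0)))))))
      where
      r₁ : ∀ x q a → q * a * (q * a) - x * q ≡ q * (q * (a * a) - x)
      r₁ = solve-∀
      r₂ : ∀ c x y → c * (y - x) ≡ c * y - c * x
      r₂ = solve-∀
    upper : N * N * U + (N * B + N * B) + C ≤ N * B + C
    upper = subst₂' (sym (proj₁ (proj₂ (hyp N b)))) T₁-id (ΣF-mono m X≤)
      where
      subst₂' : ∀ {x y x' y'} → x ≡ x' → y ≡ y' → x ≤ y → x' ≤ y'
      subst₂' refl refl p = p
    NB≥0 : 0ℤ ≤ N * B
    NB≥0 = subst (0ℤ ≤_) (trans (sym (L-quad a)) (trans (ΣF-cong m (λ k → trans (*R (a k) (row k)) (r (a k) N (c k) (g k)))) (ΣF-* m N (λ k → b k * g k)))) (lap≥0 a)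
      where
      r : ∀ a N c g → a * (N * (c * g)) ≡ N * (c * a * g)
      r = solve-∀
    NNU≤0 : N * N * U ≤ 0ℤ
    NNU≤0 = 0≤-⇒≤ (subst (0ℤ ≤_) (r (N * N * U) (N * B) C) (NB≥0 ⊕ ≤⇒0≤- upper))
      where
      r : ∀ u v c → v + (v + c - (u + (v + v) + c)) ≡ 0ℤ - u
      r = solve-∀

  glue : (∀ k → 0ℤ < c k → 0ℤ < q k) → Connected → Locally → ΣF m (λ k → c k * g k) ≡ 0ℤ → U ≤ 0ℤ
  glue q>0 conn hyp cg≡0 with fredholm m m L (λ k → c k * g k)
  ... | inj₁ (N , a , N≢0 , sol) = solution-case q>0 hyp N a N≢0 sol
  ... | inj₂ (y , ker , ≢0) = ⊥-elim (≢0 (kernel-case conn cg≡0 y ker))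

-- Subsets and matroid rank functions

_≟S_ : ∀ {n} (A B : Subset n) → Dec (A ≡ B)
_≟S_ = VecP.≡-dec Bool._≟_

∈⇒lookup : ∀ {n} {x : Fin n} {A} → x ∈ A → lookup A x ≡ true
∈⇒lookup = VecP.[]=⇒lookup

lookup⇒∈ : ∀ {n} {x : Fin n} {A} → lookup A x ≡ true → x ∈ A
lookup⇒∈ {x = x} {A} = VecP.lookup⇒[]= x A

∈─⁻ : ∀ {n} {x : Fin n} (A B : Subset n) → x ∈ A ─ B → x ∈ A × x ∉ B
∈─⁻ {x = x} A B p = p─q⊆p A B p , λ x∈B → no-both A B p x∈B
  where
  no-both : ∀ {n} {x : Fin n} (A B : Subset n) → x ∈ A ─ B → x ∈ B → Absurd
  no-both (a ∷ A) (.true ∷ B) () Vec.here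
  no-both (a ∷ A) (b ∷ B) (Vec.there p) (Vec.there q) = no-both A B p q

∈─⁺ : ∀ {n} {x : Fin n} {A B : Subset n} → x ∈ A → x ∉ B → x ∈ A ─ B
∈─⁺ = x∈p∧x∉q⇒x∈p─q

∈∪ˡ : ∀ {n} {x : Fin n} {A B : Subset n} → x ∈ A → x ∈ A ∪ B
∈∪ˡ {B = B} = p⊆p∪q B

∈∪ʳ : ∀ {n} {x : Fin n} {A B : Subset n} → x ∈ B → x ∈ A ∪ B
∈∪ʳ {A = A} {B} = q⊆p∪q A B

∪-⊆ : ∀ {n} {A B C : Subset n} → A ⊆ C → B ⊆ C → A ∪ B ⊆ C
∪-⊆ {A = A} {B} f g x∈ = [ f , g ]′ (x∈p∪q⁻ A B x∈)

∪-mono : ∀ {n} {A B C D : Subset n} → A ⊆ C → B ⊆ D → A ∪ B ⊆ C ∪ D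
∪-mono f g = ∪-⊆ (∈∪ˡ ∘ f) (∈∪ʳ ∘ g)

⁅⁆⊆ : ∀ {n} {x : Fin n} {A : Subset n} → x ∈ A → ⁅ x ⁆ ⊆ A
⁅⁆⊆ {x = x} {A} x∈A y∈ = subst (_∈ A) (sym (x∈⁅y⁆⇒x≡y x y∈)) x∈A

─-monoˡ : ∀ {n} {A B : Subset n} (T : Subset n) → A ⊆ B → A ─ T ⊆ B ─ T
─-monoˡ {A = A} T h x∈ = ∈─⁺ (h (proj₁ (∈─⁻ A T x∈))) (proj₂ (∈─⁻ A T x∈))

⊈⇒∃ : ∀ {n} {A B : Subset n} → ¬ (A ⊆ B) → ∃[ x ] (x ∈ A × x ∉ B)
⊈⇒∃ {n} {A} {B} h with FinP.any? (λ x → (x ∈? A) ×-dec ¬? (x ∈? B))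
... | yes p = p
... | no ¬p = ⊥-elim (h (λ {x} x∈A → case x ∈? B of λ { (yes q) → q ; (no q) → ⊥-elim (¬p (x , x∈A , q)) }))

≢⊥⇒∃ : ∀ {n} {A : Subset n} → A ≢ ⊥ → ∃[ x ] x ∈ A
≢⊥⇒∃ {A = A} h with ⊈⇒∃ {A = A} {⊥} (λ s → h (⊆-antisym s ⊥⊆))
... | x , p , _ = x , p

≢⊤⇒∃ : ∀ {n} {A : Subset n} → A ≢ ⊤ → ∃[ x ] x ∉ A
≢⊤⇒∃ {A = A} h with ⊈⇒∃ {A = ⊤} {A} (λ s → h (⊆-antisym ⊆⊤ s))
... | x , _ , p = x , p

⊆∧≢⇒∃ : ∀ {n} {A B : Subset n} → A ⊆ B → A ≢ B → ∃[ x ] (x ∈ B × x ∉ A)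
⊆∧≢⇒∃ s h = ⊈⇒∃ (λ s' → h (⊆-antisym s s'))

mem : ∀ {n} → Fin n → Subset n → ℤ
mem j A = if lookup A j then 1ℤ else 0ℤ

mem-∈ : ∀ {n} {j : Fin n} {A} → j ∈ A → mem j A ≡ 1ℤ
mem-∈ p rewrite ∈⇒lookup p = refl

mem-∉ : ∀ {n} {j : Fin n} {A} → j ∉ A → mem j A ≡ 0ℤ
mem-∉ {j = j} {A} p with lookup A j in eq
... | true  = ⊥-elim (p (lookup⇒∈ eq))
... | false = refl

mem-≥0 : ∀ {n} (j : Fin n) A → 0ℤ ≤ mem j A
mem-≥0 j A with lookup A j
... | true  = +≤+ z≤n
... | false = +≤+ z≤n

record IsRank {n} (r : Subset n → ℕ) : Set where
  field
    r-⊥   : r ⊥ ≡ 0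
    r-mono : ∀ {A B} → A ⊆ B → r A ℕ.≤ r B
    r-sub : ∀ A B → r (A ∪ B) ℕ.+ r (A ∩ B) ℕ.≤ r A ℕ.+ r B
    r-one : ∀ x → r ⁅ x ⁆ ℕ.≤ 1

module Rank {n} (r : Subset n → ℕ) (isRank : IsRank r) where
  open IsRank isRank public

  infix 4 _∈cl_
  _∈cl_ : Fin n → Subset n → Set
  x ∈cl A = r (A ∪ ⁅ x ⁆) ≡ r A

  r-step : ∀ A x → r (A ∪ ⁅ x ⁆) ℕ.≤ suc (r A)
  r-step A x = ℕP.≤-trans (ℕP.m≤m+n _ _) (ℕP.≤-trans (r-sub A ⁅ x ⁆)
    (ℕP.≤-trans (ℕP.+-monoʳ-≤ (r A) (r-one x)) (ℕP.≤-reflexive (ℕP.+-comm (r A) 1))))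

  ∉cl⇒suc : ∀ A x → ¬ (x ∈cl A) → r (A ∪ ⁅ x ⁆) ≡ suc (r A)
  ∉cl⇒suc A x h = ℕP.≤-antisym (r-step A x) (ℕP.≤∧≢⇒< (r-mono ∈∪ˡ) (λ e → h (sym e)))

  ∈⇒∈cl : ∀ {A x} → x ∈ A → x ∈cl A
  ∈⇒∈cl x∈A = ℕP.≤-antisym (r-mono (∪-⊆ id (⁅⁆⊆ x∈A))) (r-mono ∈∪ˡ)

  -- Submodularity for `B` and `A ∪ ⁅ x ⁆`, whose intersection contains `A`.
  ∈cl-mono : ∀ {A B x} → A ⊆ B → x ∈cl A → x ∈cl B
  ∈cl-mono {A} {B} {x} A⊆B h = ℕP.≤-antisym
    (ℕP.+-cancelʳ-≤ (r A) _ _ (ℕP.≤-trans (ℕP.+-mono-≤ (r-mono (∪-mono {A = B} {B = ⁅ x ⁆} {C = B} {D = A ∪ ⁅ x ⁆} id ∈∪ʳ))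
        (r-mono (λ y∈ → x∈p∩q⁺ (A⊆B y∈ , ∈∪ˡ y∈))))
      (ℕP.≤-trans (r-sub B (A ∪ ⁅ x ⁆)) (ℕP.≤-reflexive (cong (r B ℕ.+_) h)))))
    (r-mono ∈∪ˡ)

  r-∪-cl : ∀ A B → (∀ {x} → x ∈ B → x ∈cl A) → r (A ∪ B) ≡ r A
  r-∪-cl A B h = go ∣ B ∣ B ℕP.≤-refl h
    where
    go : ∀ m C → ∣ C ∣ ℕ.≤ m → (∀ {x} → x ∈ C → x ∈cl A) → r (A ∪ C) ≡ r A
    go m C le hC with nonempty? C
    ... | no ¬ne = cong r (⊆-antisym (∪-⊆ id (λ x∈ → ⊥-elim (¬ne (_ , x∈)))) ∈∪ˡ)
    go zero C le hC | yes (x , x∈C) = ⊥-elim (ℕP.n≮0 (ℕP.≤-trans (x∈p⇒∣p-x∣<∣p∣ x∈C) le))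
    go (suc m) C le hC | yes (x , x∈C) = trans (cong r set-eq) (trans (∈cl-mono ∈∪ˡ (hC x∈C)) rec)
      where
      C' = C ─ ⁅ x ⁆
      rec : r (A ∪ C') ≡ r A
      rec = go m C' (ℕP.≤-pred (ℕP.≤-trans (x∈p⇒∣p-x∣<∣p∣ x∈C) le)) (λ y∈ → hC (p─q⊆p C ⁅ x ⁆ y∈))
      set-eq : A ∪ C ≡ (A ∪ C') ∪ ⁅ x ⁆
      set-eq = ⊆-antisym
        (∪-⊆ (∈∪ˡ ∘ ∈∪ˡ) (λ {y} y∈C → case y ∈? ⁅ x ⁆ of λ { (yes p) → ∈∪ʳ p ; (no p) → ∈∪ˡ (∈∪ʳ (∈─⁺ y∈C p)) }))
        (∪-⊆ (∪-⊆ ∈∪ˡ (∈∪ʳ ∘ p─q⊆p C ⁅ x ⁆)) (∈∪ʳ ∘ ⁅⁆⊆ x∈C))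

  r-gap : ∀ A B → r A ℕ.< r (A ∪ B) → ∃[ x ] (x ∈ B × ¬ (x ∈cl A))
  r-gap A B lt with FinP.any? (λ x → (x ∈? B) ×-dec ¬? (r (A ∪ ⁅ x ⁆) ℕP.≟ r A))
  ... | yes p = p
  ... | no ¬p = ⊥-elim (ℕP.<-irrefl (sym (r-∪-cl A B (λ {x} x∈B → case r (A ∪ ⁅ x ⁆) ℕP.≟ r A of λ { (yes q) → q ; (no q) → ⊥-elim (¬p (x , x∈B , q)) }))) lt)

  cl : Subset n → Subset n
  cl A = tabulate (λ x → Dec.does (r (A ∪ ⁅ x ⁆) ℕP.≟ r A))

  ∈cl⁺ : ∀ {A x} → x ∈cl A → x ∈ cl A
  ∈cl⁺ {A} {x} h = lookup⇒∈ (trans (VecP.lookup∘tabulate _ x) (dec-true (r (A ∪ ⁅ x ⁆) ℕP.≟ r A) h))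
    where
    dec-true : ∀ {P : Set} (d : Dec P) → P → Dec.does d ≡ true
    dec-true (yes _) _ = refl
    dec-true (no ¬p) p = ⊥-elim (¬p p)

  ∈cl⁻ : ∀ {A x} → x ∈ cl A → x ∈cl A
  ∈cl⁻ {A} {x} h = true-dec (r (A ∪ ⁅ x ⁆) ℕP.≟ r A) (trans (sym (VecP.lookup∘tabulate _ x)) (∈⇒lookup h))
    where
    true-dec : ∀ {P : Set} (d : Dec P) → Dec.does d ≡ true → P
    true-dec (yes p) _ = p
    true-dec (no _) ()

  ⊆cl : ∀ {A} → A ⊆ cl A
  ⊆cl x∈ = ∈cl⁺ (∈⇒∈cl x∈)

  r-cl : ∀ A → r (cl A) ≡ r A
  r-cl A = trans (cong r (⊆-antisym (∈∪ʳ) (∪-⊆ ⊆cl id))) (r-∪-cl A (cl A) ∈cl⁻)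

  Flat : Subset n → Set
  Flat G = ∀ x → x ∈cl G → x ∈ G

  flat? : ∀ G → Dec (Flat G)
  flat? G with FinP.all? (λ x → ¬? (r (G ∪ ⁅ x ⁆) ℕP.≟ r G) ⊎-dec (x ∈? G))
  ... | yes h = yes (λ x x∈cl → [ (λ ¬p → ⊥-elim (¬p x∈cl)) , id ]′ (h x))
  ... | no ¬h = no (λ fl → ¬h (λ x → case r (G ∪ ⁅ x ⁆) ℕP.≟ r G of λ { (yes p) → inj₂ (fl x p) ; (no p) → inj₁ p }))

  cl-flat : ∀ A → Flat (cl A)
  cl-flat A x h = ∈cl⁺ (ℕP.≤-antisym (ℕP.≤-trans (r-mono (∪-mono ⊆cl id)) (ℕP.≤-reflexive (trans h (r-cl A)))) (r-mono ∈∪ˡ))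

  cl-min : ∀ {A G} → Flat G → A ⊆ G → cl A ⊆ G
  cl-min fl s x∈ = fl _ (∈cl-mono s (∈cl⁻ x∈))

  ⊤-flat : Flat ⊤
  ⊤-flat _ _ = ∈⊤

  ∩-flat : ∀ {F G} → Flat F → Flat G → Flat (F ∩ G)
  ∩-flat {F} {G} f g x h = x∈p∩q⁺ (f x (∈cl-mono (p∩q⊆p F G) h) , g x (∈cl-mono (p∩q⊆q F G) h))

  flat-≡ : ∀ {F G} → Flat F → F ⊆ G → r G ℕ.≤ r F → F ≡ G
  flat-≡ {F} {G} fl s le = ⊆-antisym s (λ {x} x∈G → fl x (ℕP.≤-antisym (ℕP.≤-trans (r-mono (∪-⊆ s (⁅⁆⊆ x∈G))) le) (r-mono ∈∪ˡ)))

  flat-< : ∀ {F G} → Flat F → F ⊆ G → F ≢ G → r F ℕ.< r G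
  flat-< fl s ne = ℕP.≰⇒> (λ le → ne (flat-≡ fl s le))

  flat-step : ∀ {F x} → Flat F → x ∉ F → r (F ∪ ⁅ x ⁆) ≡ suc (r F)
  flat-step {F} {x} fl x∉ = ∉cl⇒suc F x (λ h → x∉ (fl x h))

  interpolate : ∀ k A B t → A ⊆ B → k ℕ.+ r A ≡ t → t ℕ.≤ r B → ∃[ C ] (A ⊆ C × C ⊆ B × r C ≡ t)
  interpolate zero A B t s e le = A , id , s , e
  interpolate (suc k) A B t s e le with r-gap A B (ℕP.≤-trans (ℕP.≤-trans (s≤s (ℕP.m≤n+m (r A) k)) (ℕP.≤-reflexive e)) (ℕP.≤-trans le (r-mono ∈∪ʳ)))
  ... | x , x∈B , x∉cl with interpolate k (A ∪ ⁅ x ⁆) B t (∪-⊆ s (⁅⁆⊆ x∈B))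
            (trans (cong (k ℕ.+_) (∉cl⇒suc A x x∉cl)) (trans (ℕP.+-suc k (r A)) e)) le
  ...   | C , s₁ , s₂ , e' = C , s₁ ∘ ∈∪ˡ , s₂ , e'

-- Flags of flats

module Flags {n} (r : Subset n → ℕ) (isRank : IsRank r) (loopless : ∀ x → r ⁅ x ⁆ ≡ 1) where
  open Rank r isRank public

  R : ℕ
  R = r ⊤

  ⊥-flat : Flat ⊥
  ⊥-flat x h = ⊥-elim (ℕP.1+n≢0 (trans (sym (loopless x)) (trans (cong r (sym (∪-identityˡ ⁅ x ⁆))) (trans h r-⊥))))

  Cmp : Subset n → Subset n → Set
  Cmp F G = (F ⊆ G ⊎ G ⊆ F) × F ≢ G

  cmp? : ∀ F G → Dec (Cmp F G)
  cmp? F G = ((F ⊆? G) ⊎-dec (G ⊆? F)) ×-dec ¬? (F ≟S G)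

  cmp-sym : ∀ {F G} → Cmp F G → Cmp G F
  cmp-sym (inj₁ s , ne) = inj₂ s , ne ∘ sym
  cmp-sym (inj₂ s , ne) = inj₁ s , ne ∘ sym

  -- A ray of the star of `σ`. Flags are listed in order of insertion and not of inclusion, so that
  -- passing to a smaller star is a cons.
  record Link (σ : List (Subset n)) (G : Subset n) : Set where
    constructor mkLink
    field
      flat : Flat G
      ≢⊥   : G ≢ ⊥
      ≢⊤   : G ≢ ⊤
      cmps : All (λ F → Cmp F G) σ
  open Link public

  link? : ∀ σ G → Dec (Link σ G)
  link? σ G with flat? G | G ≟S ⊥ | G ≟S ⊤ | All.all? (λ F → cmp? F G) σ
  ... | yes a | no b | no c | yes d = yes (mkLink a b c d)
  ... | no a | _ | _ | _ = no (a ∘ flat)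
  ... | yes _ | yes b | _ | _ = no (λ l → ≢⊥ l b)
  ... | yes _ | no _ | yes c | _ = no (λ l → ≢⊤ l c)
  ... | yes _ | no _ | no _ | no d = no (d ∘ cmps)

  link-tail : ∀ {σ F G} → Link (F ∷ σ) G → Link σ G
  link-tail (mkLink a b c (_ ∷ d)) = mkLink a b c d

  link-head : ∀ {σ F G} → Link (F ∷ σ) G → Cmp F G
  link-head (mkLink _ _ _ (c ∷ _)) = c

  link-swap : ∀ {σ F G} → Link σ F → Link (F ∷ σ) G → Link (G ∷ σ) F
  link-swap (mkLink a b c d) l = mkLink a b c (cmp-sym (link-head l) ∷ d)

  data Flag : List (Subset n) → Set where
    []  : Flag []
    _∷_ : ∀ {σ G} → Link σ G → Flag σ → Flag (G ∷ σ)

  flag-member : ∀ {σ F} → Flag σ → F ∈ₗ σ → Flat F × F ≢ ⊥ × F ≢ ⊤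
  flag-member (l ∷ _)  (here refl) = flat l , ≢⊥ l , ≢⊤ l
  flag-member (_ ∷ fs) (there p)   = flag-member fs p

  flag-cmp : ∀ {σ F G} → Flag σ → F ∈ₗ σ → G ∈ₗ σ → F ⊆ G ⊎ G ⊆ F
  flag-cmp (l ∷ fs) (here refl) (here refl) = inj₁ id
  flag-cmp (l ∷ fs) (here refl) (there q)   = proj₁ (cmp-sym (All.lookup (cmps l) q))
  flag-cmp (l ∷ fs) (there p)   (here refl) = proj₁ (All.lookup (cmps l) p)
  flag-cmp (l ∷ fs) (there p)   (there q)   = flag-cmp fs p q

  -- The element of `C` that enters the chain last works: it avoids the largest member that does not
  -- contain `C`.
  chain-∈ : ∀ {σ} → Flag σ → ∀ C → Nonempty C → ∃[ e ] (e ∈ C × All (λ F → e ∈ F → C ⊆ F) σ)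
  chain-∈ [] C (e , e∈) = e , e∈ , []
  chain-∈ {F ∷ σ} (l ∷ fs) C ne with chain-∈ fs C ne
  ... | e , e∈C , h with e ∈? F | C ⊆? F
  ...   | no e∉F | _ = e , e∈C , (λ e∈F → ⊥-elim (e∉F e∈F)) ∷ h
  ...   | yes _ | yes C⊆F = e , e∈C , (λ _ → C⊆F) ∷ h
  ...   | yes e∈F | no C⊈F with ⊈⇒∃ C⊈F
  ...     | e' , e'∈C , e'∉F = e' , e'∈C , (λ e'∈F → ⊥-elim (e'∉F e'∈F)) ∷
              All.zipWith (λ { (c , k) e'∈F₂ → [ (λ s → ⊥-elim (e'∉F (s e'∈F₂))) , (λ s → k (s e∈F)) ]′ (proj₁ c) }) (cmps l , h)

  -- Dually, `j` is taken from the smallest member that is not contained in `G`, if there is one.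
  chain-∉ : ∀ {σ} → Flag σ → ∀ G → ∃[ j ] j ∉ G → ∃[ j ] (j ∉ G × All (λ F → F ⊆ G ⊎ j ∈ F) σ)
  chain-∉ [] G (j , j∉) = j , j∉ , []
  chain-∉ {F ∷ σ} (l ∷ fs) G ne with chain-∉ fs G ne
  ... | j , j∉G , h with F ⊆? G | j ∈? F
  ...   | yes s | _ = j , j∉G , inj₁ s ∷ h
  ...   | no _ | yes j∈F = j , j∉G , inj₂ j∈F ∷ h
  ...   | no F⊈G | no j∉F with ⊈⇒∃ F⊈G
  ...     | j' , j'∈F , j'∉G = j' , j'∉G , inj₂ j'∈F ∷
              All.zipWith step (cmps l , h)
    where
    step : ∀ {F₂} → Cmp F₂ F × (F₂ ⊆ G ⊎ j ∈ F₂) → F₂ ⊆ G ⊎ j' ∈ F₂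
    step (c , inj₁ s) = inj₁ s
    step ((inj₁ s , _) , inj₂ j∈F₂) = ⊥-elim (j∉F (s j∈F₂))
    step ((inj₂ s , _) , inj₂ j∈F₂) = inj₂ (s j'∈F)

  Covered : List (Subset n) → ℕ → Set
  Covered σ t = Any (λ F → r F ≡ t) σ

  covered? : ∀ σ t → Dec (Covered σ t)
  covered? σ t = Any.any? (λ F → r F ℕP.≟ t) σ

  link-uncovered : ∀ {σ G} → Flag σ → Link σ G → ¬ Covered σ (r G)
  link-uncovered {G = G} fs l c = go fs (cmps l) c
    where
    go : ∀ {σ} → Flag σ → All (λ F → Cmp F G) σ → Covered σ (r G) → Absurd
    go (l' ∷ _) ((inj₁ s , ne) ∷ _) (here e) = ne (flat-≡ (flat l') s (ℕP.≤-reflexive (sym e)))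
    go (l' ∷ _) ((inj₂ s , ne) ∷ _) (here e) = ne (sym (flat-≡ (flat l) s (ℕP.≤-reflexive e)))
    go (_ ∷ fs) (_ ∷ a) (there c) = go fs a c

  link-rank : ∀ {σ G} → Link σ G → 0 ℕ.< r G × r G ℕ.< R
  link-rank {G = G} l = subst (ℕ._< r G) r-⊥ (flat-< ⊥-flat ⊥⊆ (≢⊥ l ∘ sym)) , flat-< (flat l) ⊆⊤ (≢⊤ l)

  private
    indicator : List (Subset n) → ∀ {m} → Fin m → ℤ
    indicator σ t = sel (covered? σ (suc (toℕ t))) 1ℤ

  -- Members have distinct ranks strictly between `0` and `R`, so they can be counted by rank. This
  -- makes sorting the flag unnecessary.
  cov-count : ∀ {σ} → Flag σ → ΣF (ℕ.pred R) (indicator σ) ≡ + length σ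
  cov-count [] = ΣF-0 (ℕ.pred R) {indicator []} (λ t → sel-no (covered? [] (suc (toℕ t))) {1ℤ} (λ ()))
  cov-count {G ∷ σ} (l ∷ fs) = trans (ΣF-cong (ℕ.pred R) split)
      (trans (ΣF-+ (ℕ.pred R) (indicator σ) new) (trans (cong₂ _+_ (cov-count fs) one) (cong +_ (ℕP.+-comm (length σ) 1))))
    where
    new : Fin (ℕ.pred R) → ℤ
    new t = sel (r G ℕP.≟ suc (toℕ t)) 1ℤ
    split : ∀ t → indicator (G ∷ σ) t ≡ indicator σ t + new t
    split t = sel-⊎ (covered? σ (suc (toℕ t))) (r G ℕP.≟ suc (toℕ t)) (covered? (G ∷ σ) (suc (toℕ t))) there here
      (λ { (here e) → inj₂ e ; (there c) → inj₁ c }) (λ c e → link-uncovered fs l (subst (Covered σ) (sym e) c))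
    lt : ℕ.pred (r G) ℕ.< ℕ.pred R
    lt = pred-mono (proj₁ (link-rank l)) (proj₂ (link-rank l))
      where
      pred-mono : ∀ {a b} → 0 ℕ.< a → a ℕ.< b → ℕ.pred a ℕ.< ℕ.pred b
      pred-mono {suc a} {suc b} _ (s≤s h) = h
    suc-pred' : ∀ {a} → 0 ℕ.< a → a ≡ suc (ℕ.pred a)
    suc-pred' {suc a} _ = refl
    t₀ : Fin (ℕ.pred R)
    t₀ = fromℕ< lt
    e₀ : r G ≡ suc (toℕ t₀)
    e₀ = trans (suc-pred' (proj₁ (link-rank l))) (cong suc (sym (FinP.toℕ-fromℕ< lt)))
    one : ΣF (ℕ.pred R) new ≡ 1ℤ
    one = trans (ΣF-point (ℕ.pred R) t₀ new (λ k k≢ → sel-no (r G ℕP.≟ suc (toℕ k))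
                  (λ e → k≢ (FinP.toℕ-injective (ℕP.suc-injective (trans (sym e) e₀))))))
                (sel-yes (r G ℕP.≟ suc (toℕ t₀)) e₀)

  ΣF-1 : ∀ m → ΣF m (λ _ → 1ℤ) ≡ + m
  ΣF-1 zero = refl
  ΣF-1 (suc m) = cong (λ z → 1ℤ + z) (ΣF-1 m)

  flag-length : ∀ {σ} → Flag σ → length σ ℕ.≤ ℕ.pred R
  flag-length {σ} fs = ℤP.drop‿+≤+ (subst₂ _≤_ (cov-count fs) (ΣF-1 (ℕ.pred R)) (ΣF-mono (ℕ.pred R) (λ t → le t)))
    where
    le : ∀ t → indicator σ {ℕ.pred R} t ≤ 1ℤ
    le t with covered? σ (suc (toℕ t))
    ... | yes _ = ℤP.≤-refl
    ... | no _  = +≤+ z≤n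

  R>0-from : ∀ {t} → t ℕ.< R → R ≡ suc (ℕ.pred R)
  R>0-from {t} h = sym (ℕP.suc-pred R {{ℕ.>-nonZero (ℕP.≤-trans (s≤s z≤n) h)}})

  full-covered : ∀ {σ} → Flag σ → length σ ≡ ℕ.pred R → ∀ t → 0 ℕ.< t → t ℕ.< R → Covered σ t
  full-covered {σ} fs len (suc t) _ t<R with covered? σ (suc t)
  ... | yes c = c
  ... | no ¬c = ⊥-elim (ℤP.<-irrefl refl (subst (0ℤ <_) total (ΣF->0 (ℕ.pred R) nn t' pos)))
    where
    lt : t ℕ.< ℕ.pred R
    lt = ℕP.≤-pred (subst (suc t ℕ.<_) (R>0-from t<R) t<R)
    t' = fromℕ< lt
    comp : Fin (ℕ.pred R) → ℤ
    comp k = 1ℤ + -1ℤ * indicator σ k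
    nn : ∀ k → 0ℤ ≤ comp k
    nn k with covered? σ (suc (toℕ k))
    ... | yes _ = +≤+ z≤n
    ... | no _  = +≤+ z≤n
    pos : 0ℤ < comp t'
    pos = subst (0ℤ <_) (sym (cong (λ z → 1ℤ + -1ℤ * z) (sel-no (covered? σ (suc (toℕ t'))) (λ c → ¬c (subst (λ z → Covered σ (suc z)) (FinP.toℕ-fromℕ< lt) c))))) (+<+ (s≤s z≤n))
    total : ΣF (ℕ.pred R) comp ≡ 0ℤ
    total = trans (ΣF-+ (ℕ.pred R) (λ _ → 1ℤ) (λ k → -1ℤ * indicator σ k))
            (trans (cong₂ _+_ (ΣF-1 (ℕ.pred R)) (trans (ΣF-* (ℕ.pred R) -1ℤ (indicator σ)) (*R -1ℤ (trans (cov-count fs) (cong +_ len)))))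
                   (z (+ ℕ.pred R)))
      where
      z : ∀ a → a + -1ℤ * a ≡ 0ℤ
      z = solve-∀

  missing : ∀ {σ} → Flag σ → length σ ℕ.< ℕ.pred R → ∃[ t ] (0 ℕ.< t × t ℕ.< R × ¬ Covered σ t)
  missing {σ} fs lt with FinP.all? {ℕ.pred R} (λ k → covered? σ (suc (toℕ k)))
  ... | yes h = ⊥-elim (ℕP.<-irrefl (ℤP.+-injective (trans (sym (cov-count fs)) (trans (ΣF-cong (ℕ.pred R) (λ k → sel-yes (covered? σ (suc (toℕ k))) (h k))) (ΣF-1 (ℕ.pred R))))) lt)
  ... | no ¬h with FinP.¬∀⟶∃¬ (ℕ.pred R) _ (λ k → covered? σ (suc (toℕ k))) ¬h
  ...   | k , ¬c = suc (toℕ k) , s≤s z≤n , subst (suc (toℕ k) ℕ.<_) (sym (suc-pred″ R (FinP.toℕ<n k))) (s≤s (FinP.toℕ<n k)) , ¬c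
    where
    suc-pred″ : ∀ a {b} → b ℕ.< ℕ.pred a → a ≡ suc (ℕ.pred a)
    suc-pred″ zero ()
    suc-pred″ (suc a) _ = refl

  -- The improper flats serve as end points of the outermost gaps, hence `⊥ ∷ σ` here and `⊤ ∷ σ` in
  -- `upper`.
  lower : ∀ {σ} → Flag σ → ∀ t → 0 ℕ.< t → ∃[ lo ] (lo ∈ₗ ⊥ ∷ σ × r lo ℕ.< t × All (λ F → r F ℕ.< t → F ⊆ lo) σ)
  lower [] t h = ⊥ , here refl , subst (ℕ._< t) (sym r-⊥) h , []
  lower {F ∷ σ} (l ∷ fs) t h with lower fs t h
  ... | lo , m , lt , a with r F ℕP.<? t
  ...   | no ¬lt = lo , up m , lt , (λ p → ⊥-elim (¬lt p)) ∷ a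
    where
    up : lo ∈ₗ ⊥ ∷ σ → lo ∈ₗ ⊥ ∷ F ∷ σ
    up (here e) = here e
    up (there e) = there (there e)
  ...   | yes F<t = pick (lo⊆F⊎F⊆lo m)
    where
    lo⊆F⊎F⊆lo : lo ∈ₗ ⊥ ∷ σ → lo ⊆ F ⊎ F ⊆ lo
    lo⊆F⊎F⊆lo (here refl) = inj₁ ⊥⊆
    lo⊆F⊎F⊆lo (there p) = proj₁ (All.lookup (cmps l) p)
    up : lo ∈ₗ ⊥ ∷ σ → lo ∈ₗ ⊥ ∷ F ∷ σ
    up (here e) = here e
    up (there e) = there (there e)
    pick : lo ⊆ F ⊎ F ⊆ lo → ∃[ lo ] (lo ∈ₗ ⊥ ∷ F ∷ σ × r lo ℕ.< t × All (λ F → r F ℕ.< t → F ⊆ lo) (F ∷ σ))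
    pick (inj₁ s) = F , there (here refl) , F<t , (λ _ → id) ∷ All.map (λ k p {x} x∈ → s (k p x∈)) a
    pick (inj₂ s) = lo , up m , lt , (λ _ → s) ∷ a

  upper : ∀ {σ} → Flag σ → ∀ t → t ℕ.< R → ∃[ up ] (up ∈ₗ ⊤ ∷ σ × t ℕ.< r up × All (λ F → t ℕ.< r F → up ⊆ F) σ)
  upper [] t h = ⊤ , here refl , h , []
  upper {F ∷ σ} (l ∷ fs) t h with upper fs t h
  ... | hi , m , lt , a with t ℕP.<? r F
  ...   | no ¬lt = hi , up m , lt , (λ p → ⊥-elim (¬lt p)) ∷ a
    where
    up : hi ∈ₗ ⊤ ∷ σ → hi ∈ₗ ⊤ ∷ F ∷ σ
    up (here e) = here e
    up (there e) = there (there e)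
  ...   | yes t<F = pick (cmp m)
    where
    cmp : hi ∈ₗ ⊤ ∷ σ → hi ⊆ F ⊎ F ⊆ hi
    cmp (here refl) = inj₂ ⊆⊤
    cmp (there p) = proj₁ (All.lookup (cmps l) p)
    up : hi ∈ₗ ⊤ ∷ σ → hi ∈ₗ ⊤ ∷ F ∷ σ
    up (here e) = here e
    up (there e) = there (there e)
    pick : hi ⊆ F ⊎ F ⊆ hi → ∃[ hi ] (hi ∈ₗ ⊤ ∷ F ∷ σ × t ℕ.< r hi × All (λ F → t ℕ.< r F → hi ⊆ F) (F ∷ σ))
    pick (inj₂ s) = F , there (here refl) , t<F , (λ _ → id) ∷ All.map (λ k p {x} x∈ → k p (s x∈)) a
    pick (inj₁ s) = hi , up m , lt , (λ _ → s) ∷ a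

  lower-flat : ∀ {σ F} → Flag σ → F ∈ₗ ⊥ ∷ σ → Flat F
  lower-flat fs (here refl) = ⊥-flat
  lower-flat fs (there p) = proj₁ (flag-member fs p)

  upper-flat : ∀ {σ F} → Flag σ → F ∈ₗ ⊤ ∷ σ → Flat F
  upper-flat fs (here refl) = ⊤-flat
  upper-flat fs (there p) = proj₁ (flag-member fs p)

  lower⊆upper : ∀ {σ lo hi} → Flag σ → lo ∈ₗ ⊥ ∷ σ → hi ∈ₗ ⊤ ∷ σ → r lo ℕ.< r hi → lo ⊆ hi
  lower⊆upper fs (here refl) _ _ = ⊥⊆
  lower⊆upper fs (there p) (here refl) _ = ⊆⊤
  lower⊆upper fs (there p) (there q) lt with flag-cmp fs p q
  ... | inj₁ s = s
  ... | inj₂ s = ⊥-elim (ℕP.<⇒≱ lt (r-mono s))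

  mk-link : ∀ {σ t lo hi G} → Flag σ → ¬ Covered σ t →
    All (λ F → r F ℕ.< t → F ⊆ lo) σ → All (λ F → t ℕ.< r F → hi ⊆ F) σ →
    Flat G → r G ≡ t → 0 ℕ.< t → t ℕ.< R → lo ⊆ G → G ⊆ hi → Link σ G
  mk-link {σ} {t} {lo} {hi} {G} fs ¬c al ah fl e t>0 t<R lo⊆G G⊆hi =
    mkLink fl (λ { refl → ℕP.<-irrefl (trans (sym r-⊥) e) t>0 }) (λ { refl → ℕP.<-irrefl (sym e) t<R }) (go ¬c al ah)
    where
    go : ∀ {σ} → ¬ Covered σ t → All (λ F → r F ℕ.< t → F ⊆ lo) σ → All (λ F → t ℕ.< r F → hi ⊆ F) σ → All (λ F → Cmp F G) σ
    go _ [] [] = []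
    go {F ∷ σ} ¬c (a ∷ al) (b ∷ ah) = (side , λ { refl → ¬c (here e) }) ∷ go (¬c ∘ there) al ah
      where
      side : F ⊆ G ⊎ G ⊆ F
      side with r F ℕP.<? t
      ... | yes p = inj₁ (λ x∈ → lo⊆G (a p x∈))
      ... | no ¬p = inj₂ (λ x∈ → b (ℕP.≤∧≢⇒< (ℕP.≮⇒≥ ¬p) (λ q → ¬c (here (sym q)))) (G⊆hi x∈))

  exists-link : ∀ {σ} → Flag σ → ∀ t → 0 ℕ.< t → t ℕ.< R → ¬ Covered σ t → ∃[ G ] (Link σ G × r G ≡ t)
  exists-link fs t t>0 t<R ¬c with lower fs t t>0 | upper fs t t<R
  ... | lo , ml , ltl , al | hi , mh , lth , ah
    with interpolate (t ℕ.∸ r lo) lo hi t (lower⊆upper fs ml mh (ℕP.<-trans ltl lth)) (ℕP.m∸n+n≡m (ℕP.<⇒≤ ltl)) (ℕP.<⇒≤ lth)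
  ...   | C , s₁ , s₂ , e = cl C , mk-link fs ¬c al ah (cl-flat C) (trans (r-cl C) e) t>0 t<R (⊆cl ∘ s₁) (cl-min (upper-flat fs mh) s₂) , trans (r-cl C) e

  link-exists : ∀ {σ} → Flag σ → length σ ℕ.< ℕ.pred R → ∃[ G ] Link σ G
  link-exists fs lt =
    let (t , a , b , c) = missing fs lt
        (G , l , _)     = exists-link fs t a b c
    in G , l

  full-no-link : ∀ {σ G} → Flag σ → length σ ≡ ℕ.pred R → ¬ Link σ G
  full-no-link fs len l = ℕP.<-irrefl len (flag-length (l ∷ fs))

-- Deletions

card-del : ∀ {m} {A : Subset m} {x} → x ∈ A → suc ∣ A ─ ⁅ x ⁆ ∣ ≡ ∣ A ∣
card-del {A = true ∷ A} Vec.here = cong suc (cong ∣_∣ (p─⊥≡p A))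
card-del {A = true ∷ A} (Vec.there p) = cong suc (card-del p)
card-del {A = false ∷ A} (Vec.there p) = card-del p

module Deletion {n} (r : Subset n → ℕ) (isRank : IsRank r) where
  open Rank r isRank

  del : Subset n → Fin n → Subset n
  del A x = A ─ ⁅ x ⁆

  del-⊆ : ∀ {A} x → del A x ⊆ A
  del-⊆ {A} x = p─q⊆p A ⁅ x ⁆

  ∈del : ∀ {A x y} → y ∈ A → y ≢ x → y ∈ del A x
  ∈del {x = x} y∈ ne = ∈─⁺ y∈ (λ p → ne (x∈⁅y⁆⇒x≡y x p))

  ∈del⁻ : ∀ {A x y} → y ∈ del A x → y ≢ x
  ∈del⁻ {A} {x} p refl = proj₂ (∈─⁻ A ⁅ x ⁆ p) (x∈⁅x⁆ x)

  del-∪ : ∀ {A x} → x ∈ A → del A x ∪ ⁅ x ⁆ ≡ A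
  del-∪ {A} {x} x∈ = ⊆-antisym (∪-⊆ (del-⊆ x) (⁅⁆⊆ x∈))
    (λ {y} y∈ → case y FinP.≟ x of λ { (yes refl) → ∈∪ʳ (x∈⁅x⁆ x) ; (no ne) → ∈∪ˡ (∈del y∈ ne) })

  del-∉ : ∀ {A x} → x ∉ A → del A x ≡ A
  del-∉ {A} {x} x∉ = ⊆-antisym (del-⊆ x) (λ {y} y∈ → ∈del y∈ (λ { refl → x∉ y∈ }))

  del-mono : ∀ {A B} x → A ⊆ B → del A x ⊆ del B x
  del-mono x s = ─-monoˡ ⁅ x ⁆ s

  del-comm : ∀ A x y → del (del A x) y ≡ del (del A y) x
  del-comm A x y = p─q─r≡p─r─q A ⁅ x ⁆ ⁅ y ⁆

  ∣del∣ : ∀ {A x} → x ∈ A → suc ∣ del A x ∣ ≡ ∣ A ∣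
  ∣del∣ = card-del

  Spanned : Subset n → Fin n → Set
  Spanned A x = r (del A x) ≡ r A

  spanned-mono : ∀ {A B x} → A ⊆ B → x ∈ A → Spanned A x → Spanned B x
  spanned-mono {A} {B} {x} s x∈ h = sym (trans (cong r (sym (del-∪ (s x∈)))) (∈cl-mono (del-mono x s) (trans (cong r (del-∪ x∈)) (sym h))))

  not-spanned : ∀ {A x} → ¬ Spanned A x → r A ≡ suc (r (del A x))
  not-spanned {A} {x} h with x ∈? A
  ... | no x∉ = ⊥-elim (h (cong r (del-∉ x∉)))
  ... | yes x∈ = trans (cong r (sym (del-∪ x∈))) (∉cl⇒suc (del A x) x (λ e → h (sym (trans (cong r (sym (del-∪ x∈))) e))))

  not-spanned-∈ : ∀ {A x} → ¬ Spanned A x → x ∈ A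
  not-spanned-∈ {A} {x} h with x ∈? A
  ... | no x∉ = ⊥-elim (h (cong r (del-∉ x∉)))
  ... | yes x∈ = x∈

  not-spanned-sub : ∀ {A B x} → B ⊆ A → x ∈ B → ¬ Spanned A x → r B ≡ suc (r (del B x))
  not-spanned-sub s x∈ h = not-spanned (λ e → h (spanned-mono s x∈ e))

  r≤card : ∀ m A → ∣ A ∣ ℕ.≤ m → r A ℕ.≤ ∣ A ∣
  r≤card m A le with nonempty? A
  ... | no ¬ne = subst (ℕ._≤ ∣ A ∣) (sym (trans (cong r (Empty-unique ¬ne)) r-⊥)) z≤n
  r≤card zero A le | yes (x , x∈) = ⊥-elim (ℕP.n≮0 (ℕP.≤-trans (ℕP.≤-reflexive (∣del∣ x∈)) le))
  r≤card (suc m) A le | yes (x , x∈) = ℕP.≤-trans (ℕP.≤-reflexive (cong r (sym (del-∪ x∈)))) (ℕP.≤-trans (r-step (del A x) x)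
     (ℕP.≤-trans (s≤s (r≤card m (del A x) (ℕP.≤-pred (ℕP.≤-trans (ℕP.≤-reflexive (∣del∣ x∈)) le)))) (ℕP.≤-reflexive (∣del∣ x∈))))

  r≤∣∣ : ∀ A → r A ℕ.≤ ∣ A ∣
  r≤∣∣ A = r≤card ∣ A ∣ A ℕP.≤-refl

  -- Elements are removed while the set stays dependent, with `m` bounding the recursion. At the end
  -- every deletion of one element is independent, so each element is spanned by the others.
  circuit : ∀ m A → ∣ A ∣ ℕ.≤ m → r A ℕ.< ∣ A ∣ → ∃[ C ] (C ⊆ A × Nonempty C × (∀ {x} → x ∈ C → Spanned C x))
  circuit m A le lt with FinP.any? (λ x → (x ∈? A) ×-dec (r (del A x) ℕP.<? ∣ del A x ∣))
  circuit zero A le lt | _ = ⊥-elim (ℕP.n≮0 (ℕP.≤-trans lt le))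
  circuit (suc m) A le lt | yes (x , x∈ , lt') =
    let (C , s , ne , h) = circuit m (del A x) (ℕP.≤-pred (ℕP.≤-trans (ℕP.≤-reflexive (∣del∣ x∈)) le)) lt'
    in C , (λ y∈ → del-⊆ x (s y∈)) , ne , h
  circuit (suc m) A le lt | no ¬p = A , id , nonempty-A , sp
    where
    nonempty-A : Nonempty A
    nonempty-A with nonempty? A
    ... | yes p = p
    ... | no ¬ne = ⊥-elim (ℕP.n≮0 (subst (r A ℕ.<_) (trans (cong ∣_∣ (Empty-unique ¬ne)) (∣⊥∣≡0 n)) lt))
    sp : ∀ {x} → x ∈ A → Spanned A x
    sp {x} x∈ = ℕP.≤-antisym (r-mono (del-⊆ x)) (ℕP.≤-pred (ℕP.≤-trans lt (ℕP.≤-trans (ℕP.≤-reflexive (sym (∣del∣ x∈)))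
      (s≤s (ℕP.≮⇒≥ (λ lt' → ¬p (x , x∈ , lt')))))))

  -- A series pair of the restriction to `A`: neither element is a coloop, but each becomes one when
  -- the other is deleted.
  Series : Subset n → Fin n → Fin n → Set
  Series A e e' = (e ∈ A × e' ∈ A) × e ≢ e' × Spanned A e × Spanned A e' × ¬ Spanned (del A e) e'

  series-sym : ∀ {A e e'} → Series A e e' → Series A e' e
  series-sym {A} {e} {e'} ((p , q) , ne , s , s' , h) = (q , p) , ne ∘ sym , s' , s ,
    λ k → h (trans (cong r (del-comm A e e')) (trans k (trans s' (sym s))))

  -- In a subset of `A` that misses one element of the pair, the other is a coloop if it is present.
  series-rank : ∀ {A e e'} → Series A e e' → ∀ {B} → B ⊆ A → + r (del B e) - + r (del B e') ≡ mem e' B - mem e B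
  series-rank {A} {e} {e'} ser@((_ , _) , ne , s , s' , h) {B} B⊆A with e ∈? B | e' ∈? B
  ... | no e∉ | no e'∉ = trans (cong₂ (λ u v → + r u - + r v) (del-∉ e∉) (del-∉ e'∉))
          (trans (ℤP.+-inverseʳ (+ r B)) (sym (cong₂ _-_ (mem-∉ e'∉) (mem-∉ e∉))))
  ... | yes e∈ | no e'∉ = trans (cong (λ v → + r (del B e) - + v) (trans (cong r (del-∉ e'∉))
            (not-spanned-sub {del A e'} (λ {y} y∈ → ∈del (B⊆A y∈) (λ { refl → e'∉ y∈ })) e∈ (proj₂ (proj₂ (proj₂ (proj₂ (series-sym ser))))))))
          (trans (minus-suc (+ r (del B e))) (sym (cong₂ _-_ (mem-∉ e'∉) (mem-∈ e∈))))
    where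
    minus-suc : ∀ x → x - (1ℤ + x) ≡ 0ℤ - 1ℤ
    minus-suc = solve-∀
  ... | no e∉ | yes e'∈ = trans (cong (λ u → + u - + r (del B e')) (trans (cong r (del-∉ e∉))
            (not-spanned-sub {del A e} (λ {y} y∈ → ∈del (B⊆A y∈) (λ { refl → e∉ y∈ })) e'∈ h)))
          (trans (suc-minus (+ r (del B e'))) (sym (cong₂ _-_ (mem-∈ e'∈) (mem-∉ e∉))))
    where
    suc-minus : ∀ x → 1ℤ + x - x ≡ 1ℤ - 0ℤ
    suc-minus = solve-∀
  ... | yes e∈ | yes e'∈ = trans (cong₂ (λ u v → + u - + v) eq₁ (trans eq₂ (cong (suc ∘ r) (del-comm B e' e))))
          (trans (ℤP.+-inverseʳ (+ suc (r (del (del B e) e')))) (sym (cong₂ _-_ (mem-∈ e'∈) (mem-∈ e∈))))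
    where
    eq₁ : r (del B e) ≡ suc (r (del (del B e) e'))
    eq₁ = not-spanned-sub {del A e} (del-mono e B⊆A) (∈del e'∈ (ne ∘ sym)) h
    eq₂ : r (del B e') ≡ suc (r (del (del B e') e))
    eq₂ = not-spanned-sub {del A e'} (del-mono e' B⊆A) (∈del e∈ ne) (proj₂ (proj₂ (proj₂ (proj₂ (series-sym ser)))))

-- Connectivity of links

module Connectivity {n} (r : Subset n → ℕ) (isRank : IsRank r) (loopless : ∀ x → r ⁅ x ⁆ ≡ 1) where
  open Flags r isRank loopless

  module _ {σ} (fs : Flag σ) (big : suc (suc (suc (suc (length σ)))) ℕ.≤ R) (y : Subset n → ℤ)
    (adj : ∀ {G G'} → Link σ G → Link (G ∷ σ) G' → y G ≡ y G') where

    private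
      link-cons : ∀ {G H} → Link σ H → Cmp G H → Link (G ∷ σ) H
      link-cons (mkLink a b c d) k = mkLink a b c (k ∷ d)

      join-cmp : ∀ {G H} → Link σ G → Link σ H → G ⊆ H → y G ≡ y H
      join-cmp {G} {H} l l' s with G ≟S H
      ... | yes refl = refl
      ... | no ne = adj l (link-cons l' (inj₁ s , ne))

      -- No member can lie above one of `G`, `G'` and below the other, so every member is below `I`
      -- or above `J`. If `I` or `J` belongs to the link, it is adjacent to both flats; otherwise
      -- they bound a gap of the flag.
      module Incomparable {G G'} (l : Link σ G) (l' : Link σ G') (G⊈G' : ¬ (G ⊆ G')) (G'⊈G : ¬ (G' ⊆ G)) where
        I = G ∩ G'
        J = cl (G ∪ G')
        I⊆G : I ⊆ G
        I⊆G = p∩q⊆p G G'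
        I⊆G' : I ⊆ G'
        I⊆G' = p∩q⊆q G G'
        G⊆J : G ⊆ J
        G⊆J x∈ = ⊆cl (∈∪ˡ x∈)
        G'⊆J : G' ⊆ J
        G'⊆J x∈ = ⊆cl (∈∪ʳ x∈)
        I-flat : Flat I
        I-flat = ∩-flat (flat l) (flat l')
        I≢G : I ≢ G
        I≢G e = G⊈G' (λ x∈ → I⊆G' (subst (_ ∈_) (sym e) x∈))
        I≢G' : I ≢ G'
        I≢G' e = G'⊈G (λ x∈ → I⊆G (subst (_ ∈_) (sym e) x∈))
        G≢J : G ≢ J
        G≢J e = G'⊈G (λ x∈ → subst (_ ∈_) (sym e) (G'⊆J x∈))
        outside : ∀ {F} → F ∈ₗ σ → F ⊆ I ⊎ J ⊆ F
        outside {F} p with proj₁ (All.lookup (cmps l) p) | proj₁ (All.lookup (cmps l') p)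
        ... | inj₁ a | inj₁ b = inj₁ (λ x∈ → x∈p∩q⁺ (a x∈ , b x∈))
        ... | inj₁ a | inj₂ b = ⊥-elim (G'⊈G (λ x∈ → a (b x∈)))
        ... | inj₂ a | inj₁ b = ⊥-elim (G⊈G' (λ x∈ → b (a x∈)))
        ... | inj₂ a | inj₂ b = inj₂ (cl-min (proj₁ (flag-member fs p)) (∪-⊆ a b))

        between : ∀ {X} → Flat X → I ⊆ X → X ⊆ J → X ≢ I → X ≢ J → Link σ X
        between {X} fl I⊆X X⊆J ne ne' = mkLink fl
            (λ { refl → ne (⊆-antisym ⊥⊆ I⊆X) }) (λ { refl → ne' (⊆-antisym X⊆J ⊆⊤) }) (All.tabulate cmp)
          where
          cmp : ∀ {F} → F ∈ₗ σ → Cmp F X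
          cmp {F} p with outside p
          ... | inj₁ s = inj₁ (λ x∈ → I⊆X (s x∈)) , (λ { refl → ne (⊆-antisym s I⊆X) })
          ... | inj₂ s = inj₂ (λ x∈ → s (X⊆J x∈)) , (λ { refl → ne' (⊆-antisym X⊆J s) })

        via-I : Link σ I → y G ≡ y G'
        via-I k = trans (sym (join-cmp k l I⊆G)) (join-cmp k l' I⊆G')

        via-J : Link σ J → y G ≡ y G'
        via-J k = trans (join-cmp l k G⊆J) (sym (join-cmp l' k G'⊆J))

        rG< : r I ℕ.< r G
        rG< = flat-< I-flat I⊆G I≢G
        rJ> : r G ℕ.< r J
        rJ> = flat-< (flat l) G⊆J G≢J

        -- a gap of rank at least three: move along atoms
        big-gap : suc (suc (r I)) ℕ.< r J → y G ≡ y G'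
        big-gap lt =
          let (x , x∈ , x∉)    = ⊆∧≢⇒∃ I⊆G I≢G
              (x' , x'∈ , x'∉) = ⊆∧≢⇒∃ I⊆G' I≢G'
              p = cl (I ∪ ⁅ x ⁆)
              p' = cl (I ∪ ⁅ x' ⁆)
              q = cl ((I ∪ ⁅ x ⁆) ∪ ⁅ x' ⁆)
              rp : ∀ z → r (cl (I ∪ ⁅ z ⁆)) ℕ.≤ suc (r I)
              rp z = ℕP.≤-trans (ℕP.≤-reflexive (r-cl _)) (r-step I z)
              rq : r q ℕ.≤ suc (suc (r I))
              rq = ℕP.≤-trans (ℕP.≤-reflexive (r-cl _)) (ℕP.≤-trans (r-step (I ∪ ⁅ x ⁆) x') (s≤s (r-step I x)))
              lp : ∀ {z H} → Link σ H → H ⊆ J → I ⊆ H → z ∈ H → z ∉ I → Link σ (cl (I ∪ ⁅ z ⁆))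
              lp {z} lh h⊆ I⊆H z∈ z∉ = between (cl-flat _) (λ w → ⊆cl (∈∪ˡ w)) (λ w → h⊆ (cl-min (flat lh) (∪-⊆ I⊆H (⁅⁆⊆ z∈)) w))
                (λ e → z∉ (subst (z ∈_) e (⊆cl (∈∪ʳ (x∈⁅x⁆ z)))))
                (λ e → ℕP.<⇒≱ (ℕP.<-trans (s≤s ℕP.≤-refl) lt) (subst (ℕ._≤ suc (r I)) (cong r e) (rp z)))
              lq : Link σ q
              lq = between (cl-flat _) (λ w → ⊆cl (∈∪ˡ (∈∪ˡ w)))
                (cl-min (cl-flat _) (∪-⊆ (∪-⊆ (λ w → G⊆J (I⊆G w)) (⁅⁆⊆ (G⊆J x∈))) (⁅⁆⊆ (G'⊆J x'∈))))
                (λ e → x∉ (subst (x ∈_) e (⊆cl (∈∪ˡ (∈∪ʳ (x∈⁅x⁆ x))))))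
                (λ e → ℕP.<⇒≱ lt (subst (ℕ._≤ suc (suc (r I))) (cong r e) rq))
              k  = lp l G⊆J I⊆G x∈ x∉
              k' = lp l' G'⊆J I⊆G' x'∈ x'∉
              p⊆q : p ⊆ q
              p⊆q = cl-min (cl-flat _) (λ w → ⊆cl (∈∪ˡ w))
              p'⊆q : p' ⊆ q
              p'⊆q = cl-min (cl-flat _) (∪-⊆ (λ w → ⊆cl (∈∪ˡ (∈∪ˡ w))) (λ w → ⊆cl (∈∪ʳ w)))
          in trans (sym (join-cmp k l (cl-min (flat l) (∪-⊆ I⊆G (⁅⁆⊆ x∈)))))
             (trans (join-cmp k lq p⊆q) (trans (sym (join-cmp k' lq p'⊆q)) (join-cmp k' l' (cl-min (flat l') (∪-⊆ I⊆G' (⁅⁆⊆ x'∈))))))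

        -- a gap of rank two: use a flat in another gap
        small-gap : I ∈ₗ ⊥ ∷ σ → J ∈ₗ ⊤ ∷ σ → ¬ (suc (suc (r I)) ℕ.< r J) → y G ≡ y G'
        small-gap I∈ J∈ ¬lt =
          let (H , lH) = link-exists (l ∷ fs) (ℕP.≤-pred (ℕP.≤-trans (ℕP.n≤1+n _) (ℕP.≤-trans big (ℕP.≤-reflexive (R>0-from big)))))
          in finish H lH (link-head lH)
          where
          rG≤ : r G ℕ.≤ suc (r I)
          rG≤ = ℕP.≤-pred (ℕP.≤-trans rJ> (ℕP.≮⇒≥ ¬lt))
          rJ≤ : r J ℕ.≤ suc (r G)
          rJ≤ = ℕP.≤-trans (ℕP.≮⇒≥ ¬lt) (s≤s rG<)
          vsI : ∀ {H} → Link σ H → I ∈ₗ ⊥ ∷ σ → H ⊆ I ⊎ (I ⊆ H × I ≢ H)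
          vsI {H} lh (here e) = inj₂ ((λ x∈ → ⊥-elim (∉⊥ (subst (_ ∈_) e x∈))) , (λ e' → ≢⊥ lh (trans (sym e') e)))
          vsI lh (there p) with All.lookup (cmps lh) p
          ... | inj₁ s , ne = inj₂ (s , ne)
          ... | inj₂ s , ne = inj₁ s
          vsJ : ∀ {H} → Link σ H → J ∈ₗ ⊤ ∷ σ → J ⊆ H ⊎ (H ⊆ J × H ≢ J)
          vsJ {H} lh (here e) = inj₂ ((λ x∈ → subst (_ ∈_) (sym e) ∈⊤) , (λ e' → ≢⊤ lh (trans e' e)))
          vsJ lh (there p) with All.lookup (cmps lh) p
          ... | inj₁ s , ne = inj₁ s
          ... | inj₂ s , ne = inj₂ (s , (λ e → ne (sym e)))
          finish : ∀ H → Link (G ∷ σ) H → Cmp G H → y G ≡ y G'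
          finish H lH (inj₂ H⊆G , ne) with vsI (link-tail lH) I∈
          ... | inj₁ H⊆I = trans (adj l lH) (join-cmp (link-tail lH) l' (λ x∈ → I⊆G' (H⊆I x∈)))
          ... | inj₂ (I⊆H , I≢H) = ⊥-elim (ℕP.<⇒≱ (flat-< I-flat I⊆H I≢H) (ℕP.≤-pred (ℕP.≤-trans (flat-< (flat lH) H⊆G (ne ∘ sym)) rG≤)))
          finish H lH (inj₁ G⊆H , ne) with vsJ (link-tail lH) J∈
          ... | inj₁ J⊆H = trans (adj l lH) (sym (join-cmp l' (link-tail lH) (λ x∈ → J⊆H (G'⊆J x∈))))
          ... | inj₂ (H⊆J , H≢J) = ⊥-elim (ℕP.<⇒≱ (flat-< (flat lH) H⊆J H≢J) (ℕP.≤-trans rJ≤ (flat-< (flat l) G⊆H ne)))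

        J-flat : Flat J
        J-flat = cl-flat _

        conclude : y G ≡ y G'
        conclude with Any.any? (I ≟S_) (⊥ ∷ σ) | Any.any? (J ≟S_) (⊤ ∷ σ) | suc (suc (r I)) ℕP.<? r J
        ... | no ∉I | _ | _ = via-I (mkLink I-flat (λ e → ∉I (here e)) (λ e → ≢⊤ l (⊆-antisym ⊆⊤ (λ x∈ → I⊆G (subst (_ ∈_) (sym e) x∈))))
                (All.tabulate (λ {F} p → cmpI p , (λ e → ∉I (there (subst (_∈ₗ σ) e p))))))
          where
          cmpI : ∀ {F} → F ∈ₗ σ → F ⊆ I ⊎ I ⊆ F
          cmpI p with outside p
          ... | inj₁ s = inj₁ s
          ... | inj₂ s = inj₂ (λ x∈ → s (G⊆J (I⊆G x∈)))
        ... | yes _ | no ∉J | _ = via-J (mkLink J-flat (λ e → ≢⊥ l (⊆-antisym (λ x∈ → subst (_ ∈_) e (G⊆J x∈)) ⊥⊆)) (λ e → ∉J (here e))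
                (All.tabulate (λ {F} p → cmpJ p , (λ e → ∉J (there (subst (_∈ₗ σ) e p))))))
          where
          cmpJ : ∀ {F} → F ∈ₗ σ → F ⊆ J ⊎ J ⊆ F
          cmpJ p with outside p
          ... | inj₁ s = inj₁ (λ x∈ → G⊆J (I⊆G (s x∈)))
          ... | inj₂ s = inj₂ s
        ... | yes I∈ | yes J∈ | yes lt = big-gap lt
        ... | yes I∈ | yes J∈ | no ¬lt = small-gap I∈ J∈ ¬lt

    links-connected : ∀ {G G'} → Link σ G → Link σ G' → y G ≡ y G'
    links-connected {G} {G'} l l' with G ⊆? G' | G' ⊆? G
    ... | yes s | _ = join-cmp l l' s
    ... | no _ | yes s = sym (join-cmp l' l s)
    ... | no a | no b = Incomparable.conclude l l' a b

-- The Whitney polynomial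

flip : ∀ {n} → Fin n → Subset n → Subset n
flip zero    (b ∷ A) = not b ∷ A
flip (suc x) (b ∷ A) = b ∷ flip x A

flip-∉ : ∀ {n} {x : Fin n} {A} → x ∉ A → flip x A ≡ A ∪ ⁅ x ⁆
flip-∉ {x = zero} {true ∷ A} h = ⊥-elim (h Vec.here)
flip-∉ {x = zero} {false ∷ A} h = cong (true ∷_) (sym (∪-identityʳ A))
flip-∉ {x = suc x} {true ∷ A} h = cong (true ∷_) (flip-∉ (h ∘ Vec.there))
flip-∉ {x = suc x} {false ∷ A} h = cong (false ∷_) (flip-∉ (h ∘ Vec.there))

flip-∈ : ∀ {n} {x : Fin n} {A} → x ∈ A → flip x A ≡ A ─ ⁅ x ⁆
flip-∈ {A = true ∷ A} Vec.here = cong (false ∷_) (sym (p─⊥≡p A))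
flip-∈ {A = true ∷ A} (Vec.there p) = cong (true ∷_) (flip-∈ p)
flip-∈ {A = false ∷ A} (Vec.there p) = cong (false ∷_) (flip-∈ p)

ΣS-flip : ∀ {n} (x : Fin n) (f : Subset n → ℤ) → ΣS f ≡ ΣS (f ∘ flip x)
ΣS-flip zero f = trans (ΣS-suc f) (trans (ℤP.+-comm (ΣS (f ∘ (false ∷_))) (ΣS (f ∘ (true ∷_)))) (sym (ΣS-suc (f ∘ flip zero))))
ΣS-flip (suc x) f = trans (ΣS-suc f) (trans (cong₂ _+_ (ΣS-flip x (f ∘ (false ∷_))) (ΣS-flip x (f ∘ (true ∷_)))) (sym (ΣS-suc (f ∘ flip (suc x)))))

ΣS-+ : ∀ {n} (f g : Subset n → ℤ) → ΣS (λ A → f A + g A) ≡ ΣS f + ΣS g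
ΣS-+ {n} f g = ΣF-+ (size n) (f ∘ enum n) (g ∘ enum n)

ΣS-* : ∀ {n} a (f : Subset n → ℤ) → ΣS (λ A → a * f A) ≡ a * ΣS f
ΣS-* {n} a f = ΣF-* (size n) a (f ∘ enum n)

ΣS-0 : ∀ {n} {f : Subset n → ℤ} → (∀ A → f A ≡ 0ℤ) → ΣS f ≡ 0ℤ
ΣS-0 {n} h = ΣF-0 (size n) (h ∘ enum n)

self-neg : ∀ s → s ≡ - s → s ≡ 0ℤ
self-neg (+ zero) _ = refl
self-neg (+ suc k) ()
self-neg -[1+ k ] ()

-- Toggling `x` is a sign-reversing involution, so the sum is its own negative.
ΣS-cancel : ∀ {n} (x : Fin n) (g : Subset n → ℤ) → (∀ A → x ∉ A → g (A ∪ ⁅ x ⁆) ≡ - g A) → ΣS g ≡ 0ℤ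
ΣS-cancel x g h = self-neg (ΣS g) (trans (ΣS-flip x g) (trans (ΣS-cong (λ A → trans (anti A (x ∈? A)) (sym (ℤP.-1*i≡-i (g A))))) (trans (ΣS-* -1ℤ g) (ℤP.-1*i≡-i (ΣS g)))))
  where
  anti : ∀ A → Dec (x ∈ A) → g (flip x A) ≡ - g A
  anti A (no x∉) = trans (cong g (flip-∉ x∉)) (h A x∉)
  anti A (yes x∈) = trans (cong g (flip-∈ x∈)) (trans (sym (ℤP.neg-involutive (g (A ─ ⁅ x ⁆)))) (cong -_ (trans (sym (h (A ─ ⁅ x ⁆) (λ p → proj₂ (∈─⁻ A ⁅ x ⁆ p) (x∈⁅x⁆ x))))
    (cong g (⊆-antisym (∪-⊆ (p─q⊆p A ⁅ x ⁆) (⁅⁆⊆ x∈)) (λ {y} y∈ → case y ∈? ⁅ x ⁆ of λ { (yes p) → ∈∪ʳ p ; (no p) → ∈∪ˡ (∈─⁺ y∈ p) }))))))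

card-add : ∀ {n} {A : Subset n} {x} → x ∉ A → ∣ A ∪ ⁅ x ⁆ ∣ ≡ suc ∣ A ∣
card-add {A = A} {x} x∉ = sym (trans (cong suc (cong ∣_∣ (sym eq))) (card-del {A = A ∪ ⁅ x ⁆} {x} (∈∪ʳ (x∈⁅x⁆ x))))
  where
  eq : (A ∪ ⁅ x ⁆) ─ ⁅ x ⁆ ≡ A
  eq = ⊆-antisym (λ p → let (a , b) = ∈─⁻ (A ∪ ⁅ x ⁆) ⁅ x ⁆ p in [ id , (λ q → ⊥-elim (b q)) ]′ (x∈p∪q⁻ A ⁅ x ⁆ a))
    (λ {y} y∈ → ∈─⁺ (∈∪ˡ y∈) (λ q → x∉ (subst (_∈ A) (x∈⁅y⁆⇒x≡y x q) y∈)))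

in? : ∀ {n} (S B A : Subset n) → Dec (S ⊆ A × A ⊆ B)
in? S B A = (S ⊆? A) ×-dec (A ⊆? B)

ΣI : ∀ {n} → Subset n → Subset n → (Subset n → ℤ) → ℤ
ΣI S B g = ΣS (λ A → sel (in? S B A) (g A))

ΣI-cong : ∀ {n} {S B : Subset n} {g h} → (∀ A → S ⊆ A → A ⊆ B → g A ≡ h A) → ΣI S B g ≡ ΣI S B h
ΣI-cong {S = S} {B} e = ΣS-cong (λ A → sel-cong (in? S B A) (λ (p , q) → e A p q))

ΣI-split : ∀ {n} {S B : Subset n} {e} g → e ∈ B → e ∉ S → ΣI S B g ≡ ΣI S (B ─ ⁅ e ⁆) g + ΣI (S ∪ ⁅ e ⁆) B g
ΣI-split {S = S} {B} {e} g e∈ e∉ = trans (ΣS-cong (λ A → split A)) (ΣS-+ (λ A → sel (in? S (B ─ ⁅ e ⁆) A) (g A)) (λ A → sel (in? (S ∪ ⁅ e ⁆) B A) (g A)))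
  where
  split : ∀ A → sel (in? S B A) (g A) ≡ sel (in? S (B ─ ⁅ e ⁆) A) (g A) + sel (in? (S ∪ ⁅ e ⁆) B A) (g A)
  split A = sel-⊎ (in? S (B ─ ⁅ e ⁆) A) (in? (S ∪ ⁅ e ⁆) B A) (in? S B A)
    (λ (p , q) → p , (λ x∈ → p─q⊆p B ⁅ e ⁆ (q x∈))) (λ (p , q) → (λ x∈ → p (∈∪ˡ x∈)) , q)
    (λ (p , q) → side p q (e ∈? A)) (λ (p , q) (p' , q') → proj₂ (∈─⁻ B ⁅ e ⁆ (q (p' (∈∪ʳ (x∈⁅x⁆ e))))) (x∈⁅x⁆ e))
    where
    side : S ⊆ A → A ⊆ B → Dec (e ∈ A) → (S ⊆ A × A ⊆ B ─ ⁅ e ⁆) ⊎ (S ∪ ⁅ e ⁆ ⊆ A × A ⊆ B)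
    side p q (yes e∈A) = inj₂ (∪-⊆ p (⁅⁆⊆ e∈A) , q)
    side p q (no e∉A) = inj₁ (p , λ {x} x∈ → ∈─⁺ (q x∈) (λ w → e∉A (subst (_∈ A) (x∈⁅y⁆⇒x≡y e w) x∈)))

⊆∧∣∣⇒≡ : ∀ {n} {S B : Subset n} → S ⊆ B → ∣ B ∣ ℕ.≤ ∣ S ∣ → S ≡ B
⊆∧∣∣⇒≡ {S = S} {B} s le = ⊆-antisym s (λ {x} x∈ → case x ∈? S of λ { (yes p) → p
  ; (no x∉) → ⊥-elim (ℕP.<⇒≱ (ℕP.≤-trans (s≤s (p⊆q⇒∣p∣≤∣q∣ (λ {y} y∈ → ∈─⁺ (s y∈) (λ w → x∉ (subst (_∈ S) (x∈⁅y⁆⇒x≡y x w) y∈))))) (ℕP.≤-reflexive (card-del x∈))) le) })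

ΣI-binomial : ∀ {n} p N k (S B : Subset n) → S ⊆ B → ∣ B ∣ ≡ k ℕ.+ ∣ S ∣ → ∣ B ∣ ℕ.≤ N →
  ΣI S B (λ A → p ℤ.^ (N ℕ.∸ ∣ A ∣)) ≡ (p + 1ℤ) ℤ.^ k * p ℤ.^ (N ℕ.∸ ∣ B ∣)
ΣI-binomial p N zero S B s eq le = trans (ΣS-point B (λ A → sel (in? S B A) (p ℤ.^ (N ℕ.∸ ∣ A ∣)))
    (λ A ne → sel-no (in? S B A) (λ (u , v) → ne (⊆-antisym v (subst (_⊆ A) (⊆∧∣∣⇒≡ s (ℕP.≤-reflexive eq)) u)))))
  (trans (sel-yes (in? S B B) (s , id)) (sym (ℤP.*-identityˡ (p ℤ.^ (N ℕ.∸ ∣ B ∣)))))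
ΣI-binomial p N (suc k) S B s eq le = trans (ΣI-split {B = B} (λ A → p ℤ.^ (N ℕ.∸ ∣ A ∣)) e∈ e∉)
  (trans (cong₂ _+_ (ΣI-binomial p N k S B' s' (ℕP.suc-injective (trans (card-del e∈) eq)) (ℕP.≤-trans (ℕP.n≤1+n _) (ℕP.≤-trans (ℕP.≤-reflexive (card-del e∈)) le)))
                    (ΣI-binomial p N k (S ∪ ⁅ e ⁆) B (∪-⊆ s (⁅⁆⊆ e∈)) (trans eq (trans (sym (ℕP.+-suc k ∣ S ∣)) (cong (k ℕ.+_) (sym (card-add e∉))))) le))
  (trans (cong (λ j → (p + 1ℤ) ℤ.^ k * p ℤ.^ j + (p + 1ℤ) ℤ.^ k * p ℤ.^ (N ℕ.∸ ∣ B ∣)) exponent) (ring ((p + 1ℤ) ℤ.^ k) p (p ℤ.^ (N ℕ.∸ ∣ B ∣)))))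
  where
  pick : ∃[ e ] (e ∈ B × e ∉ S)
  pick = ⊈⇒∃ {A = B} {S} (λ t → ℕP.<⇒≱ (ℕP.≤-trans (s≤s (ℕP.m≤n+m ∣ S ∣ k)) (ℕP.≤-reflexive (sym eq))) (p⊆q⇒∣p∣≤∣q∣ t))
  e = proj₁ pick
  e∈ = proj₁ (proj₂ pick)
  e∉ = proj₂ (proj₂ pick)
  B' = B ─ ⁅ e ⁆
  s' : S ⊆ B'
  s' {y} y∈ = ∈─⁺ (s y∈) (λ w → e∉ (subst (_∈ S) (x∈⁅y⁆⇒x≡y e w) y∈))
  exponent : N ℕ.∸ ∣ B' ∣ ≡ suc (N ℕ.∸ ∣ B ∣)
  exponent = trans (ℕP.+-∸-assoc 1 (subst (ℕ._≤ N) (sym (card-del e∈)) le)) (cong (λ j → suc (N ℕ.∸ j)) (card-del e∈))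
  ring : ∀ a p b → a * (p * b) + a * b ≡ (p + 1ℤ) * a * b
  ring = solve-∀

sg : ℕ → ℤ
sg zero    = 1ℤ
sg (suc k) = - sg k

sg-even : ∀ k → sg (k ℕ.+ k) ≡ 1ℤ
sg-even zero = refl
sg-even (suc k) = trans (cong (-_ ∘ sg) (ℕP.+-suc k k)) (trans (ℤP.neg-involutive (sg (k ℕ.+ k))) (sg-even k))

sumTo-cong : ∀ D {f g : ℕ → ℤ} → (∀ i → i ℕ.≤ D → f i ≡ g i) → sumTo D f ≡ sumTo D g
sumTo-cong zero h = h 0 z≤n
sumTo-cong (suc D) h = cong₂ _+_ (sumTo-cong D (λ i le → h i (ℕP.m≤n⇒m≤1+n le))) (h (suc D) ℕP.≤-refl)

sumTo-+ : ∀ D (f g : ℕ → ℤ) → sumTo D (λ i → f i + g i) ≡ sumTo D f + sumTo D g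
sumTo-+ zero f g = refl
sumTo-+ (suc D) f g = trans (cong (λ w → w + (f (suc D) + g (suc D))) (sumTo-+ D f g)) (ring (sumTo D f) (sumTo D g) (f (suc D)) (g (suc D)))
  where
  ring : ∀ a b c d → a + b + (c + d) ≡ a + c + (b + d)
  ring = solve-∀

sumTo-0 : ∀ D {f : ℕ → ℤ} → (∀ i → i ℕ.≤ D → f i ≡ 0ℤ) → sumTo D f ≡ 0ℤ
sumTo-0 zero h = h 0 z≤n
sumTo-0 (suc D) h = cong₂ _+_ (sumTo-0 D (λ i le → h i (ℕP.m≤n⇒m≤1+n le))) (h (suc D) ℕP.≤-refl)

-- q · Σ cᵢ qⁱ = w has degree b + 1, nonnegative coefficients and a support that is an up-set of [0 , b]
record Good (b : ℕ) (w : ℤ → ℤ) (c : ℕ → ℤ) : Set where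
  field
    poly : ∀ q → w q ≡ sumTo b (λ i → c i * q ℤ.^ suc i)
    nn   : ∀ i → 0ℤ ≤ c i
    high : ∀ i → b ℕ.< i → c i ≡ 0ℤ
    top  : 0ℤ < c b
    up   : ∀ i → i ℕ.< b → 0ℤ < c i → 0ℤ < c (suc i)

good-cong : ∀ {b w w' c c'} → (∀ q → w' q ≡ w q) → (∀ i → c' i ≡ c i) → Good b w c → Good b w' c'
good-cong {b} {w} {w'} {c} {c'} hw hc g = record
  { poly = λ q → trans (hw q) (trans (poly q) (sumTo-cong b (λ i _ → cong (λ a → a * q ℤ.^ suc i) (sym (hc i)))))
  ; nn = λ i → subst (0ℤ ≤_) (sym (hc i)) (nn i)
  ; high = λ i lt → trans (hc i) (high i lt)
  ; top = subst (0ℤ <_) (sym (hc b)) top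
  ; up = λ i lt p → subst (0ℤ <_) (sym (hc (suc i))) (up i lt (subst (0ℤ <_) (hc i) p)) }
  where open Good g

good-δ : ∀ b → Good b (λ q → q ℤ.^ suc b) (λ i → sel (i ℕP.≟ b) 1ℤ)
good-δ b = record
  { poly = λ q → sym (poly b q)
  ; nn = λ i → sel-≥0 (i ℕP.≟ b) (λ _ → +≤+ z≤n)
  ; high = λ i lt → sel-no (i ℕP.≟ b) (λ e → ℕP.<-irrefl (sym e) lt)
  ; top = subst (0ℤ <_) (sym (sel-yes (b ℕP.≟ b) refl)) (+<+ (s≤s z≤n))
  ; up = λ i lt p → ⊥-elim (ℤP.<-irrefl (sym (sel-no (i ℕP.≟ b) {1ℤ} (λ e → ℕP.<-irrefl e lt))) p) }
  where
  poly : ∀ b q → sumTo b (λ i → sel (i ℕP.≟ b) 1ℤ * q ℤ.^ suc i) ≡ q ℤ.^ suc b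
  poly zero q = trans (cong (λ a → a * q ℤ.^ 1) (sel-yes (0 ℕP.≟ 0) {1ℤ} refl)) (ℤP.*-identityˡ (q ℤ.^ 1))
  poly (suc b) q = trans (cong₂ _+_ (sumTo-0 b {λ i → sel (i ℕP.≟ suc b) 1ℤ * q ℤ.^ suc i} (λ i le → cong (λ a → a * q ℤ.^ suc i) (sel-no (i ℕP.≟ suc b) {1ℤ} (λ e → ℕP.<-irrefl e (s≤s le)))))
      (trans (cong (λ a → a * q ℤ.^ suc (suc b)) (sel-yes (suc b ℕP.≟ suc b) {1ℤ} refl)) (ℤP.*-identityˡ (q ℤ.^ suc (suc b))))) (ℤP.+-identityˡ (q ℤ.^ suc (suc b)))

-- Below `b` either support is closed upwards. At `i = b` the support of the second summand ends,
-- and the leading coefficient of the first takes over.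
good-add : ∀ {b w w' c c'} → Good (suc b) w c → Good b w' c' → Good (suc b) (λ q → w q + w' q) (λ i → c i + c' i)
good-add {b} {w} {w'} {c} {c'} g g' = record
  { poly = λ q → trans (cong₂ _+_ (G.poly q) (trans (G'.poly q) (sym (trans (+R (sumTo b (λ i → c' i * q ℤ.^ suc i)) (cong (λ a → a * q ℤ.^ suc (suc b)) (G'.high (suc b) ℕP.≤-refl))) (ℤP.+-identityʳ (sumTo b (λ i → c' i * q ℤ.^ suc i)))))))
      (trans (sym (sumTo-+ (suc b) (λ i → c i * q ℤ.^ suc i) (λ i → c' i * q ℤ.^ suc i))) (sumTo-cong (suc b) (λ i _ → sym (ℤP.*-distribʳ-+ (q ℤ.^ suc i) (c i) (c' i)))))
  ; nn = λ i → ℤP.+-mono-≤ (G.nn i) (G'.nn i)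
  ; high = λ i lt → cong₂ _+_ (G.high i lt) (G'.high i (ℕP.<-trans (ℕP.n<1+n b) lt))
  ; top = pos+nn G.top (G'.nn (suc b))
  ; up = λ i lt p → up i lt p (0ℤ <? c i) (i ℕP.<? b) }
  where
  module G = Good g
  module G' = Good g'
  up : ∀ i → i ℕ.< suc b → 0ℤ < c i + c' i → Dec (0ℤ < c i) → Dec (i ℕ.< b) → 0ℤ < c (suc i) + c' (suc i)
  up i lt p (yes q) _ = pos+nn (G.up i lt q) (G'.nn (suc i))
  up i lt p (no ¬q) (yes i<b) = nn+pos (G.nn (suc i)) (G'.up i i<b (subst (0ℤ <_) (trans (cong (λ a → a + c' i) (ℤP.≤-antisym (ℤP.≮⇒≥ ¬q) (G.nn i))) (ℤP.+-identityˡ (c' i))) p))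
  up i lt p (no _) (no ¬i<b) = subst (λ j → 0ℤ < c (suc j) + c' (suc j)) (ℕP.≤-antisym (ℕP.≮⇒≥ ¬i<b) (ℕP.≤-pred lt)) (pos+nn G.top (G'.nn (suc b)))

module Whitney {n} (r : Subset n → ℕ) (isRank : IsRank r) where
  open Rank r isRank
  open Deletion r isRank

  -- `∣ A ∣ + r A` has the parity of `∣ A ∣ - r A` and avoids truncated subtraction.
  wt : ℤ → Subset n → ℤ
  wt q A = sg (∣ A ∣ ℕ.+ r A) * (q - 1ℤ) ℤ.^ (r ⊤ ℕ.∸ r A)

  -- `S` is already forced in and `T` already deleted, so splitting on one more element stays inside
  -- the family.
  Wh : Subset n → Subset n → ℤ → ℤ
  Wh S T q = ΣI S (⊤ ─ T) (wt q)

  indep-sub : ∀ {A B} → A ⊆ B → r B ≡ ∣ B ∣ → r A ≡ ∣ A ∣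
  indep-sub {A} {B} s e = ℕP.≤-antisym (r≤∣∣ A) (ℕP.≮⇒≥ (λ lt →
    let (C , C⊆A , (x , x∈) , sp) = circuit ∣ A ∣ A ℕP.≤-refl lt
    in ℕP.<-irrefl refl (ℕP.≤-trans (s≤s (ℕP.≤-trans (ℕP.≤-reflexive (sym (spanned-mono {C} {B} (λ y∈ → s (C⊆A y∈)) x∈ (sp x∈)))) (r≤∣∣ (del B x))))
          (ℕP.≤-reflexive (trans (∣del∣ (s (C⊆A x∈))) (sym e))))))

  wt-toggle : ∀ q {A x} → x ∉ A → x ∈cl A → wt q (A ∪ ⁅ x ⁆) ≡ - wt q A
  wt-toggle q {A} {x} x∉ h = trans (cong₂ (λ i j → sg (i ℕ.+ j) * (q - 1ℤ) ℤ.^ (r ⊤ ℕ.∸ j)) (card-add x∉) h)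
    (sym (ℤP.neg-distribˡ-* (sg (∣ A ∣ ℕ.+ r A)) ((q - 1ℤ) ℤ.^ (r ⊤ ℕ.∸ r A))))

  -- Toggling `x` never changes the rank of a set above `S`, so the terms cancel in pairs.
  Wh-zero : ∀ {S T x} → x ∈cl S → x ∉ S → x ∉ T → ∀ q → Wh S T q ≡ 0ℤ
  Wh-zero {S} {T} {x} x∈cl x∉S x∉T q = ΣS-cancel x (λ A → sel (in? S (⊤ ─ T) A) (wt q A)) toggle
    where
    toggle : ∀ A → x ∉ A → sel (in? S (⊤ ─ T) (A ∪ ⁅ x ⁆)) (wt q (A ∪ ⁅ x ⁆)) ≡ - sel (in? S (⊤ ─ T) A) (wt q A)
    toggle A x∉A = go (in? S (⊤ ─ T) (A ∪ ⁅ x ⁆)) (in? S (⊤ ─ T) A)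
      where
      go : (d : Dec (S ⊆ A ∪ ⁅ x ⁆ × A ∪ ⁅ x ⁆ ⊆ ⊤ ─ T)) (d' : Dec (S ⊆ A × A ⊆ ⊤ ─ T)) → sel d (wt q (A ∪ ⁅ x ⁆)) ≡ - sel d' (wt q A)
      go (yes _) (yes (p , _)) = wt-toggle q x∉A (∈cl-mono p x∈cl)
      go (no _) (no _) = refl
      go (yes (p , t)) (no ¬d) = ⊥-elim (¬d ((λ {y} y∈ → [ id , (λ w → ⊥-elim (x∉S (subst (_∈ S) (x∈⁅y⁆⇒x≡y x w) y∈))) ]′ (x∈p∪q⁻ A ⁅ x ⁆ (p y∈))) , (λ y∈ → t (∈∪ˡ y∈))))
      go (no ¬d) (yes (p , t)) = ⊥-elim (¬d ((λ y∈ → ∈∪ˡ (p y∈)) , ∪-⊆ t (⁅⁆⊆ (∈─⁺ ∈⊤ x∉T))))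

  -- All sets in the interval are independent; the signs disappear and what remains is the binomial
  -- expansion of `((q - 1) + 1) ^ k`.
  Wh-base : ∀ {S T} → r (⊤ ─ T) ≡ ∣ ⊤ ─ T ∣ → r (⊤ ─ T) ≡ r ⊤ → S ⊆ ⊤ ─ T → ∀ k → k ℕ.+ ∣ S ∣ ≡ r ⊤ → ∀ q → Wh S T q ≡ q ℤ.^ k
  Wh-base {S} {T} ind sp s k e q = trans (ΣI-cong {S = S} {⊤ ─ T} (λ A _ t → value A (indep-sub t ind)))
    (trans (ΣI-binomial (q - 1ℤ) (r ⊤) k S (⊤ ─ T) s (trans (sym ind) (trans sp (sym e))) (ℕP.≤-reflexive (trans (sym ind) sp)))
    (trans (cong₂ (λ x j → x ℤ.^ k * (q - 1ℤ) ℤ.^ j) (ring q) (trans (cong (r ⊤ ℕ.∸_) (trans (sym ind) sp)) (ℕP.n∸n≡0 (r ⊤)))) (ℤP.*-identityʳ (q ℤ.^ k))))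
    where
    value : ∀ A → r A ≡ ∣ A ∣ → wt q A ≡ (q - 1ℤ) ℤ.^ (r ⊤ ℕ.∸ ∣ A ∣)
    value A e = trans (cong (λ j → sg (∣ A ∣ ℕ.+ j) * (q - 1ℤ) ℤ.^ (r ⊤ ℕ.∸ j)) e)
      (trans (cong (λ w → w * (q - 1ℤ) ℤ.^ (r ⊤ ℕ.∸ ∣ A ∣)) (sg-even ∣ A ∣)) (ℤP.*-identityˡ ((q - 1ℤ) ℤ.^ (r ⊤ ℕ.∸ ∣ A ∣))))
    ring : ∀ q → q - 1ℤ + 1ℤ ≡ q
    ring = solve-∀

LogConcaveTo : ℕ → (ℕ → ℤ) → Set
LogConcaveTo b c = ∀ i → suc (suc i) ℕ.≤ b → c i * c (suc (suc i)) ≤ c (suc i) * c (suc i)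

module WhitneyNumbers {n'} (r : Subset (suc n') → ℕ) (isRank : IsRank r) (loopless : ∀ x → r ⁅ x ⁆ ≡ 1) where
  open Flags r isRank loopless
  open Deletion r isRank
  open Whitney r isRank

  -- The degree map

  n : ℕ
  n = suc n'

  Fun : Set
  Fun = Subset n → ℤ

  Flats : Set
  Flats = List (Subset n)

  sumLk : Flats → (Subset n → ℤ) → ℤ
  sumLk σ f = ΣS (λ G → sel (link? σ G) (f G))

  sumLk-cong : ∀ {σ} {f g : Fun} → (∀ G → Link σ G → f G ≡ g G) → sumLk σ f ≡ sumLk σ g
  sumLk-cong {σ} h = ΣS-cong (λ G → sel-cong (link? σ G) (h G))

  sumLk-0 : ∀ {σ} {f : Fun} → (∀ G → Link σ G → f G ≡ 0ℤ) → sumLk σ f ≡ 0ℤ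
  sumLk-0 {σ} {f} h = ΣF-0 (size n) (λ k → trans (sel-cong (link? σ (enum n k)) {y = 0ℤ} (h (enum n k))) (sel-0 (link? σ (enum n k))))

  sumLk-+ : ∀ σ (f g : Fun) → sumLk σ (λ G → f G + g G) ≡ sumLk σ f + sumLk σ g
  sumLk-+ σ f g = trans (ΣS-cong (λ G → sel-+ (link? σ G) (f G) (g G)))
    (ΣF-+ (size n) (λ k → sel (link? σ (enum n k)) (f (enum n k))) (λ k → sel (link? σ (enum n k)) (g (enum n k))))

  sumLk-* : ∀ σ a (f : Fun) → sumLk σ (λ G → a * f G) ≡ a * sumLk σ f
  sumLk-* σ a f = trans (ΣS-cong (λ G → sel-* (link? σ G) a (f G)))
    (ΣF-* (size n) a (λ k → sel (link? σ (enum n k)) (f (enum n k))))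

  sumLk-lin : ∀ σ a b (f g : Fun) → sumLk σ (λ G → a * f G + b * g G) ≡ a * sumLk σ f + b * sumLk σ g
  sumLk-lin σ a b f g = trans (sumLk-+ σ (λ G → a * f G) (λ G → b * g G)) (cong₂ _+_ (sumLk-* σ a f) (sumLk-* σ b g))

  sumLk-point : ∀ {σ} {f : Fun} B → Link σ B → (∀ G → Link σ G → G ≢ B → f G ≡ 0ℤ) → sumLk σ f ≡ f B
  sumLk-point {σ} {f} B l h = trans (ΣS-point B (λ G → sel (link? σ G) (f G))
      (λ G ne → trans (sel-cong (link? σ G) {y = 0ℤ} (λ l' → h G l' ne)) (sel-0 (link? σ G))))
    (sel-yes (link? σ B) l)

  sumLk-swap : ∀ σ (f : Subset n → Subset n → ℤ) →
    sumLk σ (λ G → sumLk (G ∷ σ) (f G)) ≡ sumLk σ (λ G' → sumLk (G' ∷ σ) (λ G → f G G'))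
  sumLk-swap σ f = trans (ΣS-cong (λ G → inside G (f G)))
    (trans (ΣF-swap (size n) (size n) (λ k l → sel (link? σ (enum n k)) (sel (link? (enum n k ∷ σ) (enum n l)) (f (enum n k) (enum n l)))))
           (trans (ΣS-cong (λ G' → ΣS-cong (λ G → exch G G' (f G G')))) (sym (ΣS-cong (λ G' → inside G' (λ G → f G G'))))))
    where
    inside : ∀ G (h : Fun) → sel (link? σ G) (sumLk (G ∷ σ) h) ≡ ΣS (λ G' → sel (link? σ G) (sel (link? (G ∷ σ) G') (h G')))
    inside G h with link? σ G
    ... | yes _ = refl
    ... | no _  = sym (ΣF-0 (size n) (λ _ → refl))
    exch : ∀ G G' x → sel (link? σ G) (sel (link? (G ∷ σ) G') x) ≡ sel (link? σ G') (sel (link? (G' ∷ σ) G) x)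
    exch G G' x = go (link? σ G) (link? (G ∷ σ) G') (link? σ G') (link? (G' ∷ σ) G)
      where
      go : (a : Dec (Link σ G)) (b : Dec (Link (G ∷ σ) G')) (c : Dec (Link σ G')) (d : Dec (Link (G' ∷ σ) G)) →
           sel a (sel b x) ≡ sel c (sel d x)
      go (yes a) (yes b) (yes c) (yes d) = refl
      go (yes a) (yes b) (yes c) (no d) = ⊥-elim (d (link-swap a b))
      go (yes a) (yes b) (no c) _ = ⊥-elim (c (link-tail b))
      go (yes a) (no b) (yes c) (yes d) = ⊥-elim (b (link-swap c d))
      go (yes a) (no b) (yes c) (no d) = refl
      go (yes a) (no b) (no c) _ = refl
      go (no a) _ (yes c) (yes d) = ⊥-elim (a (link-tail d))
      go (no a) _ (yes c) (no d) = refl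
      go (no a) _ (no c) _ = refl

  lin : (Fin n → ℤ) → Fun
  lin y G = ΣF n (λ j → mem j G * y j)

  record Lin (ℓ : Fun) : Set where
    constructor mkLin
    field
      const : ℤ
      coeff : Fin n → ℤ
      eq    : ∀ G → ℓ G ≡ const + lin coeff G

  Lin-const : ∀ c → Lin (λ _ → c)
  Lin-const c = mkLin c (λ _ → 0ℤ) (λ G → sym (trans (+R c (ΣF-0 n (λ j → ℤP.*-zeroʳ (mem j G)))) (ℤP.+-identityʳ c)))

  Lin-comb : ∀ {f g} a b → Lin f → Lin g → Lin (λ G → a * f G + b * g G)
  Lin-comb a b (mkLin c y e) (mkLin d z e') = mkLin (a * c + b * d) (λ j → a * y j + b * z j) (λ G →
    trans (cong₂ (λ u v → a * u + b * v) (e G) (e' G))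
    (trans (ring a b c d (lin y G) (lin z G))
     (+R (a * c + b * d) (trans (sym (cong₂ _+_ (ΣF-* n a (λ j → mem j G * y j)) (ΣF-* n b (λ j → mem j G * z j))))
       (trans (sym (ΣF-+ n (λ j → a * (mem j G * y j)) (λ j → b * (mem j G * z j))))
              (ΣF-cong n (λ j → ring₂ a b (mem j G) (y j) (z j))))))))
    where
    ring : ∀ a b c d u v → a * (c + u) + b * (d + v) ≡ a * c + b * d + (a * u + b * v)
    ring = solve-∀
    ring₂ : ∀ a b m y z → a * (m * y) + b * (m * z) ≡ m * (a * y + b * z)
    ring₂ = solve-∀

  Lin-cong : ∀ {f g} → (∀ G → f G ≡ g G) → Lin f → Lin g
  Lin-cong h (mkLin c y e) = mkLin c y (λ G → trans (sym (h G)) (e G))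

  Lin-mem : ∀ j → Lin (mem j)
  Lin-mem j = mkLin 0ℤ (λ k → sel (k FinP.≟ j) 1ℤ) (λ G → sym (trans (ℤP.+-identityˡ _)
    (trans (ΣF-point n j (λ k → mem k G * sel (k FinP.≟ j) 1ℤ) (λ k ne → trans (*R (mem k G) (sel-no (k FinP.≟ j) ne)) (ℤP.*-zeroʳ (mem k G))))
           (trans (*R (mem j G) (sel-yes (j FinP.≟ j) refl)) (ℤP.*-identityʳ (mem j G))))))

  Lin-+ : ∀ {f g} → Lin f → Lin g → Lin (λ G → f G + g G)
  Lin-+ {f} {g} p q = Lin-cong (λ G → cong₂ _+_ (ℤP.*-identityˡ (f G)) (ℤP.*-identityˡ (g G))) (Lin-comb 1ℤ 1ℤ p q)

  Lin-* : ∀ {f} a → Lin f → Lin (λ G → a * f G)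
  Lin-* {f} a p = Lin-cong (λ G → ring a (f G)) (Lin-comb a 0ℤ p p)
    where
    ring : ∀ a x → a * x + 0ℤ * x ≡ a * x
    ring = solve-∀

  Lin-- : ∀ {f g} → Lin f → Lin g → Lin (λ G → f G - g G)
  Lin-- {f} {g} p q = Lin-cong (λ G → ring (f G) (g G)) (Lin-comb 1ℤ -1ℤ p q)
    where
    ring : ∀ a x → 1ℤ * a + -1ℤ * x ≡ a - x
    ring = solve-∀

  Van : Flats → Fun → Set
  Van σ φ = φ ⊥ ≡ 0ℤ × φ ⊤ ≡ 0ℤ × All (λ F → φ F ≡ 0ℤ) σ

  Van-lo : ∀ {σ φ F} → Van σ φ → F ∈ₗ ⊥ ∷ σ → φ F ≡ 0ℤ
  Van-lo (a , _ , _) (here refl) = a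
  Van-lo (_ , _ , c) (there p) = All.lookup c p

  Van-hi : ∀ {σ φ F} → Van σ φ → F ∈ₗ ⊤ ∷ σ → φ F ≡ 0ℤ
  Van-hi (_ , b , _) (here refl) = b
  Van-hi (_ , _ , c) (there p) = All.lookup c p

  -- the atoms of a rank two gap partition its ground set
  module Gap {σ} (fs : Flag σ) (t : ℕ) (t>0 : 0 ℕ.< t) (t<R : t ℕ.< R) (¬c : ¬ Covered σ t) where
    lo = proj₁ (lower fs t t>0)
    hi = proj₁ (upper fs t t<R)
    lo∈ = proj₁ (proj₂ (lower fs t t>0))
    hi∈ = proj₁ (proj₂ (upper fs t t<R))
    lo< = proj₁ (proj₂ (proj₂ (lower fs t t>0)))
    hi> = proj₁ (proj₂ (proj₂ (upper fs t t<R)))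
    alo = proj₂ (proj₂ (proj₂ (lower fs t t>0)))
    ahi = proj₂ (proj₂ (proj₂ (upper fs t t<R)))
    lo⊆hi : lo ⊆ hi
    lo⊆hi = lower⊆upper fs lo∈ hi∈ (ℕP.<-trans lo< hi>)
    lo-flat : Flat lo
    lo-flat = lower-flat fs lo∈
    hi-flat : Flat hi
    hi-flat = upper-flat fs hi∈

    lo⊆link : ∀ {H} → Link σ H → r H ≡ t → lo ⊆ H
    lo⊆link {H} l e = go lo∈
      where
      go : lo ∈ₗ ⊥ ∷ σ → lo ⊆ H
      go (here p) = subst (_⊆ H) (sym p) ⊥⊆
      go (there p) with proj₁ (All.lookup (cmps l) p)
      ... | inj₁ s = s
      ... | inj₂ s = ⊥-elim (ℕP.<⇒≱ lo< (subst (ℕ._≤ r lo) e (r-mono s)))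

    link⊆hi : ∀ {H} → Link σ H → r H ≡ t → H ⊆ hi
    link⊆hi {H} l e = go hi∈
      where
      go : hi ∈ₗ ⊤ ∷ σ → H ⊆ hi
      go (here p) = subst (H ⊆_) (sym p) ⊆⊤
      go (there p) with proj₁ (All.lookup (cmps l) p)
      ... | inj₂ s = s
      ... | inj₁ s = ⊥-elim (ℕP.<⇒≱ hi> (subst (r hi ℕ.≤_) e (r-mono s)))

    r-lo : (∀ s → 0 ℕ.< s → suc s ≡ t → Covered σ s) → suc (r lo) ≡ t
    r-lo cov = go t refl t>0
      where
      up : ∀ {σ s} → suc s ≡ t → All (λ F → r F ℕ.< t → F ⊆ lo) σ → Covered σ s → s ℕ.≤ r lo
      up e (a ∷ _) (here refl) = r-mono (a (ℕP.≤-reflexive e))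
      up e (_ ∷ as) (there c) = up e as c
      go : ∀ t' → t' ≡ t → 0 ℕ.< t' → suc (r lo) ≡ t
      go (suc zero) e _ = ℕP.≤-antisym lo< (subst (ℕ._≤ suc (r lo)) e (s≤s z≤n))
      go (suc (suc s)) e _ = ℕP.≤-antisym lo< (subst (ℕ._≤ suc (r lo)) e (s≤s (up e alo (cov (suc s) (s≤s z≤n) e))))

    atom-rank : ∀ {x} → suc (r lo) ≡ t → x ∉ lo → r (cl (lo ∪ ⁅ x ⁆)) ≡ t
    atom-rank e x∉ = trans (r-cl _) (trans (flat-step lo-flat x∉) e)

    atom-link : ∀ {x} → suc (r lo) ≡ t → x ∉ lo → x ∈ hi → Link σ (cl (lo ∪ ⁅ x ⁆))
    atom-link e x∉ x∈ = mk-link fs ¬c alo ahi (cl-flat _) (atom-rank e x∉) t>0 t<R (⊆cl ∘ ∈∪ˡ) (cl-min hi-flat (∪-⊆ lo⊆hi (⁅⁆⊆ x∈)))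

    atom-∋ : ∀ x → x ∈ cl (lo ∪ ⁅ x ⁆)
    atom-∋ x = ⊆cl (∈∪ʳ (x∈⁅x⁆ x))

    atom-unique : ∀ {x H} → suc (r lo) ≡ t → x ∉ lo → Link σ H → r H ≡ t → x ∈ H → H ≡ cl (lo ∪ ⁅ x ⁆)
    atom-unique e x∉ l e' x∈H = sym (flat-≡ (cl-flat _) (cl-min (flat l) (∪-⊆ (lo⊆link l e') (⁅⁆⊆ x∈H))) (ℕP.≤-reflexive (trans e' (sym (atom-rank e x∉)))))

    private
      -- An element of `hi` outside `lo` lies in exactly one flat of the gap.
      count-in : ∀ j → suc (r lo) ≡ t → (∀ {H} → Link σ H → r H ≡ t) →
        sumLk σ (λ H → mem j H - mem j lo) ≡ mem j hi - mem j lo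
      count-in j e all with j ∈? lo | j ∈? hi
      ... | yes j∈lo | _ = trans (sumLk-0 (λ H l → trans (cong₂ _-_ (mem-∈ (lo⊆link l (all l) j∈lo)) (mem-∈ j∈lo)) refl))
              (sym (cong₂ _-_ (mem-∈ (lo⊆hi j∈lo)) (mem-∈ j∈lo)))
      ... | no j∉lo | no j∉hi = trans (sumLk-0 (λ H l → cong₂ _-_ (mem-∉ (λ j∈H → j∉hi (link⊆hi l (all l) j∈H))) (mem-∉ j∉lo)))
              (sym (cong₂ _-_ (mem-∉ j∉hi) (mem-∉ j∉lo)))
      ... | no j∉lo | yes j∈hi = trans (sumLk-point (cl (lo ∪ ⁅ j ⁆)) (atom-link e j∉lo j∈hi)
                (λ H l ne → cong₂ _-_ (mem-∉ (λ j∈H → ne (atom-unique e j∉lo l (all l) j∈H))) (mem-∉ j∉lo)))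
              (cong (λ z → z - mem j lo) (trans (mem-∈ (atom-∋ j)) (sym (mem-∈ j∈hi))))

    -- The balancing condition of the fan at a cone of codimension one. Measured from `lo`, the
    -- values of `ℓ` over the gap add up to `ℓ hi`.
    balance : suc (r lo) ≡ t → (∀ {H} → Link σ H → r H ≡ t) → ∀ {ℓ} → Lin ℓ → Van σ ℓ → sumLk σ ℓ ≡ 0ℤ
    balance e all {ℓ} (mkLin c y eq) van = begin
      sumLk σ ℓ ≡⟨ sumLk-cong {σ} {ℓ} {λ H → ΣF n (λ j → y j * (mem j H - mem j lo))} (λ H _ → diff H) ⟩
      sumLk σ (λ H → ΣF n (λ j → y j * (mem j H - mem j lo)))
        ≡⟨ ΣS-cong (λ H → sel-ΣF (link? σ H) (λ j → y j * (mem j H - mem j lo))) ⟩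
      ΣS (λ H → ΣF n (λ j → sel (link? σ H) (y j * (mem j H - mem j lo))))
        ≡⟨ ΣF-swap (size n) n (λ k j → sel (link? σ (enum n k)) (y j * (mem j (enum n k) - mem j lo))) ⟩
      ΣF n (λ j → sumLk σ (λ H → y j * (mem j H - mem j lo)))
        ≡⟨ ΣF-cong n (λ j → trans (sumLk-* σ (y j) (λ H → mem j H - mem j lo)) (*R (y j) (count-in j e all))) ⟩
      ΣF n (λ j → y j * (mem j hi - mem j lo)) ≡⟨ sym (diff hi) ⟩
      ℓ hi ≡⟨ Van-hi van hi∈ ⟩
      0ℤ ∎
      where
      open ≡-Reasoning
      sel-ΣF : ∀ {P : Set} (d : Dec P) (f : Fin n → ℤ) → sel d (ΣF n f) ≡ ΣF n (λ j → sel d (f j))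
      sel-ΣF (yes _) f = refl
      sel-ΣF (no _) f = sym (ΣF-0 n (λ _ → refl))
      ring : ∀ c u v → c + u ≡ (c + v) + (u + -1ℤ * v)
      ring = solve-∀
      ring₂ : ∀ m l y → m * y + -1ℤ * (l * y) ≡ y * (m - l)
      ring₂ = solve-∀
      diff : ∀ H → ℓ H ≡ ΣF n (λ j → y j * (mem j H - mem j lo))
      diff H = trans (eq H) (trans (ring c (lin y H) (lin y lo))
        (trans (cong₂ _+_ (trans (sym (eq lo)) (Van-lo van lo∈)) (trans (+R (lin y H) (sym (ΣF-* n -1ℤ (λ j → mem j lo * y j))))
            (trans (sym (ΣF-+ n (λ j → mem j H * y j) (λ j → -1ℤ * (mem j lo * y j)))) (ΣF-cong n (λ j → ring₂ (mem j H) (mem j lo) (y j))))))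
          (ℤP.+-identityˡ _)))

  almost-full : ∀ {σ} → Flag σ → suc (suc (length σ)) ≡ R → ∀ {G s} → Link σ G → 0 ℕ.< s → s ℕ.< R → s ≢ r G → Covered σ s
  almost-full {σ} fs len l s>0 s<R ne with full-covered (l ∷ fs) (cong ℕ.pred len) _ s>0 s<R
  ... | here e = ⊥-elim (ne (sym e))
  ... | there c = c

  balance₀ : ∀ {σ} → Flag σ → suc (suc (length σ)) ≡ R → ∀ {ℓ} → Lin ℓ → Van σ ℓ → sumLk σ ℓ ≡ 0ℤ
  balance₀ {σ} fs len {ℓ} lin-ℓ van =
    let (t , t>0 , t<R , ¬c) = missing fs (ℕP.≤-reflexive (cong ℕ.pred len))
        (G , l , rG)         = exists-link fs t t>0 t<R ¬c
        module g             = Gap fs t t>0 t<R ¬c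
    in g.balance
         (g.r-lo (λ s s>0 e → almost-full fs len l s>0 (ℕP.<-trans (ℕP.≤-reflexive e) t<R) (λ e' → ℕP.<-irrefl (trans e' rG) (ℕP.≤-reflexive e))))
         (λ {H} l' → rank-t t G l rG ¬c H l')
         lin-ℓ van
    where
    rank-t : ∀ t G → Link σ G → r G ≡ t → ¬ Covered σ t → ∀ H → Link σ H → r H ≡ t
    rank-t t G l rG ¬c H l' with r H ℕP.≟ t
    ... | yes e = e
    ... | no ne = ⊥-elim (link-uncovered fs l' (almost-full fs len l (proj₁ (link-rank l')) (proj₂ (link-rank l')) (λ e → ne (trans e rG))))

  -- For such a pair `mem i - mem j` is linear, vanishes on the flag and equals `1` at `G`.
  Sep : Flats → Subset n → Fin n → Fin n → Set
  Sep σ G i j = (i ∈ G × j ∉ G) × All (λ F → mem i F ≡ mem j F) σ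

  sep? : ∀ σ G → Dec (∃[ i ] ∃[ j ] Sep σ G i j)
  sep? σ G = FinP.any? (λ i → FinP.any? (λ j → ((i ∈? G) ×-dec ¬? (j ∈? G)) ×-dec All.all? (λ F → mem i F ℤP.≟ mem j F) σ))

  -- Let `i` enter the flag last within `G` and `j` enter first outside `G`. A member below `G` then
  -- contains neither of them, a member above `G` contains both.
  sep-exists : ∀ {σ G} → Flag σ → Link σ G → ∃[ i ] ∃[ j ] Sep σ G i j
  sep-exists {σ} {G} fs l with chain-∈ fs G (≢⊥⇒∃ (≢⊥ l)) | chain-∉ fs G (≢⊤⇒∃ (≢⊤ l))
  ... | i , i∈G , hi | j , j∉G , hj = i , j , (i∈G , j∉G) , go (cmps l) hi hj
    where
    go : ∀ {σ} → All (λ F → Cmp F G) σ → All (λ F → i ∈ F → G ⊆ F) σ → All (λ F → F ⊆ G ⊎ j ∈ F) σ → All (λ F → mem i F ≡ mem j F) σ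
    go [] [] [] = []
    go ((inj₁ F⊆G , ne) ∷ cs) (p ∷ ps) (q ∷ qs) =
      trans (mem-∉ (λ i∈F → ne (⊆-antisym F⊆G (p i∈F)))) (sym (mem-∉ (λ j∈F → j∉G (F⊆G j∈F)))) ∷ go cs ps qs
    go ((inj₂ G⊆F , ne) ∷ cs) (p ∷ ps) (inj₁ F⊆G ∷ qs) = ⊥-elim (ne (⊆-antisym F⊆G G⊆F))
    go ((inj₂ G⊆F , ne) ∷ cs) (p ∷ ps) (inj₂ j∈F ∷ qs) = trans (mem-∈ (G⊆F i∈G)) (sym (mem-∈ j∈F)) ∷ go cs ps qs

  private
    μ' : ∀ {σ G} → Dec (∃[ i ] ∃[ j ] Sep σ G i j) → Fun
    μ' (yes (i , j , _)) H = mem i H - mem j H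
    μ' (no _)            H = 0ℤ

  μ : Flats → Subset n → Fun
  μ σ G = μ' (sep? σ G)

  memDiff-⊥ : ∀ i j → mem {n} i ⊥ - mem j ⊥ ≡ 0ℤ
  memDiff-⊥ i j = cong₂ _-_ (mem-∉ {n} {i} {⊥} ∉⊥) (mem-∉ {n} {j} {⊥} ∉⊥)

  memDiff-⊤ : ∀ i j → mem {n} i ⊤ - mem j ⊤ ≡ 0ℤ
  memDiff-⊤ i j = cong₂ _-_ (mem-∈ {n} {i} {⊤} ∈⊤) (mem-∈ {n} {j} {⊤} ∈⊤)

  μ-Lin : ∀ σ G → Lin (μ σ G)
  μ-Lin σ G with sep? σ G
  ... | yes (i , j , _) = Lin-- (Lin-mem i) (Lin-mem j)
  ... | no _ = Lin-const 0ℤ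

  μ-Van : ∀ {σ} G → Van σ (μ σ G)
  μ-Van {σ} G with sep? σ G
  ... | yes (i , j , _ , a) = memDiff-⊥ i j , memDiff-⊤ i j , All.map (λ {F} e → ℤP.i≡j⇒i-j≡0 e) a
  ... | no _ = refl , refl , All.universal (λ _ → refl) σ

  μ-one : ∀ {σ G} → Flag σ → Link σ G → μ σ G G ≡ 1ℤ
  μ-one {σ} {G} fs l with sep? σ G
  ... | yes (i , j , (i∈ , j∉) , _) = cong₂ _-_ (mem-∈ i∈) (mem-∉ j∉)
  ... | no ¬s = ⊥-elim (¬s (sep-exists fs l))

  μ-≥0 : ∀ σ {G H} → H ⊆ G → 0ℤ ≤ μ σ G H
  μ-≥0 σ {G} {H} s with sep? σ G
  ... | yes (i , j , (_ , j∉) , _) = subst (0ℤ ≤_) (trans (sym (ℤP.+-identityʳ (mem i H))) (cong (λ z → mem i H - z) (sym (mem-∉ (λ j∈ → j∉ (s j∈)))))) (mem-≥0 i H)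
  ... | no _ = ℤP.≤-refl

  Van-∷ : ∀ {σ G ℓ} → Flag σ → Link σ G → Van σ ℓ → Van (G ∷ σ) (λ H → ℓ H - ℓ G * μ σ G H)
  Van-∷ {σ} {G} {ℓ} fs l (a , b , c) =
    let (a' , b' , c') = μ-Van {σ} G in
    zz a a' , zz b b' , trans (cong (λ z → ℓ G - ℓ G * z) (μ-one fs l)) (r₁ (ℓ G)) ∷ All.zipWith (λ (p , q) → zz p q) (c , c')
    where
    r₁ : ∀ a → a - a * 1ℤ ≡ 0ℤ
    r₁ = solve-∀
    r₂ : ∀ a → 0ℤ - a * 0ℤ ≡ 0ℤ
    r₂ = solve-∀
    zz : ∀ {H} → ℓ H ≡ 0ℤ → μ σ G H ≡ 0ℤ → ℓ H - ℓ G * μ σ G H ≡ 0ℤ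
    zz p q = trans (cong₂ (λ u v → u - ℓ G * v) p q) (r₂ (ℓ G))

  hat : Flats → Fun → Fun
  hat []      φ H = φ H - φ ⊥ - (φ ⊤ - φ ⊥) * mem zero H
  hat (G ∷ σ) φ H = hat σ φ H - hat σ φ G * μ σ G H

  hat-Van : ∀ {σ} → Flag σ → ∀ φ → Van σ (hat σ φ)
  hat-Van [] φ = trans (cong (λ z → φ ⊥ - φ ⊥ - (φ ⊤ - φ ⊥) * z) (mem-∉ {n} {zero} {⊥} ∉⊥)) (r₁ (φ ⊥) (φ ⊤)) ,
                 trans (cong (λ z → φ ⊤ - φ ⊥ - (φ ⊤ - φ ⊥) * z) (mem-∈ {n} {zero} {⊤} ∈⊤)) (r₂ (φ ⊥) (φ ⊤)) , []
    where
    r₁ : ∀ a b → a - a - (b - a) * 0ℤ ≡ 0ℤ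
    r₁ = solve-∀
    r₂ : ∀ a b → b - a - (b - a) * 1ℤ ≡ 0ℤ
    r₂ = solve-∀
  hat-Van (l ∷ fs) φ = Van-∷ fs l (hat-Van fs φ)

  hat-id : ∀ σ φ → Van σ φ → ∀ H → hat σ φ H ≡ φ H
  hat-id [] φ (a , b , _) H = trans (cong₂ (λ u v → φ H - u - (v - u) * mem zero H) a b) (r₁ (φ H) (mem zero H))
    where
    r₁ : ∀ x m → x - 0ℤ - (0ℤ - 0ℤ) * m ≡ x
    r₁ = solve-∀
  hat-id (G ∷ σ) φ (a , b , c ∷ cs) H = trans (cong₂ (λ u v → u - v * μ σ G H) (ih H) (trans (ih G) c)) (r₁ (φ H) (μ σ G H))
    where
    ih = hat-id σ φ (a , b , cs)
    r₁ : ∀ x m → x - 0ℤ * m ≡ x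
    r₁ = solve-∀

  hat-Lin : ∀ σ {φ} → Lin φ → Lin (hat σ φ)
  hat-Lin [] {φ} p = Lin-- (Lin-- p (Lin-const (φ ⊥))) (Lin-* (φ ⊤ - φ ⊥) (Lin-mem zero))
  hat-Lin (G ∷ σ) {φ} p = Lin-- (hat-Lin σ p) (Lin-* (hat σ φ G) (μ-Lin σ G))

  hat-diff : ∀ σ φ → Lin (λ H → φ H - hat σ φ H)
  hat-diff [] φ = Lin-cong (λ H → r₁ (φ H) (φ ⊥) (φ ⊤) (mem zero H)) (Lin-+ (Lin-const (φ ⊥)) (Lin-* (φ ⊤ - φ ⊥) (Lin-mem zero)))
    where
    r₁ : ∀ x a b m → a + (b - a) * m ≡ x - (x - a - (b - a) * m)
    r₁ = solve-∀
  hat-diff (G ∷ σ) φ = Lin-cong (λ H → r₁ (φ H) (hat σ φ H) (hat σ φ G) (μ σ G H)) (Lin-+ (hat-diff σ φ) (Lin-* (hat σ φ G) (μ-Lin σ G)))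
    where
    r₁ : ∀ x h g m → x - h + g * m ≡ x - (h - g * m)
    r₁ = solve-∀

  hat-comb : ∀ σ a b φ ψ H → hat σ (λ G → a * φ G + b * ψ G) H ≡ a * hat σ φ H + b * hat σ ψ H
  hat-comb [] a b φ ψ H = r₁ a b (φ H) (φ ⊥) (φ ⊤) (ψ H) (ψ ⊥) (ψ ⊤) (mem zero H)
    where
    r₁ : ∀ a b x p q y s t m → a * x + b * y - (a * p + b * s) - (a * q + b * t - (a * p + b * s)) * m
         ≡ a * (x - p - (q - p) * m) + b * (y - s - (t - s) * m)
    r₁ = solve-∀
  hat-comb (G ∷ σ) a b φ ψ H = trans (cong₂ (λ u v → u - v * μ σ G H) (hat-comb σ a b φ ψ H) (hat-comb σ a b φ ψ G))
      (r₁ a b (hat σ φ H) (hat σ φ G) (hat σ ψ H) (hat σ ψ G) (μ σ G H))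
    where
    r₁ : ∀ a b x g y h m → a * x + b * y - (a * g + b * h) * m ≡ a * (x - g * m) + b * (y - h * m)
    r₁ = solve-∀

  hat-cong : ∀ σ {φ ψ} → (∀ G → φ G ≡ ψ G) → ∀ H → hat σ φ H ≡ hat σ ψ H
  hat-cong [] h H = cong₂ (λ u v → u - proj₁ v - (proj₂ v - proj₁ v) * mem zero H) (h H) (cong₂ _,_ (h ⊥) (h ⊤))
  hat-cong (G ∷ σ) h H = cong₂ (λ u v → u - v * μ σ G H) (hat-cong σ h H) (hat-cong σ h G)

  D : Flats → List Fun → ℤ
  D σ []       = sel (suc (length σ) ℕP.≟ R) 1ℤ
  D σ (φ ∷ φs) = sumLk σ (λ G → hat σ φ G * D (G ∷ σ) φs)

  record Sim (σ τ : Flats) : Set where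
    constructor mkSim
    field
      len : length σ ≡ length τ
      to  : ∀ {F} → F ∈ₗ σ → F ∈ₗ τ
      from : ∀ {F} → F ∈ₗ τ → F ∈ₗ σ

  sim-∷ : ∀ {σ τ} G → Sim σ τ → Sim (G ∷ σ) (G ∷ τ)
  sim-∷ G (mkSim a b c) = mkSim (cong suc a) (λ { (here e) → here e ; (there p) → there (b p) }) (λ { (here e) → here e ; (there p) → there (c p) })

  sim-swap : ∀ σ G G' → Sim (G ∷ G' ∷ σ) (G' ∷ G ∷ σ)
  sim-swap σ G G' = mkSim refl sw sw
    where
    sw : ∀ {F G G'} → F ∈ₗ G ∷ G' ∷ σ → F ∈ₗ G' ∷ G ∷ σ
    sw (here e) = there (here e)
    sw (there (here e)) = here e
    sw (there (there p)) = there (there p)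

  link-sim : ∀ {σ τ G} → (∀ {F} → F ∈ₗ τ → F ∈ₗ σ) → Link σ G → Link τ G
  link-sim h (mkLink a b c d) = mkLink a b c (All.tabulate (λ p → All.lookup d (h p)))

  Van-- : ∀ {σ f g} → Van σ f → Van σ g → Van σ (λ H → f H - g H)
  Van-- (a , b , c) (a' , b' , c') = cong₂ _-_ a a' , cong₂ _-_ b b' , All.zipWith (λ (p , q) → cong₂ _-_ p q) (c , c')

  -- Cutting with `φs` leaves balanced weights on every star. `Balanced` and `Invariant` are proved
  -- together, since each of them for one more function uses both for the shorter list.
  Balanced : List Fun → Set
  Balanced φs = ∀ {σ} → Flag σ → ∀ {ℓ} → Lin ℓ → Van σ ℓ → sumLk σ (λ G → ℓ G * D (G ∷ σ) φs) ≡ 0ℤ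

  Invariant : List Fun → Set
  Invariant φs = ∀ {σ τ} → Flag σ → Flag τ → Sim σ τ → D σ φs ≡ D τ φs

  -- self-intersections are moved by the linear functions μ
  module Two (φs : List Fun) (bal : Balanced φs) (inv : Invariant φs) {σ} (fs : Flag σ) where
    E : Subset n → Subset n → ℤ
    E G G' = D (G' ∷ G ∷ σ) φs

    M : Fun
    M G = sumLk (G ∷ σ) (λ G' → μ σ G G' * E G G')

    S₂ : Fun → Fun → ℤ
    S₂ f g = sumLk σ (λ G → sumLk (G ∷ σ) (λ G' → f G * g G' * E G G'))

    -- The self-intersection `M G` enters with the weight `f G * g G`, so any asymmetry between `f`
    -- and `g` would have to come from `S₂`.
    expand : ∀ f g → sumLk σ (λ G → f G * sumLk (G ∷ σ) (λ G' → (g G' - g G * μ σ G G') * E G G'))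
                     ≡ S₂ f g - sumLk σ (λ G → f G * g G * M G)
    expand f g = trans (sumLk-cong {σ} {g = λ G → 1ℤ * sumLk (G ∷ σ) (λ G' → f G * g G' * E G G') + -1ℤ * (f G * g G * M G)} (λ G _ →
        trans (sym (sumLk-* (G ∷ σ) (f G) (λ G' → (g G' - g G * μ σ G G') * E G G')))
        (trans (sumLk-cong {G ∷ σ} (λ G' _ → r₁ (f G) (g G) (g G') (μ σ G G') (E G G')))
        (trans (sumLk-lin (G ∷ σ) 1ℤ (- (f G * g G)) (λ G' → f G * g G' * E G G') (λ G' → μ σ G G' * E G G'))
               (r₂ (sumLk (G ∷ σ) (λ G' → f G * g G' * E G G')) (f G * g G) (M G))))))
      (trans (sumLk-lin σ 1ℤ -1ℤ (λ G → sumLk (G ∷ σ) (λ G' → f G * g G' * E G G')) (λ G → f G * g G * M G))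
             (r₃ (S₂ f g) (sumLk σ (λ G → f G * g G * M G))))
      where
      r₁ : ∀ f g g' m e → f * ((g' - g * m) * e) ≡ 1ℤ * (f * g' * e) + - (f * g) * (m * e)
      r₁ = solve-∀
      r₂ : ∀ s a m → 1ℤ * s + - a * m ≡ 1ℤ * s + -1ℤ * (a * m)
      r₂ = solve-∀
      r₃ : ∀ a b → 1ℤ * a + -1ℤ * b ≡ a - b
      r₃ = solve-∀

    E-sym : ∀ {G G'} → Link σ G → Link (G ∷ σ) G' → E G G' ≡ E G' G
    E-sym {G} {G'} l l' = inv (l' ∷ (l ∷ fs)) (link-swap l l' ∷ (link-tail l' ∷ fs)) (sim-swap σ G' G)

    S₂-swap : ∀ f g → S₂ f g ≡ S₂ g f
    S₂-swap f g = trans (sumLk-swap σ (λ G G' → f G * g G' * E G G'))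
      (sumLk-cong {σ} (λ G' l' → sumLk-cong {G' ∷ σ} (λ G l → cong₂ _*_ (ℤP.*-comm (f G) (g G')) (E-sym (link-tail l) (link-swap l' l)))))

    -- On the star of `G` the linear function `ℓ - ℓ G * μ` vanishes on the flag, and balancing
    -- reduces the inner sum to `ℓ G * M G`.
    S₂-Lin : ∀ f {ℓ} → Lin ℓ → Van σ ℓ → S₂ f ℓ ≡ sumLk σ (λ G → f G * ℓ G * M G)
    S₂-Lin f {ℓ} lin-ℓ van = sumLk-cong {σ} (λ G l →
        trans (sumLk-cong {G ∷ σ} (λ G' _ → r₀ (f G) (ℓ G') (E G G')))
        (trans (sumLk-* (G ∷ σ) (f G) (λ G' → ℓ G' * E G G'))
        (trans (*R (f G) (inner G l)) (sym (ℤP.*-assoc (f G) (ℓ G) (M G))))))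
      where
      r₀ : ∀ a b c → a * b * c ≡ a * (b * c)
      r₀ = solve-∀
      r₁ : ∀ a g m e → a * e ≡ 1ℤ * ((a - g * m) * e) + g * (m * e)
      r₁ = solve-∀
      r₂ : ∀ x → 1ℤ * 0ℤ + x ≡ x
      r₂ = solve-∀
      inner : ∀ G → Link σ G → sumLk (G ∷ σ) (λ G' → ℓ G' * E G G') ≡ ℓ G * M G
      inner G l = trans (sumLk-cong {G ∷ σ} (λ G' _ → r₁ (ℓ G') (ℓ G) (μ σ G G') (E G G')))
        (trans (sumLk-lin (G ∷ σ) 1ℤ (ℓ G) (λ G' → (ℓ G' - ℓ G * μ σ G G') * E G G') (λ G' → μ σ G G' * E G G'))
        (trans (cong (λ z → 1ℤ * z + ℓ G * M G) (bal (l ∷ fs) (Lin-- lin-ℓ (Lin-* (ℓ G) (μ-Lin σ G))) (Van-∷ fs l van)))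
               (r₂ (ℓ G * M G))))

  balanced : ∀ φs → Balanced φs
  invariant : ∀ φs → Invariant φs

  balanced [] {σ} fs {ℓ} lin-ℓ van with suc (suc (length σ)) ℕP.≟ R
  ... | yes e = trans (sumLk-cong {σ} (λ G _ → ℤP.*-identityʳ (ℓ G))) (balance₀ fs e lin-ℓ van)
  ... | no _  = sumLk-0 {σ} (λ G _ → ℤP.*-zeroʳ (ℓ G))
  balanced (φ ∷ φs) {σ} fs {ℓ} lin-ℓ van =
    trans (T.expand ℓ (hat σ φ)) (trans (cong₂ _-_ (trans (T.S₂-swap ℓ (hat σ φ)) (T.S₂-Lin (hat σ φ) lin-ℓ van))
        (sumLk-cong {σ} (λ G _ → cong (λ z → z * T.M G) (ℤP.*-comm (ℓ G) (hat σ φ G)))))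
      (ℤP.+-inverseʳ (sumLk σ (λ G → hat σ φ G * ℓ G * T.M G))))
    where module T = Two φs (balanced φs) (invariant φs) fs

  invariant [] (fs) ft (mkSim len _ _) = cong (λ k → sel (suc k ℕP.≟ R) 1ℤ) len
  -- The two representatives of `φ` differ by a linear function vanishing on the flag, which
  -- balancing removes.
  invariant (φ ∷ φs) {σ} {τ} fs ft s@(mkSim len to from) =
    trans (ΣS-cong (λ G → sel-⇔ (link? σ G) (link? τ G) {hat σ φ G * D (G ∷ σ) φs} (link-sim from) (link-sim to)))
    (trans (sumLk-cong {τ} (λ G l → trans (*R (hat σ φ G) (invariant φs (link-sim to l ∷ fs) (l ∷ ft) (sim-∷ G s)))
              (r₁ (hat σ φ G) (hat τ φ G) (D (G ∷ τ) φs))))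
    (trans (sumLk-+ τ (λ G → hat τ φ G * D (G ∷ τ) φs) (λ G → (hat σ φ G - hat τ φ G) * D (G ∷ τ) φs))
    (trans (+R (sumLk τ (λ G → hat τ φ G * D (G ∷ τ) φs)) (balanced φs ft dl (Van-- (sim-Van (hat-Van fs φ)) (hat-Van ft φ))))
           (ℤP.+-identityʳ _))))
    where
    r₁ : ∀ a b e → a * e ≡ b * e + (a - b) * e
    r₁ = solve-∀
    r₂ : ∀ x a b → (x - b) - (x - a) ≡ a - b
    r₂ = solve-∀
    dl : Lin (λ G → hat σ φ G - hat τ φ G)
    dl = Lin-cong (λ G → r₂ (φ G) (hat σ φ G) (hat τ φ G)) (Lin-- (hat-diff τ φ) (hat-diff σ φ))
    sim-Van : ∀ {f} → Van σ f → Van τ f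
    sim-Van (a , b , c) = a , b , All.tabulate (λ p → All.lookup c (from p))

  D-Lin : ∀ {σ} → Flag σ → ∀ {ℓ} φs → Lin ℓ → D σ (ℓ ∷ φs) ≡ 0ℤ
  D-Lin {σ} fs {ℓ} φs p = balanced φs fs (hat-Lin σ p) (hat-Van fs ℓ)

  D-swap : ∀ {σ} → Flag σ → ∀ φ ψ φs → D σ (φ ∷ ψ ∷ φs) ≡ D σ (ψ ∷ φ ∷ φs)
  D-swap {σ} fs φ ψ φs = trans (T.expand (hat σ φ) (hat σ ψ))
      (trans (cong₂ _-_ (T.S₂-swap (hat σ φ) (hat σ ψ)) (sumLk-cong {σ} (λ G _ → cong (λ z → z * T.M G) (ℤP.*-comm (hat σ φ G) (hat σ ψ G)))))
             (sym (T.expand (hat σ ψ) (hat σ φ))))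
    where module T = Two φs (balanced φs) (invariant φs) fs

  D-comb : ∀ σ a b φ ψ φs → D σ ((λ G → a * φ G + b * ψ G) ∷ φs) ≡ a * D σ (φ ∷ φs) + b * D σ (ψ ∷ φs)
  D-comb σ a b φ ψ φs = trans (sumLk-cong {σ} (λ G _ → trans (cong (λ z → z * D (G ∷ σ) φs) (hat-comb σ a b φ ψ G))
        (r₁ a b (hat σ φ G) (hat σ ψ G) (D (G ∷ σ) φs))))
      (sumLk-lin σ a b (λ G → hat σ φ G * D (G ∷ σ) φs) (λ G → hat σ ψ G * D (G ∷ σ) φs))
    where
    r₁ : ∀ a b x y e → (a * x + b * y) * e ≡ a * (x * e) + b * (y * e)
    r₁ = solve-∀

  D-cong : ∀ σ {φ ψ} φs → (∀ G → φ G ≡ ψ G) → D σ (φ ∷ φs) ≡ D σ (ψ ∷ φs)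
  D-cong σ φs h = sumLk-cong {σ} (λ G _ → cong (λ z → z * D (G ∷ σ) φs) (hat-cong σ h G))

  D-Van : ∀ {σ} φ φs → Van σ φ → D σ (φ ∷ φs) ≡ sumLk σ (λ G → φ G * D (G ∷ σ) φs)
  D-Van {σ} φ φs van = sumLk-cong {σ} (λ G _ → cong (λ z → z * D (G ∷ σ) φs) (hat-id σ φ van G))

  -- Projective bundles over the degree map

  D-perm : ∀ {σ} → Flag σ → ∀ {xs ys} → xs ↭ ys → D σ xs ≡ D σ ys
  D-perm fs Perm.refl = refl
  D-perm {σ} fs (Perm.prep φ p) = sumLk-cong {σ} (λ G l → *R (hat σ φ G) (D-perm (l ∷ fs) p))
  D-perm {σ} fs (Perm.swap {xs} φ ψ p) = trans (D-swap fs φ ψ xs)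
    (sumLk-cong {σ} (λ G l → *R (hat σ ψ G) (sumLk-cong {G ∷ σ} (λ H l' → *R (hat (G ∷ σ) φ H) (D-perm (l' ∷ (l ∷ fs)) p)))))
  D-perm fs (Perm.trans p q) = trans (D-perm fs p) (D-perm fs q)

  ↭-swap : ∀ (φ ψ : Fun) φs → φ ∷ ψ ∷ φs ↭ ψ ∷ φ ∷ φs
  ↭-swap φ ψ φs = Perm.swap φ ψ Perm.refl

  -- A bundle with `k` roots has fibres of dimension `k - 1`, so a product without `δ` has degree
  -- zero unless `k = 1`. With this start `Hd` evaluates the complete homogeneous polynomial of
  -- degree `j - (k - 1)` in the roots.
  D-nil : Flats → List Fun → List Fun → ℤ
  D-nil σ []      φs = D σ φs
  D-nil σ (_ ∷ _) φs = 0ℤ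

  -- δʲ · φs on the projective bundle with roots Ψ, using δ = ψ + Δ for the first root ψ
  Hd : Flats → List Fun → ℕ → List Fun → ℤ
  Hd σ []      j       φs = 0ℤ
  Hd σ (ψ ∷ Ψ) zero    φs = D-nil σ Ψ φs
  Hd σ (ψ ∷ Ψ) (suc j) φs = Hd σ (ψ ∷ Ψ) j (ψ ∷ φs) + Hd σ Ψ j φs

  Hd-perm : ∀ {σ} → Flag σ → ∀ Ψ j {φs φs'} → φs ↭ φs' → Hd σ Ψ j φs ≡ Hd σ Ψ j φs'
  Hd-perm fs [] j p = refl
  Hd-perm fs (ψ ∷ []) zero p = D-perm fs p
  Hd-perm fs (ψ ∷ _ ∷ _) zero p = refl
  Hd-perm fs (ψ ∷ Ψ) (suc j) p = cong₂ _+_ (Hd-perm fs (ψ ∷ Ψ) j (Perm.prep ψ p)) (Hd-perm fs Ψ j p)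

  Hd-front : ∀ {σ} → Flag σ → ∀ Ψ j φ φs → Hd σ Ψ j (φ ∷ φs) ≡ sumLk σ (λ G → hat σ φ G * Hd (G ∷ σ) Ψ j φs)
  Hd-front {σ} fs [] j φ φs = sym (sumLk-0 {σ} (λ G _ → ℤP.*-zeroʳ (hat σ φ G)))
  Hd-front fs (ψ ∷ []) zero φ φs = refl
  Hd-front {σ} fs (ψ ∷ _ ∷ _) zero φ φs = sym (sumLk-0 {σ} (λ G _ → ℤP.*-zeroʳ (hat σ φ G)))
  Hd-front {σ} fs (ψ ∷ Ψ) (suc j) φ φs =
    trans (cong₂ _+_ (trans (Hd-perm fs (ψ ∷ Ψ) j (↭-swap ψ φ φs)) (Hd-front fs (ψ ∷ Ψ) j φ (ψ ∷ φs))) (Hd-front fs Ψ j φ φs))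
    (trans (sym (sumLk-+ σ (λ G → hat σ φ G * Hd (G ∷ σ) (ψ ∷ Ψ) j (ψ ∷ φs)) (λ G → hat σ φ G * Hd (G ∷ σ) Ψ j φs)))
           (sumLk-cong {σ} (λ G _ → sym (ℤP.*-distribˡ-+ (hat σ φ G) (Hd (G ∷ σ) (ψ ∷ Ψ) j (ψ ∷ φs)) (Hd (G ∷ σ) Ψ j φs)))))

  Hd-Lin : ∀ {σ} → Flag σ → ∀ Ψ j {ℓ} φs → Lin ℓ → Hd σ Ψ j (ℓ ∷ φs) ≡ 0ℤ
  Hd-Lin fs [] j φs p = refl
  Hd-Lin fs (ψ ∷ []) zero φs p = D-Lin fs φs p
  Hd-Lin fs (ψ ∷ _ ∷ _) zero φs p = refl
  Hd-Lin fs (ψ ∷ Ψ) (suc j) {ℓ} φs p =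
    cong₂ _+_ (trans (Hd-perm fs (ψ ∷ Ψ) j (↭-swap ψ ℓ φs)) (Hd-Lin fs (ψ ∷ Ψ) j (ψ ∷ φs) p)) (Hd-Lin fs Ψ j φs p)

  -- The pair `(φ , s)` encodes the class `φ + s δ`.
  Letter : Set
  Letter = Fun × ℤ

  -- The product of letters is multiplied out; `j` counts the factors `δ` and `φs` collects the base
  -- factors chosen so far.
  Dg : Flats → List Fun → List Letter → ℕ → List Fun → ℤ
  Dg σ Ψ []             j φs = Hd σ Ψ j φs
  Dg σ Ψ ((φ , s) ∷ vs) j φs = Dg σ Ψ vs j (φ ∷ φs) + s * Dg σ Ψ vs (suc j) φs

  Deg : Flats → List Fun → List Letter → ℤ
  Deg σ Ψ vs = Dg σ Ψ vs 0 []

  Dg-perm : ∀ {σ} → Flag σ → ∀ Ψ vs j {φs φs'} → φs ↭ φs' → Dg σ Ψ vs j φs ≡ Dg σ Ψ vs j φs'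
  Dg-perm fs Ψ [] j p = Hd-perm fs Ψ j p
  Dg-perm fs Ψ ((φ , s) ∷ vs) j p = cong₂ (λ u v → u + s * v) (Dg-perm fs Ψ vs j (Perm.prep φ p)) (Dg-perm fs Ψ vs (suc j) p)

  Dg-front : ∀ {σ} → Flag σ → ∀ Ψ vs j φ φs → Dg σ Ψ vs j (φ ∷ φs) ≡ sumLk σ (λ G → hat σ φ G * Dg (G ∷ σ) Ψ vs j φs)
  Dg-front fs Ψ [] j φ φs = Hd-front fs Ψ j φ φs
  Dg-front {σ} fs Ψ ((χ , s) ∷ vs) j φ φs =
    trans (cong₂ (λ u v → u + s * v) (trans (Dg-perm fs Ψ vs j (↭-swap χ φ φs)) (Dg-front fs Ψ vs j φ (χ ∷ φs))) (Dg-front fs Ψ vs (suc j) φ φs))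
    (trans (cong (λ u → u + s * sumLk σ (λ G → hat σ φ G * Dg (G ∷ σ) Ψ vs (suc j) φs)) (sym (ℤP.*-identityˡ (sumLk σ (λ G → hat σ φ G * Dg (G ∷ σ) Ψ vs j (χ ∷ φs))))))
    (trans (sym (sumLk-lin σ 1ℤ s (λ G → hat σ φ G * Dg (G ∷ σ) Ψ vs j (χ ∷ φs)) (λ G → hat σ φ G * Dg (G ∷ σ) Ψ vs (suc j) φs)))
           (sumLk-cong {σ} (λ G _ → r₁ (hat σ φ G) (Dg (G ∷ σ) Ψ vs j (χ ∷ φs)) s (Dg (G ∷ σ) Ψ vs (suc j) φs)))))
    where
    r₁ : ∀ h a s b → 1ℤ * (h * a) + s * (h * b) ≡ h * (a + s * b)
    r₁ = solve-∀

  Dg-Lin : ∀ {σ} → Flag σ → ∀ Ψ vs j {ℓ} φs → Lin ℓ → Dg σ Ψ vs j (ℓ ∷ φs) ≡ 0ℤ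
  Dg-Lin fs Ψ [] j φs p = Hd-Lin fs Ψ j φs p
  Dg-Lin fs Ψ ((χ , s) ∷ vs) j {ℓ} φs p =
    trans (cong₂ (λ u v → u + s * v) (trans (Dg-perm fs Ψ vs j (↭-swap χ ℓ φs)) (Dg-Lin fs Ψ vs j (χ ∷ φs) p)) (Dg-Lin fs Ψ vs (suc j) φs p))
          (trans (ℤP.+-identityˡ (s * 0ℤ)) (ℤP.*-zeroʳ s))

  Dg-δ : ∀ {σ} → Flag σ → ∀ ψ Ψ vs j φs → Dg σ (ψ ∷ Ψ) vs (suc j) φs ≡ Dg σ (ψ ∷ Ψ) vs j (ψ ∷ φs) + Dg σ Ψ vs j φs
  Dg-δ fs ψ Ψ [] j φs = refl
  Dg-δ {σ} fs ψ Ψ ((χ , s) ∷ vs) j φs =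
    trans (cong₂ (λ u v → u + s * v) (trans (Dg-δ fs ψ Ψ vs j (χ ∷ φs)) (cong (λ z → z + Dg σ Ψ vs j (χ ∷ φs)) (Dg-perm fs (ψ ∷ Ψ) vs j (↭-swap ψ χ φs)))) (Dg-δ fs ψ Ψ vs (suc j) φs))
          (r₁ (Dg σ (ψ ∷ Ψ) vs j (χ ∷ ψ ∷ φs)) (Dg σ Ψ vs j (χ ∷ φs)) s (Dg σ (ψ ∷ Ψ) vs (suc j) (ψ ∷ φs)) (Dg σ Ψ vs (suc j) φs))
    where
    r₁ : ∀ a b s c d → a + b + s * (c + d) ≡ a + s * c + (b + s * d)
    r₁ = solve-∀

  Dg-comb : ∀ {σ} → Flag σ → ∀ Ψ vs j a b φ ψ φs →
    Dg σ Ψ vs j ((λ G → a * φ G + b * ψ G) ∷ φs) ≡ a * Dg σ Ψ vs j (φ ∷ φs) + b * Dg σ Ψ vs j (ψ ∷ φs)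
  Dg-comb {σ} fs Ψ vs j a b φ ψ φs = trans (Dg-front fs Ψ vs j (λ G → a * φ G + b * ψ G) φs)
    (trans (sumLk-cong {σ} (λ G _ → trans (cong (λ z → z * Dg (G ∷ σ) Ψ vs j φs) (hat-comb σ a b φ ψ G)) (r₁ a b (hat σ φ G) (hat σ ψ G) (Dg (G ∷ σ) Ψ vs j φs))))
    (trans (sumLk-lin σ a b (λ G → hat σ φ G * Dg (G ∷ σ) Ψ vs j φs) (λ G → hat σ ψ G * Dg (G ∷ σ) Ψ vs j φs))
           (sym (cong₂ (λ u v → a * u + b * v) (Dg-front fs Ψ vs j φ φs) (Dg-front fs Ψ vs j ψ φs)))))
    where
    r₁ : ∀ a b x y e → (a * x + b * y) * e ≡ a * (x * e) + b * (y * e)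
    r₁ = solve-∀

  Dg-cong : ∀ {σ} → Flag σ → ∀ Ψ vs j {φ ψ} φs → (∀ G → φ G ≡ ψ G) → Dg σ Ψ vs j (φ ∷ φs) ≡ Dg σ Ψ vs j (ψ ∷ φs)
  Dg-cong {σ} fs Ψ vs j {φ} {ψ} φs h = trans (Dg-front fs Ψ vs j φ φs)
    (trans (sumLk-cong {σ} (λ G _ → cong (λ z → z * Dg (G ∷ σ) Ψ vs j φs) (hat-cong σ h G))) (sym (Dg-front fs Ψ vs j ψ φs)))

  Dg-swap : ∀ {σ} → Flag σ → ∀ Ψ u v vs j φs → Dg σ Ψ (u ∷ v ∷ vs) j φs ≡ Dg σ Ψ (v ∷ u ∷ vs) j φs
  Dg-swap {σ} fs Ψ (φ , s) (ψ , t) vs j φs =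
    trans (cong (λ z → z + t * Dg σ Ψ vs (suc j) (φ ∷ φs) + s * (Dg σ Ψ vs (suc j) (ψ ∷ φs) + t * Dg σ Ψ vs (suc (suc j)) φs)) (Dg-perm fs Ψ vs j (↭-swap ψ φ φs)))
          (r₁ (Dg σ Ψ vs j (φ ∷ ψ ∷ φs)) t (Dg σ Ψ vs (suc j) (φ ∷ φs)) s (Dg σ Ψ vs (suc j) (ψ ∷ φs)) (Dg σ Ψ vs (suc (suc j)) φs))
    where
    r₁ : ∀ a t b s c d → a + t * b + s * (c + t * d) ≡ a + s * c + t * (b + s * d)
    r₁ = solve-∀

  Deg-swap : ∀ {σ} → Flag σ → ∀ Ψ u v vs → Deg σ Ψ (u ∷ v ∷ vs) ≡ Deg σ Ψ (v ∷ u ∷ vs)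
  Deg-swap fs Ψ u v vs = Dg-swap fs Ψ u v vs 0 []

  Deg-swap-at : ∀ {σ} → Flag σ → ∀ Ψ w u v vs → Deg σ Ψ (w ∷ u ∷ v ∷ vs) ≡ Deg σ Ψ (w ∷ v ∷ u ∷ vs)
  Deg-swap-at fs Ψ (φ , s) u v vs = cong₂ (λ a b → a + s * b) (Dg-swap fs Ψ u v vs 0 (φ ∷ [])) (Dg-swap fs Ψ u v vs 1 [])

  comb : ℤ → Letter → ℤ → Letter → Letter
  comb a (φ , s) b (ψ , t) = (λ G → a * φ G + b * ψ G) , a * s + b * t

  Deg-comb : ∀ {σ} → Flag σ → ∀ Ψ a u b v vs → Deg σ Ψ (comb a u b v ∷ vs) ≡ a * Deg σ Ψ (u ∷ vs) + b * Deg σ Ψ (v ∷ vs)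
  Deg-comb {σ} fs Ψ a (φ , s) b (ψ , t) vs = trans (cong (λ z → z + (a * s + b * t) * Dg σ Ψ vs 1 []) (Dg-comb fs Ψ vs 0 a b φ ψ []))
      (r₁ a b s t (Dg σ Ψ vs 0 (φ ∷ [])) (Dg σ Ψ vs 0 (ψ ∷ [])) (Dg σ Ψ vs 1 []))
    where
    r₁ : ∀ a b s t x y e → a * x + b * y + (a * s + b * t) * e ≡ a * (x + s * e) + b * (y + t * e)
    r₁ = solve-∀

  Deg-[] : ∀ σ vs → Deg σ [] vs ≡ 0ℤ
  Deg-[] σ vs = go vs 0 []
    where
    go : ∀ vs j φs → Dg σ [] vs j φs ≡ 0ℤ
    go [] j φs = refl
    go ((φ , s) ∷ vs) j φs = trans (cong₂ (λ u v → u + s * v) (go vs j (φ ∷ φs)) (go vs (suc j) φs)) (trans (ℤP.+-identityˡ (s * 0ℤ)) (ℤP.*-zeroʳ s))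

  -- Write `φ + s δ` as `(φ + s ψ) + s Δ`. The base part, moved by `ℓ` to vanish on the flag, is
  -- supported on the links, and `Δ` is the bundle with the remaining roots.
  Deg-split : ∀ {σ} → Flag σ → ∀ ψ Ψ φ s vs (φ° ℓ : Fun) → (∀ G → φ° G ≡ φ G + s * ψ G + ℓ G) → Lin ℓ → Van σ φ° →
    Deg σ (ψ ∷ Ψ) ((φ , s) ∷ vs) ≡ sumLk σ (λ G → φ° G * Deg (G ∷ σ) (ψ ∷ Ψ) vs) + s * Deg σ Ψ vs
  Deg-split {σ} fs ψ Ψ φ s vs φ° ℓ eq p van =
    trans (cong (λ z → Dg σ (ψ ∷ Ψ) vs 0 (φ ∷ []) + s * z) (Dg-δ fs ψ Ψ vs 0 []))
    (trans (r₁ (X φ) s (X ψ) (Deg σ Ψ vs))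
    (cong (λ z → z + s * Deg σ Ψ vs) (trans (sym (trans (Dg-cong fs (ψ ∷ Ψ) vs 0 [] eq')
        (trans (Dg-comb fs (ψ ∷ Ψ) vs 0 1ℤ s (λ G → 1ℤ * φ G + 1ℤ * ℓ G) ψ [])
        (trans (cong (λ z → 1ℤ * z + s * X ψ) (trans (Dg-comb fs (ψ ∷ Ψ) vs 0 1ℤ 1ℤ φ ℓ []) (cong (λ z → 1ℤ * X φ + 1ℤ * z) (Dg-Lin fs (ψ ∷ Ψ) vs 0 [] p))))
               (r₂ (X φ) s (X ψ))))))
      (trans (Dg-front fs (ψ ∷ Ψ) vs 0 φ° []) (sumLk-cong {σ} (λ G _ → cong (λ z → z * Deg (G ∷ σ) (ψ ∷ Ψ) vs) (hat-id σ φ° van G)))))))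
    where
    X : Fun → ℤ
    X f = Dg σ (ψ ∷ Ψ) vs 0 (f ∷ [])
    r₁ : ∀ a s b e → a + s * (b + e) ≡ a + s * b + s * e
    r₁ = solve-∀
    r₂ : ∀ a s b → 1ℤ * (1ℤ * a + 1ℤ * 0ℤ) + s * b ≡ a + s * b
    r₂ = solve-∀
    r₃ : ∀ a b s c → a + s * c + b ≡ 1ℤ * (1ℤ * a + 1ℤ * b) + s * c
    r₃ = solve-∀
    eq' : ∀ G → φ° G ≡ 1ℤ * (1ℤ * φ G + 1ℤ * ℓ G) + s * ψ G
    eq' G = trans (eq G) (r₃ (φ G) (ℓ G) s (ψ G))

  ind : Subset n → Fun
  ind G H = sel (H ≟S G) 1ℤ

  ind-≡ : ∀ {G H} → H ≡ G → ind G H ≡ 1ℤ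
  ind-≡ {G} {H} e = sel-yes (H ≟S G) e

  ind-≢ : ∀ {G H} → H ≢ G → ind G H ≡ 0ℤ
  ind-≢ {G} {H} e = sel-no (H ≟S G) e

  ind-Van : ∀ {σ G} → Link σ G → Van σ (ind G)
  ind-Van l = ind-≢ (≢⊥ l ∘ sym) , ind-≢ (≢⊤ l ∘ sym) , All.map (λ c → ind-≢ (proj₂ c)) (cmps l)

  -- The indicator of a flat is a boundary divisor of the star, and restricting to it lengthens the
  -- flag.
  Deg-ind : ∀ {σ G} → Flag σ → Link σ G → ∀ Ψ vs → Deg σ Ψ ((ind G , 0ℤ) ∷ vs) ≡ Deg (G ∷ σ) Ψ vs
  Deg-ind {σ} {G} fs l Ψ vs = trans (ℤP.+-identityʳ (Dg σ Ψ vs 0 (ind G ∷ [])))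
    (trans (Dg-front fs Ψ vs 0 (ind G) [])
    (trans (sumLk-point {σ} G l (λ H _ ne → cong (λ z → z * Dg (H ∷ σ) Ψ vs 0 []) (trans (hat-id σ (ind G) (ind-Van l) H) (ind-≢ ne))))
    (trans (cong (λ z → z * Deg (G ∷ σ) Ψ vs) (trans (hat-id σ (ind G) (ind-Van l) G) (ind-≡ refl)))
           (ℤP.*-identityˡ (Deg (G ∷ σ) Ψ vs)))))

  Deg-null : ∀ {σ} → Flag σ → ∀ Ψ φ vs → Van σ φ → (∀ G → Link σ G → φ G ≡ 0ℤ) → Deg σ Ψ ((φ , 0ℤ) ∷ vs) ≡ 0ℤ
  Deg-null {σ} fs Ψ φ vs van h = trans (ℤP.+-identityʳ (Dg σ Ψ vs 0 (φ ∷ [])))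
    (trans (Dg-front fs Ψ vs 0 φ []) (sumLk-0 {σ} (λ H l → cong (λ z → z * Dg (H ∷ σ) Ψ vs 0 []) (trans (hat-id σ φ van H) (h H l)))))

  -- The letter `δ - ψ` is the class of the subbundle `Δ`.
  Deg-Δ : ∀ {σ} → Flag σ → ∀ ψ Ψ vs → Deg σ (ψ ∷ Ψ) (((λ G → - ψ G) , 1ℤ) ∷ vs) ≡ Deg σ Ψ vs
  Deg-Δ {σ} fs ψ Ψ vs = trans (Deg-split fs ψ Ψ (λ G → - ψ G) 1ℤ vs (λ _ → 0ℤ) (λ _ → 0ℤ) (λ G → r₁ (ψ G)) (Lin-const 0ℤ) (refl , refl , All.universal (λ _ → refl) σ))
    (trans (cong (λ z → z + 1ℤ * Deg σ Ψ vs) (sumLk-0 {σ} (λ _ _ → refl))) (r₂ (Deg σ Ψ vs)))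
    where
    r₁ : ∀ a → 0ℤ ≡ - a + 1ℤ * a + 0ℤ
    r₁ = solve-∀
    r₂ : ∀ a → 0ℤ + 1ℤ * a ≡ a
    r₂ = solve-∀

  -- Roots of the bundle

  ρ : Subset n → Fun
  ρ T G = + r (G ─ T)

  infixl 6 _∪₁_
  _∪₁_ : Subset n → Fin n → Subset n
  T ∪₁ e = T ∪ ⁅ e ⁆

  ψ : Subset n → Fin n → Fun
  ψ T e G = ρ T G - ρ (T ∪₁ e) G

  ─∪₁ : ∀ G T e → G ─ (T ∪₁ e) ≡ del (G ─ T) e
  ─∪₁ G T e = sym (p─q─r≡p─q∪r G T ⁅ e ⁆)

  Removable : Subset n → Fin n → Set
  Removable T e = e ∉ T × Spanned (⊤ ─ T) e

  data Valid : Subset n → List (Fin n) → Set where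
    done : ∀ {T} → r (⊤ ─ T) ≡ ∣ ⊤ ─ T ∣ → Valid T []
    _∷_  : ∀ {T e es} → Removable T e → Valid (T ∪₁ e) es → Valid T (e ∷ es)

  roots : Subset n → List (Fin n) → List Fun
  roots T []       = []
  roots T (e ∷ es) = ψ T e ∷ roots (T ∪₁ e) es

  removable-rank : ∀ {T e} → Removable T e → r (⊤ ─ (T ∪₁ e)) ≡ r (⊤ ─ T)
  removable-rank {T} {e} (_ , h) = trans (cong r (─∪₁ ⊤ T e)) h

  ∈⊤─ : ∀ {x : Fin n} {T} → x ∉ T → x ∈ ⊤ ─ T
  ∈⊤─ x∉ = ∈─⁺ ∈⊤ x∉

  valid-length : ∀ {T es} → Valid T es → length es ℕ.+ r (⊤ ─ T) ≡ ∣ ⊤ ─ T ∣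
  valid-length (done e) = e
  valid-length {T} {e ∷ es} (h ∷ v) = trans (cong suc (trans (cong (length es ℕ.+_) (sym (removable-rank h))) (valid-length v)))
    (trans (cong (suc ∘ ∣_∣) (─∪₁ ⊤ T e)) (∣del∣ (∈⊤─ (proj₁ h))))

  same-length : ∀ {T es es'} → Valid T es → Valid T es' → length es ≡ length es'
  same-length {T} v v' = ℕP.+-cancelʳ-≡ (r (⊤ ─ T)) _ _ (trans (valid-length v) (sym (valid-length v')))

  valid-exists : ∀ m T → ∣ ⊤ ─ T ∣ ℕ.≤ m → ∃[ es ] Valid T es
  valid-exists m T le with r (⊤ ─ T) ℕP.≟ ∣ ⊤ ─ T ∣
  valid-exists m T le | yes e = [] , done e
  valid-exists zero T le | no ne = ⊥-elim (ne (trans (ℕP.n≤0⇒n≡0 (ℕP.≤-trans (r≤∣∣ (⊤ ─ T)) le)) (sym (ℕP.n≤0⇒n≡0 le))))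
  valid-exists (suc m) T le | no ne =
    let (C , s , (x , x∈) , h) = circuit ∣ ⊤ ─ T ∣ (⊤ ─ T) ℕP.≤-refl (ℕP.≤∧≢⇒< (r≤∣∣ (⊤ ─ T)) ne)
        rem : Removable T x
        rem = proj₂ (∈─⁻ ⊤ T (s x∈)) , spanned-mono s x∈ (h x∈)
        (es , v) = valid-exists m (T ∪₁ x) (ℕP.≤-pred (ℕP.≤-trans (ℕP.≤-reflexive (trans (cong (suc ∘ ∣_∣) (─∪₁ ⊤ T x)) (∣del∣ (s x∈)))) le))
    in x ∷ es , rem ∷ v

  -- two adjacent roots enter only through their sum and product

  Hd-swap-roots : ∀ {σ} → Flag σ → ∀ a b a' b' Ψ → (∀ G → a G + b G ≡ a' G + b' G) →
    (∀ φs → D σ (a ∷ b ∷ φs) ≡ D σ (a' ∷ b' ∷ φs)) →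
    ∀ j φs → Hd σ (a ∷ b ∷ Ψ) j φs ≡ Hd σ (a' ∷ b' ∷ Ψ) j φs
  Hd-swap-roots {σ} fs a b a' b' Ψ sum prod = λ j φs → proj₁ (both j φs)
    where
    X X' : ℕ → List Fun → ℤ
    X j = Hd σ (a ∷ b ∷ Ψ) j
    X' j = Hd σ (a' ∷ b' ∷ Ψ) j
    -- Applying `δ = c + Δ` and then `δ = d + Δ` gives `δ δ = (c + d) δ - c d` up to a term on `Ψ`;
    -- only the sum and the product of the pair occur.
    rec : ∀ c d j φs → Hd σ (c ∷ d ∷ Ψ) (suc (suc j)) φs
        ≡ Hd σ (c ∷ d ∷ Ψ) (suc j) ((λ G → 1ℤ * c G + 1ℤ * d G) ∷ φs) - Hd σ (c ∷ d ∷ Ψ) j (c ∷ d ∷ φs) + Hd σ Ψ j φs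
    rec c d j φs = trans (r₁ (H (suc j) (c ∷ φs)) (Hd σ (d ∷ Ψ) j (d ∷ φs)) (Hd σ Ψ j φs) (H j (c ∷ d ∷ φs)))
        (cong (λ z → z - H j (c ∷ d ∷ φs) + Hd σ Ψ j φs) (sym (trans (Dg-comb fs (c ∷ d ∷ Ψ) [] (suc j) 1ℤ 1ℤ c d φs) (r₂ (H (suc j) (c ∷ φs)) (H (suc j) (d ∷ φs))))))
      where
      H = Hd σ (c ∷ d ∷ Ψ)
      r₁ : ∀ p q s t → p + (q + s) ≡ p + (t + q) - t + s
      r₁ = solve-∀
      r₂ : ∀ p q → 1ℤ * p + 1ℤ * q ≡ p + q
      r₂ = solve-∀
    prodX : ∀ j φs → Hd σ (a' ∷ b' ∷ Ψ) j (a ∷ b ∷ φs) ≡ Hd σ (a' ∷ b' ∷ Ψ) j (a' ∷ b' ∷ φs)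
    prodX = lift-prod (a' ∷ b' ∷ Ψ)
      where
      lift-prod : ∀ Ψ j φs → Hd σ Ψ j (a ∷ b ∷ φs) ≡ Hd σ Ψ j (a' ∷ b' ∷ φs)
      lift-prod [] j φs = refl
      lift-prod (χ ∷ []) zero φs = prod φs
      lift-prod (χ ∷ _ ∷ _) zero φs = refl
      lift-prod (χ ∷ Ψ) (suc j) φs = cong₂ _+_
        (trans (Hd-perm fs (χ ∷ Ψ) j (rot a b)) (trans (lift-prod (χ ∷ Ψ) j (χ ∷ φs)) (sym (Hd-perm fs (χ ∷ Ψ) j (rot a' b')))))
        (lift-prod Ψ j φs)
        where
        rot : ∀ a b → χ ∷ a ∷ b ∷ φs ↭ a ∷ b ∷ χ ∷ φs
        rot a b = Perm.trans (Perm.swap χ a Perm.refl) (Perm.prep a (Perm.swap χ b Perm.refl))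
    both : ∀ j φs → (X j φs ≡ X' j φs) × (X (suc j) φs ≡ X' (suc j) φs)
    both zero φs = refl , refl
    both (suc j) φs = proj₂ (both j φs) ,
      trans (rec a b j φs) (trans (cong₂ (λ u v → u - v + Hd σ Ψ j φs)
          (trans (proj₂ (both j ((λ G → 1ℤ * a G + 1ℤ * b G) ∷ φs))) (Dg-cong fs (a' ∷ b' ∷ Ψ) [] (suc j) φs (λ G → trans (r₂ (a G) (b G)) (trans (sum G) (sym (r₂ (a' G) (b' G)))))))
          (trans (proj₁ (both j (a ∷ b ∷ φs))) (prodX j φs)))
        (sym (rec a' b' j φs)))
      where
      r₂ : ∀ p q → 1ℤ * p + 1ℤ * q ≡ p + q
      r₂ = solve-∀

  D-null : ∀ {σ} φ φs → Van σ φ → (∀ G → Link σ G → φ G ≡ 0ℤ) → D σ (φ ∷ φs) ≡ 0ℤ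
  D-null {σ} φ φs van h = trans (D-Van φ φs van) (sumLk-0 {σ} (λ G l → cong (λ z → z * D (G ∷ σ) φs) (h G l)))

  D-modLin : ∀ {σ} → Flag σ → ∀ {φ φ'} φs → Lin (λ G → φ' G - φ G) → D σ (φ' ∷ φs) ≡ D σ (φ ∷ φs)
  D-modLin {σ} fs {φ} {φ'} φs p = trans (D-cong σ φs (λ G → r₁ (φ' G) (φ G)))
    (trans (D-comb σ 1ℤ 1ℤ φ (λ G → φ' G - φ G) φs)
    (trans (cong (λ z → 1ℤ * D σ (φ ∷ φs) + 1ℤ * z) (D-Lin fs φs p)) (r₂ (D σ (φ ∷ φs)))))
    where
    r₁ : ∀ a b → a ≡ 1ℤ * b + 1ℤ * (a - b)
    r₁ = solve-∀
    r₂ : ∀ a → 1ℤ * a + 1ℤ * 0ℤ ≡ a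
    r₂ = solve-∀

  Hd-modLin : ∀ {σ} → Flag σ → ∀ Ψ j {φ φ'} φs → Lin (λ G → φ' G - φ G) → Hd σ Ψ j (φ' ∷ φs) ≡ Hd σ Ψ j (φ ∷ φs)
  Hd-modLin {σ} fs Ψ j {φ} {φ'} φs p = trans (Dg-cong fs Ψ [] j φs (λ G → r₁ (φ' G) (φ G)))
    (trans (Dg-comb fs Ψ [] j 1ℤ 1ℤ φ (λ G → φ' G - φ G) φs)
    (trans (cong (λ z → 1ℤ * Hd σ Ψ j (φ ∷ φs) + 1ℤ * z) (Hd-Lin fs Ψ j φs p)) (r₂ (Hd σ Ψ j (φ ∷ φs)))))
    where
    r₁ : ∀ a b → a ≡ 1ℤ * b + 1ℤ * (a - b)
    r₁ = solve-∀
    r₂ : ∀ a → 1ℤ * a + 1ℤ * 0ℤ ≡ a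
    r₂ = solve-∀

  mem-─ : ∀ {e : Fin n} H T → e ∉ T → mem e (H ─ T) ≡ mem e H
  mem-─ {e} H T e∉ with e ∈? H
  ... | yes p = trans (mem-∈ (∈─⁺ p e∉)) (sym (mem-∈ p))
  ... | no ¬p = trans (mem-∉ (λ q → ¬p (proj₁ (∈─⁻ H T q)))) (sym (mem-∉ ¬p))

  Lin-memDiff : ∀ e e' → Lin (λ H → mem e' H - mem e H)
  Lin-memDiff e e' = Lin-- (Lin-mem e') (Lin-mem e)

  module Exchange (T : Subset n) (e e' : Fin n) (e≢e' : e ≢ e') where
    -- `θ` compares the two first deletions and `η` is the mixed second difference of the rank. They
    -- satisfy `ψ T e = ψ T e' - θ` and `ψ T e' - ψ (T ∪₁ e) e' = η`.
    θ η : Fun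
    θ G = ρ (T ∪₁ e) G - ρ (T ∪₁ e') G
    η G = ρ T G + ρ (T ∪₁ e ∪₁ e') G - ρ (T ∪₁ e) G - ρ (T ∪₁ e') G

    ρ-del : ∀ G x → ρ (T ∪₁ x) G ≡ + r (del (G ─ T) x)
    ρ-del G x = cong (+_ ∘ r) (─∪₁ G T x)

    ρ-del₂ : ∀ G → ρ (T ∪₁ e ∪₁ e') G ≡ + r (del (del (G ─ T) e) e')
    ρ-del₂ G = cong (+_ ∘ r) (trans (─∪₁ G (T ∪₁ e) e') (cong (λ A → del A e') (─∪₁ G T e)))

    -- If one of the elements is a coloop of `F ─ T`, or if deleting both keeps the rank, the four
    -- ranks cancel. A series pair is the only case left.
    η-series : ∀ F → η F ≢ 0ℤ → Series (F ─ T) e e'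
    η-series F η≢0 = go (r (del A e) ℕP.≟ r A) (r (del A e') ℕP.≟ r A) (r (del (del A e) e') ℕP.≟ r (del A e))
      where
      A = F ─ T
      val : ∀ {a b c d} → r A ≡ a → r (del (del A e) e') ≡ b → r (del A e) ≡ c → r (del A e') ≡ d → η F ≡ + a + + b - + c - + d
      val refl refl refl refl = cong₂ (λ u v → + r A + u - v - ρ (T ∪₁ e') F) (ρ-del₂ F) (ρ-del F e) ▸ cong (λ v → + r A + + r (del (del A e) e') - + r (del A e) - v) (ρ-del F e')
        where
        _▸_ : ∀ {x y z : ℤ} → x ≡ y → y ≡ z → x ≡ z
        _▸_ = trans
      r₁ : ∀ x y → 1ℤ + x + y - x - (1ℤ + y) ≡ 0ℤ
      r₁ = solve-∀
      r₂ : ∀ x y → 1ℤ + x + y - (1ℤ + y) - x ≡ 0ℤ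
      r₂ = solve-∀
      r₃ : ∀ x → x + x - x - x ≡ 0ℤ
      r₃ = solve-∀
      go : Dec (Spanned A e) → Dec (Spanned A e') → Dec (Spanned (del A e) e') → Series A e e'
      go (no ¬s) _ _ = ⊥-elim (η≢0 (trans (val (not-spanned ¬s) refl refl
          (trans (not-spanned-sub (del-⊆ e') (∈del (not-spanned-∈ ¬s) e≢e') ¬s) (cong (suc ∘ r) (del-comm A e' e)))) (r₁ (+ r (del A e)) (+ r (del (del A e) e')))))
      go (yes _) (no ¬s') _ = ⊥-elim (η≢0 (trans (val (not-spanned ¬s') refl
          (not-spanned-sub (del-⊆ e) (∈del (not-spanned-∈ ¬s') (e≢e' ∘ sym)) ¬s') refl) (r₂ (+ r (del A e')) (+ r (del (del A e) e')))))
      go (yes s) (yes s') (yes s'') = ⊥-elim (η≢0 (trans (val refl (trans s'' s) s s') (r₃ (+ r A))))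
      go (yes s) (yes s') (no ¬s) = (e∈ , del-⊆ e (not-spanned-∈ ¬s)) , e≢e' , s , s' , ¬s
        where
        e∈ : e ∈ A
        e∈ with e ∈? A
        ... | yes p = p
        ... | no e∉ = ⊥-elim (¬s (subst (λ B → Spanned B e') (sym (del-∉ e∉)) s'))

    -- Below `F` this is the rank formula for a series pair; above `F` both elements stay spanned
    -- and both sides are zero.
    θ-linear : ∀ {F} → Series (F ─ T) e e' → ∀ H → H ⊆ F ⊎ F ⊆ H → θ H ≡ mem e' H - mem e H
    θ-linear {F} ser@((e∈ , e'∈) , _ , s , s' , _) H c = trans (cong₂ _-_ (ρ-del H e) (ρ-del H e')) (go c)
      where
      go : H ⊆ F ⊎ F ⊆ H → + r (del (H ─ T) e) - + r (del (H ─ T) e') ≡ mem e' H - mem e H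
      go (inj₁ H⊆F) = trans (series-rank ser (─-monoˡ T H⊆F))
        (cong₂ _-_ (mem-─ H T (proj₂ (∈─⁻ F T e'∈))) (mem-─ H T (proj₂ (∈─⁻ F T e∈))))
      go (inj₂ F⊆H) = trans (cong₂ (λ u v → + u - + v) (spanned-mono (─-monoˡ T F⊆H) e∈ s) (spanned-mono (─-monoˡ T F⊆H) e'∈ s'))
        (trans (ℤP.+-inverseʳ (+ r (H ─ T))) (sym (cong₂ _-_ (mem-∈ (F⊆H (proj₁ (∈─⁻ F T e'∈)))) (mem-∈ (F⊆H (proj₁ (∈─⁻ F T e∈)))))))

    D-θ : ∀ {σ F} → Flag σ → F ∈ₗ σ → Series (F ─ T) e e' → ∀ φs → D σ (θ ∷ φs) ≡ 0ℤ
    D-θ {σ} {F} fs F∈ ser φs = trans (D-modLin fs {φ = θ'} φs (Lin-cong (λ G → r₁ (θ G) (mem e' G - mem e G)) (Lin-memDiff e e')))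
        (D-null θ' φs (zero-at ⊥ (inj₁ ⊥⊆) , zero-at ⊤ (inj₂ ⊆⊤) , All.tabulate (λ {H} p → zero-at H (flag-cmp fs p F∈)))
                      (λ G l → zero-at G (proj₁ (cmp-sym (All.lookup (cmps l) F∈)))))
      where
      θ' : Fun
      θ' G = θ G - (mem e' G - mem e G)
      r₁ : ∀ a b → b ≡ a - (a - b)
      r₁ = solve-∀
      zero-at : ∀ H → H ⊆ F ⊎ F ⊆ H → θ' H ≡ 0ℤ
      zero-at H c = ℤP.i≡j⇒i-j≡0 (θ-linear ser H c)

    -- `η` is supported on flats on whose stars `θ` is linear, so `θ` restricts to zero there. If
    -- `η` is already nonzero on a member of the flag, `θ` is zero on the whole star.
    D-θη : η ⊤ ≡ 0ℤ → ∀ {σ} → Flag σ → ∀ φs → D σ (θ ∷ η ∷ φs) ≡ 0ℤ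
    D-θη η⊤ {σ} fs φs = go (All.all? (λ F → η F ℤP.≟ 0ℤ) σ)
      where
      ⊥─ : ∀ U → ρ U ⊥ ≡ 0ℤ
      ⊥─ U = cong +_ (ℕP.n≤0⇒n≡0 (ℕP.≤-trans (r-mono (p─q⊆p ⊥ U)) (ℕP.≤-reflexive r-⊥)))
      η⊥ : η ⊥ ≡ 0ℤ
      η⊥ = cong₂ _-_ (cong₂ _-_ (cong₂ _+_ (⊥─ T) (⊥─ (T ∪₁ e ∪₁ e'))) (⊥─ (T ∪₁ e))) (⊥─ (T ∪₁ e'))
      term : ∀ G → Link σ G → Dec (η G ≡ 0ℤ) → η G * D (G ∷ σ) (θ ∷ φs) ≡ 0ℤ
      term G l (yes p) = cong (λ z → z * D (G ∷ σ) (θ ∷ φs)) p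
      term G l (no ¬p) = trans (*R (η G) (D-θ (l ∷ fs) (here refl) (η-series G ¬p) φs)) (ℤP.*-zeroʳ (η G))
      find : ∀ {σ} → ¬ All (λ F → η F ≡ 0ℤ) σ → ∃[ F ] (F ∈ₗ σ × η F ≢ 0ℤ)
      find {[]} h = ⊥-elim (h [])
      find {F ∷ σ} h with η F ℤP.≟ 0ℤ
      ... | no ne = F , here refl , ne
      ... | yes e₀ = let (F' , p , ne) = find {σ} (λ a → h (e₀ ∷ a)) in F' , there p , ne
      go : Dec (All (λ F → η F ≡ 0ℤ) σ) → D σ (θ ∷ η ∷ φs) ≡ 0ℤ
      go (yes all) = trans (D-swap fs θ η φs) (trans (D-Van η (θ ∷ φs) (η⊥ , η⊤ , all)) (sumLk-0 {σ} (λ G l → term G l (η G ℤP.≟ 0ℤ))))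
      go (no ¬all) = let (F , F∈ , ne) = find ¬all in D-θ fs F∈ (η-series F ne) (η ∷ φs)

    ∪-exch : T ∪₁ e ∪₁ e' ≡ T ∪₁ e' ∪₁ e
    ∪-exch = ⊆-antisym (∪-⊆ (∪-⊆ (∈∪ˡ ∘ ∈∪ˡ) ∈∪ʳ) (∈∪ˡ ∘ ∈∪ʳ)) (∪-⊆ (∪-⊆ (∈∪ˡ ∘ ∈∪ˡ) ∈∪ʳ) (∈∪ˡ ∘ ∈∪ʳ))

    roots-sum : ∀ G → ψ T e G + ψ (T ∪₁ e) e' G ≡ ψ T e' G + ψ (T ∪₁ e') e G
    roots-sum G = trans (r₁ (ρ T G) (ρ (T ∪₁ e) G) (ρ (T ∪₁ e ∪₁ e') G))
      (trans (cong (λ U → ρ T G - ρ U G) ∪-exch) (sym (r₁ (ρ T G) (ρ (T ∪₁ e') G) (ρ (T ∪₁ e' ∪₁ e) G))))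
      where
      r₁ : ∀ a b c → a - b + (b - c) ≡ a - c
      r₁ = solve-∀

    -- The two products differ by `θ η`.
    roots-prod : η ⊤ ≡ 0ℤ → ∀ {σ} → Flag σ → ∀ φs → D σ (ψ T e ∷ ψ (T ∪₁ e) e' ∷ φs) ≡ D σ (ψ T e' ∷ ψ (T ∪₁ e') e ∷ φs)
    roots-prod η⊤ {σ} fs φs = begin
      D σ (x ∷ y ∷ φs)
        ≡⟨ D-cong σ (y ∷ φs) (λ G → r₁ (ρ T G) (ρ (T ∪₁ e) G) (ρ (T ∪₁ e') G)) ⟩
      D σ ((λ G → 1ℤ * x' G + -1ℤ * θ G) ∷ y ∷ φs)
        ≡⟨ D-comb σ 1ℤ -1ℤ x' θ (y ∷ φs) ⟩
      1ℤ * D σ (x' ∷ y ∷ φs) + -1ℤ * D σ (θ ∷ y ∷ φs)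
        ≡⟨ cong (λ z → 1ℤ * z + -1ℤ * D σ (θ ∷ y ∷ φs)) (trans (D-swap fs x' y φs) (trans (D-cong σ (x' ∷ φs) y≗)
             (trans (D-comb σ 1ℤ 1ℤ y' θ (x' ∷ φs)) (cong (λ z → 1ℤ * z + 1ℤ * D σ (θ ∷ x' ∷ φs)) (D-swap fs y' x' φs))))) ⟩
      1ℤ * (1ℤ * D σ (x' ∷ y' ∷ φs) + 1ℤ * D σ (θ ∷ x' ∷ φs)) + -1ℤ * D σ (θ ∷ y ∷ φs)
        ≡⟨ r₃ (D σ (x' ∷ y' ∷ φs)) (D σ (θ ∷ x' ∷ φs)) (D σ (θ ∷ y ∷ φs)) ⟩
      D σ (x' ∷ y' ∷ φs) + (1ℤ * D σ (θ ∷ x' ∷ φs) + -1ℤ * D σ (θ ∷ y ∷ φs))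
        ≡⟨ +R (D σ (x' ∷ y' ∷ φs)) (trans (sym (second-slot x' y)) (trans (slot-cong η≗) (D-θη η⊤ fs φs))) ⟩
      D σ (x' ∷ y' ∷ φs) + 0ℤ
        ≡⟨ ℤP.+-identityʳ _ ⟩
      D σ (x' ∷ y' ∷ φs) ∎
      where
      open ≡-Reasoning
      x = ψ T e
      y = ψ (T ∪₁ e) e'
      x' = ψ T e'
      y' = ψ (T ∪₁ e') e
      r₁ : ∀ a b c → a - b ≡ 1ℤ * (a - c) + -1ℤ * (b - c)
      r₁ = solve-∀
      r₂ : ∀ b c d → b - d ≡ 1ℤ * (c - d) + 1ℤ * (b - c)
      r₂ = solve-∀
      r₃ : ∀ p q s → 1ℤ * (1ℤ * p + 1ℤ * q) + -1ℤ * s ≡ p + (1ℤ * q + -1ℤ * s)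
      r₃ = solve-∀
      r₄ : ∀ a b c d → 1ℤ * (a - c) + -1ℤ * (b - d) ≡ a + d - b - c
      r₄ = solve-∀
      y≗ : ∀ G → y G ≡ 1ℤ * y' G + 1ℤ * θ G
      y≗ G = trans (r₂ (ρ (T ∪₁ e) G) (ρ (T ∪₁ e') G) (ρ (T ∪₁ e ∪₁ e') G)) (cong (λ U → 1ℤ * (ρ (T ∪₁ e') G - ρ U G) + 1ℤ * θ G) ∪-exch)
      η≗ : ∀ G → 1ℤ * x' G + -1ℤ * y G ≡ η G
      η≗ G = r₄ (ρ T G) (ρ (T ∪₁ e) G) (ρ (T ∪₁ e') G) (ρ (T ∪₁ e ∪₁ e') G)
      slot-cong : ∀ {f g : Fun} → (∀ G → f G ≡ g G) → D σ (θ ∷ f ∷ φs) ≡ D σ (θ ∷ g ∷ φs)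
      slot-cong {f} {g} h = trans (D-swap fs θ f φs) (trans (D-cong σ (θ ∷ φs) h) (D-swap fs g θ φs))
      second-slot : ∀ f g → D σ (θ ∷ (λ G → 1ℤ * f G + -1ℤ * g G) ∷ φs) ≡ 1ℤ * D σ (θ ∷ f ∷ φs) + -1ℤ * D σ (θ ∷ g ∷ φs)
      second-slot f g = trans (D-swap fs θ (λ G → 1ℤ * f G + -1ℤ * g G) φs) (trans (D-comb σ 1ℤ -1ℤ f g (θ ∷ φs))
        (cong₂ (λ u v → 1ℤ * u + -1ℤ * v) (D-swap fs f θ φs) (D-swap fs g θ φs)))

  record Eqv (σ : Flats) (Ψ Ψ' : List Fun) : Set where
    constructor mkEqv
    field
      len : length Ψ ≡ length Ψ'
      val : ∀ j φs → Hd σ Ψ j φs ≡ Hd σ Ψ' j φs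

  eqv-refl : ∀ {σ Ψ} → Eqv σ Ψ Ψ
  eqv-refl = mkEqv refl (λ _ _ → refl)

  eqv-trans : ∀ {σ Ψ Ψ' Ψ''} → Eqv σ Ψ Ψ' → Eqv σ Ψ' Ψ'' → Eqv σ Ψ Ψ''
  eqv-trans (mkEqv l v) (mkEqv l' v') = mkEqv (trans l l') (λ j φs → trans (v j φs) (v' j φs))

  eqv-tail : ∀ {σ Ψ Ψ'} χ → Eqv σ Ψ Ψ' → Eqv σ (χ ∷ Ψ) (χ ∷ Ψ')
  eqv-tail {σ} {Ψ} {Ψ'} χ (mkEqv l v) = mkEqv (cong suc l) go
    where
    nil : ∀ {Ψ Ψ' : List Fun} φs → length Ψ ≡ length Ψ' → D-nil σ Ψ φs ≡ D-nil σ Ψ' φs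
    nil {[]} {[]} φs _ = refl
    nil {_ ∷ _} {_ ∷ _} φs _ = refl
    go : ∀ j φs → Hd σ (χ ∷ Ψ) j φs ≡ Hd σ (χ ∷ Ψ') j φs
    go zero φs = nil {Ψ} {Ψ'} φs l
    go (suc j) φs = cong₂ _+_ (go j (χ ∷ φs)) (v j φs)

  eqv-head : ∀ {σ} → Flag σ → ∀ {χ χ'} Ψ → Lin (λ G → χ G - χ' G) → Eqv σ (χ ∷ Ψ) (χ' ∷ Ψ)
  eqv-head {σ} fs {χ} {χ'} Ψ p = mkEqv refl go
    where
    go : ∀ j φs → Hd σ (χ ∷ Ψ) j φs ≡ Hd σ (χ' ∷ Ψ) j φs
    go zero φs = refl
    go (suc j) φs = cong (λ z → z + Hd σ Ψ j φs) (trans (go j (χ ∷ φs)) (Hd-modLin fs (χ' ∷ Ψ) j φs p))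

  module InSeries (T : Subset n) (e e' : Fin n) (ser : Series (⊤ ─ T) e e') where
    private
      e≢e' = proj₁ (proj₂ ser)
      e∉T : e ∉ T
      e∉T = proj₂ (∈─⁻ ⊤ T (proj₁ (proj₁ ser)))
      e'∉T : e' ∉ T
      e'∉T = proj₂ (∈─⁻ ⊤ T (proj₂ (proj₁ ser)))

    U U' : Subset n → Subset n
    U Y = (T ∪₁ e) ∪ Y
    U' Y = (T ∪₁ e') ∪ Y

    ─U : ∀ H Y x → H ─ ((T ∪₁ x) ∪ Y) ≡ del ((H ─ T) ─ Y) x
    ─U H Y x = trans (sym (p─q─r≡p─q∪r H (T ∪₁ x) Y)) (trans (cong (_─ Y) (─∪₁ H T x)) (p─q─r≡p─r─q (H ─ T) ⁅ x ⁆ Y))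

    -- Whichever of `e`, `e'` is deleted, the other becomes a coloop, so the two rank functions
    -- differ by a linear function that does not depend on `Y`.
    key : ∀ Y → e ∉ Y → e' ∉ Y → ∀ H → ρ (U Y) H - ρ (U' Y) H ≡ mem e' H - mem e H
    key Y e∉Y e'∉Y H = trans (cong₂ (λ A B → + r A - + r B) (─U H Y e) (─U H Y e'))
      (trans (series-rank ser {(H ─ T) ─ Y} (λ x∈ → ─-monoˡ T ⊆⊤ (p─q⊆p (H ─ T) Y x∈)))
             (cong₂ _-_ (trans (mem-─ (H ─ T) Y e'∉Y) (mem-─ H T e'∉T)) (trans (mem-─ (H ─ T) Y e∉Y) (mem-─ H T e∉T))))

    key-⊤ : ∀ Y → e ∉ Y → e' ∉ Y → r (⊤ ─ U Y) ≡ r (⊤ ─ U' Y)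
    key-⊤ Y a b = ℤP.+-injective (ℤP.i-j≡0⇒i≡j _ _ (trans (key Y a b ⊤) (memDiff-⊤ e' e)))

    ∉-∪₁ : ∀ {x y Y} → y ∉ Y → y ≢ x → y ∉ Y ∪₁ x
    ∉-∪₁ {x} {y} {Y} y∉ ne y∈ = [ y∉ , (λ p → ne (x∈⁅y⁆⇒x≡y x p)) ]′ (x∈p∪q⁻ Y ⁅ x ⁆ y∈)

    -- `Y` collects the deletions made after `e`, respectively `e'`. The differences given by `key`
    -- for `Y` and `Y ∪₁ x` are the same, hence corresponding roots are equal as functions.
    transfer : ∀ s Y → e ∉ Y → e' ∉ Y → Valid (U Y) s →
      Valid (U' Y) s × (∀ {σ} → Flag σ → Eqv σ (roots (U Y) s) (roots (U' Y) s))
    transfer [] Y e∉Y e'∉Y (done eq) = done (trans (sym (key-⊤ Y e∉Y e'∉Y)) (trans eq cards)) , (λ _ → eqv-refl)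
      where
      B = (⊤ ─ T) ─ Y
      cards : ∣ ⊤ ─ U Y ∣ ≡ ∣ ⊤ ─ U' Y ∣
      cards = ℕP.suc-injective (trans (cong (suc ∘ ∣_∣) (─U ⊤ Y e)) (trans (∣del∣ {B} (∈─⁺ (∈⊤─ e∉T) e∉Y))
                (sym (trans (cong (suc ∘ ∣_∣) (─U ⊤ Y e')) (∣del∣ {B} (∈─⁺ (∈⊤─ e'∉T) e'∉Y))))))
    transfer (x ∷ s) Y e∉Y e'∉Y ((x∉ , sp) ∷ v) =
        ((x∉' , sp') ∷ subst (λ Z → Valid Z s) (sym assoc') (proj₁ ih)) ,
        (λ {σ} fs → eqv-trans (eqv-tail (ψ (U Y) x) (subst₂ (λ Z Z' → Eqv σ (roots Z s) (roots Z' s)) (sym assoc₁) (sym assoc') (proj₂ ih fs)))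
           (eqv-head fs (roots (U' Y ∪₁ x) s) (Lin-cong (λ G → sym (same G)) (Lin-const 0ℤ))))
      where
      assoc₁ : U Y ∪₁ x ≡ U (Y ∪₁ x)
      assoc₁ = ∪-assoc (T ∪₁ e) Y ⁅ x ⁆
      assoc' : U' Y ∪₁ x ≡ U' (Y ∪₁ x)
      assoc' = ∪-assoc (T ∪₁ e') Y ⁅ x ⁆
      x≢e : x ≢ e
      x≢e refl = x∉ (∈∪ˡ (∈∪ʳ (x∈⁅x⁆ x)))
      -- Once `e` is gone, `e'` is a coloop and stays one, so it is never removable later.
      x≢e' : x ≢ e'
      x≢e' refl = proj₂ (proj₂ (proj₂ (proj₂ ser))) (spanned-mono
        (λ {y} y∈ → ∈del (∈⊤─ (λ y∈T → proj₂ (∈─⁻ ⊤ (U Y) y∈) (∈∪ˡ (∈∪ˡ y∈T)))) (λ { refl → proj₂ (∈─⁻ ⊤ (U Y) y∈) (∈∪ˡ (∈∪ʳ (x∈⁅x⁆ y))) }))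
        (∈⊤─ x∉) sp)
      x∉' : x ∉ U' Y
      x∉' p = [ (λ q → [ (λ z → x∉ (∈∪ˡ (∈∪ˡ z))) , (λ z → x≢e' (x∈⁅y⁆⇒x≡y e' z)) ]′ (x∈p∪q⁻ T ⁅ e' ⁆ q)) , (λ q → x∉ (∈∪ʳ q)) ]′ (x∈p∪q⁻ (T ∪₁ e') Y p)
      e∉ = ∉-∪₁ e∉Y (x≢e ∘ sym)
      e'∉ = ∉-∪₁ e'∉Y (x≢e' ∘ sym)
      sp' : Spanned (⊤ ─ U' Y) x
      sp' = trans (cong r (trans (sym (─∪₁ ⊤ (U' Y) x)) (cong (⊤ ─_) assoc'))) (trans (sym (key-⊤ (Y ∪₁ x) e∉ e'∉))
              (trans (cong r (trans (cong (⊤ ─_) (sym assoc₁)) (─∪₁ ⊤ (U Y) x))) (trans sp (key-⊤ Y e∉Y e'∉Y))))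
      ih = transfer s (Y ∪₁ x) e∉ e'∉ (subst (λ Z → Valid Z s) assoc₁ v)
      r₁ : ∀ a b c d → a - b - (c - d) ≡ (a - c) - (b - d)
      r₁ = solve-∀
      same : ∀ G → ψ (U Y) x G - ψ (U' Y) x G ≡ 0ℤ
      same G = trans (r₁ (ρ (U Y) G) (ρ (U Y ∪₁ x) G) (ρ (U' Y) G) (ρ (U' Y ∪₁ x) G))
        (ℤP.i≡j⇒i-j≡0 (trans (key Y e∉Y e'∉Y G) (sym (trans (cong₂ (λ Z Z' → ρ Z G - ρ Z' G) assoc₁ assoc') (key (Y ∪₁ x) e∉ e'∉ G)))))

    series-eqv : ∀ s → Valid (T ∪₁ e) s → Valid (T ∪₁ e') s × (∀ {σ} → Flag σ → Eqv σ (ψ T e ∷ roots (T ∪₁ e) s) (ψ T e' ∷ roots (T ∪₁ e') s))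
    series-eqv s v =
      let (v' , eq) = transfer s ⊥ ∉⊥ ∉⊥ (subst (λ Z → Valid Z s) (sym (∪-identityʳ (T ∪₁ e))) v) in
      subst (λ Z → Valid Z s) (∪-identityʳ (T ∪₁ e')) v' ,
      (λ {σ} fs → eqv-trans (eqv-tail (ψ T e) (subst₂ (λ Z Z' → Eqv σ (roots Z s) (roots Z' s)) (∪-identityʳ (T ∪₁ e)) (∪-identityʳ (T ∪₁ e')) (eq fs)))
        (eqv-head fs (roots (T ∪₁ e') s) (Lin-cong lin-eq (Lin-* -1ℤ (Lin-memDiff e e')))))
      where
      r₁ : ∀ a b c → -1ℤ * (b - c) ≡ a - b - (a - c)
      r₁ = solve-∀
      lin-eq : ∀ G → -1ℤ * (mem e' G - mem e G) ≡ ψ T e G - ψ T e' G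
      lin-eq G = trans (*R -1ℤ (trans (sym (key ⊥ ∉⊥ ∉⊥ G)) (cong₂ (λ Z Z' → ρ Z G - ρ Z' G) (∪-identityʳ (T ∪₁ e)) (∪-identityʳ (T ∪₁ e')))))
                       (r₁ (ρ T G) (ρ (T ∪₁ e) G) (ρ (T ∪₁ e') G))

  -- If `e'` is still removable after `e`, both orders are compared with orders that begin with the
  -- pair, and an adjacent exchange joins these. Otherwise `e` and `e'` are in series and can be
  -- substituted for each other.
  order-free : ∀ k {T es es'} → length es ≡ k → Valid T es → Valid T es' → ∀ {σ} → Flag σ → Eqv σ (roots T es) (roots T es')
  order-free k {es = []} {[]} len v v' fs = eqv-refl
  order-free k {es = []} {_ ∷ _} len v v' fs = ⊥-elim (ℕP.0≢1+n (same-length v v'))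
  order-free k {es = _ ∷ _} {[]} len v v' fs = ⊥-elim (ℕP.0≢1+n (same-length v' v))
  order-free (suc k) {T} {e ∷ s} {e' ∷ s'} len (h ∷ v) (h' ∷ v') {σ} fs with e FinP.≟ e'
  ... | yes refl = eqv-tail (ψ T e) (order-free k (ℕP.suc-injective len) v v' fs)
  ... | no e≢e' = split (r (del (del A e) e') ℕP.≟ r (del A e))
    where
    A = ⊤ ─ T
    e∈ : e ∈ A
    e∈ = ∈⊤─ (proj₁ h)
    e'∈ : e' ∈ A
    e'∈ = ∈⊤─ (proj₁ h')
    open Exchange T e e' e≢e'
    ∉-∪₁ : ∀ {x y} → y ∉ T → y ≢ x → y ∉ T ∪₁ x
    ∉-∪₁ {x} {y} y∉ ne y∈ = [ y∉ , (λ p → ne (x∈⁅y⁆⇒x≡y x p)) ]′ (x∈p∪q⁻ T ⁅ x ⁆ y∈)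
    split : Dec (Spanned (del A e) e') → Eqv σ (roots T (e ∷ s)) (roots T (e' ∷ s'))
    split (yes sp) =
      eqv-trans (eqv-tail (ψ T e) (order-free k (ℕP.suc-injective len) v (rem' ∷ vt) fs))
      (eqv-trans (mkEqv refl (Hd-swap-roots fs (ψ T e) (ψ (T ∪₁ e) e') (ψ T e') (ψ (T ∪₁ e') e) (roots (T ∪₁ e ∪₁ e') t) roots-sum (roots-prod η⊤ fs)))
      (eqv-trans (subst (λ Z → Eqv σ (ψ T e' ∷ ψ (T ∪₁ e') e ∷ roots (T ∪₁ e ∪₁ e') t) (ψ T e' ∷ ψ (T ∪₁ e') e ∷ roots Z t)) ∪-exch eqv-refl)
      (eqv-tail (ψ T e') (order-free k len' (rem'' ∷ vt') v' fs))))
      where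
      t = proj₁ (valid-exists ∣ ⊤ ─ (T ∪₁ e ∪₁ e') ∣ (T ∪₁ e ∪₁ e') ℕP.≤-refl)
      vt : Valid (T ∪₁ e ∪₁ e') t
      vt = proj₂ (valid-exists ∣ ⊤ ─ (T ∪₁ e ∪₁ e') ∣ (T ∪₁ e ∪₁ e') ℕP.≤-refl)
      vt' : Valid (T ∪₁ e' ∪₁ e) t
      vt' = subst (λ Z → Valid Z t) ∪-exch vt
      rem' : Removable (T ∪₁ e) e'
      rem' = ∉-∪₁ (proj₁ h') (e≢e' ∘ sym) , subst (λ B → Spanned B e') (sym (─∪₁ ⊤ T e)) sp
      sp'' : Spanned (del A e') e
      sp'' = trans (cong r (del-comm A e' e)) (trans sp (trans (proj₂ h) (sym (proj₂ h'))))
      rem'' : Removable (T ∪₁ e') e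
      rem'' = ∉-∪₁ (proj₁ h) e≢e' , subst (λ B → Spanned B e) (sym (─∪₁ ⊤ T e')) sp''
      len' : suc (length t) ≡ k
      len' = trans (sym (same-length v (rem' ∷ vt))) (ℕP.suc-injective len)
      r₃ : ∀ x → x + x - x - x ≡ 0ℤ
      r₃ = solve-∀
      η⊤ : η ⊤ ≡ 0ℤ
      η⊤ = trans (cong₂ (λ u v → + r A + u - v - ρ (T ∪₁ e') ⊤) (trans (ρ-del₂ ⊤) (cong +_ (trans sp (proj₂ h)))) (trans (ρ-del ⊤ e) (cong +_ (proj₂ h))))
             (trans (cong (λ z → + r A + + r A - + r A - z) (trans (ρ-del ⊤ e') (cong +_ (proj₂ h')))) (r₃ (+ r A)))
    split (no ¬sp) = eqv-trans (proj₂ se fs) (eqv-tail (ψ T e') (order-free k len' (proj₁ se) v' fs))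
      where
      se = InSeries.series-eqv T e e' ((e∈ , e'∈) , e≢e' , proj₂ h , proj₂ h' , ¬sp) s v
      len' : length s ≡ k
      len' = ℕP.suc-injective len

  Deg-eqv : ∀ {σ Ψ Ψ'} → Eqv σ Ψ Ψ' → ∀ vs → Deg σ Ψ vs ≡ Deg σ Ψ' vs
  Deg-eqv {σ} {Ψ} {Ψ'} (mkEqv _ val) vs = go vs 0 []
    where
    go : ∀ vs j φs → Dg σ Ψ vs j φs ≡ Dg σ Ψ' vs j φs
    go [] j φs = val j φs
    go ((φ , s) ∷ vs) j φs = cong₂ (λ u v → u + s * v) (go vs j (φ ∷ φs)) (go vs (suc j) φs)

  Deg-order-free : ∀ {T es es'} → Valid T es → Valid T es' → ∀ {σ} → Flag σ → ∀ vs → Deg σ (roots T es) vs ≡ Deg σ (roots T es') vs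
  Deg-order-free v v' fs vs = Deg-eqv (order-free _ refl v v' fs) vs

  -- Ample letters

  Lin-ΣF : ∀ m (f : Fin m → Fun) → (∀ k → Lin (f k)) → Lin (λ G → ΣF m (λ k → f k G))
  Lin-ΣF zero f h = Lin-const 0ℤ
  Lin-ΣF (suc m) f h = Lin-+ (h zero) (Lin-ΣF m (f ∘ suc) (h ∘ suc))

  Van-ΣF : ∀ {σ} m (f : Fin m → Fun) → (∀ k → Van σ (f k)) → Van σ (λ G → ΣF m (λ k → f k G))
  Van-ΣF m f h = ΣF-0 m (λ k → proj₁ (h k)) , ΣF-0 m (λ k → proj₁ (proj₂ (h k))) ,
                 All.tabulate (λ p → ΣF-0 m (λ k → All.lookup (proj₂ (proj₂ (h k))) p))

  A₂ : Fin n → Fin n → Fun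
  A₂ i j H = mem i H * (1ℤ - mem j H)

  -- The sum is `∣ H ∣ * (n - ∣ H ∣)`, strictly concave in the cardinality. Splitting it by pairs
  -- lets each pair be corrected by its own linear function.
  A : Fun
  A H = ΣF n (λ i → ΣF n (λ j → A₂ i j H))

  -- a representative of A₂ i j on the flag σ: if a member separates i from j, then A₂ i j is linear there
  module Local {σ} (fs : Flag σ) where
    Sp : Fin n → Fin n → Subset n → Set
    Sp i j F = i ∈ F × j ∉ F

    sp? : ∀ i j → Dec (Any (Sp i j) σ)
    sp? i j = Any.any? (λ F → (i ∈? F) ×-dec ¬? (j ∈? F)) σ

    shift : ∀ {P : Set} → Dec P → Fin n → Fin n → Fun
    shift (yes _) i j H = mem j H - mem i H
    shift (no _)  i j H = 0ℤ

    shift-Lin : ∀ {P : Set} (d : Dec P) i j → Lin (shift d i j)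
    shift-Lin (yes _) i j = Lin-memDiff i j
    shift-Lin (no _) i j = Lin-const 0ℤ

    B₂ : Fin n → Fin n → Fun
    B₂ i j H = A₂ i j H + shift (sp? i j) i j H

    -- The left side equals `A₂ j i H`. It is nonzero only if `H` contains `j` and not `i`, which a
    -- set comparable with `F` cannot do.
    sep-zero : ∀ {i j F} H → Sp i j F → H ⊆ F ⊎ F ⊆ H → A₂ i j H + (mem j H - mem i H) ≡ 0ℤ
    sep-zero {i} {j} H (i∈ , j∉) (inj₁ s) = trans (cong (λ z → mem i H * (1ℤ - z) + (z - mem i H)) (mem-∉ (λ j∈ → j∉ (s j∈)))) (r₁ (mem i H))
      where
      r₁ : ∀ x → x * (1ℤ - 0ℤ) + (0ℤ - x) ≡ 0ℤ
      r₁ = solve-∀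
    sep-zero {i} {j} H (i∈ , j∉) (inj₂ s) = trans (cong (λ z → z * (1ℤ - mem j H) + (mem j H - z)) (mem-∈ (s i∈))) (r₁ (mem j H))
      where
      r₁ : ∀ x → 1ℤ * (1ℤ - x) + (x - 1ℤ) ≡ 0ℤ
      r₁ = solve-∀

    A₂≥0 : ∀ i j H → 0ℤ ≤ A₂ i j H
    A₂≥0 i j H = mul≥0 (mem-≥0 i H) (le j)
      where
      le : ∀ j → 0ℤ ≤ 1ℤ - mem j H
      le j with lookup H j
      ... | true = +≤+ z≤n
      ... | false = +≤+ z≤n

    A₂-zero : ∀ {i j} H → ¬ Sp i j H → A₂ i j H ≡ 0ℤ
    A₂-zero {i} {j} H h with i ∈? H | j ∈? H
    ... | no i∉ | _ = cong (λ z → z * (1ℤ - mem j H)) (mem-∉ i∉)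
    ... | yes _ | yes j∈ = trans (cong (λ z → mem i H * (1ℤ - z)) (mem-∈ j∈)) (ℤP.*-zeroʳ (mem i H))
    ... | yes i∈ | no j∉ = ⊥-elim (h (i∈ , j∉))

    B₂-member : ∀ i j H → (∀ {F} → F ∈ₗ σ → H ⊆ F ⊎ F ⊆ H) → (Sp i j H → Any (Sp i j) σ) → B₂ i j H ≡ 0ℤ
    B₂-member i j H c h = go (sp? i j)
      where
      sep : Any (Sp i j) σ → A₂ i j H + (mem j H - mem i H) ≡ 0ℤ
      sep a = let (F , F∈ , s) = found a in sep-zero H s (c F∈)
        where
        found : ∀ {σ} → Any (Sp i j) σ → ∃[ F ] (F ∈ₗ σ × Sp i j F)
        found (here s) = _ , here refl , s
        found (there a) = let (F , F∈ , s) = found a in F , there F∈ , s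
      go : (d : Dec (Any (Sp i j) σ)) → A₂ i j H + shift d i j H ≡ 0ℤ
      go (yes a) = sep a
      go (no ¬a) = trans (ℤP.+-identityʳ (A₂ i j H)) (A₂-zero H (λ s → ¬a (h s)))

    B₂-Van : ∀ i j → Van σ (B₂ i j)
    B₂-Van i j = B₂-member i j ⊥ (λ _ → inj₁ ⊥⊆) (λ (p , _) → ⊥-elim (∉⊥ p)) ,
                 B₂-member i j ⊤ (λ _ → inj₂ ⊆⊤) (λ (_ , q) → ⊥-elim (q ∈⊤)) ,
                 All.tabulate (λ {H} p → B₂-member i j H (λ q → flag-cmp fs p q) (λ s → Any.map (λ { refl → s }) p))

    B₂≥0 : ∀ i j G → Link σ G → 0ℤ ≤ B₂ i j G
    B₂≥0 i j G l = go (sp? i j)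
      where
      found : ∀ {σ} → Any (Sp i j) σ → ∃[ F ] (F ∈ₗ σ × Sp i j F)
      found (here s) = _ , here refl , s
      found (there a) = let (F , F∈ , s) = found a in F , there F∈ , s
      go : (d : Dec (Any (Sp i j) σ)) → 0ℤ ≤ A₂ i j G + shift d i j G
      go (yes a) = let (F , F∈ , s) = found a in ℤP.≤-reflexive (sym (sep-zero G s (proj₁ (cmp-sym (All.lookup (cmps l) F∈)))))
      go (no _) = subst (0ℤ ≤_) (sym (ℤP.+-identityʳ (A₂ i j G))) (A₂≥0 i j G)

    B₂>0 : ∀ {i j G} → Sep σ G i j → 0ℤ < B₂ i j G
    B₂>0 {i} {j} {G} ((i∈ , j∉) , a) = subst (0ℤ <_) (sym (go (sp? i j))) (+<+ (s≤s z≤n))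
      where
      contra : ∀ {σ} → All (λ F → mem i F ≡ mem j F) σ → Any (Sp i j) σ → Absurd
      contra (e ∷ _) (here (p , q)) = ℤP.<-irrefl (trans (sym (mem-∉ q)) (trans (sym e) (mem-∈ p))) (+<+ (s≤s z≤n))
      contra (_ ∷ a) (there b) = contra a b
      go : (d : Dec (Any (Sp i j) σ)) → A₂ i j G + shift d i j G ≡ 1ℤ
      go (yes b) = ⊥-elim (contra a b)
      go (no _) = trans (ℤP.+-identityʳ (A₂ i j G)) (cong₂ (λ x y → x * (1ℤ - y)) (mem-∈ i∈) (mem-∉ j∉))

    A° : Fun
    A° H = ΣF n (λ i → ΣF n (λ j → B₂ i j H))

    shiftA : Fun
    shiftA H = ΣF n (λ i → ΣF n (λ j → shift (sp? i j) i j H))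

    A°-eq : ∀ H → A° H ≡ A H + shiftA H
    A°-eq H = trans (ΣF-cong n (λ i → ΣF-+ n (λ j → A₂ i j H) (λ j → shift (sp? i j) i j H)))
                    (ΣF-+ n (λ i → ΣF n (λ j → A₂ i j H)) (λ i → ΣF n (λ j → shift (sp? i j) i j H)))

    shiftA-Lin : Lin shiftA
    shiftA-Lin = Lin-ΣF n (λ i H → ΣF n (λ j → shift (sp? i j) i j H)) (λ i → Lin-ΣF n (λ j → shift (sp? i j) i j) (λ j → shift-Lin (sp? i j) i j))

    A°-Van : Van σ A°
    A°-Van = Van-ΣF n (λ i H → ΣF n (λ j → B₂ i j H)) (λ i → Van-ΣF n (λ j → B₂ i j) (λ j → B₂-Van i j))

    -- A pair separated by `G` but by no member of the flag contributes `1`.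
    A°>0 : ∀ G → Link σ G → 0ℤ < A° G
    A°>0 G l = let (i , j , s) = sep-exists fs l in
      ΣF->0 n {λ i → ΣF n (λ j → B₂ i j G)} (λ i → ΣF-≥0 n (λ j → B₂≥0 i j G l)) i (ΣF->0 n {λ j → B₂ i j G} (λ j → B₂≥0 i j G l) j (B₂>0 s))

    top-elt : ∃[ e ] All (λ F → e ∉ F) σ
    top-elt = let (e , _ , a) = chain-∈ fs ⊤ (zero , ∈⊤) in
      e , All.tabulate (λ p e∈F → proj₂ (proj₂ (flag-member fs p)) (⊆-antisym ⊆⊤ (All.lookup a p e∈F)))

  -- Adding the linear function `mem e`, for any `e`, gives `1` on the proper flats containing `e`
  -- and `0` elsewhere: the hyperplane class.
  α : Fun
  α H = - ind ⊤ H

  ⊥≢⊤ : ⊥ {n} ≢ ⊤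
  ⊥≢⊤ ()

  module Localα {σ} (fs : Flag σ) where
    e₀ = proj₁ (Local.top-elt fs)

    α° : Fun
    α° H = mem e₀ H - ind ⊤ H

    α°-Van : Van σ α°
    α°-Van = cong₂ _-_ (mem-∉ {n} {e₀} {⊥} ∉⊥) (ind-≢ ⊥≢⊤) , cong₂ _-_ (mem-∈ {n} {e₀} {⊤} ∈⊤) (ind-≡ {⊤} refl) ,
      All.tabulate (λ p → cong₂ _-_ (mem-∉ (All.lookup (proj₂ (Local.top-elt fs)) p)) (ind-≢ (proj₂ (proj₂ (flag-member fs p)))))

    α°≥0 : ∀ G → Link σ G → 0ℤ ≤ α° G
    α°≥0 G l = subst (0ℤ ≤_) (trans (sym (ℤP.+-identityʳ (mem e₀ G))) (cong (λ z → mem e₀ G - z) (sym (ind-≢ (≢⊤ l))))) (mem-≥0 e₀ G)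

  ψ≥0 : ∀ T e G → 0ℤ ≤ ψ T e G
  ψ≥0 T e G = ≤⇒0≤- (+≤+ (r-mono {G ─ (T ∪₁ e)} {G ─ T} (λ x∈ → ∈─⁺ (proj₁ (∈─⁻ G (T ∪₁ e) x∈)) (λ p → proj₂ (∈─⁻ G (T ∪₁ e) x∈) (∈∪ˡ p)))))

  ψ-zero : ∀ {T e} G → Spanned (G ─ T) e → ψ T e G ≡ 0ℤ
  ψ-zero {T} {e} G h = ℤP.i≡j⇒i-j≡0 (cong +_ (sym (trans (cong r (─∪₁ G T e)) h)))

  ∉-spanned : ∀ {B e} → e ∉ B → Spanned B e
  ∉-spanned e∉ = cong r (del-∉ e∉)

  -- Take the element of a circuit of `⊤ ─ T` that enters the flag last. A member containing it
  -- contains the whole circuit, so deleting the element does not lower the rank of that member.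
  good-exists : ∀ {σ T} → Flag σ → r (⊤ ─ T) ℕ.< ∣ ⊤ ─ T ∣ → ∃[ e ] (Removable T e × Van σ (ψ T e))
  good-exists {σ} {T} fs lt =
    let (C , s , ne , sp) = circuit ∣ ⊤ ─ T ∣ (⊤ ─ T) ℕP.≤-refl lt
        (e , e∈C , a)     = chain-∈ fs C ne
        e∉T = proj₂ (∈─⁻ ⊤ T (s e∈C))
        at : ∀ F → (e ∈ F → C ⊆ F) → ψ T e F ≡ 0ℤ
        at F h = ψ-zero F (case e ∈? F of λ
          { (no e∉) → ∉-spanned (λ p → e∉ (proj₁ (∈─⁻ F T p)))
          ; (yes e∈) → spanned-mono {C} (λ {x} x∈ → ∈─⁺ (h e∈ x∈) (proj₂ (∈─⁻ ⊤ T (s x∈)))) e∈C (sp e∈C) })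
    in e , (e∉T , spanned-mono s e∈C (sp e∈C)) , at ⊥ (λ p → ⊥-elim (∉⊥ p)) , at ⊤ (λ _ _ → ∈⊤) ,
       All.map (λ {F} h → at F h) a

  -- The classes `x A + y α + z δ`. Positivity of `x` makes the coefficients of all links positive,
  -- positivity of `z` that of `Δ`; `α` is only nonnegative on links, so `y` may be zero.
  record Amp : Set where
    constructor mkAmp
    field
      x y z : ℤ
      x>0 : 0ℤ < x
      y≥0 : 0ℤ ≤ y
      z>0 : 0ℤ < z
  open Amp public

  letter : Amp → Letter
  letter a = (λ G → x a * A G + y a * α G) , z a

  word : List Amp → List Letter
  word = List.map letter

  record LocalRep {σ} (T : Subset n) (e : Fin n) (a : Amp) : Set where
    field
      φ° ℓ  : Fun
      φ°-eq : ∀ G → φ° G ≡ proj₁ (letter a) G + z a * ψ T e G + ℓ G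
      ℓ-Lin : Lin ℓ
      φ°-Van : Van σ φ°
      φ°>0  : ∀ G → Link σ G → 0ℤ < φ° G

  Van-comb : ∀ {σ f g} a b → Van σ f → Van σ g → Van σ (λ H → a * f H + b * g H)
  Van-comb {σ} {f} {g} a b (p , q , s) (p' , q' , s') = c p p' , c q q' , All.zipWith (λ (u , v) → c u v) (s , s')
    where
    r₁ : ∀ a b → a * 0ℤ + b * 0ℤ ≡ 0ℤ
    r₁ = solve-∀
    c : ∀ {H} → f H ≡ 0ℤ → g H ≡ 0ℤ → a * f H + b * g H ≡ 0ℤ
    c u v = trans (cong₂ (λ m k → a * m + b * k) u v) (r₁ a b)

  local-rep : ∀ {σ} → Flag σ → ∀ {T e} → Van σ (ψ T e) → ∀ a → LocalRep {σ} T e a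
  local-rep {σ} fs {T} {e} van a = record
    { φ° = λ G → 1ℤ * (x a * L.A° G + y a * Lα.α° G) + z a * ψ T e G
    ; ℓ = λ G → x a * L.shiftA G + y a * mem Lα.e₀ G
    ; φ°-eq = λ G → trans (cong (λ w → 1ℤ * (x a * w + y a * Lα.α° G) + z a * ψ T e G) (L.A°-eq G))
                          (r₁ (x a) (A G) (L.shiftA G) (y a) (mem Lα.e₀ G) (ind ⊤ G) (z a * ψ T e G))
    ; ℓ-Lin = Lin-comb (x a) (y a) L.shiftA-Lin (Lin-mem Lα.e₀)
    ; φ°-Van = Van-comb 1ℤ (z a) (Van-comb (x a) (y a) L.A°-Van Lα.α°-Van) van
    ; φ°>0 = λ G l → pos+nn (subst (0ℤ <_) (sym (ℤP.*-identityˡ (x a * L.A° G + y a * Lα.α° G))) (pos+nn (mul>0 (x>0 a) (L.A°>0 G l)) (mul≥0 (y≥0 a) (Lα.α°≥0 G l)))) (mul≥0 (pos⇒nn (z>0 a)) (ψ≥0 T e G))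
    }
    where
    module L = Local fs
    module Lα = Localα fs
    r₁ : ∀ x A s y m i p → 1ℤ * (x * (A + s) + y * (m - i)) + p ≡ x * A + y * (- i) + p + (x * s + y * m)
    r₁ = solve-∀

  -- `d` is the dimension `R - 1 - length σ` of the star plus the dimension `length es - 1` of the
  -- fibre, written without subtraction.
  Dim : Flats → List (Fin n) → ℕ → Set
  Dim σ es d = d ℕ.+ suc (suc (length σ)) ≡ R ℕ.+ length es

  R≥1 : 1 ℕ.≤ R
  R≥1 = ℕP.≤-trans (ℕP.≤-reflexive (sym (loopless zero))) (r-mono ⊆⊤)

  dependent : ∀ {T e es} → Valid T (e ∷ es) → r (⊤ ─ T) ℕ.< ∣ ⊤ ─ T ∣
  dependent {T} {e} {es} v = ℕP.≤-trans (s≤s (ℕP.m≤n+m (r (⊤ ─ T)) (length es))) (ℕP.≤-reflexive (valid-length v))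

  flag-length' : ∀ {σ} → Flag σ → suc (length σ) ℕ.≤ R
  flag-length' fs = ℕP.≤-trans (s≤s (flag-length fs)) (ℕP.≤-reflexive (ℕP.suc-pred R {{ℕ.>-nonZero R≥1}}))

  -- A reordering after which the first root vanishes on the flag without being moved, so that it
  -- enters the representative of an ample letter as the nonnegative function it is.
  record Adapted (σ : Flats) (T : Subset n) (es : List (Fin n)) : Set where
    field
      e     : Fin n
      rest  : List (Fin n)
      valid : Valid T (e ∷ rest)
      van   : Van σ (ψ T e)
      len   : length es ≡ suc (length rest)
      same  : ∀ {τ} → Flag τ → ∀ vs → Deg τ (roots T es) vs ≡ Deg τ (ψ T e ∷ roots (T ∪₁ e) rest) vs
    tail-valid : Valid (T ∪₁ e) rest
    tail-valid with valid
    ... | _ ∷ v = v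

  adapt : ∀ {σ T e es} → Flag σ → Valid T (e ∷ es) → Adapted σ T (e ∷ es)
  adapt {σ} {T} {e} {es} fs v =
    let (e' , rem , van) = good-exists fs (dependent v)
        (es' , v')       = valid-exists ∣ ⊤ ─ (T ∪₁ e') ∣ (T ∪₁ e') ℕP.≤-refl
    in record { e = e' ; rest = es' ; valid = rem ∷ v' ; van = van ; len = same-length v (rem ∷ v')
              ; same = λ ft vs → Deg-order-free v (rem ∷ v') ft vs }

  sumLk-≥0 : ∀ {σ} {f : Fun} → (∀ G → Link σ G → 0ℤ ≤ f G) → 0ℤ ≤ sumLk σ f
  sumLk-≥0 {σ} h = ΣF-≥0 (size n) (λ k → sel-≥0 (link? σ (enum n k)) (h (enum n k)))

  sumLk->0 : ∀ {σ} {f : Fun} → (∀ G → Link σ G → 0ℤ ≤ f G) → ∀ G → Link σ G → 0ℤ < f G → 0ℤ < sumLk σ f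
  sumLk->0 {σ} {f} h G l p = ΣS->0 {f = λ G → sel (link? σ G) (f G)} (λ H → sel-≥0 (link? σ H) (h H)) G (subst (0ℤ <_) (sym (sel-yes (link? σ G) l)) p)

  dim-link : ∀ {σ es d G} → Dim σ es (suc d) → Dim (G ∷ σ) es d
  dim-link {σ} {es} {d} e = trans (ℕP.+-suc d (suc (suc (length σ)))) e

  dim-tail : ∀ {σ d es es'} → length es ≡ suc (length es') → Dim σ es (suc d) → Dim σ es' d
  dim-tail {σ} {d} {es} {es'} len e = ℕP.suc-injective (trans e (trans (cong (R ℕ.+_) len) (ℕP.+-suc R (length es'))))

  -- The first letter is a positive combination of links and `Δ`, and induction applies to each of
  -- them. Some piece is nonempty: an incomplete flag has a link, and over a complete flag the
  -- dimension forces a second root.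
  positive : ∀ C {σ T e es} → Flag σ → Valid T (e ∷ es) → Dim σ (e ∷ es) (length C) → 0ℤ < Deg σ (roots T (e ∷ es)) (word C)
  positive [] {σ} {T} {e} {[]} fs v dim = subst (0ℤ <_) (sym (sel-yes (suc (length σ) ℕP.≟ R) (ℕP.suc-injective (trans dim (ℕP.+-comm R 1))))) (+<+ (s≤s z≤n))
  positive [] {σ} {T} {e} {_ ∷ es} fs v dim = ⊥-elim (ℕP.<-irrefl dim (ℕP.≤-trans (s≤s (s≤s (flag-length' fs)))
    (ℕP.≤-trans (ℕP.≤-reflexive (ℕP.+-comm 2 R)) (ℕP.+-monoʳ-≤ R (s≤s (s≤s z≤n))))))
  positive (a ∷ C) {σ} {T} {e₀} {es₀} fs v dim =
    subst (0ℤ <_) (sym (trans (same fs (word (a ∷ C))) (Deg-split fs (ψ T e) (roots (T ∪₁ e) rest) (proj₁ (letter a)) (z a) (word C) φ° ℓ φ°-eq ℓ-Lin φ°-Van)))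
      (go (length σ ℕP.<? ℕ.pred R))
    where
    open Adapted (adapt fs v)
    open LocalRep (local-rep fs van a)
    link-pos : ∀ G → Link σ G → 0ℤ < φ° G * Deg (G ∷ σ) (ψ T e ∷ roots (T ∪₁ e) rest) (word C)
    link-pos G l = mul>0 (φ°>0 G l) (positive C (l ∷ fs) valid (subst (λ k → length C ℕ.+ suc (suc (suc (length σ))) ≡ R ℕ.+ k) len (dim-link {σ} {e₀ ∷ es₀} {length C} {G} dim)))
    tail-nn : ∀ es' → Valid (T ∪₁ e) es' → length (e₀ ∷ es₀) ≡ suc (length es') → 0ℤ ≤ z a * Deg σ (roots (T ∪₁ e) es') (word C)
    tail-nn [] _ _ = ℤP.≤-reflexive (sym (trans (*R (z a) (Deg-[] σ (word C))) (ℤP.*-zeroʳ (z a))))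
    tail-nn (e' ∷ es') v' len' = pos⇒nn (mul>0 (z>0 a) (positive C fs v' (dim-tail {σ} {length C} {e₀ ∷ es₀} {e' ∷ es'} len' dim)))
    tail-pos : ∀ es' → Valid (T ∪₁ e) es' → length (e₀ ∷ es₀) ≡ suc (length es') → ¬ (length σ ℕ.< ℕ.pred R) →
      0ℤ < z a * Deg σ (roots (T ∪₁ e) es') (word C)
    tail-pos [] _ len' ¬lt = ⊥-elim (ℕP.<-irrefl (sym dim') (s≤s (ℕP.m≤n+m (suc (suc (length σ))) (length C))))
      where
      full : suc (length σ) ≡ R
      full = trans (cong suc (ℕP.≤-antisym (flag-length fs) (ℕP.≮⇒≥ ¬lt))) (ℕP.suc-pred R {{ℕ.>-nonZero R≥1}})
      dim' : suc (length C ℕ.+ suc (suc (length σ))) ≡ suc (suc (length σ))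
      dim' = trans dim (trans (cong (R ℕ.+_) len') (trans (ℕP.+-comm R 1) (cong suc (sym full))))
    tail-pos (e' ∷ es') v' len' _ = mul>0 (z>0 a) (positive C fs v' (dim-tail {σ} {length C} {e₀ ∷ es₀} {e' ∷ es'} len' dim))
    go : Dec (length σ ℕ.< ℕ.pred R) →
      0ℤ < sumLk σ (λ G → φ° G * Deg (G ∷ σ) (ψ T e ∷ roots (T ∪₁ e) rest) (word C)) + z a * Deg σ (roots (T ∪₁ e) rest) (word C)
    go (yes lt) = let (G , l) = link-exists fs lt in
      pos+nn (sumLk->0 {σ} (λ H l' → pos⇒nn (link-pos H l')) G l (link-pos G l)) (tail-nn rest tail-valid len)
    go (no ¬lt) = nn+pos (sumLk-≥0 {σ} (λ H l' → pos⇒nn (link-pos H l'))) (tail-pos rest tail-valid len ¬lt)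

  -- The Hodge index inequality

  -- If the projection `u'` of `u` along `c` had positive square, the plane of `u'` and `c` would be
  -- positive definite. Its vector `w₁` in the complement of `c₁` would then contradict the
  -- hypothesis.
  reverse-CS : (Q : Letter → Letter → ℤ) → (∀ u v → Q u v ≡ Q v u) →
    (∀ a u b v w → Q (comb a u b v) w ≡ a * Q u w + b * Q v w) →
    ∀ c₁ c → (∀ u → Q u c₁ ≡ 0ℤ → Q u u ≤ 0ℤ) → 0ℤ < Q c c → 0ℤ < Q c₁ c →
    ∀ u → Q u u * Q c c ≤ Q u c * Q u c
  reverse-CS Q Q-sym bil c₁ c hyp cc>0 c₁c>0 u = 0≤-⇒≤ (cancel>0 cc>0 (subst (0ℤ ≤_) (r₁ (Q c c) (Q u u) (Q u c)) (≤⇒0≤- u'u'≤0)))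
    where
    bilʳ : ∀ w a u b v → Q w (comb a u b v) ≡ a * Q w u + b * Q w v
    bilʳ w a u b v = trans (Q-sym w (comb a u b v)) (trans (bil a u b v w) (cong₂ (λ x y → a * x + b * y) (Q-sym u w) (Q-sym v w)))
    quad : ∀ a u b v → Q (comb a u b v) (comb a u b v) ≡ a * (a * Q u u + b * Q u v) + b * (a * Q u v + b * Q v v)
    quad a u b v = trans (bil a u b v (comb a u b v)) (cong₂ (λ x y → a * x + b * y) (bilʳ u a u b v) (trans (bilʳ v a u b v) (cong (λ z → a * z + b * Q v v) (Q-sym v u))))
    u' = comb (Q c c) u (- Q u c) c
    u'c : Q u' c ≡ 0ℤ
    u'c = trans (bil (Q c c) u (- Q u c) c c) (ring (Q c c) (Q u c))
      where
      ring : ∀ a b → a * b + - b * a ≡ 0ℤ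
      ring = solve-∀
    u'u' : Q u' u' ≡ Q c c * (Q c c * Q u u - Q u c * Q u c)
    u'u' = trans (quad (Q c c) u (- Q u c) c) (ring (Q c c) (Q u u) (Q u c))
      where
      ring : ∀ a x b → a * (a * x + - b * b) + - b * (a * b + - b * a) ≡ a * (a * x - b * b)
      ring = solve-∀
    w₁ = comb (Q c₁ c) u' (- Q u' c₁) c
    yc₁ : Q w₁ c₁ ≡ 0ℤ
    yc₁ = trans (bil (Q c₁ c) u' (- Q u' c₁) c c₁) (trans (cong (λ z → Q c₁ c * Q u' c₁ + - Q u' c₁ * z) (Q-sym c c₁)) (ring (Q c₁ c) (Q u' c₁)))
      where
      ring : ∀ a b → a * b + - b * a ≡ 0ℤ
      ring = solve-∀
    yy : Q w₁ w₁ ≡ Q c₁ c * Q c₁ c * Q u' u' + Q u' c₁ * Q u' c₁ * Q c c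
    yy = trans (quad (Q c₁ c) u' (- Q u' c₁) c) (trans (cong (λ z → Q c₁ c * (Q c₁ c * Q u' u' + - Q u' c₁ * z) + - Q u' c₁ * (Q c₁ c * z + - Q u' c₁ * Q c c)) u'c)
           (ring (Q c₁ c) (Q u' u') (Q u' c₁) (Q c c)))
      where
      ring : ∀ p s b d → p * (p * s + - b * 0ℤ) + - b * (p * 0ℤ + - b * d) ≡ p * p * s + b * b * d
      ring = solve-∀
    u'u'≤0 : Q c c * (Q c c * Q u u - Q u c * Q u c) ≤ 0ℤ
    u'u'≤0 = ℤP.≮⇒≥ (λ pos → ℤP.<⇒≱ (subst (0ℤ <_) (sym yy) (pos+nn (mul>0 (mul>0 c₁c>0 c₁c>0) (subst (0ℤ <_) (sym u'u') pos))
               (mul≥0 (sq≥0 (Q u' c₁)) (pos⇒nn cc>0)))) (hyp w₁ yc₁))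
    r₁ : ∀ a x b → 0ℤ - a * (a * x - b * b) ≡ a * (b * b - x * a)
    r₁ = solve-∀

  valid-tail : ∀ {T e es} → Valid T (e ∷ es) → Valid (T ∪₁ e) es
  valid-tail (_ ∷ v) = v

  HodgeIndex : Flats → List Fun → List Amp → Set
  HodgeIndex σ Ψ C = ∀ u (a : Amp) →
    Deg σ Ψ (u ∷ u ∷ word C) * Deg σ Ψ (letter a ∷ letter a ∷ word C) ≤ Deg σ Ψ (u ∷ letter a ∷ word C) * Deg σ Ψ (u ∷ letter a ∷ word C)

  -- The induction step in dimension at least three

  sumLetter : ∀ m → (Fin m → ℤ) → (Fin m → Letter) → Letter
  sumLetter m b f = (λ G → ΣF m (λ k → b k * proj₁ (f k) G)) , ΣF m (λ k → b k * proj₂ (f k))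

  Deg-0 : ∀ {σ} → Flag σ → ∀ Ψ vs → Deg σ Ψ (((λ _ → 0ℤ) , 0ℤ) ∷ vs) ≡ 0ℤ
  Deg-0 {σ} fs Ψ vs = Deg-null fs Ψ (λ _ → 0ℤ) vs (refl , refl , All.universal (λ _ → refl) σ) (λ _ _ → refl)

  Deg-cong : ∀ {σ} → Flag σ → ∀ Ψ {φ φ' s s'} vs → (∀ G → φ G ≡ φ' G) → s ≡ s' → Deg σ Ψ ((φ , s) ∷ vs) ≡ Deg σ Ψ ((φ' , s') ∷ vs)
  Deg-cong {σ} fs Ψ {s = s} vs h refl = cong (λ z → z + s * Dg σ Ψ vs 1 []) (Dg-cong fs Ψ vs 0 [] h)

  Deg-sum : ∀ {σ} → Flag σ → ∀ Ψ vs m b f → Deg σ Ψ (sumLetter m b f ∷ vs) ≡ ΣF m (λ k → b k * Deg σ Ψ (f k ∷ vs))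
  Deg-sum fs Ψ vs zero b f = Deg-0 fs Ψ vs
  Deg-sum {σ} fs Ψ vs (suc m) b f =
    trans (Deg-cong fs Ψ vs (λ G → +R (b zero * proj₁ (f zero) G) (sym (ℤP.*-identityˡ (ΣF m (λ k → b (suc k) * proj₁ (f (suc k)) G))))) (+R (b zero * proj₂ (f zero)) (sym (ℤP.*-identityˡ (ΣF m (λ k → b (suc k) * proj₂ (f (suc k))))))))
    (trans (Deg-comb fs Ψ (b zero) (f zero) 1ℤ (sumLetter m (b ∘ suc) (f ∘ suc)) vs)
           (+R (b zero * Deg σ Ψ (f zero ∷ vs)) (trans (ℤP.*-identityˡ _) (Deg-sum fs Ψ vs m (b ∘ suc) (f ∘ suc)))))

  module Step {σ T e es} (fs : Flag σ) (v : Valid T (e ∷ es)) (van : Van σ (ψ T e)) (a₁ : Amp) (C' : List Amp)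
    (dim : Dim σ (e ∷ es) (suc (suc (suc (length C')))))
    (ih : ∀ {σ T e es} → Flag σ → Valid T (e ∷ es) → Dim σ (e ∷ es) (suc (suc (length C'))) → HodgeIndex σ (roots T (e ∷ es)) C') where

    open LocalRep (local-rep fs van a₁)

    Ψ' Ψ : List Fun
    Ψ' = roots (T ∪₁ e) es
    Ψ = ψ T e ∷ Ψ'
    c₁ : Letter
    c₁ = letter a₁
    W : List Letter
    W = word C'
    m : ℕ
    m = suc (size n)

    v' : Valid (T ∪₁ e) es
    v' = valid-tail v

    -- Without further roots `Δ` is empty. Its coefficient is then set to zero, so that index `zero`
    -- drops out of the graph of pieces.
    cΔ : List (Fin n) → ℤ
    cΔ []      = 0ℤ
    cΔ (_ ∷ _) = z a₁

    c : Fin m → ℤ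
    c zero    = cΔ es
    c (suc k) = sel (link? σ (enum n k)) (φ° (enum n k))

    Dl : Fin m → Letter
    Dl zero    = (λ G → - ψ T e G) , 1ℤ
    Dl (suc k) = ind (enum n k) , 0ℤ

    Q : Letter → Letter → ℤ
    Q u w = Deg σ Ψ (u ∷ w ∷ c₁ ∷ W)

    Q-sym : ∀ u w → Q u w ≡ Q w u
    Q-sym u w = Deg-swap fs Ψ u w (c₁ ∷ W)

    -- c₁ is an effective combination of the Dl
    split : ∀ vs → Deg σ Ψ (c₁ ∷ vs) ≡ ΣF m (λ k → c k * Deg σ Ψ (Dl k ∷ vs))
    split vs = trans (Deg-split fs (ψ T e) Ψ' (proj₁ c₁) (z a₁) vs φ° ℓ φ°-eq ℓ-Lin φ°-Van)
      (trans (ℤP.+-comm (sumLk σ (λ G → φ° G * Deg (G ∷ σ) Ψ vs)) (z a₁ * Deg σ Ψ' vs))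
      (cong₂ _+_ (trans (tail es) (*R (cΔ es) (sym (Deg-Δ fs (ψ T e) Ψ' vs)))) (ΣF-cong (size n) (λ k → links (enum n k)))))
      where
      tail : ∀ es → z a₁ * Deg σ (roots (T ∪₁ e) es) vs ≡ cΔ es * Deg σ (roots (T ∪₁ e) es) vs
      tail [] = trans (*R (z a₁) (Deg-[] σ vs)) (trans (ℤP.*-zeroʳ (z a₁)) (sym (cong (λ w → 0ℤ * w) (Deg-[] σ vs))))
      tail (_ ∷ _) = refl
      links : ∀ G → sel (link? σ G) (φ° G * Deg (G ∷ σ) Ψ vs) ≡ sel (link? σ G) (φ° G) * Deg σ Ψ ((ind G , 0ℤ) ∷ vs)
      links G = go (link? σ G)
        where
        go : (d : Dec (Link σ G)) → sel d (φ° G * Deg (G ∷ σ) Ψ vs) ≡ sel d (φ° G) * Deg σ Ψ ((ind G , 0ℤ) ∷ vs)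
        go (yes l) = *R (φ° G) (sym (Deg-ind fs l Ψ vs))
        go (no _) = refl

    -- Each piece with nonzero coefficient is again a bundle over a star, of dimension one less, to
    -- which the induction hypothesis applies.
    data Piece (k : Fin m) : Set where
      link : ∀ G → Link σ G → (∀ vs → Deg σ Ψ (Dl k ∷ vs) ≡ Deg (G ∷ σ) Ψ vs) → Piece k
      tail : ∀ e' es' → es ≡ e' ∷ es' → (∀ vs → Deg σ Ψ (Dl k ∷ vs) ≡ Deg σ Ψ' vs) → Piece k

    piece : ∀ k → c k ≢ 0ℤ → Piece k
    piece zero h = go es refl h
      where
      go : ∀ es' → es ≡ es' → cΔ es' ≢ 0ℤ → Piece zero
      go [] _ h = ⊥-elim (h refl)
      go (e' ∷ es') eq _ = tail e' es' eq (Deg-Δ fs (ψ T e) Ψ')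
    piece (suc k) h = go (link? σ (enum n k)) h
      where
      go : (d : Dec (Link σ (enum n k))) → sel d (φ° (enum n k)) ≢ 0ℤ → Piece (suc k)
      go (yes l) _ = link (enum n k) l (Deg-ind fs l Ψ)
      go (no _) h = ⊥-elim (h refl)

    dimLink : ∀ {G} → Dim (G ∷ σ) (e ∷ es) (suc (suc (length C')))
    dimLink {G} = dim-link {σ} {e ∷ es} {suc (suc (length C'))} {G} dim

    dimTail : Dim σ es (suc (suc (length C')))
    dimTail = dim-tail {σ} {suc (suc (length C'))} {e ∷ es} {es} refl dim

    piece-pos : ∀ {k} → Piece k → ∀ a b → 0ℤ < Deg σ Ψ (Dl k ∷ letter a ∷ letter b ∷ W)
    piece-pos (link G l eq) a b = subst (0ℤ <_) (sym (eq (letter a ∷ letter b ∷ W))) (positive (a ∷ b ∷ C') (l ∷ fs) v (dimLink {G}))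
    piece-pos (tail e' es' es≡ eq) a b = subst (0ℤ <_) (sym (eq (letter a ∷ letter b ∷ W))) (subst (λ s → 0ℤ < Deg σ (roots (T ∪₁ e) s) (word (a ∷ b ∷ C'))) (sym es≡)
      (positive (a ∷ b ∷ C') fs (subst (Valid (T ∪₁ e)) es≡ v') (subst (λ s → Dim σ s (suc (suc (length C')))) es≡ dimTail)))

    piece-index : ∀ {k} → Piece k → ∀ u →
      Deg σ Ψ (Dl k ∷ u ∷ u ∷ W) * Deg σ Ψ (Dl k ∷ c₁ ∷ c₁ ∷ W) ≤ Deg σ Ψ (Dl k ∷ u ∷ c₁ ∷ W) * Deg σ Ψ (Dl k ∷ u ∷ c₁ ∷ W)
    piece-index (link G l eq) u = subst₂ _≤_ (sym (cong₂ _*_ (eq (u ∷ u ∷ W)) (eq (c₁ ∷ c₁ ∷ W)))) (sym (cong₂ _*_ (eq (u ∷ c₁ ∷ W)) (eq (u ∷ c₁ ∷ W)))) (ih (l ∷ fs) v (dimLink {G}) u a₁)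
    piece-index (tail e' es' es≡ eq) u = subst₂ _≤_ (sym (cong₂ _*_ (eq (u ∷ u ∷ W)) (eq (c₁ ∷ c₁ ∷ W)))) (sym (cong₂ _*_ (eq (u ∷ c₁ ∷ W)) (eq (u ∷ c₁ ∷ W))))
      (subst (λ s → HodgeIndex σ (roots (T ∪₁ e) s) C') (sym es≡) (ih fs (subst (Valid (T ∪₁ e)) es≡ v') (subst (λ s → Dim σ s (suc (suc (length C')))) es≡ dimTail)) u a₁)

    c≥0 : ∀ k → 0ℤ ≤ c k
    c≥0 zero = go es
      where
      go : ∀ es → 0ℤ ≤ cΔ es
      go [] = ℤP.≤-refl
      go (_ ∷ _) = pos⇒nn (z>0 a₁)
    c≥0 (suc k) = sel-≥0 (link? σ (enum n k)) (λ l → pos⇒nn (φ°>0 (enum n k) l))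

    H : Fin m → Fin m → ℤ
    H k l = Q (Dl k) (Dl l)

    dimW : ∀ {G G'} → Dim (G' ∷ G ∷ σ) (e ∷ es) (suc (length C'))
    dimW {G} {G'} = dim-link {G ∷ σ} {e ∷ es} {suc (length C')} {G'} (dimLink {G})

    H-compat : ∀ {G G'} → Link σ G → Link (G ∷ σ) G' → 0ℤ < Q (ind G , 0ℤ) (ind G' , 0ℤ)
    H-compat {G} {G'} l l' = subst (0ℤ <_) (sym (trans (Deg-ind fs l Ψ ((ind G' , 0ℤ) ∷ c₁ ∷ W)) (Deg-ind (l ∷ fs) l' Ψ (c₁ ∷ W)))) (positive (a₁ ∷ C') (l' ∷ (l ∷ fs)) v (dimW {G} {G'}))

    -- Incomparable flats span no cone, so their divisors are disjoint; comparable ones meet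
    -- positively.
    H-links : ∀ {G G'} → Link σ G → Link σ G' → G ≢ G' → 0ℤ ≤ Q (ind G , 0ℤ) (ind G' , 0ℤ)
    H-links {G} {G'} l l' ne = go (cmp? G G')
      where
      go : Dec (Cmp G G') → 0ℤ ≤ Q (ind G , 0ℤ) (ind G' , 0ℤ)
      go (yes k) = pos⇒nn (H-compat l (mkLink (flat l') (≢⊥ l') (≢⊤ l') (k ∷ cmps l')))
      go (no ¬k) = ℤP.≤-reflexive (sym (trans (Deg-ind fs l Ψ ((ind G' , 0ℤ) ∷ c₁ ∷ W)) (Deg-null (l ∷ fs) Ψ (ind G') (c₁ ∷ W)
        (let (p , q , s) = ind-Van l' in p , q , ind-≢ ne ∷ s) (λ X lX → ind-≢ (λ { refl → ¬k (link-head lX) })))))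

    tail-link-pos : ∀ {G} e' es' → es ≡ e' ∷ es' → Link σ G → 0ℤ < Q ((λ G → - ψ T e G) , 1ℤ) (ind G , 0ℤ)
    tail-link-pos {G} e' es' es≡ l = subst (0ℤ <_) (sym (trans (Deg-Δ fs (ψ T e) Ψ' ((ind G , 0ℤ) ∷ c₁ ∷ W)) (Deg-ind fs l Ψ' (c₁ ∷ W))))
      (subst (λ s → 0ℤ < Deg (G ∷ σ) (roots (T ∪₁ e) s) (word (a₁ ∷ C'))) (sym es≡)
        (positive (a₁ ∷ C') (l ∷ fs) (subst (Valid (T ∪₁ e)) es≡ v') (subst (λ s → Dim (G ∷ σ) s (suc (length C'))) es≡ (dim-link {σ} {es} {suc (length C')} {G} dimTail))))

    is-link : ∀ k → c (suc k) ≢ 0ℤ → Link σ (enum n k)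
    is-link k h = go (link? σ (enum n k)) h
      where
      go : (d : Dec (Link σ (enum n k))) → sel d (φ° (enum n k)) ≢ 0ℤ → Link σ (enum n k)
      go (yes l) _ = l
      go (no _) h = ⊥-elim (h refl)

    is-tail : c zero ≢ 0ℤ → ∃[ e' ] ∃[ es' ] es ≡ e' ∷ es'
    is-tail h = go es refl h
      where
      go : ∀ es' → es ≡ es' → cΔ es' ≢ 0ℤ → ∃[ e' ] ∃[ es' ] es ≡ e' ∷ es'
      go [] _ h = ⊥-elim (h refl)
      go (e' ∷ es') eq _ = e' , es' , eq

    enum-inj : ∀ {k l} → enum n k ≡ enum n l → k ≡ l
    enum-inj {k} {l} eq = trans (sym (index-enum n k)) (trans (cong index eq) (index-enum n l))

    H-off : ∀ k l → k ≢ l → 0ℤ ≤ c k * c l * H k l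
    H-off k l ne = go (c k ℤP.≟ 0ℤ) (c l ℤP.≟ 0ℤ)
      where
      nn : ∀ k l → k ≢ l → c k ≢ 0ℤ → c l ≢ 0ℤ → 0ℤ ≤ H k l
      nn zero zero ne _ _ = ⊥-elim (ne refl)
      nn zero (suc l) ne p q = let (e' , es' , eq) = is-tail p in pos⇒nn (tail-link-pos e' es' eq (is-link l q))
      nn (suc k) zero ne p q = let (e' , es' , eq) = is-tail q in subst (0ℤ ≤_) (Q-sym (Dl zero) (Dl (suc k))) (pos⇒nn (tail-link-pos e' es' eq (is-link k p)))
      nn (suc k) (suc l) ne p q = H-links (is-link k p) (is-link l q) (λ eq → ne (cong suc (enum-inj eq)))
      go : Dec (c k ≡ 0ℤ) → Dec (c l ≡ 0ℤ) → 0ℤ ≤ c k * c l * H k l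
      go (yes p) _ = ℤP.≤-reflexive (sym (cong (λ w → w * c l * H k l) p))
      go (no _) (yes q) = ℤP.≤-reflexive (sym (trans (cong (λ w → c k * w * H k l) q) (cong (λ w → w * H k l) (ℤP.*-zeroʳ (c k)))))
      go (no p) (no q) = mul≥0 (mul≥0 (c≥0 k) (c≥0 l)) (nn k l ne p q)

    c>0 : ∀ k → c k ≢ 0ℤ → 0ℤ < c k
    c>0 k h = ℤP.≤∧≢⇒< (c≥0 k) (h ∘ sym)

    -- The factor `c₁` of `Q` has two roles. Expanded over the pieces it writes `Q v v` as a sum of
    -- local squares; kept as a letter it is the reference class of the local inequalities.
    conclude : ∀ u → Q u c₁ ≡ 0ℤ → Q u u ≤ 0ℤ
    conclude u uc₁ = Gl.glue q>0 conn locally cg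
      where
      g : Fin m → ℤ
      g k = Q (Dl k) u
      module Gl = Gluing m c H g (Q u u) c≥0 (λ k l → Q-sym (Dl k) (Dl l)) H-off
      front : ∀ w vs → Deg σ Ψ (w ∷ c₁ ∷ vs) ≡ ΣF m (λ k → c k * Deg σ Ψ (Dl k ∷ w ∷ vs))
      front w vs = trans (Deg-swap fs Ψ w c₁ vs) (split (w ∷ vs))
      q-eq : ∀ k → Gl.q k ≡ Q (Dl k) c₁
      q-eq k = sym (trans (front (Dl k) (c₁ ∷ W)) (ΣF-cong m (λ l → trans (ℤP.*-comm (c l) (Q (Dl l) (Dl k))) (cong (λ w → w * c l) (Q-sym (Dl l) (Dl k))))))
      q>0 : ∀ k → 0ℤ < c k → 0ℤ < Gl.q k
      q>0 k p = subst (0ℤ <_) (sym (q-eq k)) (piece-pos (piece k (λ eq → ℤP.<-irrefl (sym eq) p)) a₁ a₁)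
      cg : ΣF m (λ k → c k * g k) ≡ 0ℤ
      cg = trans (sym (front u (c₁ ∷ W))) uc₁
      w≢0 : ∀ k l → c k ≢ 0ℤ → c l ≢ 0ℤ → 0ℤ < H k l → Gl.w k l ≢ 0ℤ
      w≢0 k l p q h eq = ℤP.<-irrefl (sym eq) (mul>0 (mul>0 (c>0 k p) (c>0 l q)) h)
      conn : Gl.Connected
      conn y adj = go es refl
        where
        go : ∀ es' → es ≡ es' → ∀ k l → c k ≢ 0ℤ → c l ≢ 0ℤ → y k ≡ y l
        -- `Δ` meets the divisor of every link positively and serves as the hub of the graph.
        go (e' ∷ es') es≡ k l p q = trans (hub k p) (sym (hub l q))
          where
          c0 : c zero ≢ 0ℤ
          c0 eq = ℤP.<-irrefl (trans (sym eq) (cong cΔ es≡)) (z>0 a₁)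
          hub : ∀ k → c k ≢ 0ℤ → y k ≡ y zero
          hub zero _ = refl
          hub (suc k) p = sym (adj zero (suc k) (λ ()) (w≢0 zero (suc k) c0 p (tail-link-pos e' es' es≡ (is-link k p))))
        go [] es≡ zero l p q = ⊥-elim (p (cong cΔ es≡))
        go [] es≡ (suc k) zero p q = ⊥-elim (q (cong cΔ es≡))
        go [] es≡ (suc k) (suc l) p q = trans (yE k) (trans (Cn.links-connected fs big y' adj' (is-link k p) (is-link l q)) (sym (yE l)))
          where
          module Cn = Connectivity r isRank loopless
          y' : Subset n → ℤ
          y' G = y (suc (index G))
          yE : ∀ k → y (suc k) ≡ y' (enum n k)
          yE k = cong (y ∘ suc) (sym (index-enum n k))
          link-c : ∀ {G} → Link σ G → c (suc (index G)) ≢ 0ℤ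
          link-c {G} l eq = ℤP.<-irrefl (sym (trans (sym (trans (cong (λ H → sel (link? σ H) (φ° H)) (enum-index G)) (sel-yes (link? σ G) l))) eq)) (φ°>0 G l)
          adj' : ∀ {G G'} → Link σ G → Link (G ∷ σ) G' → y' G ≡ y' G'
          adj' {G} {G'} lG lG' = adj (suc (index G)) (suc (index G')) (λ eq → proj₂ (link-head lG') (trans (sym (enum-index G)) (trans (cong (enum n) (FinP.suc-injective eq)) (enum-index G'))))
            (w≢0 (suc (index G)) (suc (index G')) (link-c lG) (link-c (link-tail lG'))
              (subst₂ (λ X X' → 0ℤ < Q (ind X , 0ℤ) (ind X' , 0ℤ)) (sym (enum-index G)) (sym (enum-index G')) (H-compat lG lG')))
          -- With a single root the whole dimension, at least three, lies in the base, so at least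
          -- three ranks are missing from the flag.
          big : suc (suc (suc (suc (length σ)))) ℕ.≤ R
          big = ℕP.≤-pred (ℕP.≤-trans (s≤s (s≤s (s≤s (ℕP.m≤n+m (suc (suc (length σ))) (length C'))))) (ℕP.≤-reflexive (trans dim (trans (cong (λ s → R ℕ.+ suc (length s)) es≡) (ℕP.+-comm R 1)))))
      locally : Gl.Locally
      locally N b = (λ k → Deg σ Ψ (Dl k ∷ w ∷ w ∷ W)) , total , bound
        where
        s = sumLetter m b Dl
        w = comb N u 1ℤ s
        Qs : ∀ x → Q s x ≡ ΣF m (λ k → b k * Q (Dl k) x)
        Qs x = Deg-sum fs Ψ (x ∷ c₁ ∷ W) m b Dl
        Qkw : ∀ k → Q (Dl k) w ≡ N * g k + Gl.Hb b k
        Qkw k = trans (Q-sym (Dl k) w) (trans (Deg-comb fs Ψ N u 1ℤ s (Dl k ∷ c₁ ∷ W)) (cong₂ (λ x y → N * x + y) (Q-sym u (Dl k))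
          (trans (ℤP.*-identityˡ (Q s (Dl k))) (trans (Qs (Dl k)) (ΣF-cong m (λ l → trans (ℤP.*-comm (b l) (Q (Dl l) (Dl k))) (cong (λ t → t * b l) (Q-sym (Dl l) (Dl k)))))))))
        B = ΣF m (λ k → b k * g k)
        Qss : Q s s ≡ ΣF m (λ k → b k * Gl.Hb b k)
        Qss = trans (Qs s) (ΣF-cong m (λ k → *R (b k) (trans (Q-sym (Dl k) s) (trans (Qs (Dl k)) (ΣF-cong m (λ l → trans (ℤP.*-comm (b l) (Q (Dl l) (Dl k))) (cong (λ t → t * b l) (Q-sym (Dl l) (Dl k)))))))))
        Qww : Q w w ≡ N * N * Q u u + (N * B + N * B) + ΣF m (λ k → b k * Gl.Hb b k)
        Qww = trans (Deg-comb fs Ψ N u 1ℤ s (w ∷ c₁ ∷ W))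
          (trans (cong₂ (λ x y → N * x + 1ℤ * y)
              (trans (Q-sym u w) (trans (Deg-comb fs Ψ N u 1ℤ s (u ∷ c₁ ∷ W)) (cong (λ t → N * Q u u + 1ℤ * t) (Qs u))))
              (trans (Q-sym s w) (trans (Deg-comb fs Ψ N u 1ℤ s (s ∷ c₁ ∷ W)) (cong₂ (λ x y → N * x + 1ℤ * y) (trans (Q-sym u s) (Qs u)) Qss))))
            (ring N (Q u u) B (ΣF m (λ k → b k * Gl.Hb b k))))
          where
          ring : ∀ N U B S → N * (N * U + 1ℤ * B) + 1ℤ * (N * B + 1ℤ * S) ≡ N * N * U + (N * B + N * B) + S
          ring = solve-∀
        total : N * N * Q u u + (N * B + N * B) + ΣF m (λ k → b k * Gl.Hb b k) ≡ ΣF m (λ k → c k * Deg σ Ψ (Dl k ∷ w ∷ w ∷ W))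
        total = trans (sym Qww) (trans (swap₂ w) (split (w ∷ w ∷ W)))
          where
          swap₂ : ∀ w → Deg σ Ψ (w ∷ w ∷ c₁ ∷ W) ≡ Deg σ Ψ (c₁ ∷ w ∷ w ∷ W)
          swap₂ w = trans (Deg-swap₂ w) (Deg-swap fs Ψ w c₁ (w ∷ W))
            where
            Deg-swap₂ : ∀ w → Deg σ Ψ (w ∷ w ∷ c₁ ∷ W) ≡ Deg σ Ψ (w ∷ c₁ ∷ w ∷ W)
            Deg-swap₂ w = Deg-swap-at fs Ψ w w c₁ W
        bound : ∀ k → 0ℤ < c k → Deg σ Ψ (Dl k ∷ w ∷ w ∷ W) * Gl.q k ≤ (N * g k + Gl.Hb b k) * (N * g k + Gl.Hb b k)
        bound k p = subst₂ _≤_ (cong (λ t → Deg σ Ψ (Dl k ∷ w ∷ w ∷ W) * t) (sym (q-eq k))) (cong₂ _*_ (Qkw k) (Qkw k))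
          (piece-index (piece k (λ eq → ℤP.<-irrefl (sym eq) p)) w)

  -- Surfaces

  D-full : ∀ σ → suc (length σ) ≡ R → D σ [] ≡ 1ℤ
  D-full σ e = sel-yes (suc (length σ) ℕP.≟ R) e

  D₁ : ∀ σ → suc (suc (length σ)) ≡ R → ∀ φ → D σ (φ ∷ []) ≡ sumLk σ (hat σ φ)
  D₁ σ e φ = sumLk-cong {σ} (λ G _ → trans (*R (hat σ φ G) (D-full (G ∷ σ) e)) (ℤP.*-identityʳ (hat σ φ G)))

  module TwoSteps {σ} (fs : Flag σ) (len : suc (suc (suc (length σ))) ≡ R) (v w : ℕ) (v>0 : 0 ℕ.< v) (v<w : v ℕ.< w) (w<R : w ℕ.< R)
    (¬v : ¬ Covered σ v) (¬w : ¬ Covered σ w) where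

    v<R : v ℕ.< R
    v<R = ℕP.<-trans v<w w<R
    w>0 : 0 ℕ.< w
    w>0 = ℕP.<-trans v>0 v<w
    module gv = Gap fs v v>0 v<R ¬v
    module gw = Gap fs w w>0 w<R ¬w

    line : ∃[ G ] (Link σ G × r G ≡ w)
    line = exists-link fs w w>0 w<R ¬w
    l₀ : Subset n
    l₀ = proj₁ line
    ll : Link σ l₀
    ll = proj₁ (proj₂ line)
    rl : r l₀ ≡ w
    rl = proj₂ (proj₂ line)

    point : ∃[ G ] (Link σ G × r G ≡ v)
    point = exists-link fs v v>0 v<R ¬v

    ¬v-l : ¬ Covered (l₀ ∷ σ) v
    ¬v-l (here e) = ℕP.<-irrefl (trans (sym e) rl) v<w
    ¬v-l (there c) = ¬v c

    covered-other : ∀ s → 0 ℕ.< s → s ℕ.< R → s ≢ v → s ≢ w → Covered σ s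
    covered-other s s>0 s<R s≢v s≢w =
      let (_ , lp , rp) = exists-link (ll ∷ fs) v v>0 v<R ¬v-l in
      drop (almost-full (ll ∷ fs) len lp s>0 s<R (λ e → s≢v (trans e rp)))
      where
      drop : Covered (l₀ ∷ σ) s → Covered σ s
      drop (here e) = ⊥-elim (s≢w (trans (sym e) rl))
      drop (there c) = c

    link-ranks : ∀ {G} → Link σ G → r G ≡ v ⊎ r G ≡ w
    link-ranks {G} l with r G ℕP.≟ v | r G ℕP.≟ w
    ... | yes e | _ = inj₁ e
    ... | no _ | yes e = inj₂ e
    ... | no a | no b = ⊥-elim (link-uncovered fs l (covered-other (r G) (proj₁ (link-rank l)) (proj₂ (link-rank l)) a b))

    -- the hyperplane class of the upper of the two gaps
    h : Fun
    h H = sel (w ℕP.<? r H) -1ℤ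

    h-low : ∀ {H} → r H ℕ.≤ w → h H ≡ 0ℤ
    h-low {H} le = sel-no (w ℕP.<? r H) (ℕP.≤⇒≯ le)

    h-high : ∀ {H} → w ℕ.< r H → h H ≡ -1ℤ
    h-high {H} lt = sel-yes (w ℕP.<? r H) lt

    h+ : Fin n → Fun
    h+ j H = mem j H + h H

    D-h+ : ∀ {τ} → Flag τ → ∀ j φs → D τ (h ∷ φs) ≡ D τ (h+ j ∷ φs)
    D-h+ ft j φs = sym (D-modLin ft {h} {h+ j} φs (Lin-cong (λ G → ring (mem j G) (h G)) (Lin-mem j)))
      where
      ring : ∀ a b → a ≡ a + b - b
      ring = solve-∀

    h+-Van : ∀ {τ} j → All (λ F → (r F ℕ.≤ w → j ∉ F) × (w ℕ.< r F → j ∈ F)) τ → Van τ (h+ j)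
    h+-Van {τ} j a = cong₂ _+_ (mem-∉ {n} {j} {⊥} ∉⊥) (h-low {⊥} (subst (ℕ._≤ w) (sym r-⊥) z≤n)) ,
        cong₂ _+_ (mem-∈ {n} {j} {⊤} ∈⊤) (h-high {⊤} w<R) , All.map (λ {F} → at {F}) a
      where
      at : ∀ {F} → (r F ℕ.≤ w → j ∉ F) × (w ℕ.< r F → j ∈ F) → h+ j F ≡ 0ℤ
      at {F} (p , q) with w ℕP.<? r F
      ... | yes lt = trans (cong (λ z → z + -1ℤ) (mem-∈ (q lt))) refl
      ... | no ¬lt = trans (cong (λ z → z + 0ℤ) (mem-∉ (p (ℕP.≮⇒≥ ¬lt)))) refl

    -- For `j` in the upper end of the gap but outside `G`, the representative `mem j + h` vanishes
    -- on everything below `G`.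
    D-h-line : ∀ {G} → Link σ G → r G ≡ w → D (G ∷ σ) (h ∷ []) ≡ 0ℤ
    D-h-line {G} l e =
      let (j , j∈ , j∉) = ⊆∧≢⇒∃ (gw.link⊆hi l e) (λ eq → ℕP.<-irrefl (sym (trans (sym (cong r eq)) e)) gw.hi>) in
      trans (D-h+ (l ∷ fs) j []) (D-null (h+ j) [] (h+-Van j (members j j∈ j∉)) (λ H lH →
        let (s , le) = below lH in cong₂ _+_ (mem-∉ (λ j∈H → j∉ (s j∈H))) (h-low le)))
      where
      members : ∀ j → j ∈ gw.hi → j ∉ G → All (λ F → (r F ℕ.≤ w → j ∉ F) × (w ℕ.< r F → j ∈ F)) (G ∷ σ)
      members j j∈ j∉ = ((λ _ → j∉) , (λ lt → ⊥-elim (ℕP.<-irrefl (sym e) lt))) ∷ All.tabulate (λ {F} F∈ →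
        (λ le j∈F → j∉ (side F∈ le j∈F)) , (λ lt → All.lookup gw.ahi F∈ lt j∈))
        where
        side : ∀ {F} → F ∈ₗ σ → r F ℕ.≤ w → F ⊆ G
        side {F} F∈ le = go (All.lookup (cmps l) F∈)
          where
          go : Cmp F G → F ⊆ G
          go (inj₁ s , _) = s
          go (inj₂ s , ne) = ⊥-elim (ℕP.<⇒≱ (flat-< (flat l) s (ne ∘ sym)) (subst (r F ℕ.≤_) (sym e) le))
      below : ∀ {H} → Link (G ∷ σ) H → H ⊆ G × r H ℕ.≤ w
      below {H} lH = go (link-head lH) (link-ranks (link-tail lH))
        where
        go : Cmp G H → r H ≡ v ⊎ r H ≡ w → H ⊆ G × r H ℕ.≤ w
        go (inj₂ s , ne) _ = s , subst (r H ℕ.≤_) e (r-mono s)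
        go (inj₁ s , ne) (inj₁ e') = ⊥-elim (ℕP.<⇒≱ v<w (subst₂ ℕ._≤_ e e' (r-mono s)))
        go (inj₁ s , ne) (inj₂ e') = ⊥-elim (ne (flat-≡ (flat l) s (ℕP.≤-reflexive (trans e' (sym e)))))

    -- Among the flats of rank `w` above the point, exactly one contains the chosen `j`.
    D-h-point : ∀ {G} → Link σ G → r G ≡ v → D (G ∷ σ) (h ∷ []) ≡ 1ℤ
    D-h-point {G} l e =
      let (j , j∈ , j∉) = ⊆∧≢⇒∃ g.lo⊆hi (λ eq → ℕP.<-irrefl (cong r eq) (ℕP.<-trans g.lo< g.hi>)) in
      trans (D-h+ (l ∷ fs) j [])
      (trans (D-Van (h+ j) [] (h+-Van j (members j j∈ j∉)))
      (trans (sumLk-cong {G ∷ σ} {g = mem j} (λ H lH → trans (*R (h+ j H) (D-full (H ∷ G ∷ σ) len)) (trans (ℤP.*-identityʳ (h+ j H))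
                 (trans (+R (mem j H) (h-low (ℕP.≤-reflexive (all lH)))) (ℤP.+-identityʳ (mem j H))))))
      (trans (sumLk-point {G ∷ σ} (cl (g.lo ∪ ⁅ j ⁆)) (g.atom-link r-lo j∉ j∈) (λ H lH ne → mem-∉ (λ j∈H → ne (g.atom-unique r-lo j∉ lH (all lH) j∈H))))
             (mem-∈ (g.atom-∋ j)))))
      where
      ¬w' : ¬ Covered (G ∷ σ) w
      ¬w' (here e') = ℕP.<-irrefl (trans (sym e) e') v<w
      ¬w' (there c) = ¬w c
      module g = Gap (l ∷ fs) w w>0 w<R ¬w'
      cov : ∀ s → 0 ℕ.< s → suc s ≡ w → Covered (G ∷ σ) s
      cov s s>0 e' with s ℕP.≟ v
      ... | yes s≡v = here (trans e (sym s≡v))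
      ... | no s≢v = there (covered-other s s>0 (ℕP.<-trans (ℕP.≤-reflexive e') w<R) s≢v (λ s≡w → ℕP.<-irrefl s≡w (ℕP.≤-reflexive e')))
      r-lo : suc (r g.lo) ≡ w
      r-lo = g.r-lo cov
      all : ∀ {H} → Link (G ∷ σ) H → r H ≡ w
      all {H} lH = [ (λ e' → ⊥-elim (link-uncovered (l ∷ fs) lH (here (trans e (sym e'))))) , id ]′ (link-ranks (link-tail lH))
      members : ∀ j → j ∈ g.hi → j ∉ g.lo → All (λ F → (r F ℕ.≤ w → j ∉ F) × (w ℕ.< r F → j ∈ F)) (G ∷ σ)
      members j j∈ j∉ = All.tabulate (λ {F} F∈ → (λ le j∈F → j∉ (All.lookup g.alo F∈ (ℕP.≤∧≢⇒< le (λ e' → ¬w' (Any.map (λ { refl → e' }) F∈))) j∈F)) ,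
        (λ lt → All.lookup g.ahi F∈ lt j∈))

    coef : Fun → Fun
    coef u p = sel (link? σ p) (sel (r p ℕP.≟ v) (hat σ u p))

    a : Fun → ℤ
    a u = ΣS (coef u)

    D-h : ∀ u → D σ (u ∷ h ∷ []) ≡ a u
    D-h u = sumLk-cong {σ} (λ G l → go G l (r G ℕP.≟ v))
      where
      go : ∀ G → Link σ G → (d : Dec (r G ≡ v)) → hat σ u G * D (G ∷ σ) (h ∷ []) ≡ sel d (hat σ u G)
      go G l (yes e) = trans (*R (hat σ u G) (D-h-point l e)) (ℤP.*-identityʳ (hat σ u G))
      go G l (no ne) = trans (*R (hat σ u G) (D-h-line l ([ (λ e → ⊥-elim (ne e)) , id ]′ (link-ranks l)))) (ℤP.*-zeroʳ (hat σ u G))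

    base? : ∀ p → Dec (∃[ x ] (x ∈ p × x ∉ gv.lo))
    base? p = FinP.any? (λ x → (x ∈? p) ×-dec ¬? (x ∈? gv.lo))

    xp' : ∀ {p} → Dec (∃[ x ] (x ∈ p × x ∉ gv.lo)) → Fin n
    xp' (yes (x , _)) = x
    xp' (no _) = zero

    -- A marker for the flat `p` of rank `v`: an element outside the lower end of the gap, which
    -- therefore lies in no other such flat.
    xp : Subset n → Fin n
    xp p = xp' (base? p)

    xp-spec : ∀ {p} → Link σ p → r p ≡ v → xp p ∈ p × xp p ∉ gv.lo
    xp-spec {p} l e = go (base? p)
      where
      go : (d : Dec (∃[ x ] (x ∈ p × x ∉ gv.lo))) → xp' d ∈ p × xp' d ∉ gv.lo
      go (yes (_ , s)) = s
      go (no ¬s) = ⊥-elim (¬s (⊆∧≢⇒∃ (gv.lo⊆link l e) (λ eq → ℕP.<-irrefl (trans (cong r eq) e) gv.lo<)))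

    gv-lo : suc (r gv.lo) ≡ v
    gv-lo = gv.r-lo (λ s s>0 e → covered-other s s>0 (ℕP.<-trans (ℕP.≤-reflexive e) v<R) (λ s≡v → ℕP.<-irrefl s≡v (ℕP.≤-reflexive e))
      (λ s≡w → ℕP.<-irrefl s≡w (ℕP.<-trans (ℕP.≤-reflexive e) v<w)))

    -- move u by a linear function so that it vanishes at the points; this needs a u = 0
    module Primitive (u : Fun) (au : a u ≡ 0ℤ) where
      Lx : Fun
      Lx H = ΣF (size n) (λ k → coef u (enum n k) * mem (xp (enum n k)) H)

      Lx-Lin : Lin Lx
      Lx-Lin = Lin-ΣF (size n) (λ k H → coef u (enum n k) * mem (xp (enum n k)) H) (λ k → Lin-* (coef u (enum n k)) (Lin-mem (xp (enum n k))))

      u' : Fun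
      u' H = hat σ u H - Lx H

      coef-case : ∀ p {P : ℤ → Set} → P 0ℤ → (Link σ p → r p ≡ v → P (hat σ u p)) → P (coef u p)
      coef-case p {P} z f = go (link? σ p) (r p ℕP.≟ v)
        where
        go : (d : Dec (Link σ p)) (d' : Dec (r p ≡ v)) → P (sel d (sel d' (hat σ u p)))
        go (yes l) (yes e) = f l e
        go (yes _) (no _) = z
        go (no _) _ = z

      Lx-low : ∀ {F} → (∀ {p} → Link σ p → r p ≡ v → xp p ∉ F) → Lx F ≡ 0ℤ
      Lx-low {F} out = ΣF-0 (size n) (λ k → coef-case (enum n k) {λ c → c * mem (xp (enum n k)) F ≡ 0ℤ} refl
        (λ l e → trans (*R (hat σ u (enum n k)) (mem-∉ (out l e))) (ℤP.*-zeroʳ (hat σ u (enum n k)))))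

      -- All markers lie in `F`, so `Lx F` is the sum `a u` of the coefficients. This is the point
      -- where primitivity enters.
      Lx-high : ∀ {F} → (∀ {p} → Link σ p → r p ≡ v → xp p ∈ F) → Lx F ≡ 0ℤ
      Lx-high {F} inn = trans (ΣF-cong (size n) (λ k → coef-case (enum n k) {λ c → c * mem (xp (enum n k)) F ≡ c} refl
        (λ l e → trans (*R (hat σ u (enum n k)) (mem-∈ (inn l e))) (ℤP.*-identityʳ (hat σ u (enum n k)))))) au

      Lx-point : ∀ {p} → Link σ p → r p ≡ v → Lx p ≡ hat σ u p
      Lx-point {p} l e = trans (ΣS-point p (λ q → coef u q * mem (xp q) p) (λ q ne → coef-case q {λ c → c * mem (xp q) p ≡ 0ℤ} refl
            (λ l' e' → trans (*R (hat σ u q) (mem-∉ (λ x∈ → ne (trans (gv.atom-unique gv-lo (proj₂ (xp-spec l' e')) l' e' (proj₁ (xp-spec l' e')))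
                                      (sym (gv.atom-unique gv-lo (proj₂ (xp-spec l' e')) l e x∈)))))) (ℤP.*-zeroʳ (hat σ u q)))))
        (trans (cong₂ _*_ (trans (sel-yes (link? σ p) l) (sel-yes (r p ℕP.≟ v) e)) (mem-∈ (proj₁ (xp-spec l e)))) (ℤP.*-identityʳ (hat σ u p)))

      u'-Van : Van σ u'
      u'-Van = let (p , q , s) = hat-Van fs u in
        cong₂ _-_ p (Lx-low (λ _ _ → ∉⊥)) , cong₂ _-_ q (Lx-high (λ _ _ → ∈⊤)) ,
        All.tabulate (λ {F} F∈ → cong₂ _-_ (All.lookup s F∈) (member F∈ (r F ℕP.<? v)))
        where
        member : ∀ {F} → F ∈ₗ σ → Dec (r F ℕ.< v) → Lx F ≡ 0ℤ
        member {F} F∈ (yes lt) = Lx-low (λ l e x∈ → proj₂ (xp-spec l e) (All.lookup gv.alo F∈ lt x∈))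
        member {F} F∈ (no ¬lt) = Lx-high (λ {p} l e → up l e (All.lookup (cmps l) F∈) (proj₁ (xp-spec l e)))
          where
          up : ∀ {p} → Link σ p → r p ≡ v → Cmp F p → p ⊆ F
          up l e (inj₂ s , _) = s
          up l e (inj₁ s , ne) = ⊥-elim (¬lt (subst (r F ℕ.<_) e (flat-< (proj₁ (flag-member fs F∈)) s ne)))

      u'-point : ∀ {p} → Link σ p → r p ≡ v → u' p ≡ 0ℤ
      u'-point l e = ℤP.i≡j⇒i-j≡0 (sym (Lx-point l e))

      u'-diff : Lin (λ G → u G - u' G)
      u'-diff = Lin-cong (λ G → ring (u G) (hat σ u G) (Lx G)) (Lin-+ (hat-diff σ u) Lx-Lin)
        where
        ring : ∀ u h l → u - h + l ≡ u - (h - l)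
        ring = solve-∀

      move : D σ (u ∷ u ∷ []) ≡ D σ (u' ∷ u' ∷ [])
      move = trans (D-modLin fs {u'} {u} (u ∷ []) u'-diff) (trans (D-swap fs u' u []) (D-modLin fs {u'} {u} (u' ∷ []) u'-diff))

      S : Fun
      S l = sumLk (l ∷ σ) (μ σ l)

      line-below : ∀ {l H} → Link σ l → r l ≡ w → Link (l ∷ σ) H → (H ⊆ l) × r H ≡ v
      line-below {l} {H} k e lH = go (link-head lH) (link-ranks (link-tail lH))
        where
        go : Cmp l H → r H ≡ v ⊎ r H ≡ w → H ⊆ l × r H ≡ v
        go _ (inj₂ e') = ⊥-elim (link-uncovered (k ∷ fs) lH (here (trans e (sym e'))))
        go (inj₂ s , ne) (inj₁ e') = s , e'
        go (inj₁ s , ne) (inj₁ e') = ⊥-elim (ℕP.<⇒≱ v<w (subst₂ ℕ._≤_ e e' (r-mono s)))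

      D-line : ∀ {l} → Link σ l → r l ≡ w → D (l ∷ σ) (u' ∷ []) ≡ - u' l * S l
      D-line {l} k e = trans (D₁ (l ∷ σ) len u') (trans (sumLk-cong {l ∷ σ} (λ H lH →
          trans (cong₂ (λ x y → x - y * μ σ l H) (trans (hat-id σ u' u'-Van H) (u'-point (link-tail lH) (proj₂ (line-below k e lH)))) (hat-id σ u' u'-Van l)) (ring (u' l) (μ σ l H))))
        (sumLk-* (l ∷ σ) (- u' l) (μ σ l)))
        where
        ring : ∀ a m → 0ℤ - a * m ≡ - a * m
        ring = solve-∀

      S≥0 : ∀ {l} → Link σ l → r l ≡ w → 0ℤ ≤ S l
      S≥0 {l} k e = sumLk-≥0 {l ∷ σ} (λ H lH → μ-≥0 σ (proj₁ (line-below k e lH)))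

      -- After the move `u'` lives on the flats `l` of rank `w` only, and each contributes
      -- `- u' l * u' l * S l` with `S l ≥ 0`.
      negative : D σ (u ∷ u ∷ []) ≤ 0ℤ
      negative = subst (_≤ 0ℤ) (sym (trans move (D-Van u' (u' ∷ []) u'-Van))) (0≤-⇒≤ {sumLk σ X} {0ℤ} nonneg)
        where
        X : Fun
        X G = u' G * D (G ∷ σ) (u' ∷ [])
        neg : sumLk σ (λ G → -1ℤ * X G) ≡ 0ℤ - sumLk σ X
        neg = trans (sumLk-* σ -1ℤ X) (ring (sumLk σ X))
          where
          ring : ∀ x → -1ℤ * x ≡ 0ℤ - x
          ring = solve-∀
        term : ∀ {G} → Link σ G → r G ≡ v ⊎ r G ≡ w → 0ℤ ≤ -1ℤ * X G
        term {G} l (inj₁ e) = ℤP.≤-reflexive (sym (cong (λ z → -1ℤ * (z * D (G ∷ σ) (u' ∷ []))) (u'-point l e)))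
        term {G} l (inj₂ e) = subst (0ℤ ≤_) (trans (ring (u' G) (S G)) (cong (λ z → -1ℤ * (u' G * z)) (sym (D-line l e)))) (mul≥0 (sq≥0 (u' G)) (S≥0 l e))
          where
          ring : ∀ a s → a * a * s ≡ -1ℤ * (a * (- a * s))
          ring = solve-∀
        nonneg : 0ℤ ≤ 0ℤ - sumLk σ X
        nonneg = subst (0ℤ ≤_) neg (sumLk-≥0 {σ} {λ G → -1ℤ * X G} (λ G l → term l (link-ranks l)))

    a-pos : ∀ c → Van σ c → (∀ G → Link σ G → 0ℤ < c G) → 0ℤ < D σ (c ∷ h ∷ [])
    a-pos c van pos = subst (0ℤ <_) (sym (D-Van c (h ∷ []) van)) total
      where
      X : Fun
      X G = c G * D (G ∷ σ) (h ∷ [])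
      val : ∀ {G} → Link σ G → r G ≡ v → X G ≡ c G
      val {G} l e = trans (*R (c G) (D-h-point l e)) (ℤP.*-identityʳ (c G))
      nn : ∀ {G} → Link σ G → r G ≡ v ⊎ r G ≡ w → 0ℤ ≤ X G
      nn {G} l (inj₁ e) = subst (0ℤ ≤_) (sym (val l e)) (pos⇒nn (pos G l))
      nn {G} l (inj₂ e) = ℤP.≤-reflexive (sym (trans (*R (c G) (D-h-line l e)) (ℤP.*-zeroʳ (c G))))
      total : 0ℤ < sumLk σ X
      total = sumLk->0 {σ} {X} (λ G k → nn k (link-ranks k)) (proj₁ point) (proj₁ (proj₂ point))
        (subst (0ℤ <_) (sym (val (proj₁ (proj₂ point)) (proj₂ (proj₂ point)))) (pos (proj₁ point) (proj₁ (proj₂ point))))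

  -- Surfaces with three, two and one root

  twist : Letter → Fun → Fun
  twist (φ , s) χ G = φ G + s * χ G

  Deg-cons : ∀ {σ} → Flag σ → ∀ ψ Ψ u vs →
    Deg σ (ψ ∷ Ψ) (u ∷ vs) ≡ sumLk σ (λ G → hat σ (twist u ψ) G * Deg (G ∷ σ) (ψ ∷ Ψ) vs) + proj₂ u * Deg σ Ψ vs
  Deg-cons {σ} fs ψ Ψ u@(φ , s) vs = Deg-split fs ψ Ψ φ s vs (hat σ f) (λ G → -1ℤ * (f G - hat σ f G))
      (λ G → ring (φ G + s * ψ G) (hat σ f G)) (Lin-* -1ℤ (hat-diff σ f)) (hat-Van fs f)
    where
    f : Fun
    f = twist u ψ
    ring : ∀ a b → b ≡ a + -1ℤ * (a - b)
    ring = solve-∀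

  Deg-full : ∀ {σ} → Flag σ → suc (length σ) ≡ R → ∀ ψ Ψ u vs → Deg σ (ψ ∷ Ψ) (u ∷ vs) ≡ proj₂ u * Deg σ Ψ vs
  Deg-full {σ} fs full ψ Ψ u vs = trans (Deg-cons fs ψ Ψ u vs)
    (trans (cong (λ w → w + proj₂ u * Deg σ Ψ vs) (sumLk-0 {σ} {λ G → hat σ (twist u ψ) G * Deg (G ∷ σ) (ψ ∷ Ψ) vs} (λ G l → ⊥-elim (full-no-link fs (cong ℕ.pred full) l))))
           (ℤP.+-identityˡ (proj₂ u * Deg σ Ψ vs)))

  Deg-line : ∀ {σ} → Flag σ → ∀ ψ u vs →
    Deg σ (ψ ∷ []) (u ∷ vs) ≡ sumLk σ (λ G → hat σ (twist u ψ) G * Deg (G ∷ σ) (ψ ∷ []) vs)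
  Deg-line {σ} fs ψ u vs = trans (Deg-cons fs ψ [] u vs) (trans (+R S (trans (*R (proj₂ u) (Deg-[] σ vs)) (ℤP.*-zeroʳ (proj₂ u)))) (ℤP.+-identityʳ S))
    where
    S : ℤ
    S = sumLk σ (λ G → hat σ (twist u ψ) G * Deg (G ∷ σ) (ψ ∷ []) vs)

  HI : (Letter → Letter → ℤ) → Set
  HI Q = ∀ u (a : Amp) → Q u u * Q (letter a) (letter a) ≤ Q u (letter a) * Q u (letter a)

  HI-cong : ∀ {Q Q'} → (∀ u w → Q u w ≡ Q' u w) → HI Q' → HI Q
  HI-cong h hi u a = subst₂ _≤_ (sym (cong₂ _*_ (h u u) (h (letter a) (letter a)))) (sym (cong₂ _*_ (h u (letter a)) (h u (letter a)))) (hi u a)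

  -- Over a complete flag only the multiples of `δ` survive, so the form has rank one and equality
  -- holds.
  surface-fibre : ∀ {σ} → Flag σ → suc (length σ) ≡ R → ∀ ψ₁ ψ₂ ψ₃ → HI (λ u w → Deg σ (ψ₁ ∷ ψ₂ ∷ ψ₃ ∷ []) (u ∷ w ∷ []))
  surface-fibre {σ} fs full ψ₁ ψ₂ ψ₃ = HI-cong {Q' = λ u w → proj₂ u * (proj₂ w * κ)}
      (λ u w → trans (Deg-full fs full ψ₁ (ψ₂ ∷ ψ₃ ∷ []) u (w ∷ [])) (*R (proj₂ u) (Deg-full fs full ψ₂ (ψ₃ ∷ []) w [])))
      (λ u a → ℤP.≤-reflexive (ring (proj₂ u) (z a) κ))
    where
    κ : ℤ
    κ = Deg σ (ψ₃ ∷ []) []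
    ring : ∀ s t k → s * (s * k) * (t * (t * k)) ≡ s * (t * k) * (s * (t * k))
    ring = solve-∀

  -- Over a curve the form involves only the `δ`-coefficients and the base degrees `p`. The two
  -- sides differ by the square of the determinant formed by these data of `u` and of the ample
  -- letter.
  surface-ruled : ∀ {σ} → Flag σ → suc (suc (length σ)) ≡ R → ∀ ψ₁ ψ₂ → HI (λ u w → Deg σ (ψ₁ ∷ ψ₂ ∷ []) (u ∷ w ∷ []))
  surface-ruled {σ} fs len ψ₁ ψ₂ = HI-cong {Q' = Q'} eq (λ u a → 0≤-⇒≤ {Q' u u * Q' (letter a) (letter a)} (subst (0ℤ ≤_)
      (ring (proj₂ u) (z a) (p (proj₁ u)) (p (proj₁ (letter a))) (p ψ₁) (p ψ₂)) (sq≥0 (z a * p (proj₁ u) - proj₂ u * p (proj₁ (letter a))))))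
    where
    p : Fun → ℤ
    p f = sumLk σ (hat σ f)
    Q' : Letter → Letter → ℤ
    Q' (φ , s) (φ' , s') = s' * (p φ + s * p ψ₁) + s * (p φ' + s' * p ψ₂)
    ring : ∀ s t a b k l → (t * a - s * b) * (t * a - s * b) ≡
      (t * (a + s * k) + s * (b + t * l)) * (t * (a + s * k) + s * (b + t * l)) - (s * (a + s * k) + s * (a + s * l)) * (t * (b + t * k) + t * (b + t * l))
    ring = solve-∀
    p-twist : ∀ u f → p (twist u f) ≡ p (proj₁ u) + proj₂ u * p f
    p-twist (φ , s) f = trans (sumLk-cong {σ} (λ G _ → trans (hat-cong σ {φ' } {λ H → 1ℤ * φ H + s * f H} (λ H → cong (λ w → w + s * f H) (sym (ℤP.*-identityˡ (φ H)))) G) (hat-comb σ 1ℤ s φ f G)))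
      (trans (sumLk-lin σ 1ℤ s (hat σ φ) (hat σ f)) (cong (λ w → w + s * p f) (ℤP.*-identityˡ (p φ))))
      where
      φ' : Fun
      φ' = twist (φ , s) f
    fibre : ∀ w G → Link σ G → Deg (G ∷ σ) (ψ₁ ∷ ψ₂ ∷ []) (w ∷ []) ≡ proj₂ w
    fibre w G l = trans (Deg-full (l ∷ fs) len ψ₁ (ψ₂ ∷ []) w []) (trans (*R (proj₂ w) (D-full (G ∷ σ) len)) (ℤP.*-identityʳ (proj₂ w)))
    base : ∀ w → Deg σ (ψ₂ ∷ []) (w ∷ []) ≡ p (twist w ψ₂)
    base w = trans (Deg-line fs ψ₂ w []) (sumLk-cong {σ} (λ G _ → trans (*R (hat σ (twist w ψ₂) G) (D-full (G ∷ σ) len)) (ℤP.*-identityʳ (hat σ (twist w ψ₂) G))))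
    eq : ∀ u w → Deg σ (ψ₁ ∷ ψ₂ ∷ []) (u ∷ w ∷ []) ≡ Q' u w
    eq u w = trans (Deg-cons fs ψ₁ (ψ₂ ∷ []) u (w ∷ []))
      (cong₂ _+_ (trans (sumLk-cong {σ} {g = λ G → proj₂ w * hat σ (twist u ψ₁) G} (λ G l → trans (*R (hat σ (twist u ψ₁) G) (fibre w G l)) (ℤP.*-comm (hat σ (twist u ψ₁) G) (proj₂ w))))
                   (trans (sumLk-* σ (proj₂ w) (hat σ (twist u ψ₁))) (*R (proj₂ w) (p-twist u ψ₁))))
                 (*R (proj₂ u) (trans (base w) (p-twist w ψ₂))))

  two-gaps : ∀ {σ} → Flag σ → suc (suc (suc (length σ))) ≡ R →
    ∃[ v ] ∃[ w ] (0 ℕ.< v × v ℕ.< w × w ℕ.< R × ¬ Covered σ v × ¬ Covered σ w)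
  two-gaps {σ} fs len =
    let (t , t>0 , t<R , ¬t) = missing fs (ℕP.≤-trans (ℕP.n≤1+n _) (ℕP.≤-reflexive (cong ℕ.pred len)))
        (G , l , rG)         = exists-link fs t t>0 t<R ¬t
        (s , s>0 , s<R , ¬s) = missing (l ∷ fs) (ℕP.≤-reflexive (cong ℕ.pred len))
    in go t>0 t<R ¬t s>0 s<R (¬s ∘ there) (λ e → ¬s (here (trans rG e))) (ℕP.<-cmp t s)
    where
    open import Relation.Binary.Definitions using (Tri; tri<; tri≈; tri>)
    go : ∀ {t s} → 0 ℕ.< t → t ℕ.< R → ¬ Covered σ t → 0 ℕ.< s → s ℕ.< R → ¬ Covered σ s → t ≢ s → Tri (t ℕ.< s) (t ≡ s) (s ℕ.< t) →
      ∃[ v ] ∃[ w ] (0 ℕ.< v × v ℕ.< w × w ℕ.< R × ¬ Covered σ v × ¬ Covered σ w)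
    go {t} {s} t>0 t<R ¬t s>0 s<R ¬s ne (tri< lt _ _) = t , s , t>0 , lt , s<R , ¬t , ¬s
    go t>0 t<R ¬t s>0 s<R ¬s ne (tri≈ _ e _) = ⊥-elim (ne e)
    go {t} {s} t>0 t<R ¬t s>0 s<R ¬s ne (tri> _ _ gt) = s , t , s>0 , gt , t<R , ¬s , ¬t

  -- With one root `δ` equals that root and the bundle is the star itself. `reverse-CS` carries
  -- negativity from the complement of `h`, where it is computed directly, to an arbitrary ample
  -- letter.
  surface-base : ∀ {σ T e} → Flag σ → Valid T (e ∷ []) → Van σ (ψ T e) → suc (suc (suc (length σ))) ≡ R →
    HI (λ u w → Deg σ (ψ T e ∷ []) (u ∷ w ∷ []))
  surface-base {σ} {T} {e} fs v van len =
      let (v , w , v>0 , v<w , w<R , ¬v , ¬w) = two-gaps fs len in λ u a → go v w v>0 v<w w<R ¬v ¬w a u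
    where
    χ : Fun
    χ = ψ T e
    Q : Letter → Letter → ℤ
    Q u w = Deg σ (χ ∷ []) (u ∷ w ∷ [])
    eq : ∀ u w → Q u w ≡ D σ (twist u χ ∷ twist w χ ∷ [])
    eq u w = trans (Deg-line fs χ u (w ∷ [])) (sumLk-cong {σ} (λ G l → *R (hat σ (twist u χ) G) (Deg-line (l ∷ fs) χ w [])))
    go : ∀ v w → 0 ℕ.< v → v ℕ.< w → w ℕ.< R → ¬ Covered σ v → ¬ Covered σ w → ∀ a u →
      Q u u * Q (letter a) (letter a) ≤ Q u (letter a) * Q u (letter a)
    go p q p>0 p<q q<R ¬p ¬q a = reverse-CS Q (λ u w → Deg-swap fs (χ ∷ []) u w []) (λ a u b v w → Deg-comb fs (χ ∷ []) a u b v (w ∷ []))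
        c₁ (letter a) negative (positive (a ∷ a ∷ []) fs v dim) c₁-pos
      where
      module G = TwoSteps fs len p q p>0 p<q q<R ¬p ¬q
      c₁ : Letter
      c₁ = G.h , 0ℤ
      dim : Dim σ (e ∷ []) 2
      dim = trans (cong suc len) (ℕP.+-comm 1 R)
      tw-h : ∀ φs → D σ (twist c₁ χ ∷ φs) ≡ D σ (G.h ∷ φs)
      tw-h φs = D-cong σ φs (λ H → ℤP.+-identityʳ (G.h H))
      Q-h : ∀ u → Q u c₁ ≡ D σ (twist u χ ∷ G.h ∷ [])
      Q-h u = trans (eq u c₁) (trans (D-swap fs (twist u χ) (twist c₁ χ) []) (trans (tw-h (twist u χ ∷ [])) (D-swap fs G.h (twist u χ) [])))
      negative : ∀ u → Q u c₁ ≡ 0ℤ → Q u u ≤ 0ℤ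
      negative u z = subst (_≤ 0ℤ) (sym (eq u u)) (G.Primitive.negative (twist u χ) (trans (sym (G.D-h (twist u χ))) (trans (sym (Q-h u)) z)))
      open LocalRep (local-rep fs van a)
      c₁-pos : 0ℤ < Q c₁ (letter a)
      c₁-pos = subst (0ℤ <_) (trans (D-modLin fs {twist (letter a) χ} {φ°} (G.h ∷ []) (Lin-cong (λ G → trans (ring (twist (letter a) χ G) (ℓ G)) (cong (λ z → z - twist (letter a) χ G) (sym (φ°-eq G)))) ℓ-Lin))
                 (trans (sym (Q-h (letter a))) (Deg-swap fs (χ ∷ []) (letter a) c₁ []))) (G.a-pos φ° φ°-Van φ°>0)
        where
        ring : ∀ a b → b ≡ a + b - a
        ring = solve-∀

  hodge-index : ∀ C {σ T e es} → Flag σ → Valid T (e ∷ es) → Dim σ (e ∷ es) (suc (suc (length C))) → HodgeIndex σ (roots T (e ∷ es)) C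
  hodge-adapted : ∀ C {σ T e es} → Flag σ → Valid T (e ∷ es) → Van σ (ψ T e) → Dim σ (e ∷ es) (suc (suc (length C))) → HodgeIndex σ (ψ T e ∷ roots (T ∪₁ e) es) C

  hodge-index C {σ} {T} {e₀} {es₀} fs v dim =
    HI-cong {λ u w → Deg σ (roots T (e₀ ∷ es₀)) (u ∷ w ∷ word C)} (λ u w → same fs (u ∷ w ∷ word C))
      (hodge-adapted C fs valid van (trans dim (cong (R ℕ.+_) len)))
    where
    open Adapted (adapt fs v)

  hodge-adapted (a₁ ∷ C) {σ} {T} {e} {es} fs v van dim u a =
    reverse-CS Q Q-sym (λ a u b v w → Deg-comb fs (roots T (e ∷ es)) a u b v (w ∷ word (a₁ ∷ C))) (letter a₁) (letter a) conclude
      (positive (a ∷ a ∷ a₁ ∷ C) fs v dim) (positive (a₁ ∷ a ∷ a₁ ∷ C) fs v dim) u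
    where
    open Step fs v van a₁ C dim (hodge-index C) using (Q; Q-sym; conclude)
  hodge-adapted [] {σ} {T} {e} {[]} fs v van dim = surface-base fs v van (ℕP.suc-injective (trans dim (ℕP.+-comm R 1)))
  hodge-adapted [] {σ} {T} {e} {e₁ ∷ []} fs v van dim =
    surface-ruled fs (ℕP.suc-injective (ℕP.suc-injective (trans dim (ℕP.+-comm R 2)))) (ψ T e) (ψ (T ∪₁ e) e₁)
  hodge-adapted [] {σ} {T} {e} {e₁ ∷ e₂ ∷ []} fs v van dim =
    surface-fibre fs (ℕP.suc-injective (ℕP.suc-injective (ℕP.suc-injective (trans dim (ℕP.+-comm R 3))))) (ψ T e) (ψ (T ∪₁ e) e₁) (ψ ((T ∪₁ e) ∪₁ e₁) e₂)
  -- Four roots give fibres of dimension at least three, too large for a surface.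
  hodge-adapted [] {σ} {T} {e} {e₁ ∷ e₂ ∷ e₃ ∷ es} fs v van dim =
    ⊥-elim (ℕP.<-irrefl dim (ℕP.≤-trans (s≤s (s≤s (s≤s (s≤s (flag-length' fs))))) (ℕP.≤-trans (ℕP.≤-reflexive (ℕP.+-comm 4 R)) (ℕP.+-monoʳ-≤ R (s≤s (s≤s (s≤s (s≤s z≤n))))))))

  -- Nef letters

  -- If `a ≥ 1`, the leading term dominates at `N = 1 + ∣ b ∣ + ∣ c ∣`.
  leading : ∀ a b c → (∀ N → (+ suc N) * ((+ suc N) * a + b) + c ≤ 0ℤ) → a ≤ 0ℤ
  leading a b c h = ℤP.≮⇒≥ (λ a>0 → ℤP.<⇒≱ (bound (ℤP.i<j⇒suc[i]≤j a>0)) (h (ℤ.∣ b ∣ ℕ.+ ℤ.∣ c ∣)))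
    where
    N M : ℤ
    N = + suc (ℤ.∣ b ∣ ℕ.+ ℤ.∣ c ∣)
    M = + (ℤ.∣ b ∣ ℕ.+ ℤ.∣ c ∣)
    below : ∀ i → 0ℤ ≤ i + + ℤ.∣ i ∣
    below (+ k) = +≤+ z≤n
    below -[1+ k ] = ℤP.≤-reflexive (sym (ℤP.+-inverseˡ (+ suc k)))
    N>0 : 0ℤ < N
    N>0 = +<+ (s≤s z≤n)
    bound : 1ℤ ≤ a → 0ℤ < N * (N * a + b) + c
    bound a≥1 = subst (0ℤ <_) (sym (ring N a b c (+ ℤ.∣ b ∣) (+ ℤ.∣ c ∣)))
      (subst (λ s → 0ℤ < N * (N * (a - 1ℤ)) + (N * (b + + ℤ.∣ b ∣) + ((c + + ℤ.∣ c ∣) + (+ ℤ.∣ c ∣ * (N - 1ℤ) + N * s)))) (sym one)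
        (nn+pos (mul≥0 (pos⇒nn N>0) (mul≥0 (pos⇒nn N>0) (≤⇒0≤- a≥1))) (nn+pos (mul≥0 (pos⇒nn N>0) (below b))
          (nn+pos (below c) (nn+pos (mul≥0 {+ ℤ.∣ c ∣} {N - 1ℤ} (+≤+ z≤n) (+≤+ z≤n)) (subst (0ℤ <_) (sym (ℤP.*-identityʳ N)) N>0))))))
      where
      ring : ∀ N a b c B C → N * (N * a + b) + c ≡ N * (N * (a - 1ℤ)) + (N * (b + B) + ((c + C) + (C * (N - 1ℤ) + N * (N - B - C))))
      ring = solve-∀
      one : N - + ℤ.∣ b ∣ - + ℤ.∣ c ∣ ≡ 1ℤ
      one = ring₁ (+ ℤ.∣ b ∣) (+ ℤ.∣ c ∣)
        where
        ring₁ : ∀ B C → 1ℤ + (B + C) - B - C ≡ 1ℤ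
        ring₁ = solve-∀

  Deg-perm : ∀ {σ} → Flag σ → ∀ Ψ {us vs} → us ↭ vs → Deg σ Ψ us ≡ Deg σ Ψ vs
  Deg-perm {σ} fs Ψ p = go p 0 []
    where
    go : ∀ {us vs} → us ↭ vs → ∀ j φs → Dg σ Ψ us j φs ≡ Dg σ Ψ vs j φs
    go Perm.refl j φs = refl
    go (Perm.prep (φ , s) p) j φs = cong₂ (λ u v → u + s * v) (go p j (φ ∷ φs)) (go p (suc j) φs)
    go (Perm.swap {xs} {ys} u@(φ , s) v@(χ , t) p) j φs = trans (Dg-swap fs Ψ u v xs j φs)
      (cong₂ (λ a b → a + t * b) (cong₂ (λ a b → a + s * b) (go p j (φ ∷ χ ∷ φs)) (go p (suc j) (χ ∷ φs)))
                                 (cong₂ (λ a b → a + s * b) (go p (suc j) (φ ∷ φs)) (go p (suc (suc j)) φs)))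
    go (Perm.trans p q) j φs = trans (go p j φs) (go q j φs)

  -- x is a limit of ample letters: N x + b is ample for all N > 0
  record Nef (x : Letter) : Set where
    field
      b   : Amp
      amp : ℕ → Amp
      fst : ∀ N G → proj₁ (letter (amp N)) G ≡ proj₁ (comb (+ suc N) x 1ℤ (letter b)) G
      snd : ∀ N → proj₂ (letter (amp N)) ≡ proj₂ (comb (+ suc N) x 1ℤ (letter b))

    Deg-amp : ∀ {σ} → Flag σ → ∀ Ψ N vs → Deg σ Ψ (letter (amp N) ∷ vs) ≡ + suc N * Deg σ Ψ (x ∷ vs) + Deg σ Ψ (letter b ∷ vs)
    Deg-amp {σ} fs Ψ N vs = trans (Deg-cong fs Ψ vs (fst N) (snd N)) (trans (Deg-comb fs Ψ (+ suc N) x 1ℤ (letter b) vs)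
      (+R (+ suc N * Deg σ Ψ (x ∷ vs)) (ℤP.*-identityˡ (Deg σ Ψ (letter b ∷ vs)))))

  α* δ* : Letter
  α* = α , 0ℤ
  δ* = (λ _ → 0ℤ) , 1ℤ

  unit : Amp
  unit = mkAmp 1ℤ 0ℤ 1ℤ (+<+ (s≤s z≤n)) (+≤+ z≤n) (+<+ (s≤s z≤n))

  α-nef : Nef α*
  α-nef = record { b = unit ; amp = λ N → mkAmp 1ℤ (+ suc N) 1ℤ (+<+ (s≤s z≤n)) (+≤+ z≤n) (+<+ (s≤s z≤n))
                 ; fst = λ N G → ring (+ suc N) (A G) (α G) ; snd = λ N → sym (cong (λ w → w + 1ℤ) (ℤP.*-zeroʳ (+ suc N))) }
    where
    ring : ∀ N a b → 1ℤ * a + N * b ≡ N * b + 1ℤ * (1ℤ * a + 0ℤ * b)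
    ring = solve-∀

  δ-nef : Nef δ*
  δ-nef = record { b = unit ; amp = λ N → mkAmp 1ℤ 0ℤ (+ suc N + 1ℤ) (+<+ (s≤s z≤n)) (+≤+ z≤n) (+<+ (s≤s z≤n))
                 ; fst = λ N G → ring (+ suc N) (A G) (α G) ; snd = λ N → ring₁ (+ suc N) }
    where
    ring : ∀ N a b → 1ℤ * a + 0ℤ * b ≡ N * 0ℤ + 1ℤ * (1ℤ * a + 0ℤ * b)
    ring = solve-∀
    ring₁ : ∀ N → N + 1ℤ ≡ N * 1ℤ + 1ℤ * 1ℤ
    ring₁ = solve-∀

  -- The letters of `X` are replaced one at a time by the ample letters `N x + b`. Both sides become
  -- quadratic in `N`, and the leading coefficients give the limit.
  nef-index : ∀ X → All Nef X → ∀ C {σ T e es} → Flag σ → Valid T (e ∷ es) → Dim σ (e ∷ es) (suc (suc (length X ℕ.+ length C))) →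
    HI (λ u w → Deg σ (roots T (e ∷ es)) (u ∷ w ∷ X ++ word C))
  nef-index [] [] C fs v dim = hodge-index C fs v dim
  nef-index (x ∷ X) (nx ∷ nX) C {σ} {T} {e} {es} fs v dim u a = limit
    where
    open Nef nx
    Ψ : List Fun
    Ψ = roots T (e ∷ es)
    V : List Letter
    V = X ++ word C
    Q Q' : Letter → Letter → ℤ
    Q u w = Deg σ Ψ (u ∷ w ∷ x ∷ V)
    Q' u w = Deg σ Ψ (u ∷ w ∷ letter b ∷ V)
    to-front : ∀ u w c → u ∷ w ∷ c ∷ V ↭ c ∷ u ∷ w ∷ V
    to-front u w c = Perm.trans (Perm.prep u (Perm.swap w c Perm.refl)) (Perm.swap u c Perm.refl)
    eq : ∀ N u w → Deg σ Ψ (u ∷ w ∷ X ++ word (amp N ∷ C)) ≡ + suc N * Q u w + Q' u w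
    eq N u w = trans (Deg-perm fs Ψ (Perm.trans (Perm.prep u (Perm.prep w (PermP.shift (letter (amp N)) X (word C)))) (to-front u w (letter (amp N)))))
      (trans (Deg-amp fs Ψ N (u ∷ w ∷ V)) (cong₂ (λ s t → + suc N * s + t) (sym (Deg-perm fs Ψ (to-front u w x))) (sym (Deg-perm fs Ψ (to-front u w (letter b))))))
    ih : ∀ N → HI (λ u w → Deg σ Ψ (u ∷ w ∷ X ++ word (amp N ∷ C)))
    ih N = nef-index X nX (amp N ∷ C) fs v (trans (cong (λ k → suc (suc k) ℕ.+ suc (suc (length σ))) (ℕP.+-suc (length X) (length C))) dim)
    ih' : ∀ N → (+ suc N * Q u u + Q' u u) * (+ suc N * Q (letter a) (letter a) + Q' (letter a) (letter a)) ≤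
                (+ suc N * Q u (letter a) + Q' u (letter a)) * (+ suc N * Q u (letter a) + Q' u (letter a))
    ih' N = subst₂ _≤_ (cong₂ _*_ (eq N u u) (eq N (letter a) (letter a))) (cong₂ _*_ (eq N u (letter a)) (eq N u (letter a))) (ih N u a)
    limit : Q u u * Q (letter a) (letter a) ≤ Q u (letter a) * Q u (letter a)
    limit = asymptotic (Q u u) (Q' u u) (Q (letter a) (letter a)) (Q' (letter a) (letter a)) (Q u (letter a)) (Q' u (letter a)) ih'
      where
      asymptotic : ∀ k k' l l' m m' → (∀ N → (+ suc N * k + k') * (+ suc N * l + l') ≤ (+ suc N * m + m') * (+ suc N * m + m')) → k * l ≤ m * m
      asymptotic k k' l l' m m' h = ℤP.i-j≤0⇒i≤j (leading (k * l - m * m) (k * l' + k' * l - (m * m' + m' * m)) (k' * l' - m' * m')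
        (λ N → subst (_≤ 0ℤ) (ring (+ suc N) k k' l l' m m') (ℤP.i≤j⇒i-j≤0 (h N))))
        where
        ring : ∀ N k k' l l' m m' → (N * k + k') * (N * l + l') - (N * m + m') * (N * m + m') ≡
          N * (N * (k * l - m * m) + (k * l' + k' * l - (m * m' + m' * m))) + (k' * l' - m' * m')
        ring = solve-∀

  -- The last limit is taken in the reference letter, which occurs twice; again both sides are
  -- quadratic in `N`.
  nef-log-concave : ∀ X → All Nef X → ∀ {c} → Nef c → ∀ {σ T e es} → Flag σ → Valid T (e ∷ es) → Dim σ (e ∷ es) (suc (suc (length X))) → ∀ u →
    Deg σ (roots T (e ∷ es)) (u ∷ u ∷ X) * Deg σ (roots T (e ∷ es)) (c ∷ c ∷ X) ≤
    Deg σ (roots T (e ∷ es)) (u ∷ c ∷ X) * Deg σ (roots T (e ∷ es)) (u ∷ c ∷ X)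
  nef-log-concave X nX {c} nc {σ} {T} {e} {es} fs v dim u =
    asymptotic (Q u u) (Q c c) (Q c β) (Q β β) (Q u c) (Q u β) (λ N → subst₂ _≤_ (*R (Q u u) (both N)) (cong₂ _*_ (right N u) (right N u)) (hi N))
    where
    open Nef nc
    Ψ : List Fun
    Ψ = roots T (e ∷ es)
    Q : Letter → Letter → ℤ
    Q u w = Deg σ Ψ (u ∷ w ∷ X)
    β : Letter
    β = letter b
    Q-sym : ∀ u w → Q u w ≡ Q w u
    Q-sym u w = Deg-swap fs Ψ u w X
    left : ∀ N w → Q (letter (amp N)) w ≡ + suc N * Q c w + Q β w
    left N w = Deg-amp fs Ψ N (w ∷ X)
    right : ∀ N w → Q w (letter (amp N)) ≡ + suc N * Q w c + Q w β
    right N w = trans (Q-sym w (letter (amp N))) (trans (left N w) (cong₂ (λ s t → + suc N * s + t) (Q-sym c w) (Q-sym β w)))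
    both : ∀ N → Q (letter (amp N)) (letter (amp N)) ≡ + suc N * (+ suc N * Q c c + Q c β) + (+ suc N * Q c β + Q β β)
    both N = trans (left N (letter (amp N))) (cong₂ (λ s t → + suc N * s + t) (right N c) (trans (right N β) (cong (λ s → + suc N * s + Q β β) (Q-sym β c))))
    hi : ∀ N → Q u u * Q (letter (amp N)) (letter (amp N)) ≤ Q u (letter (amp N)) * Q u (letter (amp N))
    hi N = subst (λ V → Deg σ Ψ (u ∷ u ∷ V) * Deg σ Ψ (letter (amp N) ∷ letter (amp N) ∷ V) ≤ Deg σ Ψ (u ∷ letter (amp N) ∷ V) * Deg σ Ψ (u ∷ letter (amp N) ∷ V))
      (++-identityʳ X) (nef-index X nX [] fs v (trans (cong (λ k → suc (suc k) ℕ.+ suc (suc (length σ))) (ℕP.+-identityʳ (length X))) dim) u (amp N))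
      where
      open import Data.List.Properties using (++-identityʳ)
    asymptotic : ∀ k p q s m m' → (∀ N → k * (+ suc N * (+ suc N * p + q) + (+ suc N * q + s)) ≤ (+ suc N * m + m') * (+ suc N * m + m')) → k * p ≤ m * m
    asymptotic k p q s m m' h = ℤP.i-j≤0⇒i≤j (leading (k * p - m * m) (k * q + k * q - (m * m' + m' * m)) (k * s - m' * m')
      (λ N → subst (_≤ 0ℤ) (ring (+ suc N) k p q s m m') (ℤP.i≤j⇒i-j≤0 (h N))))
      where
      ring : ∀ N k p q s m m' → k * (N * (N * p + q) + (N * q + s)) - (N * m + m') * (N * m + m') ≡
        N * (N * (k * p - m * m) + (k * q + k * q - (m * m' + m' * m))) + (k * s - m' * m')
      ring = solve-∀

  -- Evaluation of the intersection numbers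

  record Interval (τ : Flats) (F G : Subset n) : Set where
    constructor mkInterval
    field
      F∈    : F ∈ₗ ⊥ ∷ τ
      G∈    : G ∈ₗ ⊤ ∷ τ
      F⊆G   : F ⊆ G
      sides : All (λ K → K ⊆ F ⊎ G ⊆ K) τ

  Agree : Subset n → Subset n → Subset n → Set
  Agree Y H H' = (∀ {x} → x ∈ Y → x ∈ H → x ∈ H') × (∀ {x} → x ∈ Y → x ∈ H' → x ∈ H)

  Between : Subset n → Subset n → Subset n → Set
  Between F G H = F ⊆ H × H ⊆ G

  -- Inside the gap, `φ` is pulled back from the restriction to `Y`.
  Dep : Subset n → Subset n → Subset n → Fun → Set
  Dep Y F G φ = ∀ H H' → Between F G H → Between F G H' → Agree Y H H' → φ H ≡ φ H'

  record DepLin (Y F G : Subset n) (φ : Fun) : Set where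
    constructor mkDep
    field
      rep  : Fun
      diff : Lin (λ H → φ H - rep H)
      dep  : Dep Y F G rep

  dep-sub : ∀ {Y F G F' G' φ} → F ⊆ F' → G' ⊆ G → DepLin Y F G φ → DepLin Y F' G' φ
  dep-sub s t (mkDep f d h) = mkDep f d (λ H H' (p , q) (p' , q') → h H H' ((λ x∈ → p (s x∈)) , (λ x∈ → t (q x∈))) ((λ x∈ → p' (s x∈)) , (λ x∈ → t (q' x∈))))

  Van-member : ∀ {τ φ K} → Van τ φ → K ∈ₗ ⊥ ∷ ⊤ ∷ τ → φ K ≡ 0ℤ
  Van-member (p , _ , _) (here refl) = p
  Van-member (_ , q , _) (there (here refl)) = q
  Van-member (_ , _ , a) (there (there K∈)) = All.lookup a K∈

  low : ∀ {τ : Flats} {K : Subset n} → K ∈ₗ ⊥ ∷ τ → K ∈ₗ ⊥ ∷ ⊤ ∷ τ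
  low (here e) = here e
  low (there p) = there (there p)

  mem-cong : ∀ {x : Fin n} {H H'} → (x ∈ H → x ∈ H') → (x ∈ H' → x ∈ H) → mem x H ≡ mem x H'
  mem-cong {x} {H} {H'} f g = go (x ∈? H)
    where
    go : Dec (x ∈ H) → mem x H ≡ mem x H'
    go (yes p) = trans (mem-∈ p) (sym (mem-∈ (f p)))
    go (no ¬p) = trans (mem-∉ ¬p) (sym (mem-∉ (λ q → ¬p (g q))))

  -- the linear correction of a representative is concentrated in one element j of G ─ F
  module Normalise {τ F G} (ft : Flag τ) (I : Interval τ F G) (φ₁ : Fun) (j : Fin n) (j∈G : j ∈ G) (j∉F : j ∉ F) where
    open Interval I

    ℓ₂ : Fun
    ℓ₂ H = φ₁ H - hat τ φ₁ H

    open Lin (hat-diff τ φ₁) renaming (const to c₀; coeff to y₀; eq to eq₀)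

    -- All elements of `G ─ F` are collapsed to `j`. Sets below `F` contain none of them and sets
    -- above `G` all of them, so nothing changes at the members of the flag.
    p' : ∀ x → Dec (x ∈ G × x ∉ F) → Fin n
    p' x (yes _) = j
    p' x (no _)  = x

    p : Fin n → Fin n
    p x = p' x ((x ∈? G) ×-dec ¬? (x ∈? F))

    ℓ₃ : Fun
    ℓ₃ H = c₀ + ΣF n (λ x → y₀ x * mem (p x) H)

    ℓ₃-Lin : Lin ℓ₃
    ℓ₃-Lin = Lin-+ (Lin-const c₀) (Lin-ΣF n (λ x H → y₀ x * mem (p x) H) (λ x → Lin-* (y₀ x) (Lin-mem (p x))))

    ℓ₃-value : ∀ H K → (∀ x → mem (p x) H ≡ mem x K) → ℓ₃ H ≡ ℓ₂ K
    ℓ₃-value H K h = trans (+R c₀ (ΣF-cong n (λ x → trans (*R (y₀ x) (h x)) (ℤP.*-comm (y₀ x) (mem x K))))) (sym (eq₀ K))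

    ℓ₃-side : ∀ {K} → K ⊆ F ⊎ G ⊆ K → ℓ₃ K ≡ ℓ₂ K
    ℓ₃-side {K} s = ℓ₃-value K K (λ x → go s ((x ∈? G) ×-dec ¬? (x ∈? F)))
      where
      go : ∀ {x} → K ⊆ F ⊎ G ⊆ K → (d : Dec (x ∈ G × x ∉ F)) → mem (p' x d) K ≡ mem x K
      go _ (no _) = refl
      go (inj₁ s) (yes (x∈G , x∉F)) = trans (mem-∉ (λ q → j∉F (s q))) (sym (mem-∉ (λ q → x∉F (s q))))
      go (inj₂ s) (yes (x∈G , x∉F)) = trans (mem-∈ (s j∈G)) (sym (mem-∈ (s x∈G)))

    ℓ₃-low : ∀ {H} → Between F G H → j ∉ H → ℓ₃ H ≡ ℓ₂ F
    ℓ₃-low {H} (s , t) j∉H = ℓ₃-value H F (λ x → go ((x ∈? G) ×-dec ¬? (x ∈? F)))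
      where
      go : ∀ {x} (d : Dec (x ∈ G × x ∉ F)) → mem (p' x d) H ≡ mem x F
      go (yes (x∈G , x∉F)) = trans (mem-∉ j∉H) (sym (mem-∉ x∉F))
      go {x} (no ¬d) = mem-cong (λ x∈H → case x ∈? F of λ { (yes q) → q ; (no q) → ⊥-elim (¬d (t x∈H , q)) }) s

    ℓ₃-high : ∀ {H} → Between F G H → j ∈ H → ℓ₃ H ≡ ℓ₂ G
    ℓ₃-high {H} (s , t) j∈H = ℓ₃-value H G (λ x → go ((x ∈? G) ×-dec ¬? (x ∈? F)))
      where
      go : ∀ {x} (d : Dec (x ∈ G × x ∉ F)) → mem (p' x d) H ≡ mem x G
      go (yes (x∈G , x∉F)) = trans (mem-∈ j∈H) (sym (mem-∈ x∈G))
      go {x} (no ¬d) = mem-cong t (λ x∈G → case x ∈? F of λ { (yes q) → s q ; (no q) → ⊥-elim (¬d (x∈G , q)) })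

    φ° : Fun
    φ° H = φ₁ H - ℓ₃ H

    φ°-side : ∀ {K} → K ∈ₗ ⊥ ∷ ⊤ ∷ τ → K ⊆ F ⊎ G ⊆ K → φ° K ≡ 0ℤ
    φ°-side {K} K∈ s = trans (cong (λ w → φ₁ K - w) (ℓ₃-side s)) (trans (ring (φ₁ K) (hat τ φ₁ K)) (Van-member (hat-Van ft φ₁) K∈))
      where
      ring : ∀ a b → a - (a - b) ≡ b
      ring = solve-∀

    φ°-Van : Van τ φ°
    φ°-Van = φ°-side (here refl) (inj₁ ⊥⊆) , φ°-side (there (here refl)) (inj₂ ⊆⊤) ,
      All.tabulate (λ K∈ → φ°-side (there (there K∈)) (All.lookup sides K∈))

    ℓ₂-equal : φ₁ F ≡ φ₁ G → ℓ₂ F ≡ ℓ₂ G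
    ℓ₂-equal e = cong₂ _-_ e (trans (Van-member (hat-Van ft φ₁) (low F∈)) (sym (Van-member (hat-Van ft φ₁) (there G∈))))

    φ°-Dep : ∀ {Y} → Dep Y F G φ₁ → j ∈ Y ⊎ φ₁ F ≡ φ₁ G → Dep Y F G φ°
    φ°-Dep {Y} d cs H H' b b' ag = cong₂ _-_ (d H H' b b' ag) (go cs (j ∈? H) (j ∈? H'))
      where
      go : j ∈ Y ⊎ φ₁ F ≡ φ₁ G → Dec (j ∈ H) → Dec (j ∈ H') → ℓ₃ H ≡ ℓ₃ H'
      go _ (yes p) (yes p') = trans (ℓ₃-high b p) (sym (ℓ₃-high b' p'))
      go _ (no p) (no p') = trans (ℓ₃-low b p) (sym (ℓ₃-low b' p'))
      go (inj₁ j∈Y) (yes p) (no p') = ⊥-elim (p' (proj₁ ag j∈Y p))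
      go (inj₁ j∈Y) (no p) (yes p') = ⊥-elim (p (proj₂ ag j∈Y p'))
      go (inj₂ e) (yes p) (no p') = trans (ℓ₃-high b p) (trans (sym (ℓ₂-equal e)) (sym (ℓ₃-low b' p')))
      go (inj₂ e) (no p) (yes p') = trans (ℓ₃-low b p) (trans (ℓ₂-equal e) (sym (ℓ₃-high b' p')))

  normalise : ∀ {Y τ F G φ} → Flag τ → Interval τ F G → F ≢ G → DepLin Y F G φ →
    Σ Fun λ φ° → Lin (λ H → φ H - φ° H) × Van τ φ° × Dep Y F G φ°
  normalise {Y} {τ} {F} {G} {φ} ft I F≢G (mkDep φ₁ d h) = go (FinP.any? (λ x → (x ∈? Y) ×-dec (x ∈? G) ×-dec ¬? (x ∈? F)))
    where
    open Interval I
    build : ∀ j (j∈G : j ∈ G) (j∉F : j ∉ F) → j ∈ Y ⊎ φ₁ F ≡ φ₁ G → Σ Fun λ φ° → Lin (λ H → φ H - φ° H) × Van τ φ° × Dep Y F G φ°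
    build j j∈G j∉F cs = N.φ° , Lin-cong (λ H → ring (φ H) (φ₁ H) (N.ℓ₃ H)) (Lin-+ d N.ℓ₃-Lin) , N.φ°-Van , N.φ°-Dep h cs
      where
      module N = Normalise ft I φ₁ j j∈G j∉F
      ring : ∀ a b c → a - b + c ≡ a - (b - c)
      ring = solve-∀
    go : Dec (∃[ x ] (x ∈ Y × x ∈ G × x ∉ F)) → Σ Fun λ φ° → Lin (λ H → φ H - φ° H) × Van τ φ° × Dep Y F G φ°
    go (yes (j , j∈Y , j∈G , j∉F)) = build j j∈G j∉F (inj₁ j∈Y)
    go (no none) = let (j , j∈G , j∉F) = ⊆∧≢⇒∃ F⊆G F≢G in
      build j j∈G j∉F (inj₂ (h F G (id , F⊆G) (F⊆G , id) ((λ _ x∈ → F⊆G x∈) , (λ {x} x∈Y x∈G → case x ∈? F of λ { (yes q) → q ; (no q) → ⊥-elim (none (x , x∈Y , x∈G , q)) }))))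

  flat-absorb : ∀ {F B} → Flat F → r (F ∪ B) ℕ.≤ r F → B ⊆ F
  flat-absorb {F} {B} fl le {x} x∈ = fl x (ℕP.≤-antisym (ℕP.≤-trans (r-mono (∪-mono id (⁅⁆⊆ x∈))) le) (r-mono ∈∪ˡ))

  -- The functions come from the restriction to `Y`, which is too small for the gap. A flat `H`
  -- splits the gap, and `Y` fails to span one of the halves. If that half has rank at least two,
  -- induction applies; if it has rank one, `H` agrees on `Y` with its end point, where the
  -- normalised function is zero.
  vanishing : ∀ Y φs {τ F G} → Flag τ → Interval τ F G → suc (suc (r F)) ℕ.≤ r G → r (F ∪ (Y ∩ G)) ℕ.< r G → All (DepLin Y F G) φs → D τ φs ≡ 0ℤ
  vanishing Y [] {τ} {F} {G} ft I gap _ _ = sel-no (suc (length τ) ℕP.≟ R) (λ full → uncovered sides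
      (full-covered ft (cong ℕ.pred full) (suc (r F)) (s≤s z≤n) (ℕP.≤-trans gap (r-mono ⊆⊤))))
    where
    open Interval I
    uncovered : ∀ {τ} → All (λ K → K ⊆ F ⊎ G ⊆ K) τ → ¬ Covered τ (suc (r F))
    uncovered (inj₁ s ∷ _) (here e) = ℕP.<-irrefl e (s≤s (r-mono s))
    uncovered (inj₂ s ∷ _) (here e) = ℕP.<-irrefl (sym e) (ℕP.≤-trans gap (r-mono s))
    uncovered (_ ∷ a) (there c) = uncovered a c
  vanishing Y (φ ∷ φs) {τ} {F} {G} ft I gap lt (d ∷ ds) = result (normalise ft I (λ e → ℕP.<-irrefl (cong r e) (ℕP.<-trans (ℕP.n<1+n (r F)) gap)) d)
    where
    open Interval I
    flatF : Flat F
    flatF = lower-flat ft F∈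
    push : ∀ {H K : Subset n} {U : Subset n} → K ∈ₗ U ∷ τ → K ∈ₗ U ∷ H ∷ τ
    push (here e) = here e
    push (there p) = there (there p)
    result : (Σ Fun λ φ° → Lin (λ H → φ H - φ° H) × Van τ φ° × Dep Y F G φ°) → D τ (φ ∷ φs) ≡ 0ℤ
    result (φ° , lin , van , dep) = trans (D-modLin ft {φ°} {φ} φs lin) (trans (D-Van φ° φs van) (sumLk-0 {τ} {λ H → φ° H * D (H ∷ τ) φs} (λ H l → term l)))
      where
      outside : ∀ {H} → Link τ H → H ⊆ F ⊎ G ⊆ H → φ° H * D (H ∷ τ) φs ≡ 0ℤ
      outside {H} l s = trans (*R (φ° H) (vanishing Y φs (l ∷ ft) (mkInterval (push F∈) (push G∈) F⊆G (s ∷ sides)) gap lt ds)) (ℤP.*-zeroʳ (φ° H))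
      kill : ∀ {H K} → K ∈ₗ ⊥ ∷ ⊤ ∷ τ → Between F G H → Between F G K → Agree Y H K → φ° H * D (H ∷ τ) φs ≡ 0ℤ
      kill {H} {K} K∈ b b' ag = cong (λ w → w * D (H ∷ τ) φs) (trans (dep H K b b' ag) (Van-member van K∈))
      inside : ∀ {H} → Link τ H → Between F G H → Dec (r (F ∪ (Y ∩ H)) ℕ.< r H) → φ° H * D (H ∷ τ) φs ≡ 0ℤ
      inside {H} l (s , t) (yes lt') = go (suc (suc (r F)) ℕP.≤? r H)
        where
        go : Dec (suc (suc (r F)) ℕ.≤ r H) → φ° H * D (H ∷ τ) φs ≡ 0ℤ
        go (yes gap') = trans (*R (φ° H) (vanishing Y φs (l ∷ ft) (mkInterval (push F∈) (there (here refl)) s (inj₂ id ∷ All.map [ inj₁ , (λ u → inj₂ (λ {x} x∈ → u (t x∈))) ]′ sides)) gap' lt'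
                        (All.map (dep-sub id t) ds))) (ℤP.*-zeroʳ (φ° H))
        go (no ¬gap) = kill (low F∈) (s , t) (id , F⊆G) ((λ x∈Y x∈H → flat-absorb flatF (ℕP.≤-pred (ℕP.≤-trans lt' (ℕP.≤-pred (ℕP.≰⇒> ¬gap)))) (x∈p∩q⁺ (x∈Y , x∈H))) , (λ _ x∈F → s x∈F))
      inside {H} l (s , t) (no ¬lt) = go (suc (suc (r H)) ℕP.≤? r G)
        where
        spanned : r (H ∪ (Y ∩ G)) ℕ.< r G
        spanned = ℕP.≤-trans (s≤s (ℕP.≤-trans (r-mono (∪-⊆ (λ x∈ → cl-mono (subst (_ ∈_) (sym H≡) x∈)) (λ x∈ → ⊆cl (∈∪ʳ x∈)))) (ℕP.≤-reflexive (r-cl (F ∪ (Y ∩ G)))))) lt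
          where
          H≡ : cl (F ∪ (Y ∩ H)) ≡ H
          H≡ = flat-≡ (cl-flat _) (cl-min (flat l) (∪-⊆ s (p∩q⊆q Y H))) (ℕP.≤-trans (ℕP.≮⇒≥ ¬lt) (ℕP.≤-reflexive (sym (r-cl _))))
          cl-mono : cl (F ∪ (Y ∩ H)) ⊆ cl (F ∪ (Y ∩ G))
          cl-mono = cl-min (cl-flat _) (∪-⊆ (λ x∈ → ⊆cl (∈∪ˡ x∈)) (λ x∈ → ⊆cl (∈∪ʳ (x∈p∩q⁺ (p∩q⊆p Y H x∈ , t (p∩q⊆q Y H x∈))))))
        go : Dec (suc (suc (r H)) ℕ.≤ r G) → φ° H * D (H ∷ τ) φs ≡ 0ℤ
        go (yes gap') = trans (*R (φ° H) (vanishing Y φs (l ∷ ft) (mkInterval (there (here refl)) (push G∈) t (inj₁ id ∷ All.map [ (λ u → inj₁ (λ {x} x∈ → s (u x∈))) , inj₂ ]′ sides)) gap' spanned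
                        (All.map (dep-sub s id) ds))) (ℤP.*-zeroʳ (φ° H))
        go (no ¬gap) = kill (there G∈) (s , t) (F⊆G , id) ((λ _ x∈H → t x∈H) , (λ x∈Y x∈G → flat-absorb (flat l) (ℕP.≤-pred (ℕP.≤-trans spanned (ℕP.≤-pred (ℕP.≰⇒> ¬gap)))) (x∈p∩q⁺ (x∈Y , x∈G))))
      cmpF : ∀ {H} → Link τ H → F ∈ₗ ⊥ ∷ τ → F ⊆ H ⊎ H ⊆ F
      cmpF l (here refl) = inj₁ ⊥⊆
      cmpF l (there p) = proj₁ (All.lookup (cmps l) p)
      cmpG : ∀ {H} → Link τ H → G ∈ₗ ⊤ ∷ τ → G ⊆ H ⊎ H ⊆ G
      cmpG l (here refl) = inj₂ ⊆⊤
      cmpG l (there p) = proj₁ (All.lookup (cmps l) p)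
      term : ∀ {H} → Link τ H → φ° H * D (H ∷ τ) φs ≡ 0ℤ
      term {H} l = go (cmpF l F∈) (cmpG l G∈)
        where
        go : F ⊆ H ⊎ H ⊆ F → G ⊆ H ⊎ H ⊆ G → φ° H * D (H ∷ τ) φs ≡ 0ℤ
        go (inj₂ s) _ = outside l (inj₁ s)
        go (inj₁ _) (inj₁ s) = outside l (inj₂ s)
        go (inj₁ s) (inj₂ t) = inside l (s , t) (r (F ∪ (Y ∩ H)) ℕP.<? r H)

  Deg-vanishing : ∀ Y {τ F G} → Flag τ → Interval τ F G → suc (suc (r F)) ℕ.≤ r G → r (F ∪ (Y ∩ G)) ℕ.< r G →
    ∀ Ψ → All (DepLin Y F G) Ψ → ∀ vs → All (λ v → DepLin Y F G (proj₁ v)) vs → Deg τ Ψ vs ≡ 0ℤ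
  Deg-vanishing Y {τ} {F} {G} ft I gap lt Ψ dΨ vs dvs = dg vs dvs 0 [] []
    where
    hd : ∀ Ψ → All (DepLin Y F G) Ψ → ∀ j φs → All (DepLin Y F G) φs → Hd τ Ψ j φs ≡ 0ℤ
    hd [] _ j φs _ = refl
    hd (ψ ∷ []) _ zero φs d = vanishing Y φs ft I gap lt d
    hd (ψ ∷ _ ∷ _) _ zero φs d = refl
    hd (ψ ∷ Ψ) (dψ ∷ dΨ) (suc j) φs d = cong₂ _+_ (hd (ψ ∷ Ψ) (dψ ∷ dΨ) j (ψ ∷ φs) (dψ ∷ d)) (hd Ψ dΨ j φs d)
    dg : ∀ vs → All (λ v → DepLin Y F G (proj₁ v)) vs → ∀ j φs → All (DepLin Y F G) φs → Dg τ Ψ vs j φs ≡ 0ℤ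
    dg [] _ j φs d = hd Ψ dΨ j φs d
    dg ((φ , s) ∷ vs) (dφ ∷ dvs) j φs d = trans (cong₂ (λ u v → u + s * v) (dg vs dvs j (φ ∷ φs) (dφ ∷ d)) (dg vs dvs (suc j) φs d))
      (trans (ℤP.+-identityˡ (s * 0ℤ)) (ℤP.*-zeroʳ s))

  dep-const : ∀ {Y F G φ} → (∀ H → Between F G H → φ H ≡ 0ℤ) → DepLin Y F G φ
  dep-const {φ = φ} h = mkDep φ (Lin-cong (λ H → sym (ℤP.+-inverseʳ (φ H))) (Lin-const 0ℤ)) (λ H H' b b' _ → trans (h H b) (sym (h H' b')))

  α-zero : ∀ {H} → H ≢ ⊤ → α H ≡ 0ℤ
  α-zero ne = cong -_ (ind-≢ ne)

  -- Powers of the hyperplane class and the expansion of δ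

  record Complete (σ : Flats) (F : Subset n) : Set where
    field
      flag  : Flag σ
      F∈    : F ∈ₗ ⊥ ∷ σ
      below : All (λ K → K ⊆ F) σ
      cov   : ∀ t → 0 ℕ.< t → t ℕ.≤ r F → Covered σ t
      len   : length σ ≡ r F
      F≢⊤   : F ≢ ⊤

    F-flat : Flat F
    F-flat = lower-flat flag F∈

    above : ∀ {G} → Link σ G → F ⊆ G × r F ℕ.< r G
    above {G} l = go (cmp F∈)
      where
      cmp : F ∈ₗ ⊥ ∷ σ → Cmp F G
      cmp (here refl) = inj₁ ⊥⊆ , λ e → ≢⊥ l (sym e)
      cmp (there p) = All.lookup (cmps l) p
      go : Cmp F G → F ⊆ G × r F ℕ.< r G
      go (inj₁ s , ne) = s , flat-< F-flat s ne
      go (inj₂ s , ne) = ⊥-elim (link-uncovered flag l (cov (r G) (proj₁ (link-rank l)) (r-mono s)))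

    interval : ∀ {G} → Link σ G → Interval (G ∷ σ) F G
    interval l = mkInterval (push F∈) (there (here refl)) (proj₁ (above l)) (inj₂ id ∷ All.map inj₁ below)
      where
      push : ∀ {G} → F ∈ₗ ⊥ ∷ σ → F ∈ₗ ⊥ ∷ G ∷ σ
      push (here e) = here e
      push (there p) = there (there p)

    module Next {e : Fin n} (e∉F : e ∉ F) where
      F' : Subset n
      F' = cl (F ∪ ⁅ e ⁆)

      e∈F' : e ∈ F'
      e∈F' = ⊆cl (∈∪ʳ (x∈⁅x⁆ e))

      F⊆F' : F ⊆ F'
      F⊆F' x∈ = ⊆cl (∈∪ˡ x∈)

      r-F' : r F' ≡ suc (r F)
      r-F' = trans (r-cl (F ∪ ⁅ e ⁆)) (flat-step F-flat e∉F)

      next-link : F' ≢ ⊤ → Link σ F'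
      next-link ne = mkLink (cl-flat (F ∪ ⁅ e ⁆)) (λ eq → ∉⊥ (subst (e ∈_) eq e∈F')) ne
        (All.tabulate (λ {K} K∈ → cmp {K} (All.lookup below K∈)))
        where
        cmp : ∀ {K} → K ⊆ F → Cmp K F'
        cmp {K} s = inj₁ (λ x∈ → F⊆F' (s x∈)) , λ eq → e∉F (s (subst (e ∈_) (sym eq) e∈F'))

      next : F' ≢ ⊤ → Complete (F' ∷ σ) F'
      next ne = record { flag = next-link ne ∷ flag ; F∈ = there (here refl) ; below = id ∷ All.map (λ {K} s {x} x∈ → F⊆F' (s x∈)) below
        ; cov = λ t t>0 t≤ → go t>0 t≤ (t ℕP.≤? r F) ; len = trans (cong suc len) (sym r-F') ; F≢⊤ = ne }
        where
        go : ∀ {t} → 0 ℕ.< t → t ℕ.≤ r F' → Dec (t ℕ.≤ r F) → Covered (F' ∷ σ) t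
        go t>0 t≤ (yes le) = there (cov _ t>0 le)
        go t>0 t≤ (no ¬le) = here (ℕP.≤-antisym (ℕP.≤-trans (ℕP.≤-reflexive r-F') (ℕP.≰⇒> ¬le)) t≤)

      unique : ∀ {G} → Link σ G → e ∈ G → r G ≡ suc (r F) → G ≡ F'
      unique l e∈G eq = sym (flat-≡ (cl-flat (F ∪ ⁅ e ⁆)) (cl-min (flat l) (∪-⊆ (proj₁ (above l)) (⁅⁆⊆ e∈G))) (ℕP.≤-reflexive (trans eq (sym r-F'))))

  complete-[] : Complete [] ⊥
  complete-[] = record { flag = [] ; F∈ = here refl ; below = [] ; cov = λ t t>0 t≤ → ⊥-elim (ℕP.n≮0 (ℕP.≤-trans t>0 (ℕP.≤-trans t≤ (ℕP.≤-reflexive r-⊥))))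
    ; len = sym r-⊥ ; F≢⊤ = ⊥≢⊤ }

  -- `α` is represented by the proper flats through an `e` outside `F`. Those of rank above
  -- `r F + 1` leave a gap on which the remaining factors are zero, so only the closure of
  -- `F ∪ ⁅ e ⁆` counts.
  D-α : ∀ k {σ F} → Complete σ F → suc (k ℕ.+ r F) ≡ R → D σ (List.replicate k α) ≡ 1ℤ
  D-α zero {σ} c e = D-full σ (trans (cong suc (Complete.len c)) e)
  D-α (suc k) {σ} {F} c eq = trans (D-modLin flag {α°} {α} αs (Lin-cong (λ H → ring (α H) (mem e H)) (Lin-* -1ℤ (Lin-mem e))))
      (trans (D-Van α° αs α°-Van) (trans (sumLk-point {σ} {X} N.F' l₀ (λ G l ne → term l ne (e ∈? G)))
        (trans (cong₂ _*_ (α°-∈ (≢⊤ l₀) N.e∈F') (D-α k (N.next (≢⊤ l₀)) (trans (cong suc (trans (cong (k ℕ.+_) N.r-F') (ℕP.+-suc k (r F)))) eq))) refl)))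
    where
    open Complete c
    e : Fin n
    e = proj₁ (≢⊤⇒∃ F≢⊤)
    e∉F : e ∉ F
    e∉F = proj₂ (≢⊤⇒∃ F≢⊤)
    module N = Next e∉F
    αs : List Fun
    αs = List.replicate k α
    α° : Fun
    α° H = α H + mem e H
    X : Fun
    X G = α° G * D (G ∷ σ) αs
    ring : ∀ a b → -1ℤ * b ≡ a - (a + b)
    ring = solve-∀
    l₀ : Link σ N.F'
    l₀ = N.next-link (λ F'≡⊤ → ℕP.<-irrefl (trans (sym N.r-F') (cong r F'≡⊤)) (ℕP.≤-trans (s≤s (s≤s (ℕP.m≤n+m (r F) k))) (ℕP.≤-reflexive eq)))
    α°-∉ : ∀ {H} → H ≢ ⊤ → e ∉ H → α° H ≡ 0ℤ
    α°-∉ ne e∉ = cong₂ _+_ (α-zero ne) (mem-∉ e∉)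
    α°-∈ : ∀ {H} → H ≢ ⊤ → e ∈ H → α° H ≡ 1ℤ
    α°-∈ ne e∈ = cong₂ _+_ (α-zero ne) (mem-∈ e∈)
    α°-Van : Van σ α°
    α°-Van = α°-∉ ⊥≢⊤ ∉⊥ , cong₂ _+_ (cong -_ (ind-≡ {⊤} refl)) (mem-∈ {n} {e} {⊤} ∈⊤) ,
      All.tabulate (λ {K} K∈ → α°-∉ (proj₂ (proj₂ (flag-member flag K∈))) (λ e∈ → e∉F (All.lookup below K∈ e∈)))
    term : ∀ {G} → Link σ G → G ≢ N.F' → Dec (e ∈ G) → X G ≡ 0ℤ
    term {G} l ne (no e∉) = cong (λ w → w * D (G ∷ σ) αs) (α°-∉ (≢⊤ l) e∉)
    term {G} l ne (yes e∈) = trans (*R (α° G) (vanishing ⊥ αs (l ∷ flag) (interval l) (ℕP.≤∧≢⇒< (proj₂ (above l)) (λ eq' → ne (N.unique l e∈ (sym eq'))))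
        (ℕP.≤-trans (s≤s (r-mono (∪-⊆ id (λ x∈ → ⊥-elim (∉⊥ (p∩q⊆p ⊥ G x∈)))))) (proj₂ (above l))) (deps k))) (ℤP.*-zeroʳ (α° G))
      where
      deps : ∀ k → All (DepLin ⊥ F G) (List.replicate k α)
      deps zero = []
      deps (suc k) = dep-const (λ H (_ , t) → α-zero (λ { refl → ≢⊤ l (⊆-antisym ⊆⊤ t) })) ∷ deps k

  Deg-α : ∀ σ ψ k → Deg σ (ψ ∷ []) (List.replicate k α*) ≡ D σ (List.replicate k α)
  Deg-α σ ψ k = trans (go k []) (cong (D σ) (++-identityʳ (List.replicate k α)))
    where
    open import Data.List.Properties using (++-identityʳ)
    shift : ∀ k (φs : List Fun) → List.replicate k α ++ α ∷ φs ≡ α ∷ List.replicate k α ++ φs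
    shift zero φs = refl
    shift (suc k) φs = cong (α ∷_) (shift k φs)
    go : ∀ k φs → Dg σ (ψ ∷ []) (List.replicate k α*) 0 φs ≡ D σ (List.replicate k α ++ φs)
    go zero φs = refl
    go (suc k) φs = trans (ℤP.+-identityʳ _) (trans (go k (α ∷ φs)) (cong (D σ) (shift k φs)))

  Deg-α₂ : ∀ σ ψ χ Ψ k → Deg σ (ψ ∷ χ ∷ Ψ) (List.replicate k α*) ≡ 0ℤ
  Deg-α₂ σ ψ χ Ψ k = go k []
    where
    go : ∀ k φs → Dg σ (ψ ∷ χ ∷ Ψ) (List.replicate k α*) 0 φs ≡ 0ℤ
    go zero φs = refl
    go (suc k) φs = trans (ℤP.+-identityʳ _) (go k (α ∷ φs))

  -- Keeps flag and Whitney sum in step: `F ─ T`, the forced part of `Wh (F ─ T) T`, is a basis of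
  -- `F`.
  record State (σ : Flats) (F T : Subset n) : Set where
    field
      complete    : Complete σ F
      independent : r (F ─ T) ≡ ∣ F ─ T ∣
      spans       : r (F ─ T) ≡ r F
    open Complete complete public

    F⊆cl : F ⊆ cl (F ─ T)
    F⊆cl {x} x∈ = ∈cl⁺ (ℕP.≤-antisym (ℕP.≤-trans (r-mono (∪-⊆ (p─q⊆p F T) (⁅⁆⊆ x∈))) (ℕP.≤-reflexive (sym spans))) (r-mono ∈∪ˡ))

    r-absorb : ∀ {B} → F ─ T ⊆ B → r (F ∪ B) ≡ r B
    r-absorb {B} s = ℕP.≤-antisym (ℕP.≤-trans (r-mono (∪-⊆ (λ x∈ → cl-min (cl-flat B) (λ y∈ → ⊆cl (s y∈)) (F⊆cl x∈)) ⊆cl)) (ℕP.≤-reflexive (r-cl B))) (r-mono ∈∪ʳ)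

    -- A circuit of `⊤ ─ T` is not contained in `F`, because `F ─ T` is independent.
    free-element : r (⊤ ─ T) ℕ.< ∣ ⊤ ─ T ∣ → ∃[ e ] (e ∉ F × Removable T e)
    free-element lt =
      let (C , s , (x , x∈) , sp) = circuit ∣ ⊤ ─ T ∣ (⊤ ─ T) ℕP.≤-refl lt
          (e , e∈C , e∉F) = ⊈⇒∃ {A = C} {F} (λ C⊆F → contra (λ {y} y∈ → ∈─⁺ (C⊆F y∈) (proj₂ (∈─⁻ ⊤ T (s y∈)))) x∈ (sp x∈))
      in e , e∉F , proj₂ (∈─⁻ ⊤ T (s e∈C)) , spanned-mono s e∈C (sp e∈C)
      where
      contra : ∀ {C x} → C ⊆ F ─ T → x ∈ C → Spanned C x → Absurd
      contra {C} {x} s x∈ sp = ℕP.<-irrefl refl (ℕP.≤-trans (s≤s (ℕP.≤-trans (ℕP.≤-reflexive (sym (spanned-mono s x∈ sp))) (r≤∣∣ (del (F ─ T) x))))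
        (ℕP.≤-reflexive (trans (∣del∣ (s x∈)) (sym independent))))

  -- Shared by `α*` and `δ*`: the base part of such a letter is zero in every gap below a proper
  -- flat, so `Deg-vanishing` has to inspect only the roots.
  Plain : Letter → Set
  Plain (φ , _) = ∀ H → H ≢ ⊤ → φ H ≡ 0ℤ

  module DeltaStep {σ F T} (st : State σ F T) {e : Fin n} (e∉F : e ∉ F) (rem : Removable T e) (es : List (Fin n)) where
    open State st public
    open Next e∉F public

    Ψ Ψ' : List Fun
    Ψ' = roots (T ∪₁ e) es
    Ψ = ψ T e ∷ Ψ'

    e∉T : e ∉ T
    e∉T = proj₁ rem

    ψ-∉ : ∀ {G} → e ∉ G → ψ T e G ≡ 0ℤ
    ψ-∉ {G} e∉ = ψ-zero G (∉-spanned (λ p → e∉ (proj₁ (∈─⁻ G T p))))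

    ψ-one : ∀ G → ¬ Spanned (G ─ T) e → ψ T e G ≡ 1ℤ
    ψ-one G ns = trans (cong₂ (λ a b → + a - + b) (not-spanned ns) (cong r (─∪₁ G T e))) (ring (+ r (del (G ─ T) e)))
      where
      ring : ∀ a → 1ℤ + a - a ≡ 1ℤ
      ring = solve-∀

    ψ-Van : Van σ (ψ T e)
    ψ-Van = ψ-∉ {⊥} ∉⊥ , ψ-zero ⊤ (proj₂ rem) , All.map (λ {K} s → ψ-∉ {K} (λ e∈ → e∉F (s e∈))) below

    root-dep : ∀ {G T' e'} → T ∪₁ e ⊆ T' → DepLin (⊤ ─ (T ∪₁ e)) F G (ψ T' e')
    root-dep {G} {T'} {e'} s = mkDep (ψ T' e') (Lin-cong (λ H → sym (ℤP.+-inverseʳ (ψ T' e' H))) (Lin-const 0ℤ))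
      (λ H H' _ _ ag → cong₂ (λ A B → + r A - + r B) (cut H H' s ag) (cut H H' (λ x∈ → ∈∪ˡ (s x∈)) ag))
      where
      cut : ∀ H H' {U} → T ∪₁ e ⊆ U → Agree (⊤ ─ (T ∪₁ e)) H H' → H ─ U ≡ H' ─ U
      cut H H' {U} t (f , g) = ⊆-antisym
        (λ x∈ → let (p , q) = ∈─⁻ H U x∈ in ∈─⁺ (f (∈─⁺ ∈⊤ (λ w → q (t w))) p) q)
        (λ x∈ → let (p , q) = ∈─⁻ H' U x∈ in ∈─⁺ (g (∈─⁺ ∈⊤ (λ w → q (t w))) p) q)

    roots-dep : ∀ {G T'} es → T ∪₁ e ⊆ T' → All (DepLin (⊤ ─ (T ∪₁ e)) F G) (roots T' es)
    roots-dep [] s = []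
    roots-dep (e' ∷ es) s = root-dep s ∷ roots-dep es (λ x∈ → ∈∪ˡ (s x∈))

    -- As long as `e` is not spanned in `G ─ T`, the first root agrees with `mem e` between `F` and
    -- `G`.
    first-dep : ∀ {Y G} → ¬ Spanned (G ─ T) e → DepLin Y F G (ψ T e)
    first-dep {Y} {G} ns = mkDep (λ H → ψ T e H - mem e H) (Lin-cong (λ H → ring (ψ T e H) (mem e H)) (Lin-mem e))
        (λ H H' b b' _ → trans (vanish b (e ∈? H)) (sym (vanish b' (e ∈? H'))))
      where
      ring : ∀ a b → b ≡ a - (a - b)
      ring = solve-∀
      vanish : ∀ {H} → Between F G H → Dec (e ∈ H) → ψ T e H - mem e H ≡ 0ℤ
      vanish (_ , t) (no e∉) = cong₂ _-_ (ψ-∉ e∉) (mem-∉ e∉)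
      vanish {H} (_ , t) (yes e∈) = cong₂ _-_ (ψ-one H (λ sp → ns (spanned-mono (─-monoˡ T t) (∈─⁺ e∈ e∉T) sp))) (mem-∈ e∈)

    -- Between `F` and `G` all roots come, up to linear functions, from the restriction to
    -- `⊤ ─ (T ∪₁ e)`. Together with `F` this set fails to span `G`, since `F ─ T` survives the
    -- deletion of `e`.
    upper-zero : ∀ {G} → Link σ G → ¬ Spanned (G ─ T) e → suc (suc (r F)) ℕ.≤ r G → ∀ W → All Plain W → Deg (G ∷ σ) Ψ W ≡ 0ℤ
    upper-zero {G} l ns gap W pl = Deg-vanishing Y (l ∷ flag) (interval l) gap lt Ψ (first-dep ns ∷ roots-dep es id) W
        (All.map (λ {v} p → dep-const (λ H (_ , t) → p H (λ { refl → ≢⊤ l (⊆-antisym ⊆⊤ t) }))) pl)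
      where
      Y : Subset n
      Y = ⊤ ─ (T ∪₁ e)
      Y∩G : Y ∩ G ⊆ del (G ─ T) e
      Y∩G x∈ = let (p , q) = x∈p∩q⁻ Y G x∈ in subst (_ ∈_) (─∪₁ G T e) (∈─⁺ q (proj₂ (∈─⁻ ⊤ (T ∪₁ e) p)))
      lt : r (F ∪ (Y ∩ G)) ℕ.< r G
      lt = ℕP.≤-trans (s≤s (ℕP.≤-trans (r-mono (∪-mono id Y∩G)) (ℕP.≤-reflexive (r-absorb (λ {x} x∈ →
             ∈del (─-monoˡ T (proj₁ (above l)) x∈) (λ { refl → e∉F (proj₁ (∈─⁻ F T x∈)) }))))))
           (ℕP.≤-trans (ℕP.≤-reflexive (sym (not-spanned ns))) (r-mono (p─q⊆p G T)))

    expand : ∀ W → Deg σ Ψ (δ* ∷ W) ≡ sumLk σ (λ G → ψ T e G * Deg (G ∷ σ) Ψ W) + Deg σ Ψ' W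
    expand W = trans (Deg-split flag (ψ T e) Ψ' (λ _ → 0ℤ) 1ℤ W (ψ T e) (λ _ → 0ℤ) (λ G → ring (ψ T e G)) (Lin-const 0ℤ) ψ-Van)
      (+R (sumLk σ (λ G → ψ T e G * Deg (G ∷ σ) Ψ W)) (ℤP.*-identityˡ (Deg σ Ψ' W)))
      where
      ring : ∀ a → a ≡ 0ℤ + 1ℤ * a + 0ℤ
      ring = solve-∀

    -- In the expansion of `δ` only the closure of `F ∪ ⁅ e ⁆` can contribute, and only if `e` is a
    -- coloop of its part outside `T`.
    other-zero : ∀ W → All Plain W → ∀ {G} → Link σ G → ¬ (G ≡ F' × ¬ Spanned (F' ─ T) e) → ψ T e G * Deg (G ∷ σ) Ψ W ≡ 0ℤ
    other-zero W pl {G} l h = go (r (del (G ─ T) e) ℕP.≟ r (G ─ T))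
      where
      go : Dec (Spanned (G ─ T) e) → ψ T e G * Deg (G ∷ σ) Ψ W ≡ 0ℤ
      go (yes sp) = cong (λ w → w * Deg (G ∷ σ) Ψ W) (ψ-zero G sp)
      go (no ns) = trans (*R (ψ T e G) (upper-zero l ns (ℕP.≤∧≢⇒< (proj₂ (above l)) ne) W pl)) (ℤP.*-zeroʳ (ψ T e G))
        where
        e∈G : e ∈ G
        e∈G = proj₁ (∈─⁻ G T (not-spanned-∈ ns))
        ne : suc (r F) ≢ r G
        ne eq = h (unique l e∈G (sym eq) , λ sp → ns (subst (λ K → Spanned (K ─ T) e) (sym (unique l e∈G (sym eq))) sp))

    F'≢⊤ : ¬ Spanned (F' ─ T) e → F' ≢ ⊤
    F'≢⊤ ns eq = ns (subst (λ K → Spanned (K ─ T) e) (sym eq) (proj₂ rem))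

    δ-spanned : Spanned (F' ─ T) e → ∀ W → All Plain W → Deg σ Ψ (δ* ∷ W) ≡ Deg σ Ψ' W
    δ-spanned sp W pl = trans (expand W) (trans (cong (λ w → w + Deg σ Ψ' W) (sumLk-0 {σ} {λ G → ψ T e G * Deg (G ∷ σ) Ψ W} (λ G l → other-zero W pl l (λ (_ , ns) → ns sp))))
      (ℤP.+-identityˡ (Deg σ Ψ' W)))

    δ-new : ¬ Spanned (F' ─ T) e → ∀ W → All Plain W → Deg σ Ψ (δ* ∷ W) ≡ Deg σ Ψ' W + Deg (F' ∷ σ) Ψ W
    δ-new ns W pl = trans (expand W) (trans (cong (λ w → w + Deg σ Ψ' W) (trans (sumLk-point {σ} {λ G → ψ T e G * Deg (G ∷ σ) Ψ W} F' (next-link (F'≢⊤ ns)) (λ G l ne → other-zero W pl l (λ (eq , _) → ne eq)))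
        (trans (cong (λ w → w * Deg (F' ∷ σ) Ψ W) (ψ-one F' ns)) (ℤP.*-identityˡ (Deg (F' ∷ σ) Ψ W)))))
      (ℤP.+-comm (Deg (F' ∷ σ) Ψ W) (Deg σ Ψ' W)))

    same-set : F ─ (T ∪₁ e) ≡ F ─ T
    same-set = trans (─∪₁ F T e) (del-∉ (λ p → e∉F (proj₁ (∈─⁻ F T p))))

    state-del : State σ F (T ∪₁ e)
    state-del = record { complete = complete ; independent = subst (λ A → r A ≡ ∣ A ∣) (sym same-set) independent ; spans = trans (cong r same-set) spans }

    F─T∪e⊆ : (F ─ T) ∪ ⁅ e ⁆ ⊆ F' ─ T
    F─T∪e⊆ = ∪-⊆ (─-monoˡ T F⊆F') (⁅⁆⊆ (∈─⁺ e∈F' e∉T))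

    r-new : r ((F ─ T) ∪ ⁅ e ⁆) ≡ suc (r F)
    r-new = trans (∉cl⇒suc (F ─ T) e (λ h → e∉F (F-flat e (∈cl-mono (p─q⊆p F T) h)))) (cong suc spans)

    new-set : ¬ Spanned (F' ─ T) e → F' ─ T ≡ (F ─ T) ∪ ⁅ e ⁆
    new-set ns = ⊆-antisym (λ {x} x∈ → go x∈ (x FinP.≟ e)) F─T∪e⊆
      where
      r-del : r (del (F' ─ T) e) ℕ.≤ r (F ─ T)
      r-del = ℕP.≤-pred (ℕP.≤-trans (ℕP.≤-reflexive (sym (not-spanned ns))) (ℕP.≤-trans (r-mono (p─q⊆p F' T)) (ℕP.≤-reflexive (trans r-F' (cong suc (sym spans))))))
      sub : F ─ T ⊆ del (F' ─ T) e
      sub x∈ = ∈del (─-monoˡ T F⊆F' x∈) (λ { refl → e∉F (proj₁ (∈─⁻ F T x∈)) })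
      go : ∀ {x} → x ∈ F' ─ T → Dec (x ≡ e) → x ∈ (F ─ T) ∪ ⁅ e ⁆
      go x∈ (yes refl) = ∈∪ʳ (x∈⁅x⁆ e)
      go {x} x∈ (no ne) = ∈∪ˡ (∈─⁺ (flat-absorb F-flat (ℕP.≤-trans (ℕP.≤-reflexive (r-absorb sub)) (ℕP.≤-trans r-del (ℕP.≤-reflexive spans))) (∈del x∈ ne)) (proj₂ (∈─⁻ F' T x∈)))

    state-new : ¬ Spanned (F' ─ T) e → State (F' ∷ σ) F' T
    state-new ns = record { complete = next (F'≢⊤ ns)
      ; independent = trans r-F'─T (trans (cong suc (trans (sym spans) (trans independent (cong ∣_∣ (sym del≡))))) (∣del∣ (∈─⁺ e∈F' e∉T)))
      ; spans = trans r-F'─T (sym r-F') }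
      where
      r-F'─T : r (F' ─ T) ≡ suc (r F)
      r-F'─T = trans (cong r (new-set ns)) r-new
      del≡ : del (F' ─ T) e ≡ F ─ T
      del≡ = ⊆-antisym (λ {x} x∈ → [ id , (λ q → ⊥-elim (∈del⁻ x∈ (x∈⁅y⁆⇒x≡y e q))) ]′ (x∈p∪q⁻ (F ─ T) ⁅ e ⁆ (subst (x ∈_) (new-set ns) (del-⊆ e x∈))))
        (λ {x} x∈ → ∈del (─-monoˡ T F⊆F' x∈) (λ { refl → e∉F (proj₁ (∈─⁻ F T x∈)) }))

    -- an element of F' ─ T that is spanned by S ∪ e makes the truncated Whitney sum vanish
    extra : Spanned (F' ─ T) e → ∃[ x ] (x ∈cl ((F ─ T) ∪ ⁅ e ⁆) × x ∉ (F ─ T) ∪ ⁅ e ⁆ × x ∉ T)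
    extra sp =
      let (x , x∈ , x∉F) = ⊈⇒∃ {A = del (F' ─ T) e} {F} (λ s → ℕP.<⇒≱ (ℕP.≤-reflexive (sym r-new))
                              (ℕP.≤-trans (r-mono F─T∪e⊆) (ℕP.≤-trans (ℕP.≤-reflexive (sym sp)) (r-mono s))))
          (x∈F' , x∉T) = ∈─⁻ F' T (del-⊆ e x∈)
      in x , ℕP.≤-antisym (ℕP.≤-trans (r-mono (∪-⊆ (λ y∈ → proj₁ (∈─⁻ F' T (F─T∪e⊆ y∈))) (⁅⁆⊆ x∈F'))) (ℕP.≤-reflexive (trans r-F' (sym r-new)))) (r-mono ∈∪ˡ) ,
         (λ p → [ (λ q → x∉F (proj₁ (∈─⁻ F T q))) , (λ q → ∈del⁻ x∈ (x∈⁅y⁆⇒x≡y e q)) ]′ (x∈p∪q⁻ (F ─ T) ⁅ e ⁆ p)) , x∉T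

  -- The Whitney recursion for monomials in α and δ

  monomial : ℕ → ℕ → List Letter
  monomial i j = List.replicate i δ* ++ List.replicate j α*

  plain : ∀ i j → All Plain (monomial i j)
  plain (suc i) j = (λ _ _ → refl) ∷ plain i j
  plain zero zero = []
  plain zero (suc j) = (λ H → α-zero {H}) ∷ plain zero j

  -- The guard excludes the monomials of wrong degree that truncated subtraction would produce.
  cc : Flats → List Fun → ℕ → ℕ → ℤ
  cc σ Ψ d i = sel (i ℕP.≤? d) (Deg σ Ψ (monomial (d ℕ.∸ i) i))

  -- Every monomial except the pure power of `α` has a factor `δ`, to which the expansion `P`
  -- applies.
  cc-suc : ∀ σ Ψ d (P : List Letter → ℤ) → (∀ W → All Plain W → Deg σ Ψ (δ* ∷ W) ≡ P W) → ∀ i →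
    cc σ Ψ (suc d) i ≡ sel (i ℕP.≤? d) (P (monomial (d ℕ.∸ i) i)) + sel (i ℕP.≟ suc d) (Deg σ Ψ (List.replicate (suc d) α*))
  cc-suc σ Ψ d P h i = go (i ℕP.≤? suc d) (i ℕP.≤? d) (i ℕP.≟ suc d)
    where
    last : Deg σ Ψ (monomial (suc d ℕ.∸ suc d) (suc d)) ≡ Deg σ Ψ (List.replicate (suc d) α*)
    last = cong (λ k → Deg σ Ψ (monomial k (suc d))) (ℕP.n∸n≡0 d)
    go : (a : Dec (i ℕ.≤ suc d)) (b : Dec (i ℕ.≤ d)) (c : Dec (i ≡ suc d)) → sel a (Deg σ Ψ (monomial (suc d ℕ.∸ i) i)) ≡
      sel b (P (monomial (d ℕ.∸ i) i)) + sel c (Deg σ Ψ (List.replicate (suc d) α*))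
    go (yes _) (yes le) (no _) = trans (cong (λ k → Deg σ Ψ (monomial k i)) (ℕP.+-∸-assoc 1 le)) (trans (h (monomial (d ℕ.∸ i) i) (plain (d ℕ.∸ i) i)) (sym (ℤP.+-identityʳ (P (monomial (d ℕ.∸ i) i)))))
    go _ (yes le) (yes refl) = ⊥-elim (ℕP.1+n≰n le)
    go (yes _) (no _) (yes refl) = trans last (sym (ℤP.+-identityˡ (Deg σ Ψ (List.replicate (suc d) α*))))
    go (yes le) (no ¬le) (no ne) = ⊥-elim (ne (ℕP.≤-antisym le (ℕP.≰⇒> ¬le)))
    go (no ¬le) (yes le) _ = ⊥-elim (¬le (ℕP.m≤n⇒m≤1+n le))
    go (no ¬le) _ (yes e) = ⊥-elim (¬le (ℕP.≤-reflexive e))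
    go (no _) (no _) (no _) = refl

  -- Sets avoiding `e` correspond to the bundle with fewer roots, sets containing `e` to the next
  -- flat of the flag. If `e` is spanned in the new flat, the second part is zero on both sides. `b`
  -- is the dimension of the star of `σ`.
  good : ∀ d b {σ F T e es} → State σ F T → Valid T (e ∷ es) → suc (b ℕ.+ r F) ≡ R → d ≡ b ℕ.+ length es → r (⊤ ─ T) ≡ R →
    Good b (Wh (F ─ T) T) (cc σ (roots T (e ∷ es)) d)

  module Induction {σ F T e es} (b : ℕ) (st : State σ F T) (e∉F : e ∉ F) (rem : Removable T e) (v : Valid (T ∪₁ e) es)
      (eq : suc (b ℕ.+ r F) ≡ R) (sp : r (⊤ ─ T) ≡ R) where
    open DeltaStep st e∉F rem es

    S : Subset n
    S = F ─ T

    sp' : r (⊤ ─ (T ∪₁ e)) ≡ R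
    sp' = trans (removable-rank rem) sp

    W₁ : ℤ → ℤ
    W₁ q = Wh S (T ∪₁ e) q

    W₂ : ℤ → ℤ
    W₂ q = Wh (S ∪ ⁅ e ⁆) T q

    Wh-split : ∀ q → Wh S T q ≡ W₁ q + W₂ q
    Wh-split q = trans (ΣI-split {S = S} {⊤ ─ T} (wt q) (∈⊤─ e∉T) (λ p → e∉F (proj₁ (∈─⁻ F T p))))
      (cong (λ B → ΣI S B (wt q) + W₂ q) (sym (─∪₁ ⊤ T e)))

    W₁-base : es ≡ [] → ∀ q → W₁ q ≡ q ℤ.^ suc b
    W₁-base refl = Wh-base {S} {T ∪₁ e} (basis v) sp'
        (λ x∈ → ∈─⁺ ∈⊤ (λ w → [ proj₂ (∈─⁻ F T x∈) , (λ u → e∉F (subst (_∈ F) (x∈⁅y⁆⇒x≡y e u) (proj₁ (∈─⁻ F T x∈)))) ]′ (x∈p∪q⁻ T ⁅ e ⁆ w)))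
        (suc b) (trans (cong (suc b ℕ.+_) (trans (sym independent) spans)) eq)
      where
      basis : Valid (T ∪₁ e) [] → r (⊤ ─ (T ∪₁ e)) ≡ ∣ ⊤ ─ (T ∪₁ e) ∣
      basis (done h) = h

    W₂-zero : Spanned (F' ─ T) e → ∀ q → W₂ q ≡ 0ℤ
    W₂-zero h = let (x , x∈cl , x∉ , x∉T) = extra h in Wh-zero x∈cl x∉ x∉T

    span? : Dec (Spanned (F' ─ T) e)
    span? = r (del (F' ─ T) e) ℕP.≟ r (F' ─ T)

    b>0 : ¬ Spanned (F' ─ T) e → b ≢ 0
    b>0 ns refl = F'≢⊤ ns (flat-≡ (cl-flat (F ∪ ⁅ e ⁆)) ⊆⊤ (ℕP.≤-reflexive (trans (sym eq) (sym r-F'))))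

  good zero b {σ} {F} {T} {e₀} {es₀} st v eq d≡ sp = good-cong (λ q → trans (I.Wh-split q) (trans (cong₂ _+_ (trans (I.W₁-base es≡[] q) (cong (λ k → q ℤ.^ suc k) b≡0)) (I.W₂-zero spanned q)) (ℤP.+-identityʳ (q ℤ.^ 1))))
      coef (subst (λ k → Good k (λ q → q ℤ.^ 1) (λ i → sel (i ℕP.≟ 0) 1ℤ)) (sym b≡0) (good-δ 0))
    where
    open State st
    el : ∃[ e ] (e ∉ F × Removable T e)
    el = free-element (dependent v)
    e : Fin n
    e = proj₁ el
    rem : Removable T e
    rem = proj₂ (proj₂ el)
    es' : ∃[ es ] Valid (T ∪₁ e) es
    es' = valid-exists ∣ ⊤ ─ (T ∪₁ e) ∣ (T ∪₁ e) ℕP.≤-refl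
    module I = Induction b st (proj₁ (proj₂ el)) rem (proj₂ es') eq sp
    b≡0 : b ≡ 0
    b≡0 = ℕP.m+n≡0⇒m≡0 b (sym d≡)
    es₀≡0 : length es₀ ≡ 0
    es₀≡0 = ℕP.m+n≡0⇒n≡0 b (sym d≡)
    nil : ∀ {A : Set} (xs : List A) → length xs ≡ 0 → xs ≡ []
    nil [] _ = refl
    es≡[] : proj₁ es' ≡ []
    es≡[] = nil (proj₁ es') (ℕP.suc-injective (trans (sym (same-length v (rem ∷ proj₂ es'))) (cong suc es₀≡0)))
    spanned : Spanned (cl (F ∪ ⁅ e ⁆) ─ T) e
    spanned = case I.span? of λ { (yes h) → h ; (no ns) → ⊥-elim (I.b>0 ns b≡0) }
    unit-value : ∀ es → length es ≡ 0 → Deg σ (roots T (e₀ ∷ es)) [] ≡ 1ℤ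
    unit-value [] _ = D-full σ (trans (cong suc len) (trans (cong (λ k → suc (k ℕ.+ r F)) (sym b≡0)) eq))
    coef : ∀ i → cc σ (roots T (e₀ ∷ es₀)) 0 i ≡ sel (i ℕP.≟ 0) 1ℤ
    coef zero = trans (sel-yes (0 ℕP.≤? 0) {Deg σ (roots T (e₀ ∷ es₀)) []} z≤n) (trans (unit-value es₀ es₀≡0) (sym (sel-yes (0 ℕP.≟ 0) {1ℤ} refl)))
    coef (suc i) = trans (sel-no (suc i ℕP.≤? 0) {Deg σ (roots T (e₀ ∷ es₀)) (monomial 0 (suc i))} (λ ())) (sym (sel-no (suc i ℕP.≟ 0) {1ℤ} (λ ())))
  good (suc d) b {σ} {F} {T} {e₀} {es₀} st v eq d≡ sp = good-cong I.Wh-split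
      (λ i → sel-cong (i ℕP.≤? suc d) (λ _ → Deg-order-free v (rem ∷ proj₂ es') flag (monomial (suc d ℕ.∸ i) i)))
      (total I.span?)
    where
    open State st
    el : ∃[ e ] (e ∉ F × Removable T e)
    el = free-element (dependent v)
    e : Fin n
    e = proj₁ el
    rem : Removable T e
    rem = proj₂ (proj₂ el)
    es' : ∃[ es ] Valid (T ∪₁ e) es
    es' = valid-exists ∣ ⊤ ─ (T ∪₁ e) ∣ (T ∪₁ e) ℕP.≤-refl
    es : List (Fin n)
    es = proj₁ es'
    module I = Induction b st (proj₁ (proj₂ el)) rem (proj₂ es') eq sp
    module S = DeltaStep st (proj₁ (proj₂ el)) rem es
    len≡ : length es₀ ≡ length es
    len≡ = ℕP.suc-injective (same-length v (rem ∷ proj₂ es'))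
    d≡' : suc d ≡ b ℕ.+ length es
    d≡' = trans d≡ (cong (b ℕ.+_) len≡)
    -- The monomial without `δ` is booked with the deletion: with a single root it is the
    -- coefficient of `q ^ suc b`, with more roots it is zero.
    c₁ : ℕ → ℤ
    c₁ i = sel (i ℕP.≤? d) (Deg σ S.Ψ' (monomial (d ℕ.∸ i) i)) + sel (i ℕP.≟ suc d) (Deg σ S.Ψ (List.replicate (suc d) α*))
    first : Good b I.W₁ c₁
    first = go es refl (proj₂ es')
      where
      go : ∀ es'' → es ≡ es'' → Valid (T ∪₁ e) es'' → Good b I.W₁ c₁
      go [] e≡ _ = good-cong (I.W₁-base e≡) coef (good-δ b)
        where
        sd≡b : suc d ≡ b
        sd≡b = trans d≡' (trans (cong (λ xs → b ℕ.+ length xs) e≡) (ℕP.+-identityʳ b))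
        coef : ∀ i → c₁ i ≡ sel (i ℕP.≟ b) 1ℤ
        coef i = trans (cong₂ _+_ (trans (sel-cong (i ℕP.≤? d) {y = 0ℤ} (λ _ → trans (cong (λ xs → Deg σ (roots (T ∪₁ e) xs) (monomial (d ℕ.∸ i) i)) e≡) (Deg-[] σ (monomial (d ℕ.∸ i) i)))) (sel-0 (i ℕP.≤? d)))
            (trans (sel-cong (i ℕP.≟ suc d) {y = 1ℤ} (λ _ → trans (cong (λ xs → Deg σ (ψ T e ∷ roots (T ∪₁ e) xs) (List.replicate (suc d) α*)) e≡)
                (trans (Deg-α σ (ψ T e) (suc d)) (D-α (suc d) complete (trans (cong (λ k → suc (k ℕ.+ r F)) sd≡b) eq)))))
              (sel-⇔ (i ℕP.≟ suc d) (i ℕP.≟ b) (λ p → trans p sd≡b) (λ p → trans p (sym sd≡b))))) (ℤP.+-identityˡ (sel (i ℕP.≟ b) 1ℤ))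
      go (e₁ ∷ es₁) e≡ v₁ = good-cong (λ q → cong (λ A → Wh A (T ∪₁ e) q) (sym S.same-set)) coef
          (good d b S.state-del v₁ eq (ℕP.suc-injective (trans d≡' (trans (cong (λ xs → b ℕ.+ length xs) e≡) (ℕP.+-suc b (length es₁))))) I.sp')
        where
        coef : ∀ i → c₁ i ≡ cc σ (roots (T ∪₁ e) (e₁ ∷ es₁)) d i
        coef i = trans (cong₂ _+_ (cong (λ xs → sel (i ℕP.≤? d) (Deg σ (roots (T ∪₁ e) xs) (monomial (d ℕ.∸ i) i))) e≡)
            (trans (sel-cong (i ℕP.≟ suc d) {y = 0ℤ} (λ _ → trans (cong (λ xs → Deg σ (ψ T e ∷ roots (T ∪₁ e) xs) (List.replicate (suc d) α*)) e≡)
                (Deg-α₂ σ (ψ T e) (ψ (T ∪₁ e) e₁) (roots ((T ∪₁ e) ∪₁ e₁) es₁) (suc d)))) (sel-0 (i ℕP.≟ suc d))))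
          (ℤP.+-identityʳ (cc σ (roots (T ∪₁ e) (e₁ ∷ es₁)) d i))
    total : Dec (Spanned (S.F' ─ T) e) → Good b (λ q → I.W₁ q + I.W₂ q) (cc σ S.Ψ (suc d))
    total (yes h) = good-cong (λ q → trans (+R (I.W₁ q) (I.W₂-zero h q)) (ℤP.+-identityʳ (I.W₁ q)))
      (cc-suc σ S.Ψ d (Deg σ S.Ψ') (S.δ-spanned h)) first
    total (no ns) = go b refl
      where
      go : ∀ b' → b ≡ b' → Good b (λ q → I.W₁ q + I.W₂ q) (cc σ S.Ψ (suc d))
      go zero b≡ = ⊥-elim (I.b>0 ns b≡)
      go (suc b') b≡ = good-cong (λ q → refl) coef (subst (λ k → Good k (λ q → I.W₁ q + I.W₂ q) (λ i → c₁ i + c₂ i)) (sym b≡)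
          (good-add (subst (λ k → Good k I.W₁ c₁) b≡ first) second))
        where
        c₂ : ℕ → ℤ
        c₂ = cc (S.F' ∷ σ) S.Ψ d
        second : Good b' I.W₂ c₂
        second = good-cong (λ q → cong (λ A → Wh A T q) (sym (S.new-set ns))) (λ _ → refl)
          (good d b' (S.state-new ns) (rem ∷ proj₂ es') (trans (cong (λ k → suc (b' ℕ.+ k)) S.r-F') (trans (cong suc (ℕP.+-suc b' (r F))) (trans (cong (λ k → suc (k ℕ.+ r F)) (sym b≡)) eq)))
            (ℕP.suc-injective (trans d≡' (cong (ℕ._+ length es) b≡))) sp)
        coef : ∀ i → cc σ S.Ψ (suc d) i ≡ c₁ i + c₂ i
        coef i = trans (cc-suc σ S.Ψ d (λ W → Deg σ S.Ψ' W + Deg (S.F' ∷ σ) S.Ψ W) (S.δ-new ns) i)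
          (trans (cong (λ w → w + κ) (sel-+ (i ℕP.≤? d) (Deg σ S.Ψ' M) (Deg (S.F' ∷ σ) S.Ψ M))) (ring (sel (i ℕP.≤? d) (Deg σ S.Ψ' M)) (c₂ i) κ))
          where
          M : List Letter
          M = monomial (d ℕ.∸ i) i
          κ : ℤ
          κ = sel (i ℕP.≟ suc d) (Deg σ S.Ψ (List.replicate (suc d) α*))
          ring : ∀ a b c → a + b + c ≡ a + c + b
          ring = solve-∀

  -- Log-concavity of the Whitney coefficients

  Wh-full : ∀ q → Wh ⊥ ⊥ q ≡ ΣS (wt q)
  Wh-full q = ΣS-cong {n} {λ A → sel (in? ⊥ (⊤ ─ ⊥) A) (wt q A)} {wt q} (λ A → sel-yes (in? ⊥ (⊤ ─ ⊥) A) (⊥⊆ , λ _ → ∈─⁺ ∈⊤ ∉⊥))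

  monomial-nef : ∀ i j → All Nef (monomial i j)
  monomial-nef (suc i) j = δ-nef ∷ monomial-nef i j
  monomial-nef zero zero = []
  monomial-nef zero (suc j) = α-nef ∷ monomial-nef zero j

  length-monomial : ∀ i j → length (monomial i j) ≡ i ℕ.+ j
  length-monomial (suc i) j = cong suc (length-monomial i j)
  length-monomial zero zero = refl
  length-monomial zero (suc j) = cong suc (length-monomial zero j)

  -- Three consecutive coefficients share the factor `M`; they are the two squares and the mixed
  -- degree of `α` and `δ` against `M`.
  cc-log-concave : ∀ {e es} d → Valid ⊥ (e ∷ es) → Dim [] (e ∷ es) d → LogConcaveTo d (cc [] (roots ⊥ (e ∷ es)) d)
  cc-log-concave {e} {es} d v dim i le = subst₂ _≤_ (trans (ℤP.*-comm (X (α* ∷ α* ∷ M)) (X (δ* ∷ δ* ∷ M))) (cong₂ _*_ v₀ v₂)) (cong₂ _*_ v₁ v₁)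
      (nef-log-concave M (monomial-nef m i) δ-nef [] v dim' α*)
    where
    X : List Letter → ℤ
    X = Deg [] (roots ⊥ (e ∷ es))
    m : ℕ
    m = d ℕ.∸ suc (suc i)
    M : List Letter
    M = monomial m i
    c : ℕ → ℤ
    c = cc [] (roots ⊥ (e ∷ es)) d
    m+ : suc (suc m) ℕ.+ i ≡ d
    m+ = trans (cong suc (sym (ℕP.+-suc m i))) (trans (sym (ℕP.+-suc m (suc i))) (ℕP.m∸n+n≡m le))
    dim' : Dim [] (e ∷ es) (suc (suc (length M)))
    dim' = trans (cong (λ k → suc (suc k) ℕ.+ 2) (length-monomial m i)) (trans (cong (ℕ._+ 2) m+) dim)
    value : ∀ j k → k ℕ.+ j ≡ d → X (monomial k j) ≡ c j
    value j k e' = trans (cong (λ w → X (monomial w j)) (trans (sym (ℕP.m+n∸n≡m k j)) (cong (ℕ._∸ j) e'))) (sym (sel-yes (j ℕP.≤? d) (ℕP.≤-trans (ℕP.m≤n+m j k) (ℕP.≤-reflexive e'))))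
    v₀ : X (δ* ∷ δ* ∷ M) ≡ c i
    v₀ = value i (suc (suc m)) m+
    v₁ : X (α* ∷ δ* ∷ M) ≡ c (suc i)
    v₁ = trans (Deg-perm [] _ (Perm.trans (Perm.swap α* δ* Perm.refl) (Perm.prep δ* (Perm.↭-sym (PermP.shift α* (List.replicate m δ*) (List.replicate i α*))))))
      (value (suc i) (suc m) (trans (cong suc (ℕP.+-suc m i)) m+))
    v₂ : X (α* ∷ α* ∷ M) ≡ c (suc (suc i))
    v₂ = trans (Deg-perm [] _ (Perm.↭-sym (Perm.trans (PermP.shift α* (List.replicate m δ*) (α* ∷ List.replicate i α*)) (Perm.prep α* (PermP.shift α* (List.replicate m δ*) (List.replicate i α*))))))
      (value (suc (suc i)) m (ℕP.m∸n+n≡m le))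

  whitney-numbers : ∀ b → suc b ≡ r ⊤ → Σ (ℕ → ℤ) λ c → Good b (λ q → ΣS (wt q)) c × LogConcaveTo b c
  whitney-numbers b eq = go (proj₁ vs) (proj₂ vs)
    where
    vs : ∃[ es ] Valid ⊥ es
    vs = valid-exists ∣ ⊤ {n} ─ ⊥ ∣ ⊥ ℕP.≤-refl
    ⊤─⊥ : ⊤ {n} ─ ⊥ ≡ ⊤
    ⊤─⊥ = p─⊥≡p ⊤
    ⊥─⊥ : ⊥ {n} ─ ⊥ ≡ ⊥
    ⊥─⊥ = p─⊥≡p ⊥
    start : State [] ⊥ ⊥
    start = record { complete = complete-[] ; independent = subst (λ A → r A ≡ ∣ A ∣) (sym ⊥─⊥) (trans r-⊥ (sym (∣⊥∣≡0 n))) ; spans = cong r ⊥─⊥ }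
    eq' : suc (b ℕ.+ r ⊥) ≡ R
    eq' = trans (cong suc (trans (cong (b ℕ.+_) r-⊥) (ℕP.+-identityʳ b))) eq
    go : ∀ es → Valid ⊥ es → Σ (ℕ → ℤ) λ c → Good b (λ q → ΣS (wt q)) c × LogConcaveTo b c
    -- If `⊤` is independent there is no root and no bundle; the polynomial is `q ^ suc b` by direct
    -- summation.
    go [] (done h) = (λ i → sel (i ℕP.≟ b) 1ℤ) , good-cong (λ q → trans (sym (Wh-full q)) (Wh-base {⊥} {⊥} h (cong r ⊤─⊥) ⊥⊆ (suc b)
        (trans (cong (suc b ℕ.+_) (∣⊥∣≡0 n)) (trans (ℕP.+-identityʳ (suc b)) eq)) q)) (λ _ → refl) (good-δ b) ,
      λ i le → subst (_≤ c (suc i) * c (suc i)) (sym (cong (λ w → w * c (suc (suc i))) (sel-no (i ℕP.≟ b) {1ℤ} (λ e → ℕP.<-irrefl e (ℕP.≤-trans (ℕP.n≤1+n (suc i)) le))))) (sq≥0 (c (suc i)))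
      where
      c : ℕ → ℤ
      c i = sel (i ℕP.≟ b) 1ℤ
    go (e ∷ es) v = cc [] (roots ⊥ (e ∷ es)) d , good-cong (λ q → trans (sym (Wh-full q)) (cong (λ A → Wh A ⊥ q) (sym ⊥─⊥))) (λ _ → refl)
        (good d b start v eq' refl (cong r ⊤─⊥)) , λ i le → cc-log-concave d v dim i (ℕP.≤-trans le (ℕP.m≤m+n b (length es)))
      where
      d : ℕ
      d = b ℕ.+ length es
      dim : Dim [] (e ∷ es) d
      dim = trans (ℕP.+-comm d 2) (trans (cong suc (sym (ℕP.+-suc b (length es)))) (cong (ℕ._+ suc (length es)) eq))

-- The rank function of a matroid

∣∣-∪∩ : ∀ {n} (A B : Subset n) → ∣ A ∪ B ∣ ℕ.+ ∣ A ∩ B ∣ ≡ ∣ A ∣ ℕ.+ ∣ B ∣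
∣∣-∪∩ [] [] = refl
∣∣-∪∩ (true ∷ A) (true ∷ B) = cong suc (trans (ℕP.+-suc ∣ A ∪ B ∣ ∣ A ∩ B ∣) (trans (cong suc (∣∣-∪∩ A B)) (sym (ℕP.+-suc ∣ A ∣ ∣ B ∣))))
∣∣-∪∩ (true ∷ A) (false ∷ B) = cong suc (∣∣-∪∩ A B)
∣∣-∪∩ (false ∷ A) (true ∷ B) = trans (cong suc (∣∣-∪∩ A B)) (sym (ℕP.+-suc ∣ A ∣ ∣ B ∣))
∣∣-∪∩ (false ∷ A) (false ∷ B) = ∣∣-∪∩ A B

module MatroidRank {n} (M : Matroid n) where

  Ind : Subset n → Set
  Ind A = indep M A ≡ true

  ind? : ∀ A → Dec (Ind A)
  ind? A = indep M A BoolP.≟ true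

  ind-⊥ : Ind ⊥
  ind-⊥ = indep-∅ M

  ind-sub : ∀ {A B} → A ⊆ B → Ind B → Ind A
  ind-sub {A} {B} s = indep-hered M A B s

  record Basis (A I : Subset n) : Set where
    field
      basis : Subset n
      I⊆    : I ⊆ basis
      ⊆A    : basis ⊆ A
      ind   : Ind basis
      max   : ∀ {J} → J ⊆ A → Ind J → ∣ J ∣ ℕ.≤ ∣ basis ∣

  extend : ∀ k A I → ∣ A ∣ ℕ.≤ k ℕ.+ ∣ I ∣ → I ⊆ A → Ind I → Basis A I
  extend k A I le s ind = go (FinP.any? (λ x → (x ∈? A) ×-dec ¬? (x ∈? I) ×-dec ind? (I ∪ ⁅ x ⁆))) k le
    where
    card : ∀ {x} → x ∉ I → suc ∣ I ∣ ℕ.≤ ∣ I ∪ ⁅ x ⁆ ∣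
    card {x} x∉ = p⊂q⇒∣p∣<∣q∣ ((λ y∈ → ∈∪ˡ y∈) , x , ∈∪ʳ (x∈⁅x⁆ x) , x∉)
    go : Dec (∃[ x ] (x ∈ A × x ∉ I × Ind (I ∪ ⁅ x ⁆))) → ∀ k → ∣ A ∣ ℕ.≤ k ℕ.+ ∣ I ∣ → Basis A I
    go (no none) _ _ = record { basis = I ; I⊆ = id ; ⊆A = s ; ind = ind ; max = λ {J} J⊆A iJ → ℕP.≮⇒≥ (λ lt →
      let (x , x∈J , x∉I , ix) = indep-aug M I J ind iJ lt in none (x , J⊆A x∈J , x∉I , ix)) }
    go (yes (x , x∈ , x∉ , ix)) zero le = ⊥-elim (ℕP.<⇒≱ (ℕP.≤-trans (card x∉) (p⊆q⇒∣p∣≤∣q∣ (∪-⊆ s (⁅⁆⊆ x∈)))) le)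
    go (yes (x , x∈ , x∉ , ix)) (suc k) le = record { basis = basis ; I⊆ = λ y∈ → I⊆ (∈∪ˡ y∈) ; ⊆A = ⊆A ; ind = Basis.ind B ; max = max }
      where
      B : Basis A (I ∪ ⁅ x ⁆)
      B = extend k A (I ∪ ⁅ x ⁆) (ℕP.≤-trans le (ℕP.≤-trans (ℕP.≤-reflexive (sym (ℕP.+-suc k ∣ I ∣))) (ℕP.+-monoʳ-≤ k (card x∉)))) (∪-⊆ s (⁅⁆⊆ x∈)) ix
      open Basis B hiding (ind)

  -- Opaque: the rank is used only through the fields of `Basis`.
  abstract
    basis-of : ∀ A → Basis A ⊥
    basis-of A = extend ∣ A ∣ A ⊥ (ℕP.m≤m+n ∣ A ∣ ∣ ⊥ {n} ∣) ⊥⊆ ind-⊥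

  rk : Subset n → ℕ
  rk A = ∣ Basis.basis (basis-of A) ∣

  rk-≥ : ∀ {A J} → J ⊆ A → Ind J → ∣ J ∣ ℕ.≤ rk A
  rk-≥ {A} = Basis.max (basis-of A)

  rk-basis : ∀ {A I} (B : Basis A I) → ∣ Basis.basis B ∣ ≡ rk A
  rk-basis {A} B = ℕP.≤-antisym (rk-≥ (Basis.⊆A B) (Basis.ind B)) (Basis.max B (Basis.⊆A (basis-of A)) (Basis.ind (basis-of A)))

  rk-ind : ∀ {A} → Ind A → rk A ≡ ∣ A ∣
  rk-ind {A} i = ℕP.≤-antisym (p⊆q⇒∣p∣≤∣q∣ (Basis.⊆A (basis-of A))) (rk-≥ id i)

  ind-rk : ∀ {A} → rk A ≡ ∣ A ∣ → Ind A
  ind-rk {A} e = subst Ind (eq (ℕP.≤-reflexive (sym e)) (Basis.⊆A (basis-of A))) (Basis.ind (basis-of A))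
    where
    eq : ∀ {B} → ∣ A ∣ ℕ.≤ ∣ B ∣ → B ⊆ A → B ≡ A
    eq {B} le s = ⊆-antisym s (λ {x} x∈ → case x ∈? B of λ { (yes p) → p ; (no x∉) → ⊥-elim (ℕP.<⇒≱ (p⊂q⇒∣p∣<∣q∣ ((λ y∈ → s y∈) , x , x∈ , x∉)) le) })

  rk-isRank : IsRank rk
  rk-isRank = record
    { r-⊥ = ℕP.n≤0⇒n≡0 (ℕP.≤-trans (p⊆q⇒∣p∣≤∣q∣ (Basis.⊆A (basis-of ⊥))) (ℕP.≤-reflexive (∣⊥∣≡0 n)))
    ; r-mono = λ {A} {B} s → rk-≥ (λ x∈ → s (Basis.⊆A (basis-of A) x∈)) (Basis.ind (basis-of A))
    ; r-sub = sub
    ; r-one = λ x → ℕP.≤-trans (p⊆q⇒∣p∣≤∣q∣ (Basis.⊆A (basis-of ⁅ x ⁆))) (ℕP.≤-reflexive (∣⁅x⁆∣≡1 x)) }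
    where
    -- A basis of `A ∩ B` is extended to one of `A ∪ B`, whose parts in `A` and in `B` are then
    -- counted.
    sub : ∀ A B → rk (A ∪ B) ℕ.+ rk (A ∩ B) ℕ.≤ rk A ℕ.+ rk B
    sub A B = ℕP.≤-trans (ℕP.+-mono-≤ (ℕP.≤-trans (ℕP.≤-reflexive (sym (rk-basis BJ))) (p⊆q⇒∣p∣≤∣q∣ J⊆)) (p⊆q⇒∣p∣≤∣q∣ I⊆'))
        (ℕP.≤-trans (ℕP.≤-reflexive (∣∣-∪∩ (J ∩ A) (J ∩ B))) (ℕP.+-mono-≤ (rk-≥ (p∩q⊆q J A) (ind-sub (p∩q⊆p J A) (Basis.ind BJ))) (rk-≥ (p∩q⊆q J B) (ind-sub (p∩q⊆p J B) (Basis.ind BJ)))))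
      where
      I : Subset n
      I = Basis.basis (basis-of (A ∩ B))
      I⊆A∩B : I ⊆ A ∩ B
      I⊆A∩B = Basis.⊆A (basis-of (A ∩ B))
      BJ : Basis (A ∪ B) I
      BJ = extend ∣ A ∪ B ∣ (A ∪ B) I (ℕP.m≤m+n _ _) (λ x∈ → ∈∪ˡ (p∩q⊆p A B (I⊆A∩B x∈))) (Basis.ind (basis-of (A ∩ B)))
      J : Subset n
      J = Basis.basis BJ
      J⊆ : J ⊆ (J ∩ A) ∪ (J ∩ B)
      J⊆ x∈ = [ (λ p → ∈∪ˡ (x∈p∩q⁺ (x∈ , p))) , (λ p → ∈∪ʳ (x∈p∩q⁺ (x∈ , p))) ]′ (x∈p∪q⁻ A B (Basis.⊆A BJ x∈))
      I⊆' : I ⊆ (J ∩ A) ∩ (J ∩ B)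
      I⊆' x∈ = x∈p∩q⁺ (x∈p∩q⁺ (Basis.I⊆ BJ x∈ , p∩q⊆p A B (I⊆A∩B x∈)) , x∈p∩q⁺ (Basis.I⊆ BJ x∈ , p∩q⊆q A B (I⊆A∩B x∈)))

∈-allSubsets : ∀ {n} (A : Subset n) → A ∈ₗ allSubsets n
∈-allSubsets [] = here refl
∈-allSubsets {suc n} (false ∷ A) = ∈-++⁺ˡ (∈-map⁺ (false ∷_) (∈-allSubsets A))
  where open import Data.List.Membership.Propositional.Properties using (∈-++⁺ˡ; ∈-map⁺)
∈-allSubsets {suc n} (true ∷ A) = ∈-++⁺ʳ (List.map (false ∷_) (allSubsets n)) (∈-map⁺ (true ∷_) (∈-allSubsets A))
  where open import Data.List.Membership.Propositional.Properties using (∈-++⁺ʳ; ∈-map⁺)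

maxL-filter-≤ : ∀ {A : Set} (p : A → Bool) (f : A → ℕ) k xs → (∀ x → p x ≡ true → f x ℕ.≤ k) → maxL (List.map f (List.filterᵇ p xs)) ℕ.≤ k
maxL-filter-≤ p f k [] h = z≤n
maxL-filter-≤ p f k (x ∷ xs) h with p x in eq
... | true = ℕP.⊔-lub (h x eq) (maxL-filter-≤ p f k xs h)
... | false = maxL-filter-≤ p f k xs h

maxL-filter-≥ : ∀ {A : Set} (p : A → Bool) (f : A → ℕ) {x} xs → x ∈ₗ xs → p x ≡ true → f x ℕ.≤ maxL (List.map f (List.filterᵇ p xs))
maxL-filter-≥ p f (x ∷ xs) (here refl) e with p x
... | true = ℕP.m≤m⊔n (f x) _
maxL-filter-≥ p f (y ∷ xs) (there q) e with p y
... | true = ℕP.≤-trans (maxL-filter-≥ p f xs q e) (ℕP.m≤n⊔m (f y) _)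
... | false = maxL-filter-≥ p f xs q e

rank≡rk : ∀ {n} (M : Matroid n) → rank M ≡ MatroidRank.rk M ⊤
rank≡rk {n} M = ℕP.≤-antisym (maxL-filter-≤ (indep M) ∣_∣ (rk ⊤) (allSubsets n) (λ A i → rk-≥ ⊆⊤ i))
    (maxL-filter-≥ (indep M) ∣_∣ (allSubsets n) (∈-allSubsets (Basis.basis (basis-of ⊤))) (Basis.ind (basis-of ⊤)))
  where open MatroidRank M

-- Broken circuits

extremum : ∀ {n} {P : Fin n → Set} (P? : ∀ m → Dec (P m)) (_≼_ : Fin n → Fin n → Set) → (∀ {a} → a ≼ a) → (∀ a b → a ≼ b ⊎ b ≼ a) → (∀ {a b c} → a ≼ b → b ≼ c → a ≼ c) →
  (∀ m → ¬ P m) ⊎ ∃[ m ] (P m × ∀ y → P y → y ≼ m)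
extremum {zero} P? _≼_ rfl total trs = inj₁ (λ ())
extremum {suc n} {P} P? _≼_ rfl total trs = go (P? zero) (extremum (P? ∘ suc) (λ a b → suc a ≼ suc b) rfl (λ a b → total (suc a) (suc b)) trs)
  where
  Result : Set
  Result = (∀ m → ¬ P m) ⊎ ∃[ m ] (P m × ∀ y → P y → y ≼ m)
  go : Dec (P zero) → (∀ m → ¬ P (suc m)) ⊎ ∃[ m ] (P (suc m) × ∀ y → P (suc y) → suc y ≼ suc m) → Result
  go (no ¬p) (inj₁ h) = inj₁ (λ { zero → ¬p ; (suc m) → h m })
  go (no ¬p) (inj₂ (m , p , h)) = inj₂ (suc m , p , λ { zero q → ⊥-elim (¬p q) ; (suc y) q → h y q })
  go (yes p) (inj₁ h) = inj₂ (zero , p , λ { zero _ → rfl ; (suc y) q → ⊥-elim (h y q) })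
  go (yes p) (inj₂ (m , pm , h)) = cmp (total zero (suc m))
    where
    cmp : zero ≼ suc m ⊎ suc m ≼ zero → Result
    cmp (inj₁ le) = inj₂ (suc m , pm , λ { zero _ → le ; (suc y) q → h y q })
    cmp (inj₂ le) = inj₂ (zero , p , λ { zero _ → rfl ; (suc y) q → trs (h y q) le })

module BrokenCircuits {n} (r : Subset n → ℕ) (isRank : IsRank r) (ρ : Fin n → ℕ) (inj : ∀ {x y} → ρ x ≡ ρ y → x ≡ y) where
  open Rank r isRank
  open Deletion r isRank
  open Whitney r isRank

  above : Fin n → Subset n → Subset n
  above m A = tabulate (λ y → lookup A y ∧ Dec.does (ρ m ℕP.<? ρ y))

  above⁺ : ∀ {m A y} → y ∈ A → ρ m ℕ.< ρ y → y ∈ above m A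
  above⁺ {m} {A} {y} y∈ lt = lookup⇒∈ (trans (VecP.lookup∘tabulate (λ y → lookup A y ∧ Dec.does (ρ m ℕP.<? ρ y)) y) (cong₂ _∧_ (∈⇒lookup y∈) (dec-true (ρ m ℕP.<? ρ y) lt)))
    where open import Relation.Nullary.Decidable using (dec-true)

  above⁻ : ∀ {m A y} → y ∈ above m A → y ∈ A × ρ m ℕ.< ρ y
  above⁻ {m} {A} {y} h = go (lookup A y) (ρ m ℕP.<? ρ y) refl (trans (sym (VecP.lookup∘tabulate (λ y → lookup A y ∧ Dec.does (ρ m ℕP.<? ρ y)) y)) (∈⇒lookup h))
    where
    go : ∀ b (d : Dec (ρ m ℕ.< ρ y)) → lookup A y ≡ b → b ∧ Dec.does d ≡ true → y ∈ A × ρ m ℕ.< ρ y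
    go true (yes lt) e _ = lookup⇒∈ e , lt
    go true (no _) _ ()
    go false _ _ ()

  -- The condition does not ask whether `m` lies in `A`; this is what allows `m` to be toggled.
  Active : Subset n → Fin n → Set
  Active A m = m ∈cl above m A

  active? : ∀ A m → Dec (Active A m)
  active? A m = r (above m A ∪ ⁅ m ⁆) ℕP.≟ r (above m A)

  MaxActive : Subset n → Fin n → Set
  MaxActive A m = Active A m × (∀ y → ρ m ℕ.< ρ y → ¬ Active A y)

  maxActive? : ∀ A m → Dec (MaxActive A m)
  maxActive? A m = active? A m ×-dec FinP.all? (λ y → imp? (ρ m ℕP.<? ρ y) (¬? (active? A y)))
    where
    imp? : ∀ {P Q : Set} → Dec P → Dec Q → Dec (P → Q)
    imp? (no ¬p) _ = yes (λ p → ⊥-elim (¬p p))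
    imp? (yes p) (yes q) = yes (λ _ → q)
    imp? (yes p) (no ¬q) = no (λ f → ¬q (f p))

  NBC : Subset n → Set
  NBC A = ∀ m → ¬ Active A m

  nbc? : ∀ A → Dec (NBC A)
  nbc? A = FinP.all? (λ m → ¬? (active? A m))

  max-unique : ∀ {A m m'} → MaxActive A m → MaxActive A m' → m ≡ m'
  max-unique {A} {m} {m'} (a , h) (a' , h') = inj (ℕP.≤-antisym (ℕP.≮⇒≥ (λ lt → h' m lt a)) (ℕP.≮⇒≥ (λ lt → h m' lt a')))

  -- toggling the largest active element m does not change the sets A_{>y} with y ≥ m
  above-toggle : ∀ {A m y} → ρ m ℕ.≤ ρ y → above y (A ∪ ⁅ m ⁆) ≡ above y A
  above-toggle {A} {m} {y} le = ⊆-antisym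
    (λ {z} z∈ → let (p , lt) = above⁻ {y} {A ∪ ⁅ m ⁆} z∈ in above⁺ {y} {A} ([ id , (λ w → ⊥-elim (ℕP.<⇒≱ lt (subst (λ v → ρ v ℕ.≤ ρ y) (sym (x∈⁅y⁆⇒x≡y m w)) le))) ]′ (x∈p∪q⁻ A ⁅ m ⁆ p)) lt)
    (λ z∈ → let (p , lt) = above⁻ {y} {A} z∈ in above⁺ {y} {A ∪ ⁅ m ⁆} (∈∪ˡ p) lt)

  active-toggle : ∀ {A m y} → ρ m ℕ.≤ ρ y → Active (A ∪ ⁅ m ⁆) y ≡ Active A y
  active-toggle {A} {m} {y} le = cong (y ∈cl_) (above-toggle {A} {m} {y} le)

  max-toggle : ∀ {A m} → (MaxActive (A ∪ ⁅ m ⁆) m → MaxActive A m) × (MaxActive A m → MaxActive (A ∪ ⁅ m ⁆) m)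
  max-toggle {A} {m} = (λ (a , h) → subst id (active-toggle {A} {m} {m} ℕP.≤-refl) a , λ y lt a' → h y lt (subst id (sym (active-toggle {A} {m} {y} (ℕP.<⇒≤ lt))) a')) ,
    (λ (a , h) → subst id (sym (active-toggle {A} {m} {m} ℕP.≤-refl)) a , λ y lt a' → h y lt (subst id (active-toggle {A} {m} {y} (ℕP.<⇒≤ lt)) a'))

  max-sum : ∀ q m → ΣS (λ A → sel (maxActive? A m) (wt q A)) ≡ 0ℤ
  max-sum q m = ΣS-cancel m (λ A → sel (maxActive? A m) (wt q A)) (λ A m∉ → go A m∉ (maxActive? (A ∪ ⁅ m ⁆) m) (maxActive? A m))
    where
    go : ∀ A → m ∉ A → (d : Dec (MaxActive (A ∪ ⁅ m ⁆) m)) (d' : Dec (MaxActive A m)) → sel d (wt q (A ∪ ⁅ m ⁆)) ≡ - sel d' (wt q A)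
    go A m∉ (yes _) (yes (a , _)) = wt-toggle q m∉ (∈cl-mono (λ x∈ → proj₁ (above⁻ {m} {A} x∈)) a)
    go A m∉ (no _) (no _) = refl
    go A m∉ (yes h) (no ¬h) = ⊥-elim (¬h (proj₁ (max-toggle {A}) h))
    go A m∉ (no ¬h) (yes h) = ⊥-elim (¬h (proj₂ (max-toggle {A}) h))

  decompose : ∀ A x → x ≡ sel (nbc? A) x + ΣF n (λ m → sel (maxActive? A m) x)
  decompose A x = go (extremum (active? A) (λ a b → ρ a ℕ.≤ ρ b) ℕP.≤-refl (λ a b → ℕP.≤-total (ρ a) (ρ b)) ℕP.≤-trans)
    where
    go : (∀ m → ¬ Active A m) ⊎ ∃[ m ] (Active A m × ∀ y → Active A y → ρ y ℕ.≤ ρ m) → x ≡ sel (nbc? A) x + ΣF n (λ m → sel (maxActive? A m) x)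
    go (inj₁ none) = sym (trans (cong₂ _+_ (sel-yes (nbc? A) none) (ΣF-0 n {λ m → sel (maxActive? A m) x} (λ m → sel-no (maxActive? A m) (λ (a , _) → none m a)))) (ℤP.+-identityʳ x))
    go (inj₂ (m , a , h)) = sym (trans (cong₂ _+_ (sel-no (nbc? A) (λ none → none m a))
        (trans (ΣF-point n m (λ m → sel (maxActive? A m) x) (λ k ne → sel-no (maxActive? A k) (λ p → ne (max-unique {A} p mx)))) (sel-yes (maxActive? A m) mx))) (ℤP.+-identityˡ x))
      where
      mx : MaxActive A m
      mx = a , λ y lt a' → ℕP.<⇒≱ lt (h y a')

  nbc-sum : ∀ q → ΣS (wt q) ≡ ΣS (λ A → sel (nbc? A) (wt q A))
  nbc-sum q = trans (ΣS-cong {n} (λ A → decompose A (wt q A)))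
    (trans (ΣS-+ (λ A → sel (nbc? A) (wt q A)) (λ A → ΣF n (λ m → sel (maxActive? A m) (wt q A))))
    (trans (+R N (trans (ΣF-swap (size n) n (λ k m → sel (maxActive? (enum n k) m) (wt q (enum n k)))) (ΣF-0 n {λ m → ΣS (λ A → sel (maxActive? A m) (wt q A))} (max-sum q)))) (ℤP.+-identityʳ N)))
    where
    N : ℤ
    N = ΣS (λ A → sel (nbc? A) (wt q A))

  -- The least element of a circuit in `A` is spanned by the rest of the circuit, which lies above
  -- it, and is therefore active.
  nbc-indep : ∀ {A} → NBC A → r A ≡ ∣ A ∣
  nbc-indep {A} none = ℕP.≤-antisym (r≤∣∣ A) (ℕP.≮⇒≥ (λ lt → contra (circuit ∣ A ∣ A ℕP.≤-refl lt)))
    where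
    contra : ∃[ C ] (C ⊆ A × Nonempty C × (∀ {x} → x ∈ C → Spanned C x)) → Absurd
    contra (C , s , (x , x∈) , sp) = go (extremum (_∈? C) (λ a b → ρ b ℕ.≤ ρ a) ℕP.≤-refl (λ a b → ℕP.≤-total (ρ b) (ρ a)) (λ p q → ℕP.≤-trans q p))
      where
      go : (∀ m → m ∉ C) ⊎ ∃[ m ] (m ∈ C × ∀ y → y ∈ C → ρ m ℕ.≤ ρ y) → Absurd
      go (inj₁ e) = e x x∈
      go (inj₂ (m , m∈ , least)) = none m (∈cl-mono {del C m} (λ {y} y∈ → above⁺ {m} {A} (s (del-⊆ m y∈)) (ℕP.≤∧≢⇒< (least y (del-⊆ m y∈)) (λ e → ∈del⁻ y∈ (inj (sym e)))))
        (trans (cong r (del-∪ m∈)) (sym (sp m∈))))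

  nbc-wt : ∀ q {A} → NBC A → wt q A ≡ (q - 1ℤ) ℤ.^ (r ⊤ ℕ.∸ ∣ A ∣)
  nbc-wt q {A} h = trans (cong (λ j → sg (∣ A ∣ ℕ.+ j) * (q - 1ℤ) ℤ.^ (r ⊤ ℕ.∸ j)) (nbc-indep {A} h))
    (trans (cong (λ w → w * (q - 1ℤ) ℤ.^ (r ⊤ ℕ.∸ ∣ A ∣)) (sg-even ∣ A ∣)) (ℤP.*-identityˡ ((q - 1ℤ) ℤ.^ (r ⊤ ℕ.∸ ∣ A ∣))))

  loop-active : ∀ {x} → r ⁅ x ⁆ ≡ 0 → ∀ A → ¬ NBC A
  loop-active {x} e A none = none x (∈cl-mono {⊥} {above x A} ⊥⊆ (trans (cong r (∪-identityˡ ⁅ x ⁆)) (trans e (sym r-⊥))))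

-- Broken circuits found by Boolean search

anyL-sound : ∀ {A : Set} {p : A → Bool} xs → anyL p xs ≡ true → ∃[ x ] (p x ≡ true)
anyL-sound {p = p} (x ∷ xs) h with p x in eq
... | true = x , eq
... | false = anyL-sound xs h

anyL-complete : ∀ {A : Set} {p : A → Bool} {x xs} → x ∈ₗ xs → p x ≡ true → anyL p xs ≡ true
anyL-complete {p = p} {xs = _ ∷ xs} (here refl) h = cong (_∨ anyL p xs) h
anyL-complete {p = p} {xs = y ∷ _} (there q) h = trans (cong (p y ∨_) (anyL-complete q h)) (BoolP.∨-zeroʳ (p y))

allL-sound : ∀ {A : Set} {p : A → Bool} {x xs} → allL p xs ≡ true → x ∈ₗ xs → p x ≡ true
allL-sound {p = p} {xs = y ∷ _} h q with p y in eq
allL-sound h (here refl) | true = eq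
allL-sound h (there q) | true = allL-sound h q

allL-complete : ∀ {A : Set} {p : A → Bool} xs → (∀ x → p x ≡ true) → allL p xs ≡ true
allL-complete [] h = refl
allL-complete (x ∷ xs) h = cong₂ _∧_ (h x) (allL-complete xs h)

∧-sound : ∀ {a b} → a ∧ b ≡ true → a ≡ true × b ≡ true
∧-sound {true} {true} _ = refl , refl

imp-sound : ∀ {a b} → not a ∨ b ≡ true → a ≡ true → b ≡ true
imp-sound {true} h _ = h

imp-complete : ∀ {a b} → (a ≡ true → b ≡ true) → not a ∨ b ≡ true
imp-complete {true} h = h refl
imp-complete {false} h = refl

not-sound : ∀ {a} → not a ≡ true → a ≢ true
not-sound {false} _ ()

not-complete : ∀ {a} → a ≢ true → not a ≡ true
not-complete {true} h = ⊥-elim (h refl)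
not-complete {false} _ = refl

allFin-sound : ∀ {n} {p : Fin n → Bool} → allFin? p ≡ true → ∀ i → p i ≡ true
allFin-sound h i = allL-sound h (∈-allFin i)
  where open import Data.List.Membership.Propositional.Properties using (∈-allFin)

≤ᵇ-sound : ∀ {a b} → (a ℕ.≤ᵇ b) ≡ true → a ℕ.≤ b
≤ᵇ-sound {a} {b} h = ℕP.≤ᵇ⇒≤ a b (subst Bool.T (sym h) _)

≤ᵇ-complete : ∀ {a b} → a ℕ.≤ b → (a ℕ.≤ᵇ b) ≡ true
≤ᵇ-complete {a} {b} h = T⇒true (ℕP.≤⇒≤ᵇ h)
  where
  T⇒true : ∀ {x} → Bool.T x → x ≡ true
  T⇒true {true} _ = refl

module BrokenCircuitComplex {n} (M : Matroid n) (ρ : Fin n → ℕ) (inj : ∀ {x y} → ρ x ≡ ρ y → x ≡ y) where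
  open MatroidRank M public
  open Rank rk rk-isRank
  open Deletion rk rk-isRank
  open Whitney rk rk-isRank public
  open BrokenCircuits rk rk-isRank ρ inj public
  open import Data.List.Membership.Propositional.Properties using (∈-allFin)

  minimal-dependent : ∀ k A → ∣ A ∣ ℕ.≤ k → ¬ Ind A → ∃[ C ] (C ⊆ A × ¬ Ind C × (∀ x → x ∈ C → Ind (C ─ ⁅ x ⁆)))
  minimal-dependent k A le h = go (FinP.any? (λ x → (x ∈? A) ×-dec ¬? (ind? (A ─ ⁅ x ⁆)))) k le
    where
    go : Dec (∃[ x ] (x ∈ A × ¬ Ind (A ─ ⁅ x ⁆))) → ∀ k → ∣ A ∣ ℕ.≤ k → ∃[ C ] (C ⊆ A × ¬ Ind C × (∀ x → x ∈ C → Ind (C ─ ⁅ x ⁆)))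
    go (no none) _ _ = A , id , h , λ x x∈ → case ind? (A ─ ⁅ x ⁆) of λ { (yes i) → i ; (no ¬i) → ⊥-elim (none (x , x∈ , ¬i)) }
    go (yes (x , x∈ , ¬i)) zero le = ⊥-elim (ℕP.n≮0 (ℕP.≤-trans (ℕP.≤-reflexive (card-del x∈)) le))
    go (yes (x , x∈ , ¬i)) (suc k) le =
      let (C , s , d , m) = minimal-dependent k (A ─ ⁅ x ⁆) (ℕP.≤-pred (ℕP.≤-trans (ℕP.≤-reflexive (card-del x∈)) le)) ¬i
      in C , (λ y∈ → p─q⊆p A ⁅ x ⁆ (s y∈)) , d , m

  broken⇒active : ∀ {A} → containsBrokenCircuit M ρ A ≡ true → ∃[ m ] Active A m
  broken⇒active {A} h =
    let (C , h₁) = anyL-sound (allSubsets n) h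
        (m , h₂) = anyL-sound (List.allFin n) h₁
        (circ , h₃) = ∧-sound {isCircuit M C} h₂
        (least , sub) = ∧-sound {isLeastIn ρ C m} h₃
        (dep , min) = ∧-sound {not (indep M C)} circ
        (m∈ , low) = ∧-sound {memB m C} least
    in m , active C m (not-sound dep) (λ i i∈ → imp-sound (allFin-sound min i) (∈⇒lookup i∈)) (lookup⇒∈ m∈)
             (λ y y∈ → ≤ᵇ-sound (imp-sound (allFin-sound low y) (∈⇒lookup y∈))) (λ {y} y∈ → lookup⇒∈ (imp-sound (allFin-sound sub y) (∈⇒lookup y∈)))
    where
    active : ∀ C m → ¬ Ind C → (∀ i → i ∈ C → Ind (C ─ ⁅ i ⁆)) → m ∈ C → (∀ y → y ∈ C → ρ m ℕ.≤ ρ y) → C ─ ⁅ m ⁆ ⊆ A → Active A m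
    active C m dep min m∈ least s = ∈cl-mono {del C m} (λ {y} y∈ → above⁺ {m} {A} (s y∈) (ℕP.≤∧≢⇒< (least y (del-⊆ m y∈)) (λ e → ∈del⁻ y∈ (inj (sym e)))))
      (ℕP.≤-antisym (ℕP.≤-trans (ℕP.≤-reflexive (cong rk (del-∪ m∈))) (ℕP.≤-pred (ℕP.≤-trans (ℕP.≤∧≢⇒< (r≤∣∣ C) (λ e → dep (ind-rk e)))
        (ℕP.≤-reflexive (trans (sym (∣del∣ m∈)) (cong suc (sym (rk-ind (min m m∈))))))))) (r-mono ∈∪ˡ))

  -- Add `m` to a basis of the part of `A` above `m`. The result is dependent, and a minimal
  -- dependent subset of it contains `m` as its least element.
  active⇒broken : ∀ {A m} → Active A m → containsBrokenCircuit M ρ A ≡ true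
  active⇒broken {A} {m} act =
    let (C , s , dep , min) = minimal-dependent ∣ I ∪ ⁅ m ⁆ ∣ (I ∪ ⁅ m ⁆) ℕP.≤-refl dependent
        m∈ : m ∈ C
        m∈ = case m ∈? C of λ { (yes p) → p ; (no m∉) → ⊥-elim (dep (ind-sub (λ {y} y∈ → [ id , (λ w → ⊥-elim (m∉ (subst (_∈ C) (x∈⁅y⁆⇒x≡y m w) y∈))) ]′ (x∈p∪q⁻ I ⁅ m ⁆ (s y∈))) (Basis.ind B))) }
        rest : ∀ {y} → y ∈ C → y ≢ m → y ∈ A × ρ m ℕ.< ρ y
        rest = λ {y} y∈ ne → above⁻ {m} {A} (Basis.⊆A B ([ id , (λ w → ⊥-elim (ne (x∈⁅y⁆⇒x≡y m w))) ]′ (x∈p∪q⁻ I ⁅ m ⁆ (s y∈))))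
    in anyL-complete (∈-allSubsets C) (anyL-complete (∈-allFin m) (cong₂ _∧_
         (cong₂ _∧_ (not-complete dep) (allL-complete (List.allFin n) (λ i → imp-complete (λ i∈ → min i (lookup⇒∈ i∈)))))
         (cong₂ _∧_ (cong₂ _∧_ (∈⇒lookup m∈) (allL-complete (List.allFin n) (λ y → imp-complete (λ y∈ → ≤ᵇ-complete (least (rest {y} (lookup⇒∈ y∈)) (y FinP.≟ m))))))
           (allL-complete (List.allFin n) (λ y → imp-complete (λ y∈ → ∈⇒lookup (proj₁ (rest {y} (del-⊆ m (lookup⇒∈ y∈)) (∈del⁻ {C} (lookup⇒∈ y∈))))))))))
    where
    B : Basis (above m A) ⊥
    B = basis-of (above m A)
    I : Subset n
    I = Basis.basis B
    m∉I : m ∉ I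
    m∉I m∈ = ℕP.<-irrefl refl (proj₂ (above⁻ {m} {A} (Basis.⊆A B m∈)))
    dependent : ¬ Ind (I ∪ ⁅ m ⁆)
    dependent i = ℕP.<⇒≱ (ℕP.≤-reflexive (sym (card-add m∉I)))
      (ℕP.≤-trans (rk-≥ (∪-mono (Basis.⊆A B) id) i) (ℕP.≤-trans (ℕP.≤-reflexive act) (ℕP.≤-reflexive (sym (rk-basis B)))))
    least : ∀ {y} → (y ≢ m → y ∈ A × ρ m ℕ.< ρ y) → Dec (y ≡ m) → ρ m ℕ.≤ ρ y
    least _ (yes refl) = ℕP.≤-refl
    least h (no ne) = ℕP.<⇒≤ (proj₂ (h ne))

  BCface⇒nbc : ∀ {A} → BCface M ρ A ≡ true → NBC A
  BCface⇒nbc {A} h m act = not-sound h (active⇒broken {A} act)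

  nbc⇒BCface : ∀ {A} → NBC A → BCface M ρ A ≡ true
  nbc⇒BCface {A} h = not-complete (λ b → let (m , act) = broken⇒active {A} b in h m act)

  BCface-card : ∀ A → BCface M ρ A ≡ true → ∣ A ∣ ℕ.≤ rk ⊤
  BCface-card A h = ℕP.≤-trans (ℕP.≤-reflexive (sym (nbc-indep {A} (BCface⇒nbc {A} h)))) (r-mono ⊆⊤)

  BC-sum : ∀ q → ΣS (λ A → if BCface M ρ A then (q - 1ℤ) ℤ.^ (rk ⊤ ℕ.∸ ∣ A ∣) else 0ℤ) ≡ ΣS (wt q)
  BC-sum q = trans (ΣS-cong {n} (λ A → go A (BCface M ρ A) refl (nbc? A))) (sym (nbc-sum q))
    where
    go : ∀ A b → BCface M ρ A ≡ b → (d : Dec (NBC A)) → (if b then (q - 1ℤ) ℤ.^ (rk ⊤ ℕ.∸ ∣ A ∣) else 0ℤ) ≡ sel d (wt q A)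
    go A true e (yes h) = sym (nbc-wt q {A} h)
    go A false e (no _) = refl
    go A true e (no ¬h) = ⊥-elim (¬h (BCface⇒nbc {A} e))
    go A false e (yes h) = ⊥-elim (not-sound (cong not e) (nbc⇒BCface {A} h))

∣─∣+∣∩∣ : ∀ {n} (B A : Subset n) → ∣ B ─ A ∣ ℕ.+ ∣ A ∩ B ∣ ≡ ∣ B ∣
∣─∣+∣∩∣ [] [] = refl
∣─∣+∣∩∣ (true ∷ B) (true ∷ A) = trans (ℕP.+-suc ∣ B ─ A ∣ ∣ A ∩ B ∣) (cong suc (∣─∣+∣∩∣ B A))
∣─∣+∣∩∣ (true ∷ B) (false ∷ A) = cong suc (∣─∣+∣∩∣ B A)
∣─∣+∣∩∣ (false ∷ B) (true ∷ A) = ∣─∣+∣∩∣ B A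
∣─∣+∣∩∣ (false ∷ B) (false ∷ A) = ∣─∣+∣∩∣ B A

-- the free coextension by one element
module Coextension {n} (r : Subset n → ℕ) (isRank : IsRank r) where
  open Rank r isRank
  open Deletion r isRank

  -- The new element is the head. In the dual matroid it is a generic extension; here it lets a set
  -- that avoids it exceed its old rank by at most one, and it removes all loops.
  rN : Subset (suc n) → ℕ
  rN (false ∷ A) = ∣ A ∣ ℕ.⊓ suc (r A)
  rN (true ∷ A)  = suc (r A)

  r-∪-card : ∀ A B → r (A ∪ B) ℕ.+ ∣ A ∩ B ∣ ℕ.≤ r A ℕ.+ ∣ B ∣
  r-∪-card A B = ℕP.≤-trans (ℕP.+-monoˡ-≤ ∣ A ∩ B ∣ (ℕP.≤-trans (r-mono (∪-⊆ ∈∪ˡ (λ {x} x∈ → case x ∈? A of λ { (yes p) → ∈∪ˡ p ; (no p) → ∈∪ʳ (∈─⁺ x∈ p) })))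
      (ℕP.≤-trans (ℕP.m≤m+n _ (r (A ∩ (B ─ A)))) (ℕP.≤-trans (r-sub A (B ─ A)) (ℕP.+-monoʳ-≤ (r A) (r≤∣∣ (B ─ A)))))))
    (ℕP.≤-reflexive (trans (ℕP.+-assoc (r A) ∣ B ─ A ∣ ∣ A ∩ B ∣) (cong (r A ℕ.+_) (∣─∣+∣∩∣ B A))))

  sub-ranks : ∀ A B → suc (r (A ∪ B)) ℕ.+ suc (r (A ∩ B)) ℕ.≤ suc (r A) ℕ.+ suc (r B)
  sub-ranks A B = s≤s (subst₂ ℕ._≤_ (sym (ℕP.+-suc (r (A ∪ B)) (r (A ∩ B)))) (sym (ℕP.+-suc (r A) (r B))) (s≤s (r-sub A B)))

  sub-mixed : ∀ A B → suc (r (A ∪ B)) ℕ.+ rN (false ∷ (A ∩ B)) ℕ.≤ suc (r A) ℕ.+ rN (false ∷ B)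
  sub-mixed A B = go (ℕP.⊓-sel ∣ B ∣ (suc (r B)))
    where
    go : ∣ B ∣ ℕ.⊓ suc (r B) ≡ ∣ B ∣ ⊎ ∣ B ∣ ℕ.⊓ suc (r B) ≡ suc (r B) → suc (r (A ∪ B)) ℕ.+ rN (false ∷ (A ∩ B)) ℕ.≤ suc (r A) ℕ.+ rN (false ∷ B)
    go (inj₁ e) = ℕP.≤-trans (ℕP.+-monoʳ-≤ (suc (r (A ∪ B))) (ℕP.m⊓n≤m ∣ A ∩ B ∣ _)) (ℕP.≤-trans (s≤s (r-∪-card A B)) (ℕP.≤-reflexive (cong (suc (r A) ℕ.+_) (sym e))))
    go (inj₂ e) = ℕP.≤-trans (ℕP.+-monoʳ-≤ (suc (r (A ∪ B))) (ℕP.m⊓n≤n ∣ A ∩ B ∣ _)) (ℕP.≤-trans (sub-ranks A B) (ℕP.≤-reflexive (cong (suc (r A) ℕ.+_) (sym e))))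

  rN-sub : ∀ A B → rN (A ∪ B) ℕ.+ rN (A ∩ B) ℕ.≤ rN A ℕ.+ rN B
  rN-sub (true ∷ A) (true ∷ B) = sub-ranks A B
  rN-sub (true ∷ A) (false ∷ B) = sub-mixed A B
  rN-sub (false ∷ A) (true ∷ B) = ℕP.≤-trans (ℕP.≤-reflexive (cong₂ (λ X Y → suc (r X) ℕ.+ rN (false ∷ Y)) (∪-comm A B) (∩-comm A B)))
    (ℕP.≤-trans (sub-mixed B A) (ℕP.≤-reflexive (ℕP.+-comm (suc (r B)) (rN (false ∷ A)))))
  rN-sub (false ∷ A) (false ∷ B) = go (ℕP.⊓-sel ∣ A ∣ (suc (r A)))
    where
    swap : ∀ A B → rN (false ∷ (A ∪ B)) ℕ.+ rN (false ∷ (A ∩ B)) ≡ rN (false ∷ (B ∪ A)) ℕ.+ rN (false ∷ (B ∩ A))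
    swap A B = cong₂ (λ X Y → rN (false ∷ X) ℕ.+ rN (false ∷ Y)) (∪-comm A B) (∩-comm A B)
    rank-left : ∀ A B → ∣ A ∣ ℕ.⊓ suc (r A) ≡ suc (r A) → rN (false ∷ (A ∪ B)) ℕ.+ rN (false ∷ (A ∩ B)) ℕ.≤ rN (false ∷ A) ℕ.+ rN (false ∷ B)
    rank-left A B e = ℕP.≤-trans (ℕP.+-monoˡ-≤ (rN (false ∷ (A ∩ B))) (ℕP.m⊓n≤n ∣ A ∪ B ∣ _)) (ℕP.≤-trans (sub-mixed A B) (ℕP.≤-reflexive (cong (ℕ._+ rN (false ∷ B)) (sym e))))
    go : ∣ A ∣ ℕ.⊓ suc (r A) ≡ ∣ A ∣ ⊎ ∣ A ∣ ℕ.⊓ suc (r A) ≡ suc (r A) → rN (false ∷ (A ∪ B)) ℕ.+ rN (false ∷ (A ∩ B)) ℕ.≤ rN (false ∷ A) ℕ.+ rN (false ∷ B)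
    go (inj₂ e) = rank-left A B e
    go (inj₁ e) = go' (ℕP.⊓-sel ∣ B ∣ (suc (r B)))
      where
      go' : ∣ B ∣ ℕ.⊓ suc (r B) ≡ ∣ B ∣ ⊎ ∣ B ∣ ℕ.⊓ suc (r B) ≡ suc (r B) → rN (false ∷ (A ∪ B)) ℕ.+ rN (false ∷ (A ∩ B)) ℕ.≤ rN (false ∷ A) ℕ.+ rN (false ∷ B)
      go' (inj₂ e') = ℕP.≤-trans (ℕP.≤-reflexive (swap A B)) (ℕP.≤-trans (rank-left B A e') (ℕP.≤-reflexive (ℕP.+-comm (rN (false ∷ B)) (rN (false ∷ A)))))
      go' (inj₁ e') = ℕP.≤-trans (ℕP.+-mono-≤ (ℕP.m⊓n≤m ∣ A ∪ B ∣ (suc (r (A ∪ B)))) (ℕP.m⊓n≤m ∣ A ∩ B ∣ (suc (r (A ∩ B))))) (ℕP.≤-reflexive (trans (∣∣-∪∩ A B) (cong₂ ℕ._+_ (sym e) (sym e'))))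

  rN-mono : ∀ {A B} → A ⊆ B → rN A ℕ.≤ rN B
  rN-mono {true ∷ A} {true ∷ B} s = s≤s (r-mono (drop-∷-⊆ s))
  rN-mono {true ∷ A} {false ∷ B} s = absurd (s Vec.here)
    where
    absurd : ∀ {P : Set} → zero ∈ false ∷ B → P
    absurd ()
  rN-mono {false ∷ A} {true ∷ B} s = ℕP.≤-trans (ℕP.m⊓n≤n ∣ A ∣ _) (s≤s (r-mono (drop-∷-⊆ s)))
  rN-mono {false ∷ A} {false ∷ B} s = ℕP.⊓-mono-≤ (p⊆q⇒∣p∣≤∣q∣ (drop-∷-⊆ s)) (s≤s (r-mono (drop-∷-⊆ s)))

  rN-single : ∀ x → rN ⁅ x ⁆ ≡ 1
  rN-single zero = cong suc r-⊥
  rN-single (suc x) = cong (ℕ._⊓ suc (r ⁅ x ⁆)) (∣⁅x⁆∣≡1 x)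

  rN-isRank : IsRank rN
  rN-isRank = record { r-⊥ = cong (ℕ._⊓ suc (r ⊥)) (∣⊥∣≡0 n) ; r-mono = rN-mono ; r-sub = rN-sub ; r-one = λ x → ℕP.≤-reflexive (rN-single x) }

  module N = Whitney rN rN-isRank

  ind? : ∀ A → Dec (r A ≡ ∣ A ∣)
  ind? A = r A ℕP.≟ ∣ A ∣

  -- dependent sets cancel in pairs {A , A ∪ 0}
  wt-pair : ∀ q A → N.wt q (false ∷ A) + N.wt q (true ∷ A) ≡ q * sel (ind? A) ((q - 1ℤ) ℤ.^ (r ⊤ ℕ.∸ ∣ A ∣))
  wt-pair q A = go (ind? A)
    where
    p : ℤ
    p = q - 1ℤ
    true-value : ∀ k → r A ≡ k → N.wt q (true ∷ A) ≡ sg (∣ A ∣ ℕ.+ k) * p ℤ.^ (r ⊤ ℕ.∸ k)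
    true-value k e = cong₂ (λ s j → s * p ℤ.^ (r ⊤ ℕ.∸ j)) (trans (cong (λ j → - sg j) (ℕP.+-suc ∣ A ∣ (r A))) (trans (ℤP.neg-involutive (sg (∣ A ∣ ℕ.+ r A))) (cong (λ j → sg (∣ A ∣ ℕ.+ j)) e))) e
    false-value : ∀ k → rN (false ∷ A) ≡ k → N.wt q (false ∷ A) ≡ sg (∣ A ∣ ℕ.+ k) * p ℤ.^ (suc (r ⊤) ℕ.∸ k)
    false-value k e = cong (λ j → sg (∣ A ∣ ℕ.+ j) * p ℤ.^ (suc (r ⊤) ℕ.∸ j)) e
    go : (d : Dec (r A ≡ ∣ A ∣)) → N.wt q (false ∷ A) + N.wt q (true ∷ A) ≡ q * sel d (p ℤ.^ (r ⊤ ℕ.∸ ∣ A ∣))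
    go (yes e) = trans (cong₂ _+_ (trans (false-value ∣ A ∣ (ℕP.m≤n⇒m⊓n≡m (ℕP.≤-trans (ℕP.≤-reflexive (sym e)) (ℕP.n≤1+n (r A)))))
          (cong₂ (λ s j → s * p ℤ.^ j) (sg-even ∣ A ∣) (ℕP.+-∸-assoc 1 (ℕP.≤-trans (ℕP.≤-reflexive (sym e)) (r-mono ⊆⊤)))))
        (trans (true-value ∣ A ∣ e) (cong (λ s → s * p ℤ.^ (r ⊤ ℕ.∸ ∣ A ∣)) (sg-even ∣ A ∣)))) (ring q (p ℤ.^ (r ⊤ ℕ.∸ ∣ A ∣)))
      where
      ring : ∀ q x → 1ℤ * ((q - 1ℤ) * x) + 1ℤ * x ≡ q * x
      ring = solve-∀
    go (no ne) = trans (cong₂ _+_ (trans (false-value (suc (r A)) (ℕP.m≥n⇒m⊓n≡n (ℕP.≤∧≢⇒< (r≤∣∣ A) ne))) (cong (λ j → sg j * p ℤ.^ (r ⊤ ℕ.∸ r A)) (ℕP.+-suc ∣ A ∣ (r A)))) (true-value (r A) refl))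
        (ring q (sg (∣ A ∣ ℕ.+ r A)) (p ℤ.^ (r ⊤ ℕ.∸ r A)))
      where
      ring : ∀ q s x → - s * x + s * x ≡ q * 0ℤ
      ring = solve-∀

  coextension-sum : ∀ q → ΣS (N.wt q) ≡ q * ΣS (λ A → sel (ind? A) ((q - 1ℤ) ℤ.^ (r ⊤ ℕ.∸ ∣ A ∣)))
  coextension-sum q = trans (ΣS-suc (N.wt q)) (trans (sym (ΣS-+ (λ A → N.wt q (false ∷ A)) (λ A → N.wt q (true ∷ A))))
    (trans (ΣS-cong {n} (wt-pair q)) (ΣS-* q (λ A → sel (ind? A) ((q - 1ℤ) ℤ.^ (r ⊤ ℕ.∸ ∣ A ∣))))))

-- h-vectors

sumTo-* : ∀ D a (f : ℕ → ℤ) → sumTo D (λ i → a * f i) ≡ a * sumTo D f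
sumTo-* zero a f = refl
sumTo-* (suc D) a f = trans (cong (λ w → w + a * f (suc D)) (sumTo-* D a f)) (sym (ℤP.*-distribˡ-+ a (sumTo D f) (f (suc D))))

sumTo-head : ∀ D (f : ℕ → ℤ) → sumTo (suc D) f ≡ f 0 + sumTo D (f ∘ suc)
sumTo-head zero f = refl
sumTo-head (suc D) f = trans (cong (λ w → w + f (suc (suc D))) (sumTo-head D f)) (ℤP.+-assoc (f 0) (sumTo D (f ∘ suc)) (f (suc (suc D))))

sumTo-reverse : ∀ D (f : ℕ → ℤ) → sumTo D (λ i → f (D ℕ.∸ i)) ≡ sumTo D f
sumTo-reverse zero f = refl
sumTo-reverse (suc D) f = trans (sumTo-head D (λ i → f (suc D ℕ.∸ i))) (trans (+R (f (suc D)) (sumTo-reverse D f)) (ℤP.+-comm (f (suc D)) (sumTo D f)))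

sumTo-point : ∀ D k (f : ℕ → ℤ) → k ℕ.≤ D → (∀ i → i ≢ k → f i ≡ 0ℤ) → sumTo D f ≡ f k
sumTo-point zero zero f _ _ = refl
sumTo-point (suc D) k f le h = go (k ℕP.≟ suc D)
  where
  go : Dec (k ≡ suc D) → sumTo (suc D) f ≡ f k
  go (yes refl) = trans (cong (λ w → w + f (suc D)) (sumTo-0 D (λ i i≤ → h i (λ e → ℕP.<-irrefl e (s≤s i≤))))) (ℤP.+-identityˡ (f (suc D)))
  go (no ne) = trans (cong₂ _+_ (sumTo-point D k f (ℕP.≤-pred (ℕP.≤∧≢⇒< le ne)) h) (h (suc D) (ne ∘ sym))) (ℤP.+-identityʳ (f k))

horner : ∀ D p (f : ℕ → ℤ) → sumTo (suc D) (λ i → f i * p ℤ.^ (suc D ℕ.∸ i)) ≡ p * sumTo D (λ i → f i * p ℤ.^ (D ℕ.∸ i)) + f (suc D)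
horner D p f = cong₂ _+_ (trans (sumTo-cong D (λ i le → trans (cong (λ k → f i * p ℤ.^ k) (ℕP.+-∸-assoc 1 le)) (ring (f i) p (p ℤ.^ (D ℕ.∸ i))))) (sumTo-* D p (λ i → f i * p ℤ.^ (D ℕ.∸ i))))
    (trans (cong (λ k → f (suc D) * p ℤ.^ k) (ℕP.n∸n≡0 D)) (ℤP.*-identityʳ (f (suc D))))
  where
  ring : ∀ a p x → a * (p * x) ≡ p * (a * x)
  ring = solve-∀

-- By Horner's rule each step multiplies by `q - 1`, which takes differences of the coefficients.
shifted-expansion : ∀ D (f : ℕ → ℤ) → Σ (ℕ → ℤ) λ e → (∀ i → D ℕ.< i → e i ≡ 0ℤ) ×
  (∀ q → sumTo D (λ i → f i * (q - 1ℤ) ℤ.^ (D ℕ.∸ i)) ≡ sumTo D (λ i → e i * q ℤ.^ i))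
shifted-expansion zero f = e , (λ { (suc i) _ → refl }) , λ q → refl
  where
  e : ℕ → ℤ
  e zero = f 0
  e (suc i) = 0ℤ
shifted-expansion (suc D) f = go (shifted-expansion D f)
  where
  go : (Σ (ℕ → ℤ) λ e → (∀ i → D ℕ.< i → e i ≡ 0ℤ) × (∀ q → sumTo D (λ i → f i * (q - 1ℤ) ℤ.^ (D ℕ.∸ i)) ≡ sumTo D (λ i → e i * q ℤ.^ i))) →
    Σ (ℕ → ℤ) λ e → (∀ i → suc D ℕ.< i → e i ≡ 0ℤ) × (∀ q → sumTo (suc D) (λ i → f i * (q - 1ℤ) ℤ.^ (suc D ℕ.∸ i)) ≡ sumTo (suc D) (λ i → e i * q ℤ.^ i))
  go (e , z , h) = e' , (λ { (suc i) (s≤s lt) → cong₂ _-_ (z i lt) (z (suc i) (ℕP.m≤n⇒m≤1+n lt)) }) , λ q → trans (horner D (q - 1ℤ) f) (trans (cong (λ w → (q - 1ℤ) * w + f (suc D)) (h q)) (sym (eq q)))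
    where
    e' : ℕ → ℤ
    e' zero = f (suc D) - e 0
    e' (suc i) = e i - e (suc i)
    eq : ∀ q → sumTo (suc D) (λ i → e' i * q ℤ.^ i) ≡ (q - 1ℤ) * sumTo D (λ i → e i * q ℤ.^ i) + f (suc D)
    eq q = trans (sumTo-head D (λ i → e' i * q ℤ.^ i))
      (trans (+R ((f (suc D) - e 0) * 1ℤ) (trans (sumTo-cong D (λ i _ → ring₁ (e i) (e (suc i)) q (q ℤ.^ i)))
        (trans (sumTo-+ D (λ i → q * (e i * q ℤ.^ i)) (λ i → -1ℤ * (e (suc i) * q ℤ.^ suc i))) (cong₂ _+_ (sumTo-* D q (λ i → e i * q ℤ.^ i)) (sumTo-* D -1ℤ (λ i → e (suc i) * q ℤ.^ suc i))))))
      (trans (ring₂ (f (suc D)) (e 0) q E T) (trans (cong (λ w → q * E - w + f (suc D)) tail) (ring₃ q E (f (suc D))))))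
      where
      E T : ℤ
      E = sumTo D (λ i → e i * q ℤ.^ i)
      T = sumTo D (λ i → e (suc i) * q ℤ.^ suc i)
      tail : e 0 * 1ℤ + T ≡ 1ℤ * E
      tail = trans (sym (sumTo-head D (λ i → e i * q ℤ.^ i))) (trans (+R E (cong (λ w → w * q ℤ.^ suc D) (z (suc D) ℕP.≤-refl))) (trans (ℤP.+-identityʳ E) (sym (ℤP.*-identityˡ E))))
      ring₁ : ∀ a b q x → (a - b) * (q * x) ≡ q * (a * x) + -1ℤ * (b * (q * x))
      ring₁ = solve-∀
      ring₂ : ∀ f a q E T → (f - a) * 1ℤ + (q * E + -1ℤ * T) ≡ q * E - (a * 1ℤ + T) + f
      ring₂ = solve-∀
      ring₃ : ∀ q E f → q * E - 1ℤ * E + f ≡ (q - 1ℤ) * E + f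
      ring₃ = solve-∀

-- d is divisible by all q ≥ 1, hence zero
multiple-zero : ∀ d (H : ℤ → ℤ) → (∀ N → + suc N * H (+ suc N) + d ≡ 0ℤ) → d ≡ 0ℤ
multiple-zero d H h = go (ℤ.∣ H q ∣) refl
  where
  q : ℤ
  q = + suc ℤ.∣ d ∣
  abs : ℤ.∣ d ∣ ≡ suc ℤ.∣ d ∣ ℕ.* ℤ.∣ H q ∣
  abs = trans (cong ℤ.∣_∣ d≡) (trans (ℤP.∣-i∣≡∣i∣ (q * H q)) (ℤP.abs-* q (H q)))
    where
    d≡ : d ≡ - (q * H q)
    d≡ = trans (ring d (q * H q)) (trans (cong (λ w → w - q * H q) (h ℤ.∣ d ∣)) (ℤP.+-identityˡ (- (q * H q))))
      where
      ring : ∀ d x → d ≡ x + d - x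
      ring = solve-∀
  go : ∀ k → ℤ.∣ H q ∣ ≡ k → d ≡ 0ℤ
  go zero e = ℤP.∣i∣≡0⇒i≡0 (trans abs (trans (cong (suc ℤ.∣ d ∣ ℕ.*_) e) (ℕP.*-zeroʳ (suc ℤ.∣ d ∣))))
  go (suc k) e = ⊥-elim (ℕP.<-irrefl (trans abs (cong (suc ℤ.∣ d ∣ ℕ.*_) e)) (ℕP.m≤m*n (suc ℤ.∣ d ∣) (suc k)))

-- Evaluation at positive integers suffices: the last coefficient is killed by divisibility, and
-- then the factor `q` can be cancelled.
coefficients-zero : ∀ D (d : ℕ → ℤ) → (∀ N → sumTo D (λ i → d i * (+ suc N) ℤ.^ (D ℕ.∸ i)) ≡ 0ℤ) → ∀ i → i ℕ.≤ D → d i ≡ 0ℤ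
coefficients-zero zero d h zero _ = trans (sym (ℤP.*-identityʳ (d 0))) (h 0)
coefficients-zero (suc D) d h i le = go (i ℕP.≟ suc D)
  where
  H : ℤ → ℤ
  H q = sumTo D (λ i → d i * q ℤ.^ (D ℕ.∸ i))
  h' : ∀ N → + suc N * H (+ suc N) + d (suc D) ≡ 0ℤ
  h' N = trans (sym (horner D (+ suc N) d)) (h N)
  last : d (suc D) ≡ 0ℤ
  last = multiple-zero (d (suc D)) H h'
  lower-zero : ∀ N → H (+ suc N) ≡ 0ℤ
  lower-zero N = [ (λ ()) , id ]′ (ℤP.i*j≡0⇒i≡0∨j≡0 (+ suc N) (trans (sym (trans (+R (+ suc N * H (+ suc N)) last) (ℤP.+-identityʳ (+ suc N * H (+ suc N))))) (h' N)))
  go : Dec (i ≡ suc D) → d i ≡ 0ℤ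
  go (yes refl) = last
  go (no ne) = coefficients-zero D d lower-zero i (ℕP.≤-pred (ℕP.≤∧≢⇒< le ne))

coefficients-unique : ∀ D (g h : ℕ → ℤ) → (∀ N → sumTo D (λ i → h i * (+ suc N) ℤ.^ (D ℕ.∸ i)) ≡ sumTo D (λ i → g i * (+ suc N) ℤ.^ (D ℕ.∸ i))) →
  ∀ i → i ℕ.≤ D → h i ≡ g i
coefficients-unique D g h eq i le = ℤP.i-j≡0⇒i≡j (h i) (g i) (coefficients-zero D (λ i → h i - g i) (λ N →
    trans (sumTo-cong D (λ i _ → ring (h i) (g i) ((+ suc N) ℤ.^ (D ℕ.∸ i))))
    (trans (sumTo-+ D (λ i → h i * (+ suc N) ℤ.^ (D ℕ.∸ i)) (λ i → -1ℤ * (g i * (+ suc N) ℤ.^ (D ℕ.∸ i))))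
    (trans (cong₂ _+_ (eq N) (sumTo-* D -1ℤ (λ i → g i * (+ suc N) ℤ.^ (D ℕ.∸ i)))) (zero-sum (sumTo D (λ i → g i * (+ suc N) ℤ.^ (D ℕ.∸ i))))))) i le)
  where
  ring : ∀ a b x → (a - b) * x ≡ a * x + -1ℤ * (b * x)
  ring = solve-∀
  zero-sum : ∀ a → a + -1ℤ * a ≡ 0ℤ
  zero-sum = solve-∀

-- From face counts to the h-vector

sumL : {A : Set} → List A → (A → ℤ) → ℤ
sumL [] g = 0ℤ
sumL (x ∷ xs) g = g x + sumL xs g

sumL-++ : {A : Set} (xs ys : List A) (g : A → ℤ) → sumL (xs ++ ys) g ≡ sumL xs g + sumL ys g
sumL-++ [] ys g = sym (ℤP.+-identityˡ (sumL ys g))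
sumL-++ (x ∷ xs) ys g = trans (+R (g x) (sumL-++ xs ys g)) (sym (ℤP.+-assoc (g x) (sumL xs g) (sumL ys g)))

sumL-map : {A B : Set} (f : A → B) (xs : List A) (g : B → ℤ) → sumL (List.map f xs) g ≡ sumL xs (g ∘ f)
sumL-map f [] g = refl
sumL-map f (x ∷ xs) g = +R (g (f x)) (sumL-map f xs g)

sumL-allSubsets : ∀ n (g : Subset n → ℤ) → sumL (allSubsets n) g ≡ ΣS g
sumL-allSubsets zero g = refl
sumL-allSubsets (suc n) g = trans (sumL-++ (List.map (false ∷_) (allSubsets n)) (List.map (true ∷_) (allSubsets n)) g)
  (trans (cong₂ _+_ (trans (sumL-map (false ∷_) (allSubsets n) g) (sumL-allSubsets n (g ∘ (false ∷_)))) (trans (sumL-map (true ∷_) (allSubsets n) g) (sumL-allSubsets n (g ∘ (true ∷_)))))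
         (sym (ΣS-suc g)))

face-sum : ∀ {n} (face : Subset n → Bool) D p → (∀ A → face A ≡ true → ∣ A ∣ ℕ.≤ D) →
  sumTo D (λ i → + fvec face i * p ℤ.^ (D ℕ.∸ i)) ≡ ΣS (λ A → if face A then p ℤ.^ (D ℕ.∸ ∣ A ∣) else 0ℤ)
face-sum {n} face D p card = trans (go (allSubsets n)) (sumL-allSubsets n g)
  where
  g : Subset n → ℤ
  g A = if face A then p ℤ.^ (D ℕ.∸ ∣ A ∣) else 0ℤ
  one : Bool → ℤ
  one b = if b then 1ℤ else 0ℤ
  count-step : ∀ b k x → + (if b then suc k else k) * x ≡ one b * x + + k * x
  count-step true k x = ℤP.*-distribʳ-+ x 1ℤ (+ k)
  count-step false k x = sym (ℤP.+-identityˡ (+ k * x))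
  ≡ᵇ-refl : ∀ k → (k ℕ.≡ᵇ k) ≡ true
  ≡ᵇ-refl zero = refl
  ≡ᵇ-refl (suc k) = ≡ᵇ-refl k
  ≡ᵇ-≢ : ∀ k i → i ≢ k → (k ℕ.≡ᵇ i) ≡ false
  ≡ᵇ-≢ zero zero ne = ⊥-elim (ne refl)
  ≡ᵇ-≢ zero (suc i) ne = refl
  ≡ᵇ-≢ (suc k) zero ne = refl
  ≡ᵇ-≢ (suc k) (suc i) ne = ≡ᵇ-≢ k i (ne ∘ cong suc)
  single : ∀ A b → face A ≡ b → sumTo D (λ i → one (b ∧ (∣ A ∣ ℕ.≡ᵇ i)) * p ℤ.^ (D ℕ.∸ i)) ≡ (if b then p ℤ.^ (D ℕ.∸ ∣ A ∣) else 0ℤ)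
  single A true e = trans (sumTo-point D ∣ A ∣ (λ i → one (∣ A ∣ ℕ.≡ᵇ i) * p ℤ.^ (D ℕ.∸ i)) (card A e) (λ i ne → cong (λ b → one b * p ℤ.^ (D ℕ.∸ i)) (≡ᵇ-≢ ∣ A ∣ i ne)))
    (trans (cong (λ b → one b * p ℤ.^ (D ℕ.∸ ∣ A ∣)) (≡ᵇ-refl ∣ A ∣)) (ℤP.*-identityˡ (p ℤ.^ (D ℕ.∸ ∣ A ∣))))
  single A false e = sumTo-0 D {λ i → 0ℤ * p ℤ.^ (D ℕ.∸ i)} (λ i _ → refl)
  go : ∀ L → sumTo D (λ i → + countL (λ S → face S ∧ (∣ S ∣ ℕ.≡ᵇ i)) L * p ℤ.^ (D ℕ.∸ i)) ≡ sumL L g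
  go [] = sumTo-0 D {λ i → 0ℤ * p ℤ.^ (D ℕ.∸ i)} (λ i _ → refl)
  go (A ∷ L) = trans (sumTo-cong D (λ i _ → count-step (face A ∧ (∣ A ∣ ℕ.≡ᵇ i)) (countL (λ S → face S ∧ (∣ S ∣ ℕ.≡ᵇ i)) L) (p ℤ.^ (D ℕ.∸ i))))
    (trans (sumTo-+ D (λ i → one (face A ∧ (∣ A ∣ ℕ.≡ᵇ i)) * p ℤ.^ (D ℕ.∸ i)) (λ i → + countL (λ S → face S ∧ (∣ S ∣ ℕ.≡ᵇ i)) L * p ℤ.^ (D ℕ.∸ i)))
           (cong₂ _+_ (single A (face A) refl) (go L)))

nonneg⇒pos : ∀ {a} → 0ℤ ≤ a → a ≢ 0ℤ → 0ℤ < a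
nonneg⇒pos h ne = ℤP.≤∧≢⇒< h (ne ∘ sym)

-- The support of `e` is closed upwards, so after reversal it is an initial segment and has no
-- internal zeros.
nice-reverse : ∀ D (h e : ℕ → ℤ) → (∀ i → 0ℤ ≤ e i) → LogConcaveTo D e → (∀ i → i ℕ.< D → 0ℤ < e i → 0ℤ < e (suc i)) →
  (∀ k → k ℕ.≤ D → h k ≡ e (D ℕ.∸ k)) → NiceSequence D h
nice-reverse D h e nn lc up eq = (λ i le → subst (0ℤ ≤_) (sym (eq i le)) (nn (D ℕ.∸ i))) , log-concave , no-zeros
  where
  ∸-suc : ∀ {i} → i ℕ.< D → D ℕ.∸ i ≡ suc (D ℕ.∸ suc i)
  ∸-suc lt = ℕP.+-∸-assoc 1 lt
  log-concave : LogConcave D h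
  log-concave (suc i) _ lt = subst₂ _≤_ (trans (ℤP.*-comm (e j) (e (suc (suc j)))) (cong₂ _*_ (trans (cong e (sym (trans (∸-suc i<D) (cong suc (∸-suc lt))))) (sym (eq i (ℕP.<⇒≤ i<D)))) (sym (eq (suc (suc i)) lt))))
      (cong₂ _*_ mid mid) (lc j (ℕP.≤-trans (ℕP.≤-reflexive (sym (trans (∸-suc i<D) (cong suc (∸-suc lt))))) (ℕP.m∸n≤m D i)))
    where
    j : ℕ
    j = D ℕ.∸ suc (suc i)
    i<D : i ℕ.< D
    i<D = ℕP.<-trans (ℕP.n<1+n i) lt
    mid : e (suc j) ≡ h (suc i)
    mid = trans (cong e (sym (∸-suc lt))) (sym (eq (suc i) (ℕP.<⇒≤ lt)))
  climb : ∀ k a → k ℕ.+ a ℕ.≤ D → 0ℤ < e a → 0ℤ < e (k ℕ.+ a)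
  climb zero a le p = p
  climb (suc k) a le p = up (k ℕ.+ a) le (climb k a (ℕP.<⇒≤ le) p)
  no-zeros : NoInternalZeros D h
  no-zeros i j k i<j j<k k≤D _ hk hj = ℤP.<-irrefl (sym (trans (sym (eq j (ℕP.≤-trans (ℕP.<⇒≤ j<k) k≤D))) hj))
    (subst (λ m → 0ℤ < e m) sum (climb (k ℕ.∸ j) (D ℕ.∸ k) (ℕP.≤-trans (ℕP.≤-reflexive sum) (ℕP.m∸n≤m D j)) (nonneg⇒pos (nn (D ℕ.∸ k)) (λ z → hk (trans (eq k k≤D) z)))))
    where
    sum : k ℕ.∸ j ℕ.+ (D ℕ.∸ k) ≡ D ℕ.∸ j
    sum = trans (ℕP.+-comm (k ℕ.∸ j) (D ℕ.∸ k)) (trans (sym (ℕP.+-∸-assoc (D ℕ.∸ k) (ℕP.<⇒≤ j<k))) (cong (ℕ._∸ j) (ℕP.m∸n+n≡m k≤D)))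

h-exists : ∀ f D → ∃[ h ] IsHVector f D h
h-exists f D = let (e , _ , eq) = shifted-expansion D (λ i → + f i) in
  (λ i → e (D ℕ.∸ i)) , λ q → trans (eq q) (sym (sumTo-reverse D (λ i → e i * q ℤ.^ i)))

h-vector-nice : ∀ {n} (face : Subset n → Bool) D (e : ℕ → ℤ) → (∀ A → face A ≡ true → ∣ A ∣ ℕ.≤ D) →
  (∀ i → 0ℤ ≤ e i) → LogConcaveTo D e → (∀ i → i ℕ.< D → 0ℤ < e i → 0ℤ < e (suc i)) →
  (∀ N → ΣS (λ A → if face A then (+ suc N - 1ℤ) ℤ.^ (D ℕ.∸ ∣ A ∣) else 0ℤ) ≡ sumTo D (λ i → e i * (+ suc N) ℤ.^ i)) →
  HVectorNice face D
h-vector-nice face D e card nn lc up eq = h-exists (fvec face) D , λ h hv → nice-reverse D h e nn lc up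
  (coefficients-unique D (λ k → e (D ℕ.∸ k)) h (λ N → trans (sym (hv (+ suc N))) (trans (face-sum face D (+ suc N - 1ℤ) card)
    (trans (eq N) (sym (sumTo-reverse D (λ i → e i * (+ suc N) ℤ.^ i)))))))

-- The independence complex and the broken circuit complex

IN-nice : ∀ {n} (M : Matroid n) → HVectorNice (INface M) (MatroidRank.rk M ⊤)
IN-nice {n} M = go (WhitneyNumbers.whitney-numbers rN rN-isRank rN-single (rk ⊤) refl)
  where
  open MatroidRank M hiding (ind?)
  open Coextension rk rk-isRank
  go : (Σ (ℕ → ℤ) λ c → Good (rk ⊤) (λ q → ΣS (N.wt q)) c × LogConcaveTo (rk ⊤) c) → HVectorNice (INface M) (rk ⊤)
  go (c , g , lc) = h-vector-nice (INface M) (rk ⊤) c (λ A i → rk-≥ ⊆⊤ i) nn lc up (λ k → eq (+ suc k) (λ ()))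
    where
    open Good g
    -- Both sides are compared after multiplication by `q`, the factor carried by the Whitney
    -- polynomial of the coextension.
    eq : ∀ q → q ≢ 0ℤ → ΣS (λ A → if INface M A then (q - 1ℤ) ℤ.^ (rk ⊤ ℕ.∸ ∣ A ∣) else 0ℤ) ≡ sumTo (rk ⊤) (λ i → c i * q ℤ.^ i)
    eq q q≢0 = ℤP.*-cancelˡ-≡ q _ _ {{ℤ.≢-nonZero q≢0}} (trans (*R q (ΣS-cong {n} (λ A → pick A (indep M A) refl (ind? A))))
        (trans (sym (coextension-sum q)) (trans (poly q) (trans (sumTo-cong (rk ⊤) (λ i _ → ring (c i) q (q ℤ.^ i))) (sumTo-* (rk ⊤) q (λ i → c i * q ℤ.^ i))))))
      where
      ring : ∀ a q x → a * (q * x) ≡ q * (a * x)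
      ring = solve-∀
      pick : ∀ A b → indep M A ≡ b → (d : Dec (rk A ≡ ∣ A ∣)) → (if b then (q - 1ℤ) ℤ.^ (rk ⊤ ℕ.∸ ∣ A ∣) else 0ℤ) ≡ sel d ((q - 1ℤ) ℤ.^ (rk ⊤ ℕ.∸ ∣ A ∣))
      pick A true e (yes _) = refl
      pick A false e (no _) = refl
      pick A true e (no ¬i) = ⊥-elim (¬i (rk-ind e))
      pick A false e (yes i) = ⊥-elim (not-sound (cong not e) (ind-rk i))

BC-nice : ∀ {n} (M : Matroid n) (ρ : Fin n → ℕ) → (∀ {x y} → ρ x ≡ ρ y → x ≡ y) → HVectorNice (BCface M ρ) (MatroidRank.rk M ⊤)
BC-nice {n} M ρ inj = go (FinP.any? (λ x → rk ⁅ x ⁆ ℕP.≟ 0)) (rk ⊤) refl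
  where
  open BrokenCircuitComplex M ρ inj
  open IsRank rk-isRank
  -- A loop makes the empty set a broken circuit, so there are no faces at all and every coefficient
  -- is zero.
  loop : ∀ x → rk ⁅ x ⁆ ≡ 0 → HVectorNice (BCface M ρ) (rk ⊤)
  loop x e = h-vector-nice (BCface M ρ) (rk ⊤) (λ _ → 0ℤ) BCface-card (λ _ → ℤP.≤-refl) (λ _ _ → ℤP.≤-refl) (λ i _ p → p)
    (λ N → trans (ΣS-0 {n} (λ A → no-face A (BCface M ρ A) refl ((+ suc N - 1ℤ) ℤ.^ (rk ⊤ ℕ.∸ ∣ A ∣)))) (sym (sumTo-0 (rk ⊤) {λ i → 0ℤ * (+ suc N) ℤ.^ i} (λ _ _ → refl))))
    where
    no-face : ∀ A b → BCface M ρ A ≡ b → ∀ w → (if b then w else 0ℤ) ≡ 0ℤ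
    no-face A true h _ = ⊥-elim (loop-active {x} e A (BCface⇒nbc {A} h))
    no-face A false h _ = refl
  -- In rank zero the defining identity is `f 0 = h 0`, read off at `q = 0`.
  point : rk ⊤ ≡ 0 → HVectorNice (BCface M ρ) 0
  point e = h-exists (fvec (BCface M ρ)) 0 , λ h hv →
    (λ { zero _ → subst (0ℤ ≤_) (trans (sym (ℤP.*-identityʳ (+ fvec (BCface M ρ) 0))) (trans (hv 0ℤ) (ℤP.*-identityʳ (h 0)))) (+≤+ z≤n) }) , (λ _ _ ()) , λ { _ _ zero _ () ; _ _ (suc k) _ _ () }
  positive-rank : ∀ {n} (M : Matroid n) (ρ : Fin n → ℕ) (inj : ∀ {x y} → ρ x ≡ ρ y → x ≡ y) → (∀ x → MatroidRank.rk M ⁅ x ⁆ ≡ 1) → ∀ b → suc b ≡ MatroidRank.rk M ⊤ → HVectorNice (BCface M ρ) (suc b)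
  positive-rank {zero} M ρ inj ll b e = ⊥-elim (ℕP.1+n≢0 (trans e (IsRank.r-⊥ (MatroidRank.rk-isRank M))))
  positive-rank {suc n'} M ρ inj ll b e = build (WhitneyNumbers.whitney-numbers B.rk B.rk-isRank ll b e)
    where
    module B = BrokenCircuitComplex M ρ inj
    build : (Σ (ℕ → ℤ) λ c → Good b (λ q → ΣS (B.wt q)) c × LogConcaveTo b c) → HVectorNice (BCface M ρ) (suc b)
    build (c , g , lc) = h-vector-nice (BCface M ρ) (suc b) e' (λ A h → subst (∣ A ∣ ℕ.≤_) (sym e) (B.BCface-card A h)) nn' lc' up' (λ N → eq (+ suc N))
      where
      open Good g
      -- The Whitney polynomial is divisible by `q`, so the coefficients move up by one place and
      -- the constant term is zero.
      e' : ℕ → ℤ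
      e' zero = 0ℤ
      e' (suc i) = c i
      nn' : ∀ i → 0ℤ ≤ e' i
      nn' zero = ℤP.≤-refl
      nn' (suc i) = nn i
      lc' : LogConcaveTo (suc b) e'
      lc' zero _ = sq≥0 (c 0)
      lc' (suc i) (s≤s le) = lc i le
      up' : ∀ i → i ℕ.< suc b → 0ℤ < e' i → 0ℤ < e' (suc i)
      up' zero _ (+<+ ())
      up' (suc i) (s≤s lt) p = up i lt p
      eq : ∀ q → ΣS (λ A → if BCface M ρ A then (q - 1ℤ) ℤ.^ (suc b ℕ.∸ ∣ A ∣) else 0ℤ) ≡ sumTo (suc b) (λ i → e' i * q ℤ.^ i)
      eq q = trans (cong (λ k → ΣS (λ A → if BCface M ρ A then (q - 1ℤ) ℤ.^ (k ℕ.∸ ∣ A ∣) else 0ℤ)) e) (trans (B.BC-sum q) (trans (poly q)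
        (sym (trans (sumTo-head b (λ i → e' i * q ℤ.^ i)) (ℤP.+-identityˡ (sumTo b (λ i → c i * q ℤ.^ suc i)))))))
  go : Dec (∃[ x ] (rk ⁅ x ⁆ ≡ 0)) → ∀ k → rk ⊤ ≡ k → HVectorNice (BCface M ρ) (rk ⊤)
  go (yes (x , e)) _ _ = loop x e
  go (no none) zero e = subst (HVectorNice (BCface M ρ)) (sym e) (point e)
  go (no none) (suc b) e = subst (HVectorNice (BCface M ρ)) (sym e) (positive-rank M ρ inj (λ x → ℕP.≤-antisym (r-one x) (ℕP.n≢0⇒n>0 (λ z → none (x , z)))) b (sym e))

theorem2 : ∀ {c ℓ : Level} (n : ℕ) (M : Matroid n) → RepresentableCharZero M c ℓ →
    (ρ : Fin n → ℕ) → Injective _≡_ _≡_ ρ →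
    HVectorNice (INface M) (rank M) × HVectorNice (BCface M ρ) (rank M)
theorem2 n M _ ρ inj =
  subst (HVectorNice (INface M)) (sym (rank≡rk M)) (IN-nice M) ,
  subst (HVectorNice (BCface M ρ)) (sym (rank≡rk M)) (BC-nice M ρ inj)
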